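{- Let $p<q$ be primes with $p$ odd, and let $\beta\in[1,p-1]$ with $q\equiv\beta\pmod p$. Let $\beta^*\in[1,p-1]$ be the inverse of $\beta$ modulo $p$. Then $M(p;q)\le M_\beta(p)\le m(\beta^*)$.
   Context: For a positive integer $n$, write the $n$-th cyclotomic polynomial as $\Phi_n(x)=\sum_{k=0}^{\varphi(n)}a_n(k)x^k$ and let its height be $A(n)=\max_k|a_n(k)|$. For an odd prime $p$ and a prime $q>p$, let $M(p;q)=\max\{A(pqr): r \text{ prime}, r>q\}$. For $1\le\beta\le p-1$, let $M_\beta(p)=\max\{M(p;q): q>p \text{ prime},\ q\equiv\beta \pmod p\}$ (this maximum exists). For $1\le j\le p-1$, define $w(j)=\frac{p-1}{2}+j$ if $j<\frac p4$; $w(j)=p-j$ if $\frac p4<j\le\frac{p-1}{2}$; $w(j)=w(p-j)$ if $j>\frac{p-1}{2}$; and $m(j)=\min\{w(j),\lfloor\frac{2}{3}p\rfloor\}$. -}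

module Defs where

open import Data.Nat using (ℕ; zero; suc; _+_; _*_; _∸_; _≤_; _<_; _/_; _⊓_)
open import Data.Nat.Divisibility using (_∣?_)
open import Data.Nat.Properties using (_≟_; _<?_; _≤?_)
open import Data.Integer as ℤ using (ℤ; +_)
open import Data.List using (List; []; _∷_; foldr; filter; map; upTo; applyUpTo)
open import Relation.Nullary.Decidable using (⌊_⌋)
open import Data.Bool using (if_then_else_)
open import Relation.Binary.PropositionalEquality using (_≡_)

-- Integer power series / polynomials, as coefficient functions ℕ → ℤ.
Poly : Set
Poly = ℕ → ℤ

sumTo : ℕ → (ℕ → ℤ) → ℤ
sumTo zero    f = f 0
sumTo (suc n) f = sumTo n f ℤ.+ f (suc n)

_⊛_ : Poly → Poly → Poly
(f ⊛ g) n = sumTo n (λ i → f i ℤ.* g (n ∸ i))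

one : Poly
one zero    = + 1
one (suc _) = + 0

xⁿ-1 : ℕ → Poly
xⁿ-1 n k = (if ⌊ k ≟ n ⌋ then + 1 else + 0) ℤ.- (if ⌊ k ≟ 0 ⌋ then + 1 else + 0)

divisors : ℕ → List ℕ
divisors n = filter (λ d → d ∣? n) (applyUpTo suc n)

divProd : (ℕ → Poly) → ℕ → Poly
divProd F n = foldr (λ d acc → F d ⊛ acc) one (divisors n)

-- F is the family of cyclotomic polynomials: ∏_{d ∣ n} F d = x^n - 1 for all n ≥ 1.
-- (This determines each F n uniquely, as ℤ[[x]] is an integral domain and the
-- factors are monic; hence F n = Φ_n and F n k = a_n(k), zero for k > φ(n).)
IsCyclotomicFamily : (ℕ → Poly) → Set
IsCyclotomicFamily F = ∀ n → 1 ≤ n → ∀ k → divProd F n k ≡ xⁿ-1 n k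

-- w(j) for 1 ≤ j ≤ (p-1)/2  (p odd, so 4j ≠ p)
wLow : ℕ → ℕ → ℕ
wLow p j = if ⌊ 4 * j <? p ⌋ then (p ∸ 1) / 2 + j else p ∸ j

w : ℕ → ℕ → ℕ
w p j = if ⌊ 2 * j ≤? p ∸ 1 ⌋ then wLow p j else wLow p (p ∸ j)

m : ℕ → ℕ → ℕ
m p j = w p j ⊓ ((2 * p) / 3)

{-# OPTIONS --safe #-}
-- Write Q = β*, C = p q, and let R be the inverse of r modulo p.  Multiplying the defining products
-- over the divisors of p q r gives (x − 1) F_pqr = (x^p − 1)(x^q − 1) G with (x^C − 1) G = c(x^r), where c is
-- the coefficient sequence of F_pq.  Hence (Kaplan) the n-th coefficient of F_pqr is a sum over m < p of
-- b(m) − b(m + q), where b(m) = c(v) if v ≤ n / r and 0 otherwise, v being the residue of (n − m) / r mod C.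
-- In the coordinates v ≡ x q + y p (mod C) one has c(v) = [x < Q] + [y < s] − 1, s = p⁻¹ mod q; the indices m run
-- once through the residues x, and passing from m to m + q keeps y and lowers x by R.
--
-- The reflections Q ↦ p − Q and R ↦ p − R only change the sign, so Q, R < p / 2.  With α = min(Q, R) and
-- β = max(Q, R), the differences +1 occur at residues outside [α , α + β) and the differences −1 inside;
-- counting residues bounds their numbers P, M by P ≤ p − β, P ≤ 2 α + β and M ≤ β.  This gives the bound by w.
--
-- For the bound 2 p / 3 suppose 3 (P − M) > 2 p.  Then few residues are exceptional, and there are links
-- x → x + β of two kinds, between two low residues and between two top residues.  A link takes a fixed time T
-- (difference of the indices m) modulo p, and the displacement of the other two coordinates depends only on
-- whether it crosses the end of the time interval; the two kinds have incompatible displacements.  So the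
-- non-exceptional residues of the block V = [α + β , p − β) are, up to few errors, those whose link crosses.
-- As x is an arithmetic progression in time, comparing V with its translates contradicts this.

module Submission where

open import Defs hiding (m; w; wLow)
open import Data.Nat using (ℕ; _*_; _∸_; _≤_; _<_; _%_; NonZero)
open import Data.Nat.Primality using (Prime)
open import Data.Integer using (∣_∣)
open import Data.Product using (_×_)
open import Relation.Binary.PropositionalEquality using (_≡_)

open import Data.Bool using (Bool; true; false; _∧_; _∨_; not; if_then_else_) renaming (T to IsTrue)
open import Data.Empty using (⊥; ⊥-elim)
import Data.Integer as ℤ
import Data.Integer.Properties as ℤP
open import Data.List using (List; []; _∷_)
open import Data.Nat
open import Data.Nat.DivMod
open import Data.Nat.Properties
open import Data.Product using (Σ; _,_; proj₁; proj₂)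
open import Data.Sum using (_⊎_; inj₁; inj₂; [_,_]′; swap)
open import Data.Unit using (tt)
open import Relation.Binary.PropositionalEquality
open import Relation.Nullary using (Dec; yes; no; ¬_)
open import Relation.Nullary.Decidable using (⌊_⌋)
open import Algebra.Properties.CommutativeSemigroup +-commutativeSemigroup using (interchange; x∙yz≈y∙xz)
open import Algebra.Properties.CommutativeSemigroup *-commutativeSemigroup using () renaming (x∙yz≈y∙xz to *-swap; interchange to *-interchange)

-- The elementary bounds for P already give 2 p / 3 unless 3 β < p and 6 α + 3 β > 2 p; only that
-- range needs the long argument. There the identity P + X + β = p + M, with X the number of
-- exceptional residues, turns 3 (P - M) > 2 p into 3 X + 3 β < p, and contradictions come from
-- finding more than X exceptions. The block V has D = p - α - 2 β elements, with 3 X < D and 3 D <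
-- p. The residue advances by λ ≡ - Q R modulo p per unit of time, and the crossing residues occupy
-- the last T moments. If λ is at distance at least 2 from the multiples of p, a few steps carry V
-- off itself while crossing times mostly stay crossing, which is contradictory unless T = 1, that
-- is λ = β. The values λ ≡ ± β would make the other parameter ± 1, so they are excluded once α ≥ 2,
-- and α = 1 is counted separately. λ ≡ - 1 fails by T + β < p. The real obstacle is λ = 1: time
-- then follows the cyclic order of residues, and V may nearly be an interval of time. There β is
-- split into halves: gaps of both halves cannot occur between tops, and a missing gap forces too
-- many exceptions.

infixr 6 _⋆_

_⋆_ : ∀ {a b} k → a ≤ b → k * a ≤ k * b
k ⋆ h = *-monoʳ-≤ k h

-- Normalisation of polynomial expressions over ℕ and linear certificates

infixl 6 _:+_
infixl 7 _:*_
infix 8 #_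

data Expr : Set where
  var #_ : ℕ → Expr
  _:+_ _:*_ : Expr → Expr → Expr

Mono Poly⁺ : Set
Mono = List ℕ
Poly⁺ = List (ℕ × Mono)

lookup : List ℕ → ℕ → ℕ
lookup [] _ = 0
lookup (x ∷ _) zero = x
lookup (_ ∷ ρ) (suc i) = lookup ρ i

⟦_⟧ : Expr → List ℕ → ℕ
⟦ var i ⟧ ρ = lookup ρ i
⟦ # k ⟧ ρ = k
⟦ e :+ f ⟧ ρ = ⟦ e ⟧ ρ + ⟦ f ⟧ ρ
⟦ e :* f ⟧ ρ = ⟦ e ⟧ ρ * ⟦ f ⟧ ρ

⟦_⟧ᵐ : Mono → List ℕ → ℕ
⟦ [] ⟧ᵐ ρ = 1
⟦ i ∷ m ⟧ᵐ ρ = lookup ρ i * ⟦ m ⟧ᵐ ρ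

⟦_⟧ᵖ : Poly⁺ → List ℕ → ℕ
⟦ [] ⟧ᵖ ρ = 0
⟦ (c , m) ∷ P ⟧ᵖ ρ = c * ⟦ m ⟧ᵐ ρ + ⟦ P ⟧ᵖ ρ

eqᵐ ltᵐ : Mono → Mono → Bool
eqᵐ [] [] = true
eqᵐ (i ∷ m) (j ∷ n) = (i ≡ᵇ j) ∧ eqᵐ m n
eqᵐ _ _ = false
ltᵐ [] [] = false
ltᵐ [] (_ ∷ _) = true
ltᵐ (_ ∷ _) [] = false
ltᵐ (i ∷ m) (j ∷ n) = if i ≡ᵇ j then ltᵐ m n else i <ᵇ j

insert : ℕ → Mono → Mono
insert i [] = i ∷ []
insert i (j ∷ m) = if i <ᵇ j then i ∷ j ∷ m else j ∷ insert i m

_·ᵐ_ : Mono → Mono → Mono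
[] ·ᵐ n = n
(i ∷ m) ·ᵐ n = insert i (m ·ᵐ n)

add : ℕ → Mono → Poly⁺ → Poly⁺
add c m [] = (c , m) ∷ []
add c m ((d , n) ∷ P) = if eqᵐ m n then (c + d , n) ∷ P else if ltᵐ m n then (c , m) ∷ (d , n) ∷ P else (d , n) ∷ add c m P

_+ᵖ_ _·ᵖ_ : Poly⁺ → Poly⁺ → Poly⁺
[] +ᵖ Q = Q
((c , m) ∷ P) +ᵖ Q = add c m (P +ᵖ Q)

scale : ℕ → Mono → Poly⁺ → Poly⁺
scale c m [] = []
scale c m ((d , n) ∷ Q) = add (c * d) (m ·ᵐ n) (scale c m Q)

[] ·ᵖ Q = []
((c , m) ∷ P) ·ᵖ Q = scale c m Q +ᵖ (P ·ᵖ Q)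

norm : Expr → Poly⁺
norm (var i) = (1 , i ∷ []) ∷ []
norm (# zero) = []
norm (# (suc k)) = (suc k , []) ∷ []
norm (e :+ f) = norm e +ᵖ norm f
norm (e :* f) = norm e ·ᵖ norm f

module _ (ρ : List ℕ) where
  open ≡-Reasoning

  eqᵐ-sound : ∀ m n → eqᵐ m n ≡ true → ⟦ m ⟧ᵐ ρ ≡ ⟦ n ⟧ᵐ ρ
  eqᵐ-sound [] [] _ = refl
  eqᵐ-sound (i ∷ m) (j ∷ n) e with i ≡ᵇ j in ij
  ... | true = cong₂ _*_ (cong (lookup ρ) (≡ᵇ⇒≡ i j (subst IsTrue (sym ij) tt))) (eqᵐ-sound m n e)

  insert-sound : ∀ i m → ⟦ insert i m ⟧ᵐ ρ ≡ lookup ρ i * ⟦ m ⟧ᵐ ρ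
  insert-sound i [] = refl
  insert-sound i (j ∷ m) with i <ᵇ j
  ... | true = refl
  ... | false = trans (cong (lookup ρ j *_) (insert-sound i m)) (*-swap (lookup ρ j) (lookup ρ i) _)

  ·ᵐ-sound : ∀ m n → ⟦ m ·ᵐ n ⟧ᵐ ρ ≡ ⟦ m ⟧ᵐ ρ * ⟦ n ⟧ᵐ ρ
  ·ᵐ-sound [] n = sym (+-identityʳ _)
  ·ᵐ-sound (i ∷ m) n = trans (insert-sound i (m ·ᵐ n)) (trans (cong (lookup ρ i *_) (·ᵐ-sound m n)) (sym (*-assoc (lookup ρ i) _ _)))

  add-sound : ∀ c m P → ⟦ add c m P ⟧ᵖ ρ ≡ c * ⟦ m ⟧ᵐ ρ + ⟦ P ⟧ᵖ ρ
  add-sound c m [] = refl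
  add-sound c m ((d , n) ∷ P) with eqᵐ m n in e
  ... | true = trans (cong (_+ ⟦ P ⟧ᵖ ρ) (trans (*-distribʳ-+ (⟦ n ⟧ᵐ ρ) c d) (cong (λ u → c * u + d * ⟦ n ⟧ᵐ ρ) (sym (eqᵐ-sound m n e))))) (+-assoc (c * ⟦ m ⟧ᵐ ρ) _ _)
  ... | false with ltᵐ m n
  ...   | true = refl
  ...   | false = trans (cong (d * ⟦ n ⟧ᵐ ρ +_) (add-sound c m P)) (x∙yz≈y∙xz (d * ⟦ n ⟧ᵐ ρ) (c * ⟦ m ⟧ᵐ ρ) _)

  +ᵖ-sound : ∀ P Q → ⟦ P +ᵖ Q ⟧ᵖ ρ ≡ ⟦ P ⟧ᵖ ρ + ⟦ Q ⟧ᵖ ρ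
  +ᵖ-sound [] Q = refl
  +ᵖ-sound ((c , m) ∷ P) Q = trans (add-sound c m (P +ᵖ Q)) (trans (cong (c * ⟦ m ⟧ᵐ ρ +_) (+ᵖ-sound P Q)) (sym (+-assoc (c * ⟦ m ⟧ᵐ ρ) _ _)))

  scale-sound : ∀ c m Q → ⟦ scale c m Q ⟧ᵖ ρ ≡ c * ⟦ m ⟧ᵐ ρ * ⟦ Q ⟧ᵖ ρ
  scale-sound c m [] = sym (*-zeroʳ (c * ⟦ m ⟧ᵐ ρ))
  scale-sound c m ((d , n) ∷ Q) = begin
    ⟦ add (c * d) (m ·ᵐ n) (scale c m Q) ⟧ᵖ ρ ≡⟨ add-sound (c * d) (m ·ᵐ n) (scale c m Q) ⟩
    c * d * ⟦ m ·ᵐ n ⟧ᵐ ρ + ⟦ scale c m Q ⟧ᵖ ρ ≡⟨ cong₂ _+_ (trans (cong (c * d *_) (·ᵐ-sound m n)) (*-interchange c d _ _)) (scale-sound c m Q) ⟩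
    c * ⟦ m ⟧ᵐ ρ * (d * ⟦ n ⟧ᵐ ρ) + c * ⟦ m ⟧ᵐ ρ * ⟦ Q ⟧ᵖ ρ ≡⟨ sym (*-distribˡ-+ (c * ⟦ m ⟧ᵐ ρ) _ _) ⟩
    c * ⟦ m ⟧ᵐ ρ * (d * ⟦ n ⟧ᵐ ρ + ⟦ Q ⟧ᵖ ρ) ∎

  ·ᵖ-sound : ∀ P Q → ⟦ P ·ᵖ Q ⟧ᵖ ρ ≡ ⟦ P ⟧ᵖ ρ * ⟦ Q ⟧ᵖ ρ
  ·ᵖ-sound [] Q = refl
  ·ᵖ-sound ((c , m) ∷ P) Q = trans (+ᵖ-sound (scale c m Q) (P ·ᵖ Q)) (trans (cong₂ _+_ (scale-sound c m Q) (·ᵖ-sound P Q)) (sym (*-distribʳ-+ (⟦ Q ⟧ᵖ ρ) (c * ⟦ m ⟧ᵐ ρ) _)))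

  norm-sound : ∀ e → ⟦ norm e ⟧ᵖ ρ ≡ ⟦ e ⟧ ρ
  norm-sound (var i) = trans (+-identityʳ _) (trans (+-identityʳ _) (*-identityʳ _))
  norm-sound (# zero) = refl
  norm-sound (# (suc k)) = trans (+-identityʳ _) (*-identityʳ (suc k))
  norm-sound (e :+ f) = trans (+ᵖ-sound (norm e) (norm f)) (cong₂ _+_ (norm-sound e) (norm-sound f))
  norm-sound (e :* f) = trans (·ᵖ-sound (norm e) (norm f)) (cong₂ _*_ (norm-sound e) (norm-sound f))

-- The hypothesis is closed by `refl` at each use: expressions refer to the entries of `ρ` by
-- position, so normalisation computes even though the entries are open terms.
ring : ∀ e f ρ → norm e ≡ norm f → ⟦ e ⟧ ρ ≡ ⟦ f ⟧ ρ
ring e f ρ h = trans (sym (norm-sound ρ e)) (trans (cong (λ P → ⟦ P ⟧ᵖ ρ) h) (norm-sound ρ f))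

v0 v1 v2 v3 v4 v5 v6 v7 v8 v9 v10 v11 v12 v13 v14 v15 v16 : Expr
v0 = var 0
v1 = var 1
v2 = var 2
v3 = var 3
v4 = var 4
v5 = var 5
v6 = var 6
v7 = var 7
v8 = var 8
v9 = var 9
v10 = var 10
v11 = var 11
v12 = var 12
v13 = var 13
v14 = var 14
v15 = var 15
v16 = var 16

-- A one-pass sufficient test for domination: normal forms are sorted by monomial, and variables
-- over ℕ are nonnegative, so it is enough that each monomial of the smaller side occurs with at
-- least its coefficient in the larger one.
covers : Poly⁺ → Poly⁺ → Bool
covers P [] = true
covers [] (_ ∷ _) = false
covers ((c , m) ∷ P) ((d , n) ∷ Q) = if eqᵐ m n then (d ≤ᵇ c) ∧ covers P Q else covers P ((d , n) ∷ Q)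

module _ (ρ : List ℕ) where
  covers-sound : ∀ P Q → covers P Q ≡ true → ⟦ Q ⟧ᵖ ρ ≤ ⟦ P ⟧ᵖ ρ
  covers-sound P [] _ = z≤n
  covers-sound ((c , m) ∷ P) ((d , n) ∷ Q) e with eqᵐ m n in mn
  ... | false = ≤-trans (covers-sound P ((d , n) ∷ Q) e) (m≤n+m _ _)
  ... | true with d ≤ᵇ c in dc
  ...   | true = +-mono-≤ (≤-trans (≤-reflexive (cong (d *_) (sym (eqᵐ-sound ρ m n mn)))) (*-monoˡ-≤ (⟦ m ⟧ᵐ ρ) (≤ᵇ⇒≤ d c (subst IsTrue (sym dc) tt)))) (covers-sound P Q e)

  covers-≤ : ∀ e f → covers (norm e) (norm f) ≡ true → ⟦ f ⟧ ρ ≤ ⟦ e ⟧ ρ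
  covers-≤ e f h = ≤-trans (≤-reflexive (sym (norm-sound ρ f))) (≤-trans (covers-sound (norm e) (norm f) h) (≤-reflexive (norm-sound ρ e)))

-- Linear arithmetic over ℕ by Farkas certificates: nonnegative combinations of known (in)equalities,
-- compared coefficient by coefficient with the goal.
record Fact (_∼_ : ℕ → ℕ → Set) (ρ : List ℕ) : Set where
  constructor fact
  field
    {lhs rhs} : Expr
    proof : ⟦ lhs ⟧ ρ ∼ ⟦ rhs ⟧ ρ
open Fact

module _ {ρ : List ℕ} where
  infixr 3 _&_ _&ᵉ_
  infix 4 _·_
  infix 5 _<=_by_ _==_by_ _==˘_by_ _≐_by_

  _<=_by_ : ∀ l r → ⟦ l ⟧ ρ ≤ ⟦ r ⟧ ρ → Fact _≤_ ρ
  l <= r by h = fact {lhs = l} {r} h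

  _==_by_ : ∀ l r → ⟦ l ⟧ ρ ≡ ⟦ r ⟧ ρ → Fact _≤_ ρ
  l == r by h = fact {lhs = l} {r} (≤-reflexive h)

  _==˘_by_ : ∀ l r → ⟦ r ⟧ ρ ≡ ⟦ l ⟧ ρ → Fact _≤_ ρ
  l ==˘ r by h = fact {lhs = l} {r} (≤-reflexive (sym h))

  _≐_by_ : ∀ l r → ⟦ l ⟧ ρ ≡ ⟦ r ⟧ ρ → Fact _≡_ ρ
  l ≐ r by h = fact {lhs = l} {r} h

  trivialᵉ : Fact _≡_ ρ
  trivialᵉ = fact {lhs = # 0} {# 0} refl

  _&_ : Fact _≤_ ρ → Fact _≤_ ρ → Fact _≤_ ρ
  f & g = fact {lhs = lhs f :+ lhs g} {rhs f :+ rhs g} (+-mono-≤ (proof f) (proof g))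

  _·_ : ℕ → Fact _≤_ ρ → Fact _≤_ ρ
  k · f = fact {lhs = # k :* lhs f} {# k :* rhs f} (k ⋆ proof f)

  _&ᵉ_ : Fact _≡_ ρ → Fact _≡_ ρ → Fact _≡_ ρ
  f &ᵉ g = fact {lhs = lhs f :+ lhs g} {rhs f :+ rhs g} (cong₂ _+_ (proof f) (proof g))

by-contra : ∀ {a b} → (suc b ≤ a → ⊥) → a ≤ b
by-contra f = ≮⇒≥ f

module _ (ρ : List ℕ) where
  -- The summed facts are absurd when the left side dominates the right side plus one. A strict
  -- inequality therefore enters as `# 1 :+ …` and contributes its unit.
  lin⊥ : ∀ {A : Set} (f : Fact _≤_ ρ) → covers (norm (lhs f)) (norm (# 1 :+ rhs f)) ≡ true → A
  lin⊥ f h = ⊥-elim (<-irrefl refl (≤-trans (covers-≤ ρ (lhs f) (# 1 :+ rhs f) h) (proof f)))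

  lin≤ : ∀ l r (f : Fact _≤_ ρ) → covers (norm (r :+ lhs f)) (norm (l :+ rhs f)) ≡ true → ⟦ l ⟧ ρ ≤ ⟦ r ⟧ ρ
  lin≤ l r f h = +-cancelʳ-≤ (⟦ rhs f ⟧ ρ) _ _ (≤-trans (covers-≤ ρ (r :+ lhs f) (l :+ rhs f) h) (+-monoʳ-≤ (⟦ r ⟧ ρ) (proof f)))

  -- Integer rounding: the negated goal is added `k` times to the facts, which accepts conclusions
  -- whose rational slack is only a fraction of a unit.
  lin≤* : ∀ k l r (f : Fact _≤_ ρ) → covers (norm (# k :* (# 1 :+ r) :+ lhs f)) (norm (# 1 :+ (# k :* l :+ rhs f))) ≡ true → ⟦ l ⟧ ρ ≤ ⟦ r ⟧ ρ
  lin≤* k l r f h = by-contra λ g → lin⊥ (fact {lhs = # k :* (# 1 :+ r) :+ lhs f} {# k :* l :+ rhs f} (+-mono-≤ (k ⋆ g) (proof f))) h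

  lin≡ : ∀ l r (f : Fact _≡_ ρ) → norm (l :+ rhs f) ≡ norm (r :+ lhs f) → ⟦ l ⟧ ρ ≡ ⟦ r ⟧ ρ
  lin≡ l r f h = +-cancelʳ-≡ (⟦ rhs f ⟧ ρ) _ _ (trans (ring (l :+ rhs f) (r :+ lhs f) ρ h) (cong (⟦ r ⟧ ρ +_) (proof f)))

-- Counting the residues that pass a Boolean test

cnt : (ℕ → Bool) → ℕ → ℕ
cnt f zero = 0
cnt f (suc n) = (if f n then 1 else 0) + cnt f n

cnt-cong : ∀ {f g} n → (∀ x → x < n → f x ≡ g x) → cnt f n ≡ cnt g n
cnt-cong zero h = refl
cnt-cong (suc n) h rewrite h n ≤-refl | cnt-cong n (λ x l → h x (m≤n⇒m≤1+n l)) = refl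

cnt-none : ∀ {f} n → (∀ x → x < n → f x ≡ false) → cnt f n ≡ 0
cnt-none zero h = refl
cnt-none (suc n) h rewrite h n ≤-refl = cnt-none n (λ x l → h x (m≤n⇒m≤1+n l))

cnt-all : ∀ {f} n → (∀ x → x < n → f x ≡ true) → cnt f n ≡ n
cnt-all zero h = refl
cnt-all (suc n) h rewrite h n ≤-refl = cong suc (cnt-all n (λ x l → h x (m≤n⇒m≤1+n l)))

remove : (ℕ → Bool) → ℕ → ℕ → Bool
remove g y z = g z ∧ not ⌊ z ≟ y ⌋

remove-≢ : ∀ {g y z} → g z ≡ true → z ≢ y → remove g y z ≡ true
remove-≢ {g} {y} {z} e n with z ≟ y
... | yes q = ⊥-elim (n q)
... | no _ rewrite e = refl

cnt-remove : ∀ g y m → y < m → g y ≡ true → cnt g m ≡ suc (cnt (remove g y) m)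
cnt-remove g y (suc m) l e with m ≟ y
... | yes refl rewrite e =
  cong suc (cnt-cong m λ x x<m → eqv x x<m)
  where
  eqv : ∀ x → x < m → g x ≡ remove g m x
  eqv x x<m with x ≟ m
  ... | yes refl = ⊥-elim (<-irrefl refl x<m)
  ... | no _ with g x
  ...   | true = refl
  ...   | false = refl
... | no m≢y with g m
...   | true = cong suc (cnt-remove g y m (≤∧≢⇒< (≤-pred l) (λ q → m≢y (sym q))) e)
...   | false = cnt-remove g y m (≤∧≢⇒< (≤-pred l) (λ q → m≢y (sym q))) e

-- A relation takes the place of a map because targets are produced by case distinctions; only the
-- relation then has to determine the origin. Each step strikes the target of the largest `x` out of
-- `g`.
cnt-inj : ∀ {f g} (R : ℕ → ℕ → Set) n m →
  (∀ x → x < n → f x ≡ true → Σ ℕ λ y → y < m × g y ≡ true × R x y) →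
  (∀ x x′ y → x < n → x′ < n → f x ≡ true → f x′ ≡ true → y < m → R x y → R x′ y → x ≡ x′) →
  cnt f n ≤ cnt g m
cnt-inj R zero m total inj = z≤n
cnt-inj {f} {g} R (suc n) m total inj with f n in e
... | false = cnt-inj R n m (λ x l → total x (m≤n⇒m≤1+n l))
  (λ x x′ y l l′ → inj x x′ y (m≤n⇒m≤1+n l) (m≤n⇒m≤1+n l′))
... | true with total n ≤-refl e
...   | y , y<m , gy , r rewrite cnt-remove g y m y<m gy =
  s≤s (cnt-inj R n m total′ (λ x x′ y l l′ → inj x x′ y (m≤n⇒m≤1+n l) (m≤n⇒m≤1+n l′)))
  where
  total′ : ∀ x → x < n → f x ≡ true → Σ ℕ λ y′ → y′ < m × remove g y y′ ≡ true × R x y′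
  total′ x l fx with total x (m≤n⇒m≤1+n l) fx
  ... | z , z<m , gz , r′ = z , z<m , remove-≢ {g} gz z≢y , r′
    where
    z≢y : z ≢ y
    z≢y refl = <-irrefl (inj x n y (m≤n⇒m≤1+n l) ≤-refl fx e y<m r′ r) l

cnt-⊆ : ∀ f g n → (∀ x → x < n → f x ≡ true → g x ≡ true) → cnt f n ≤ cnt g n
cnt-⊆ f g n h = cnt-inj {f} {g} _≡_ n n (λ x l e → x , l , h x l e , refl)
  (λ x x′ y _ _ _ _ _ r r′ → trans r (sym r′))

cnt≤ : ∀ f (R : ℕ → ℕ → Set) n k → (∀ x → x < n → f x ≡ true → Σ ℕ λ y → y < k × R x y) →
  (∀ x x′ y → x < n → x′ < n → f x ≡ true → f x′ ≡ true → R x y → R x′ y → x ≡ x′) → cnt f n ≤ k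
cnt≤ f R n k total inj = subst (cnt f n ≤_) (cnt-all {λ _ → true} k λ _ _ → refl)
  (cnt-inj {f} {λ _ → true} R n k (λ x l e → let (y , y<k , r) = total x l e in y , y<k , refl , r)
    (λ x x′ y l l′ e e′ _ → inj x x′ y l l′ e e′))

≤cnt : ∀ g (R : ℕ → ℕ → Set) k m → (∀ i → i < k → Σ ℕ λ y → y < m × g y ≡ true × R i y) →
  (∀ i i′ y → i < k → i′ < k → y < m → R i y → R i′ y → i ≡ i′) → k ≤ cnt g m
≤cnt g R k m total inj = subst (_≤ cnt g m) (cnt-all {λ _ → true} k λ _ _ → refl)
  (cnt-inj {λ _ → true} {g} R k m (λ i l _ → total i l) (λ i i′ y l l′ _ _ y<m → inj i i′ y l l′ y<m))

cnt-split : ∀ (f g : ℕ → Bool) n → cnt f n ≡ cnt (λ x → f x ∧ g x) n + cnt (λ x → f x ∧ not (g x)) n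
cnt-split f g zero = refl
cnt-split f g (suc n) with f n | g n | cnt-split f g n
... | true | true | ih = cong suc ih
... | true | false | ih = trans (cong suc ih) (sym (+-suc _ _))
... | false | _ | ih = ih

cnt-balance : ∀ (f g h k : ℕ → Bool) n → (∀ x → x < n → (if f x then 1 else 0) + (if g x then 1 else 0) ≡ (if h x then 1 else 0) + (if k x then 1 else 0)) →
  cnt f n + cnt g n ≡ cnt h n + cnt k n
cnt-balance f g h k zero e = refl
cnt-balance f g h k (suc n) e = begin
  (a + cnt f n) + (b + cnt g n) ≡⟨ interchange a (cnt f n) b (cnt g n) ⟩
  (a + b) + (cnt f n + cnt g n) ≡⟨ cong₂ _+_ (e n ≤-refl) (cnt-balance f g h k n λ x l → e x (m≤n⇒m≤1+n l)) ⟩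
  (c + d) + (cnt h n + cnt k n) ≡⟨ interchange c d (cnt h n) (cnt k n) ⟩
  (c + cnt h n) + (d + cnt k n) ∎
  where
  open ≡-Reasoning
  a = if f n then 1 else 0
  b = if g n then 1 else 0
  c = if h n then 1 else 0
  d = if k n then 1 else 0

within : ℕ → ℕ → ℕ → Bool
within a b x = ⌊ a ≤? x ⌋ ∧ ⌊ x <? b ⌋

within⁺ : ∀ {a b x} → a ≤ x → x < b → within a b x ≡ true
within⁺ {a} {b} {x} l u with a ≤? x | x <? b
... | yes _ | yes _ = refl
... | yes _ | no n = ⊥-elim (n u)
... | no n | _ = ⊥-elim (n l)

within⁻ : ∀ {a b x} → within a b x ≡ true → a ≤ x × x < b
within⁻ {a} {b} {x} e with a ≤? x | x <? b
... | yes l | yes u = l , u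

cnt-within : ∀ a k n → a + k ≤ n → cnt (within a (a + k)) n ≡ k
cnt-within a k n h = ≤-antisym
  (cnt≤ _ (λ x y → x ≡ a + y) n k total λ x x′ y _ _ _ _ r r′ → trans r (sym r′))
  (≤cnt _ (λ x y → y ≡ a + x) k n
      (λ x l → a + x , ≤-trans (+-monoʳ-< a l) h , within⁺ (m≤m+n a x) (+-monoʳ-< a l) , refl)
      (λ x x′ y _ _ _ r r′ → +-cancelˡ-≡ a x x′ (trans (sym r) r′)))
  where
  total : ∀ x → x < n → within a (a + k) x ≡ true → Σ ℕ λ y → y < k × x ≡ a + y
  total x _ e with within⁻ {a} e
  ... | l , u = x ∸ a , +-cancelˡ-< a (x ∸ a) k (subst (_< a + k) (sym (m+[n∸m]≡n l)) u) , sym (m+[n∸m]≡n l)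

search : ∀ (f : ℕ → Bool) n → (Σ ℕ λ x → x < n × f x ≡ true) ⊎ (∀ x → x < n → f x ≡ false)
search f zero = inj₂ λ x ()
search f (suc n) with f n in e
... | true = inj₁ (n , ≤-refl , e)
... | false with search f n
...   | inj₁ (x , l , h) = inj₁ (x , m≤n⇒m≤1+n l , h)
...   | inj₂ h = inj₂ λ x l → case x l
  where
  case : ∀ x → x < suc n → f x ≡ false
  case x l with x ≟ n
  ... | yes refl = e
  ... | no x≢n = h x (≤∧≢⇒< (≤-pred l) x≢n)

T≢F : ∀ {b : Bool} {A : Set} → b ≡ true → b ≡ false → A
T≢F refl ()

∧-true : ∀ {a b} → a ∧ b ≡ true → a ≡ true × b ≡ true
∧-true {true} {true} _ = refl , refl

∧-intro : ∀ {a b} → a ≡ true → b ≡ true → a ∧ b ≡ true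
∧-intro refl refl = refl

dec-true : ∀ {A : Set} {d : Dec A} → ⌊ d ⌋ ≡ true → A
dec-true {d = yes a} _ = a

dec-intro : ∀ {A : Set} {d : Dec A} → A → ⌊ d ⌋ ≡ true
dec-intro {d = yes _} _ = refl
dec-intro {d = no n} a = ⊥-elim (n a)

dec-false : ∀ {A : Set} {d : Dec A} → ⌊ d ⌋ ≡ false → ¬ A
dec-false {d = no n} _ = n

not-true : ∀ {b} → not b ≡ true → b ≡ false
not-true {false} _ = refl

not-intro : ∀ {b} → b ≡ false → not b ≡ true
not-intro refl = refl

bool? : ∀ b → b ≡ true ⊎ b ≡ false
bool? true = inj₁ refl
bool? false = inj₂ refl

-- Residues, their differences ±1 and the elementary bounds

scaleS : ∀ {a b} q → a ≤ b → a * q ≤ b * q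
scaleS q h = *-monoˡ-≤ q h

module Residues (p q N α β : ℕ) (Y W : ℕ → ℕ) (plus neg : ℕ → Bool) where
 -- `Y x` is the second coordinate and `W x` the distance N - v, both modulo p q, so the sum x q + Y
 -- + W is N modulo p q. The three `S` predicates record how often that sum wraps; `Tops` places
 -- both summands within the margins α q and β q of p q.
 Tops S₀ S₁ S₂ : ℕ → Set
 Tops x = p * q ≤ Y x + α * q × p * q ≤ W x + β * q
 S₀ x = x * q + Y x + W x ≡ N
 S₁ x = x * q + Y x + W x ≡ N + p * q
 S₂ x = x * q + Y x + W x ≡ N + 2 * (p * q)

 -- The interface between the coefficients and the combinatorial argument. It is symmetric under
 -- exchanging (`α`, `Y`) with (`β`, `W`), since which of the two parameters is smaller is decided
 -- only when it is applied.
 record Layout : Set where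
  field
    q-pos : 0 < q
    N< : N < p * q
    Y< : ∀ x → x < p → Y x < p * q
    W< : ∀ x → x < p → W x < p * q
    plus⁻ : ∀ x → x < p → plus x ≡ true →
      (x < α × x < β × (S₀ x ⊎ (S₁ x × Tops x))) ⊎ (α + β ≤ x × S₂ x × Tops x)
    neg⁻ : ∀ x → x < p → neg x ≡ true → x < α + β × (α ≤ x ⊎ β ≤ x)
    ¬neg⁻ : ∀ x → x < p → α ≤ x → β ≤ x → x < α + β → neg x ≡ false →
      (S₁ x × Y x + α * q < p * q × W x + β * q < p * q) ⊎ S₂ x

 module Easy (L : Layout) (α≤β : α ≤ β) (α+β≤p : α + β ≤ p) where
  open Layout L

  mid : ℕ → Bool
  mid = within α (α + β)

  -- Exceptions are deviations from the extremal pattern: `plus` everywhere outside `mid`, no `neg`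
  -- inside.
  exc : ℕ → Bool
  exc x = if mid x then neg x else not (plus x)

  plus-mid : ∀ x → x < p → mid x ≡ true → plus x ≡ false
  plus-mid x x<p m with bool? (plus x)
  ... | inj₂ e = e
  ... | inj₁ e with plus⁻ x x<p e
  ...   | inj₁ (x<α , _) = ⊥-elim (<⇒≱ x<α (proj₁ (within⁻ {α} m)))
  ...   | inj₂ (l , _) = ⊥-elim (<⇒≱ (proj₂ (within⁻ {α} m)) l)

  neg-mid : ∀ x → x < p → neg x ≡ true → mid x ≡ true
  neg-mid x x<p e with neg⁻ x x<p e
  ... | u , inj₁ l = within⁺ l u
  ... | u , inj₂ l = within⁺ (≤-trans α≤β l) u

  cnt-mid : cnt mid p ≡ β
  cnt-mid = cnt-within α β p α+β≤p

  -- Pointwise `plus` and `exc` together match the complement of `mid` together with `neg`, and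
  -- `mid` has β elements.
  balance : cnt plus p + cnt exc p + β ≡ p + cnt neg p
  balance = trans (cong (_+ β) bal) (trans (trans (+-assoc (cnt (λ x → not (mid x)) p) _ _) (trans (cong (cnt (λ x → not (mid x)) p +_) (+-comm _ β)) (sym (+-assoc (cnt (λ x → not (mid x)) p) β _)))) (cong (_+ cnt neg p) (trans (+-comm _ β) tot)))
    where
    bal : cnt plus p + cnt exc p ≡ cnt (λ x → not (mid x)) p + cnt neg p
    bal = cnt-balance plus exc (λ x → not (mid x)) neg p pt
      where
      pt : ∀ x → x < p → (if plus x then 1 else 0) + (if exc x then 1 else 0) ≡ (if not (mid x) then 1 else 0) + (if neg x then 1 else 0)
      pt x x<p with mid x in em
      ... | true rewrite plus-mid x x<p em = refl
      ... | false with neg x in en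
      ...   | true = T≢F (neg-mid x x<p en) em
      ...   | false with plus x
      ...     | true = refl
      ...     | false = refl
    tot : β + cnt (λ x → not (mid x)) p ≡ p
    tot = trans (cong (_+ cnt (λ x → not (mid x)) p) (sym cnt-mid)) (trans (cnt-balance mid (λ x → not (mid x)) (λ _ → true) (λ _ → false) p (λ x _ → pt x)) (trans (cong₂ _+_ (cnt-all p λ _ _ → refl) (cnt-none p λ _ _ → refl)) (+-identityʳ p)))
      where
      pt : ∀ x → (if mid x then 1 else 0) + (if not (mid x) then 1 else 0) ≡ 1 + 0
      pt x with mid x
      ... | true = refl
      ... | false = refl

  neg≤β : cnt neg p ≤ β
  neg≤β = subst (cnt neg p ≤_) cnt-mid (cnt-⊆ neg mid p neg-mid)

  isS₀ : ℕ → Bool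
  isS₀ x = ⌊ x * q + Y x + W x ≟ N ⌋

  low : ℕ → Bool
  low x = plus x ∧ isS₀ x

  bulk : ℕ → Bool
  bulk x = plus x ∧ not (isS₀ x)

  -- Counted apart so that `chain` can charge to it the low residues x for which (x + β) q exceeds
  -- N.
  hole : ℕ → Bool
  hole x = within β (α + β) x ∧ ⌊ N <? x * q ⌋

  -- A residue x below α with one wrap behaves as the integer x + p with two. After this lift all
  -- bulk residues lie in one interval of α + β consecutive integers.
  Lift : ℕ → ℕ → Set
  Lift x z = (z ≡ x ⊎ z ≡ x + p) × N < z * q × z * q ≤ N + (α + β) * q

  bulk-lift : ∀ x → x < p → bulk x ≡ true → Σ ℕ (Lift x)
  bulk-lift x x<p e with plus⁻ x x<p (proj₁ (∧-true e))
  ... | inj₁ (_ , _ , inj₁ s) = T≢F (dec-intro {d = x * q + Y x + W x ≟ N} s) (not-true (proj₂ (∧-true {plus x} e)))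
  ... | inj₁ (x<α , _ , inj₂ (s , t , u)) = x + p , inj₂ refl ,
    (lin≤ (N ∷ x ∷ p ∷ q ∷ (Y x) ∷ (W x) ∷ []) (# 1 :+ v0) ((v1 :+ v2) :* v3) (v0 :+ v2 :* v3 ==˘ v1 :* v3 :+ v4 :+ v5 by s & # 1 :+ v4 <= v2 :* v3 by Y< x x<p & # 1 :+ v5 <= v2 :* v3 by W< x x<p) refl) ,
    (lin≤ (x ∷ p ∷ q ∷ N ∷ α ∷ β ∷ (Y x) ∷ (W x) ∷ []) ((v0 :+ v1) :* v2) (v3 :+ (v4 :+ v5) :* v2) (v0 :* v2 :+ v6 :+ v7 == v3 :+ v1 :* v2 by s & v1 :* v2 <= v6 :+ v4 :* v2 by t & v1 :* v2 <= v7 :+ v5 :* v2 by u) refl)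
  ... | inj₂ (_ , s , t , u) = x , inj₁ refl ,
    (lin≤ (N ∷ x ∷ q ∷ p ∷ (Y x) ∷ (W x) ∷ []) (# 1 :+ v0) (v1 :* v2) (v0 :+ # 2 :* (v3 :* v2) ==˘ v1 :* v2 :+ v4 :+ v5 by s & # 1 :+ v4 <= v3 :* v2 by Y< x x<p & # 1 :+ v5 <= v3 :* v2 by W< x x<p) refl) ,
    (lin≤ (x ∷ q ∷ N ∷ α ∷ β ∷ (Y x) ∷ (W x) ∷ p ∷ []) (v0 :* v1) (v2 :+ (v3 :+ v4) :* v1) (v0 :* v1 :+ v5 :+ v6 == v2 :+ # 2 :* (v7 :* v1) by s & v7 :* v1 <= v5 :+ v3 :* v1 by t & v7 :* v1 <= v6 :+ v4 :* v1 by u) refl)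

  cancelS : ∀ {a b} → a * q < b * q → a < b
  cancelS {a} {b} h = *-cancelʳ-< q a b h

  -- Bulk residues lift to z with N < z q ≤ N + (α + β) q; the holes are the residues of
  -- this window which are known to contribute nothing.
  window : cnt bulk p + cnt hole p ≤ α + β
  window = subst (_≤ α + β) (sym both) (cnt≤ (λ x → bulk x ∨ hole x) R p (α + β) total inj)
    where
    instance
      q≢0 : NonZero q
      q≢0 = >-nonZero q-pos
    -- The integers z of the window are n₀ + 1, ..., n₀ + α + β, so the slot of z is z - n₀ - 1.
    n₀ = N / q
    R : ℕ → ℕ → Set
    R x i = Lift x (suc (n₀ + i))
    both : cnt bulk p + cnt hole p ≡ cnt (λ x → bulk x ∨ hole x) p
    both = trans (cnt-balance bulk hole (λ x → bulk x ∨ hole x) (λ _ → false) p pt) (trans (cong (cnt (λ x → bulk x ∨ hole x) p +_) (cnt-none p λ _ _ → refl)) (+-identityʳ _))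
      where
      pt : ∀ x → x < p → (if bulk x then 1 else 0) + (if hole x then 1 else 0) ≡ (if bulk x ∨ hole x then 1 else 0) + 0
      pt x x<p with bulk x in eb | hole x in eh
      ... | true | false = refl
      ... | false | true = refl
      ... | false | false = refl
      ... | true | true = T≢F (proj₁ (∧-true eb)) (plus-mid x x<p (within⁺ (≤-trans α≤β (proj₁ w)) (proj₂ w)))
        where w = within⁻ {β} (proj₁ (∧-true eh))
    n₀-spec : N ≡ N % q + n₀ * q
    n₀-spec = m≡m%n+[m/n]*n N q
    n₀-rem : N % q < q
    n₀-rem = m%n<n N q
    slot : ∀ x z → Lift x z → Σ ℕ λ i → i < α + β × R x i
    slot x z (r , l , u) = z ∸ suc n₀ , bound , subst (Lift x) (sym z≡) (r , l , u)
      where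
      n₀<z : n₀ < z
      n₀<z = cancelS (lin≤ (n₀ ∷ q ∷ z ∷ N ∷ (N % q) ∷ []) (# 1 :+ (v0 :* v1)) (v2 :* v1) (# 1 :+ v3 <= v2 :* v1 by l & v4 :+ v0 :* v1 ==˘ v3 by n₀-spec) refl)
      z≡ : suc (n₀ + (z ∸ suc n₀)) ≡ z
      z≡ = m+[n∸m]≡n n₀<z
      z< : z < suc n₀ + (α + β)
      z< = cancelS (lin≤ (z ∷ q ∷ n₀ ∷ α ∷ β ∷ N ∷ (N % q) ∷ []) (# 1 :+ (v0 :* v1)) ((# 1 :+ v2 :+ (v3 :+ v4)) :* v1) (v0 :* v1 <= v5 :+ (v3 :+ v4) :* v1 by u & v5 == v6 :+ v2 :* v1 by n₀-spec & # 1 :+ v6 <= v1 by n₀-rem) refl)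
      bound : z ∸ suc n₀ < α + β
      bound = +-cancelˡ-< (suc n₀) _ _ (subst (_< suc n₀ + (α + β)) (sym z≡) z<)
    total : ∀ x → x < p → bulk x ∨ hole x ≡ true → Σ ℕ λ i → i < α + β × R x i
    total x x<p e with bool? (bulk x)
    ... | inj₁ eb = slot x _ (proj₂ (bulk-lift x x<p eb))
    ... | inj₂ eb with ∧-true {within β (α + β) x} (subst (λ b → b ∨ hole x ≡ true) eb e)
    ...   | w , d = slot x x (inj₁ refl , N<xq , (lin≤ (x ∷ q ∷ N ∷ α ∷ β ∷ []) (v0 :* v1) (v2 :+ (v3 :+ v4) :* v1) (v0 :* v1 <= (v3 :+ v4) :* v1 by scaleS q (<⇒≤ (proj₂ (within⁻ {β} w)))) refl))
      where
      N<xq : N < x * q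
      N<xq = dec-true {d = N <? x * q} d
    inj : ∀ x x′ y → x < p → x′ < p → bulk x ∨ hole x ≡ true → bulk x′ ∨ hole x′ ≡ true → R x y → R x′ y → x ≡ x′
    inj x x′ y x<p x′<p _ _ (inj₁ e , _) (inj₁ e′ , _) = trans (sym e) e′
    inj x x′ y x<p x′<p _ _ (inj₂ e , _) (inj₂ e′ , _) = +-cancelʳ-≡ p x x′ (trans (sym e) e′)
    inj x x′ y x<p x′<p _ _ (inj₁ e , _) (inj₂ e′ , _) = ⊥-elim (<⇒≱ x<p (subst (p ≤_) (trans (sym e′) e) (m≤n+m p x′)))
    inj x x′ y x<p x′<p _ _ (inj₂ e , _) (inj₁ e′ , _) = ⊥-elim (<⇒≱ x′<p (subst (p ≤_) (trans (sym e) e′) (m≤n+m p x)))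

  low-lt : ∀ x → x < p → low x ≡ true → x < α
  low-lt x x<p e with plus⁻ x x<p (proj₁ (∧-true e)) | dec-true {d = x * q + Y x + W x ≟ N} (proj₂ (∧-true {plus x} e))
  ... | inj₁ (l , _) | _ = l
  ... | inj₂ (_ , s , _) | s₀ = lin⊥ (N ∷ p ∷ q ∷ x ∷ (Y x) ∷ (W x) ∷ []) (v0 :+ # 2 :* (v1 :* v2) ==˘ v3 :* v2 :+ v4 :+ v5 by s & v3 :* v2 :+ v4 :+ v5 == v0 by s₀ & 2 · # 1 :+ v0 <= v1 :* v2 by N<) refl

  plus≤ : cnt plus p ≤ α + (α + β)
  plus≤ = lin≤ ((cnt plus p) ∷ α ∷ β ∷ (cnt low p) ∷ (cnt bulk p) ∷ (cnt hole p) ∷ []) v0 (v1 :+ (v1 :+ v2)) (v0 == v3 :+ v4 by cnt-split plus isS₀ p & v4 :+ v5 <= v1 :+ v2 by window & v3 <= v1 by low≤) refl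
    where
    low≤ : cnt low p ≤ α
    low≤ = cnt≤ low _≡_ p α (λ x l e → x , low-lt x l e , refl) (λ x x′ y _ _ _ _ r r′ → trans r (sym r′))

  plus≤′ : cnt plus p + β ≤ p
  plus≤′ = lin≤ ((cnt plus p) ∷ β ∷ p ∷ (cnt (λ x → not (plus x)) p) ∷ (cnt mid p) ∷ []) (v0 :+ v1) v2 (v0 :+ v3 == v2 by tot & v4 <= v3 by mid≤ & v1 ==˘ v4 by cnt-mid) refl
    where
    pt : ∀ x → x < p → (if plus x then 1 else 0) + (if not (plus x) then 1 else 0) ≡ 1 + 0
    pt x _ with plus x
    ... | true = refl
    ... | false = refl
    tot : cnt plus p + cnt (λ x → not (plus x)) p ≡ p
    tot = trans (cnt-balance plus (λ x → not (plus x)) (λ _ → true) (λ _ → false) p pt) (trans (cong₂ _+_ (cnt-all p λ _ _ → refl) (cnt-none p λ _ _ → refl)) (+-identityʳ p))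
    mid≤ : cnt mid p ≤ cnt (λ x → not (plus x)) p
    mid≤ = cnt-⊆ mid (λ x → not (plus x)) p (λ x l e → not-intro (plus-mid x l e))

 -- The progression x - β, x, x + β, x + 2 β modulo p, with `u` for x - β. From x on, the wrap count
 -- goes 0, 1, 2; these links fix the displacement of the fast kind and show that three of them fit
 -- into the time interval.
 record Chain : Set where
  field
    x : ℕ
    x<α : x < α
    s₀ : S₀ x
    s₁ : S₁ (x + β)
    y₁ : Y (x + β) + α * q < p * q
    w₁ : W (x + β) + β * q < p * q
    s₂ : S₂ (x + 2 * β)
    t₂ : Tops (x + 2 * β)
    u : ℕ
    u≡ : u + β ≡ x + p
    s₃ : S₂ u
    t₃ : Tops u

 -- A link between two tops: both have two wraps, so Y + W drops by exactly β q. It fixes the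
 -- displacement of the slow kind.
 record Double : Set where
  field
    y : ℕ
    y≥ : α + β ≤ y
    y< : y + β < p
    s : S₂ y
    t : Tops y
    s′ : S₂ (y + β)
    t′ : Tops (y + β)

 -- From here on 3 S > 2 p is assumed, where S = cnt plus p - cnt neg p, and refuted.
 module Large (L : Layout) (α≤β : α ≤ β) (3β<p : 3 * β + 1 ≤ p) (reg : 2 * p + 1 ≤ 6 * α + 3 * β)
   (big : 2 * p + 1 + 3 * cnt neg p ≤ 3 * cnt plus p) where
  open Layout L
  α+β≤p : α + β ≤ p
  α+β≤p = lin≤ (α ∷ β ∷ p ∷ []) (v0 :+ v1) v2 (v0 <= v1 by α≤β & # 3 :* v1 :+ # 1 <= v2 by 3β<p) refl
  open Easy L α≤β α+β≤p public

  X : ℕ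
  X = cnt exc p

  bal : cnt plus p + cnt exc p + β ≡ p + cnt neg p
  bal = balance

  X-small : 3 * X + 3 * β + 1 ≤ p
  X-small = lin≤ ((cnt exc p) ∷ β ∷ p ∷ (cnt plus p) ∷ (cnt neg p) ∷ []) (# 3 :* v0 :+ # 3 :* v1 :+ # 1) v2 (3 · v3 :+ v0 :+ v1 == v2 :+ v4 by bal & # 2 :* v2 :+ # 1 :+ # 3 :* v4 <= # 3 :* v3 by big) refl

  upper-plus : ∀ x → x < p → α + β ≤ x → plus x ≡ true → S₂ x × Tops x
  upper-plus x x<p l e with plus⁻ x x<p e
  ... | inj₂ (_ , s) = s
  ... | inj₁ (x<α , _) = lin⊥ (α ∷ β ∷ x ∷ []) (v0 :+ v1 <= v2 by l & # 1 :+ v2 <= v0 by x<α) refl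

  upper-exc : ∀ x → α + β ≤ x → plus x ≡ false → exc x ≡ true
  upper-exc x l e with mid x in em
  ... | true = ⊥-elim (<⇒≱ (proj₂ (within⁻ {α} em)) l)
  ... | false rewrite e = refl

  lower-exc : ∀ x → x < α → plus x ≡ false → exc x ≡ true
  lower-exc x l e with mid x in em
  ... | true = ⊥-elim (<⇒≱ l (proj₁ (within⁻ {α} em)))
  ... | false rewrite e = refl

  mid-exc : ∀ x → x < p → neg x ≡ true → exc x ≡ true
  mid-exc x l e rewrite neg-mid x l e = e

  excU : ℕ → Bool
  excU x = ⌊ α + β ≤? x ⌋ ∧ not (plus x)

  -- `neg` residues lie inside `mid`, those of `excU` above it, so the two are disjoint sets of
  -- exceptions.
  excU+neg : cnt excU p + cnt neg p ≤ X
  excU+neg = lin≤ ((cnt excU p) ∷ (cnt neg p) ∷ (cnt exc p) ∷ (cnt (λ x → exc x ∧ mid x) p) ∷ (cnt (λ x → exc x ∧ not (mid x)) p) ∷ []) (v0 :+ v1) v2 (v3 :+ v4 ==˘ v2 by cnt-split exc mid p & v1 <= v3 by h₁ & v0 <= v4 by h₂) refl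
    where
    h₁ : cnt neg p ≤ cnt (λ x → exc x ∧ mid x) p
    h₁ = cnt-⊆ _ _ p λ x l e → ∧-intro (mid-exc x l e) (neg-mid x l e)
    h₂ : cnt excU p ≤ cnt (λ x → exc x ∧ not (mid x)) p
    h₂ = cnt-⊆ _ _ p λ x l e → let (d , e′) = ∧-true e ; α+β≤x = dec-true {d = α + β ≤? x} d in
      ∧-intro (upper-exc x α+β≤x (not-true e′)) (not-intro (not-mid x α+β≤x))
      where
      not-mid : ∀ x → α + β ≤ x → mid x ≡ false
      not-mid x l with mid x in em
      ... | true = ⊥-elim (<⇒≱ (proj₂ (within⁻ {α} em)) l)
      ... | false = refl

  p-β : ℕ
  p-β = p ∸ β
  p-β+ : p-β + β ≡ p
  p-β+ = m∸n+n≡m (lin≤ (β ∷ p ∷ []) v0 v1 (# 3 :* v0 :+ # 1 <= v1 by 3β<p) refl)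

  early : ℕ → Bool
  early x = ⌊ (x + β) * q ≤? N ⌋

  link₁ link₂ link₃ : ℕ → Bool
  link₁ x = not (neg (x + β))
  link₂ x = plus (x + 2 * β)
  link₃ x = plus (x + p-β)

  chain? : ℕ → Bool
  chain? x = ((low x ∧ early x) ∧ link₁ x) ∧ (link₂ x ∧ link₃ x)

  shift-inj : ∀ c x x′ y → y ≡ x + c → y ≡ x′ + c → x ≡ x′
  shift-inj c x x′ y e e′ = +-cancelʳ-≡ c x x′ (trans (sym e) e′)

  -- The arithmetic of `chain`: k counts the early low residues, k₁′ those spoilt at x + β, k₂′
  -- those spoilt at x + 2 β, and k₂ the rest, which must be spoilt at x - β. Late low residues (k′)
  -- are paid for by holes.
  no-chain : ∀ {A : Set} {pl X n bu ho lo k k′ eU k₁ k₁′ k₂ k₂′} → pl + X + β ≡ p + n → 2 * p + 1 + 3 * n ≤ 3 * pl →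
    bu + ho ≤ α + β → pl ≡ lo + bu → lo ≡ k + k′ → k′ ≤ ho → eU + n ≤ X → k ≡ k₁ + k₁′ → k₁′ ≤ n →
    k₁ ≡ k₂ + k₂′ → k₂′ ≤ eU → k₂ ≤ eU → α ≤ β → A
  no-chain {_} {pl} {X} {n} {bu} {ho} {lo} {k} {k′} {eU} {k₁} {k₁′} {k₂} {k₂′} h₁ h₂ h₃ h₄ h₅ h₆ h₇ h₈ h₉ h₁₀ h₁₁ h₁₂ h₁₃ =
    (lin⊥ (pl ∷ X ∷ β ∷ p ∷ n ∷ α ∷ eU ∷ []) (2 · v0 :+ v1 :+ v2 == v3 :+ v4 by h₁ & # 2 :* v3 :+ # 1 :+ # 3 :* v4 <= # 3 :* v0 by h₂ & v0 <= v5 :+ v2 :+ v4 :+ # 2 :* v6 by pl≤ & 2 · v6 :+ v4 <= v1 by h₇ & v5 <= v2 by α≤β) refl)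
    where
    k≤ : k ≤ n + 2 * eU
    k≤ = lin≤ (k ∷ n ∷ eU ∷ k₁ ∷ k₁′ ∷ k₂ ∷ k₂′ ∷ []) v0 (v1 :+ # 2 :* v2) (v0 == v3 :+ v4 by h₈ & v4 <= v1 by h₉ & v3 == v5 :+ v6 by h₁₀ & v6 <= v2 by h₁₁ & v5 <= v2 by h₁₂) refl
    pl≤ : pl ≤ α + β + n + 2 * eU
    pl≤ = lin≤ (pl ∷ α ∷ β ∷ n ∷ eU ∷ bu ∷ ho ∷ lo ∷ k ∷ k′ ∷ []) v0 (v1 :+ v2 :+ v3 :+ # 2 :* v4) (v5 :+ v6 <= v1 :+ v2 by h₃ & v0 == v7 :+ v5 by h₄ & v7 == v8 :+ v9 by h₅ & v9 <= v6 by h₆ & v8 <= v3 :+ # 2 :* v4 by k≤) refl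

  -- Were every low early residue x spoilt at x + β, x + 2β or x - β, then
  -- S ≤ α + β + 2 cnt excU together with S = p - β - X would give 3 S ≤ 2 p.
  chain : Chain
  chain with search chain? p
  ... | inj₁ (x , x<p , e) = record
    { x = x ; x<α = x<α ; s₀ = dec-true {d = x * q + Y x + W x ≟ N} (proj₂ (∧-true {plus x} lo))
    ; s₁ = proj₁ mids ; y₁ = proj₁ (proj₂ mids) ; w₁ = proj₂ (proj₂ mids)
    ; s₂ = proj₁ up₂ ; t₂ = proj₂ up₂ ; u = x + p-β
    ; u≡ = trans (+-assoc x p-β β) (cong (x +_) p-β+) ; s₃ = proj₁ up₃ ; t₃ = proj₂ up₃ }
    where
    e₁ = ∧-true {(low x ∧ early x) ∧ link₁ x} e
    e₂ = ∧-true {low x ∧ early x} (proj₁ e₁)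
    e₃ = ∧-true {link₂ x} (proj₂ e₁)
    lo : low x ≡ true
    lo = proj₁ (∧-true {low x} (proj₁ e₂))
    x<α = low-lt x x<p lo
    ear : (x + β) * q ≤ N
    ear = dec-true {d = (x + β) * q ≤? N} (proj₂ (∧-true {low x} (proj₁ e₂)))
    mids : S₁ (x + β) × Y (x + β) + α * q < p * q × W (x + β) + β * q < p * q
    mids with ¬neg⁻ (x + β) (lin≤ (x ∷ β ∷ p ∷ α ∷ []) (# 1 :+ (v0 :+ v1)) v2 (2 · # 1 :+ v0 <= v3 by x<α & 2 · v3 <= v1 by α≤β & # 3 :* v1 :+ # 1 <= v2 by 3β<p) refl) (lin≤ (α ∷ x ∷ β ∷ []) v0 (v1 :+ v2) (v0 <= v2 by α≤β) refl) (m≤n+m β x) (lin≤ (x ∷ β ∷ α ∷ []) (# 1 :+ (v0 :+ v1)) (v2 :+ v1) (# 1 :+ v0 <= v2 by x<α) refl) (not-true (proj₂ e₂))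
    ... | inj₁ s = s
    -- Being early means (x + β) q ≤ N, so two wraps would need Y + W ≥ 2 p q.
    ... | inj₂ s = lin⊥ (N ∷ p ∷ q ∷ x ∷ β ∷ (Y (x + β)) ∷ (W (x + β)) ∷ []) (v0 :+ # 2 :* (v1 :* v2) ==˘ (v3 :+ v4) :* v2 :+ v5 :+ v6 by s & (v3 :+ v4) :* v2 <= v0 by ear & # 1 :+ v5 <= v1 :* v2 by Y< (x + β) x+β<p & # 1 :+ v6 <= v1 :* v2 by W< (x + β) x+β<p) refl
      where
      x+β<p : x + β < p
      x+β<p = lin≤ (x ∷ β ∷ p ∷ α ∷ []) (# 1 :+ (v0 :+ v1)) v2 (2 · # 1 :+ v0 <= v3 by x<α & 2 · v3 <= v1 by α≤β & # 3 :* v1 :+ # 1 <= v2 by 3β<p) refl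
    up₂ = upper-plus (x + 2 * β) (lin≤ (x ∷ β ∷ p ∷ α ∷ []) (# 1 :+ (v0 :+ # 2 :* v1)) v2 (# 1 :+ v0 <= v3 by x<α & v3 <= v1 by α≤β & # 3 :* v1 :+ # 1 <= v2 by 3β<p) refl) (lin≤ (α ∷ β ∷ x ∷ []) (v0 :+ v1) (v2 :+ # 2 :* v1) (v0 <= v1 by α≤β) refl) (proj₁ e₃)
    up₃ = upper-plus (x + p-β) (lin≤ (x ∷ p-β ∷ p ∷ α ∷ β ∷ []) (# 1 :+ (v0 :+ v1)) v2 (# 1 :+ v0 <= v3 by x<α & v3 <= v4 by α≤β & v1 :+ v4 == v2 by p-β+) refl) (lin≤ (α ∷ β ∷ x ∷ p-β ∷ p ∷ []) (v0 :+ v1) (v2 :+ v3) (v0 <= v1 by α≤β & # 3 :* v1 :+ # 1 <= v4 by 3β<p & v4 ==˘ v3 :+ v1 by p-β+) refl) (proj₂ e₃)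
  ... | inj₂ none = no-chain bal big window (cnt-split plus isS₀ p) (cnt-split low early p) K′≤ excU+neg (cnt-split K link₁ p) K₁′≤ (cnt-split K₁ link₂ p) K₂′≤ K₂≤ α≤β
    where
    K K′ K₁ K₁′ K₂ K₂′ : ℕ → Bool
    K x = low x ∧ early x
    K′ x = low x ∧ not (early x)
    K₁ x = K x ∧ link₁ x
    K₁′ x = K x ∧ not (link₁ x)
    K₂ x = K₁ x ∧ link₂ x
    K₂′ x = K₁ x ∧ not (link₂ x)
    K<α : ∀ x → x < p → K x ≡ true → x < α
    K<α x l e = low-lt x l (proj₁ (∧-true {low x} e))
    K′≤ : cnt K′ p ≤ cnt hole p
    K′≤ = cnt-inj (λ x y → y ≡ x + β) p p total λ x x′ y _ _ _ _ _ → shift-inj β x x′ y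
      where
      total : ∀ x → x < p → K′ x ≡ true → Σ ℕ λ y → y < p × hole y ≡ true × y ≡ x + β
      total x l e with ∧-true {low x} e
      ... | lo , ne = let x<α = low-lt x l lo in x + β , (lin≤ (x ∷ β ∷ p ∷ α ∷ []) (# 1 :+ (v0 :+ v1)) v2 (2 · # 1 :+ v0 <= v3 by x<α & 2 · v3 <= v1 by α≤β & # 3 :* v1 :+ # 1 <= v2 by 3β<p) refl) ,
        ∧-intro (within⁺ (m≤n+m β x) (+-monoˡ-< β x<α)) (dec-intro {d = N <? (x + β) * q} (≰⇒> (dec-false {d = (x + β) * q ≤? N} (not-true ne)))) , refl
    K₁′≤ : cnt K₁′ p ≤ cnt neg p
    K₁′≤ = cnt-inj (λ x y → y ≡ x + β) p p total λ x x′ y _ _ _ _ _ → shift-inj β x x′ y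
      where
      total : ∀ x → x < p → K₁′ x ≡ true → Σ ℕ λ y → y < p × neg y ≡ true × y ≡ x + β
      total x l e with ∧-true {K x} e
      ... | k , ne with neg (x + β) in en
      ...   | true = x + β , (lin≤ (x ∷ β ∷ p ∷ α ∷ []) (# 1 :+ (v0 :+ v1)) v2 (2 · # 1 :+ v0 <= v3 by K<α x l k & 2 · v3 <= v1 by α≤β & # 3 :* v1 :+ # 1 <= v2 by 3β<p) refl) , en , refl
      ...   | false = T≢F refl (not-true ne)
    K₂′≤ : cnt K₂′ p ≤ cnt excU p
    K₂′≤ = cnt-inj (λ x y → y ≡ x + 2 * β) p p total λ x x′ y _ _ _ _ _ → shift-inj (2 * β) x x′ y
      where
      total : ∀ x → x < p → K₂′ x ≡ true → Σ ℕ λ y → y < p × excU y ≡ true × y ≡ x + 2 * β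
      total x l e with ∧-true {K₁ x} e
      ... | k , ne = x + 2 * β , (lin≤ (x ∷ β ∷ p ∷ α ∷ []) (# 1 :+ (v0 :+ # 2 :* v1)) v2 (# 1 :+ v0 <= v3 by K<α x l (proj₁ (∧-true {K x} k)) & v3 <= v1 by α≤β & # 3 :* v1 :+ # 1 <= v2 by 3β<p) refl) ,
        ∧-intro (dec-intro {d = α + β ≤? x + 2 * β} (lin≤ (α ∷ β ∷ x ∷ []) (v0 :+ v1) (v2 :+ # 2 :* v1) (v0 <= v1 by α≤β) refl)) ne , refl
    K₂≤ : cnt K₂ p ≤ cnt excU p
    K₂≤ = cnt-inj (λ x y → y ≡ x + p-β) p p total λ x x′ y _ _ _ _ _ → shift-inj p-β x x′ y
      where
      total : ∀ x → x < p → K₂ x ≡ true → Σ ℕ λ y → y < p × excU y ≡ true × y ≡ x + p-β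
      total x l e with ∧-true {K₁ x} e
      ... | k , e₂ = x + p-β , (lin≤ (x ∷ p-β ∷ p ∷ α ∷ β ∷ []) (# 1 :+ (v0 :+ v1)) v2 (# 1 :+ v0 <= v3 by K<α x l (proj₁ (∧-true {K x} k)) & v3 <= v4 by α≤β & v1 :+ v4 == v2 by p-β+) refl) ,
        ∧-intro (dec-intro {d = α + β ≤? x + p-β} (lin≤ (α ∷ β ∷ x ∷ p-β ∷ p ∷ []) (v0 :+ v1) (v2 :+ v3) (v0 <= v1 by α≤β & # 3 :* v1 :+ # 1 <= v4 by 3β<p & v4 ==˘ v3 :+ v1 by p-β+) refl)) (not-intro e₃) , refl
        where
        e₃ : plus (x + p-β) ≡ false
        e₃ with plus (x + p-β) in q₃
        ... | false = refl
        ... | true = T≢F (∧-intro k (∧-intro e₂ q₃)) (none x l)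

  double? : ℕ → Bool
  double? y = (⌊ α + β ≤? y ⌋ ∧ ⌊ y + β <? p ⌋) ∧ (plus y ∧ plus (y + β))

  not-double : ∀ y → α + β ≤ y → y + β < p → double? y ≡ false → exc y ≡ true ⊎ exc (y + β) ≡ true
  not-double y l u e with bool? (plus y) | bool? (plus (y + β))
  ... | inj₂ e₁ | _ = inj₁ (upper-exc y l e₁)
  ... | inj₁ e₁ | inj₂ e₂ = inj₂ (upper-exc (y + β) (≤-trans l (m≤m+n y β)) e₂)
  ... | inj₁ e₁ | inj₁ e₂ = T≢F (∧-intro {⌊ α + β ≤? y ⌋ ∧ ⌊ y + β <? p ⌋} (∧-intro (dec-intro {d = α + β ≤? y} l) (dec-intro {d = y + β <? p} u)) (∧-intro e₁ e₂)) e

  double : Double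
  double with search double? p
  ... | inj₁ (y , y<p , e) = record { y = y ; y≥ = l ; y< = u ; s = proj₁ a ; t = proj₂ a ; s′ = proj₁ b ; t′ = proj₂ b }
    where
    e₁ = ∧-true {⌊ α + β ≤? y ⌋ ∧ ⌊ y + β <? p ⌋} e
    e₂ = ∧-true {⌊ α + β ≤? y ⌋} (proj₁ e₁)
    e₃ = ∧-true {plus y} (proj₂ e₁)
    l = dec-true {d = α + β ≤? y} (proj₁ e₂)
    u = dec-true {d = y + β <? p} (proj₂ e₂)
    a = upper-plus y y<p l (proj₁ e₃)
    b = upper-plus (y + β) u (≤-trans l (m≤m+n y β)) (proj₂ e₃)
  ... | inj₂ none = go
    where
    -- The pairs (y, y + β) for the first k values y ≥ α + β are disjoint because k ≤ β, and each
    -- contains an exception.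
    bound : ∀ k → k ≤ β → α + 2 * β + k ≤ p → k ≤ X
    bound k k≤β fits = ≤cnt exc (λ i y → y ≡ α + β + i ⊎ y ≡ α + β + i + β) k p total inj
      where
      total : ∀ i → i < k → Σ ℕ λ y → y < p × exc y ≡ true × (y ≡ α + β + i ⊎ y ≡ α + β + i + β)
      total i i<k with not-double (α + β + i) (m≤m+n (α + β) i) (lin≤ (α ∷ β ∷ i ∷ p ∷ k ∷ []) (# 1 :+ (v0 :+ v1 :+ v2 :+ v1)) v3 (# 1 :+ v2 <= v4 by i<k & v0 :+ # 2 :* v1 :+ v4 <= v3 by fits) refl) (none (α + β + i) (lin≤ (α ∷ β ∷ i ∷ p ∷ k ∷ []) (# 1 :+ (v0 :+ v1 :+ v2)) v3 (# 1 :+ v2 <= v4 by i<k & v0 :+ # 2 :* v1 :+ v4 <= v3 by fits) refl))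
      ... | inj₁ e = α + β + i , (lin≤ (α ∷ β ∷ i ∷ p ∷ k ∷ []) (# 1 :+ (v0 :+ v1 :+ v2)) v3 (# 1 :+ v2 <= v4 by i<k & v0 :+ # 2 :* v1 :+ v4 <= v3 by fits) refl) , e , inj₁ refl
      ... | inj₂ e = α + β + i + β , (lin≤ (α ∷ β ∷ i ∷ p ∷ k ∷ []) (# 1 :+ (v0 :+ v1 :+ v2 :+ v1)) v3 (# 1 :+ v2 <= v4 by i<k & v0 :+ # 2 :* v1 :+ v4 <= v3 by fits) refl) , e , inj₂ refl
      inj : ∀ i i′ y → i < k → i′ < k → y < p → (y ≡ α + β + i ⊎ y ≡ α + β + i + β) → (y ≡ α + β + i′ ⊎ y ≡ α + β + i′ + β) → i ≡ i′
      inj i i′ y l l′ _ (inj₁ r) (inj₁ r′) = +-cancelˡ-≡ (α + β) i i′ (trans (sym r) r′)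
      inj i i′ y l l′ _ (inj₂ r) (inj₂ r′) = +-cancelˡ-≡ (α + β) i i′ (+-cancelʳ-≡ β _ _ (trans (sym r) r′))
      inj i i′ y l l′ _ (inj₁ r) (inj₂ r′) = lin⊥ (y ∷ α ∷ β ∷ i ∷ i′ ∷ k ∷ []) (v0 == v1 :+ v2 :+ v3 by r & v1 :+ v2 :+ v4 :+ v2 ==˘ v0 by r′ & # 1 :+ v3 <= v5 by l & v5 <= v2 by k≤β) refl
      inj i i′ y l l′ _ (inj₂ r) (inj₁ r′) = lin⊥ (α ∷ β ∷ i ∷ y ∷ i′ ∷ k ∷ []) (v0 :+ v1 :+ v2 :+ v1 ==˘ v3 by r & v3 == v0 :+ v1 :+ v4 by r′ & # 1 :+ v4 <= v5 by l′ & v5 <= v1 by k≤β) refl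
    go : Double
    -- If β pairs fit, β ≤ X; with 6 α + 3 β > 2 p this contradicts 3 X + 3 β < p. Otherwise p - α -
    -- 2 β pairs fit, and p ≤ α + 2 β + X contradicts it directly.
    go with α + 3 * β ≤? p
    ... | yes fits = lin⊥ (β ∷ X ∷ p ∷ α ∷ []) (3 · v0 <= v1 by bound β ≤-refl fits′ & 2 · # 3 :* v1 :+ # 3 :* v0 :+ # 1 <= v2 by X-small & # 2 :* v2 :+ # 1 <= # 6 :* v3 :+ # 3 :* v0 by reg & 6 · v3 <= v0 by α≤β) refl
      where
      fits′ : α + 2 * β + β ≤ p
      fits′ = lin≤ (α ∷ β ∷ p ∷ []) (v0 :+ # 2 :* v1 :+ v1) v2 (v0 :+ # 3 :* v1 <= v2 by fits) refl
    ... | no ¬fits = lin⊥ (k ∷ X ∷ p ∷ α ∷ β ∷ []) (v0 <= v1 by bound k k≤β (≤-reflexive e) & v2 ==˘ v3 :+ # 2 :* v4 :+ v0 by e & # 3 :* v1 :+ # 3 :* v4 :+ # 1 <= v2 by X-small & v3 <= v4 by α≤β) refl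
      where
      k = p ∸ (α + 2 * β)
      e : α + 2 * β + k ≡ p
      e = m+[n∸m]≡n (lin≤ (α ∷ β ∷ p ∷ []) (v0 :+ # 2 :* v1) v2 (v0 <= v1 by α≤β & # 3 :* v1 :+ # 1 <= v2 by 3β<p) refl)
      k≤β : k ≤ β
      k≤β = lin≤ (k ∷ β ∷ α ∷ p ∷ []) v0 v1 (v2 :+ # 2 :* v1 :+ v0 == v3 by e & # 1 :+ v3 <= v2 :+ # 3 :* v1 by ≰⇒> ¬fits) refl

-- Residues ordered in time

-- u ≡ v modulo M, for u < M and v < 2 M
Mod : ℕ → ℕ → ℕ → Set
Mod M u v = u ≡ v ⊎ u + M ≡ v

-- Congruences are carried as equalities with a multiple of the modulus on either side, which avoids
-- subtraction; here they turn into equalities of reduced residues.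
uniq : ∀ {p z x} k l → z < p → x < p → z + k * p ≡ x + l * p → z ≡ x
uniq {p} {z} {x} k l z<p x<p e = begin
  z ≡⟨ sym (m<n⇒m%n≡m z<p) ⟩
  z % p ≡⟨ sym ([m+kn]%n≡m%n z k p) ⟩
  (z + k * p) % p ≡⟨ cong (_% p) e ⟩
  (x + l * p) % p ≡⟨ [m+kn]%n≡m%n x l p ⟩
  x % p ≡⟨ m<n⇒m%n≡m x<p ⟩
  x ∎
  where
  open ≡-Reasoning
  instance
    p≢0 : NonZero p
    p≢0 = >-nonZero (≤-trans (s≤s z≤n) z<p)

-- - A modulo M. The value at 0 is separate so that the result stays below M.
Opp : ℕ → ℕ → ℕ
Opp M zero = 0
Opp M (suc A) = M ∸ suc A

Opp< : ∀ {M A} → A < M → Opp M A < M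
Opp< {suc M} {zero} _ = s≤s z≤n
Opp< {suc M} {suc A} _ = s≤s (m∸n≤m M A)

mod-flip : ∀ {M u v A} → v < M → A < M → Mod M u (v + A) → Mod M v (u + Opp M A)
mod-flip {M} {u} {v} {zero} _ _ (inj₁ e) = inj₁ (lin≡ (v ∷ u ∷ []) v0 (v1 :+ # 0) (v0 :+ # 0 ≐ v1 by (sym e)) refl)
mod-flip {M} {u} {v} {zero} v<M _ (inj₂ e) = lin⊥ (u ∷ M ∷ v ∷ []) (v0 :+ v1 == v2 :+ # 0 by e & # 1 :+ v2 <= v1 by v<M) refl
mod-flip {M} {u} {v} {suc A} _ A<M (inj₁ e) = inj₂ (lin≡ (v ∷ M ∷ u ∷ (M ∸ suc A) ∷ (suc A) ∷ []) (v0 :+ v1) (v2 :+ v3) (v0 :+ v4 ≐ v2 by (sym e) &ᵉ v1 ≐ v3 :+ v4 by (sym (m∸n+n≡m (<⇒≤ A<M)))) refl)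
mod-flip {M} {u} {v} {suc A} _ A<M (inj₂ e) = inj₁ (lin≡ (v ∷ u ∷ (M ∸ suc A) ∷ (suc A) ∷ M ∷ []) v0 (v1 :+ v2) (v0 :+ v3 ≐ v1 :+ v4 by (sym e) &ᵉ v4 ≐ v2 :+ v3 by (sym (m∸n+n≡m (<⇒≤ A<M)))) refl)

-- A clock on the residues: `lam` is the advance of the residue per unit of time, `AY d` and `AW d`
-- the displacements over d units. They do not depend on the starting time, but are asserted only
-- while the clock does not pass p.
record Timing (p M : ℕ) (Y W : ℕ → ℕ) : Set where
  field
    tm xt : ℕ → ℕ
    tm< : ∀ x → x < p → tm x < p
    xt< : ∀ t → t < p → xt t < p
    xt-tm : ∀ x → x < p → xt (tm x) ≡ x
    tm-xt : ∀ t → t < p → tm (xt t) ≡ t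
    lam : ℕ
    lam≤ : lam ≤ p
    shX : ∀ d t → t + d < p → Σ ℕ λ k → xt (t + d) + k * p ≡ xt t + d * lam
    AY AW : ℕ → ℕ
    AY< : ∀ d → AY d < M
    AW< : ∀ d → AW d < M
    shY : ∀ d t → t + d < p → Mod M (Y (xt (t + d))) (Y (xt t) + AY d)
    shW : ∀ d t → t + d < p → Mod M (W (xt (t + d))) (W (xt t) + AW d)

module _ {p M : ℕ} {Y W : ℕ → ℕ} (Y< : ∀ x → x < p → Y x < M) (W< : ∀ x → x < p → W x < M) where
  -- Reading the clock backwards negates `lam` and both displacements. A link then takes p - T
  -- instead of T and crosses exactly if it did not before, so the link of a `Double` may be assumed
  -- to cross.
  reverse : Timing p M Y W → Timing p M Y W
  reverse τ = record
    { tm = λ x → p ∸ suc (tm x) ; xt = λ t → xt (p ∸ suc t)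
    ; tm< = λ x l → m∸n<p (tm x) l
    ; xt< = λ t l → xt< _ (m∸n<p t l)
    ; xt-tm = λ x l → trans (cong xt (back (tm< x l))) (xt-tm x l)
    ; tm-xt = λ t l → trans (cong (λ s → p ∸ suc s) (tm-xt _ (m∸n<p t l))) (back l)
    ; lam = p ∸ lam ; lam≤ = m∸n≤m p lam
    ; shX = shX′
    ; AY = λ d → Opp M (AY d) ; AW = λ d → Opp M (AW d)
    ; AY< = λ d → Opp< (AY< d) ; AW< = λ d → Opp< (AW< d)
    ; shY = λ d t l → mod-flip (Y< _ (xt< _ (m∸n<p (t + d) l))) (AY< d) (subst (λ s → Mod M (Y (xt s)) (Y (xt (p ∸ suc (t + d))) + AY d)) (shift d t l) (shY d (p ∸ suc (t + d)) (shift< d t l)))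
    ; shW = λ d t l → mod-flip (W< _ (xt< _ (m∸n<p (t + d) l))) (AW< d) (subst (λ s → Mod M (W (xt s)) (W (xt (p ∸ suc (t + d))) + AW d)) (shift d t l) (shW d (p ∸ suc (t + d)) (shift< d t l))) }
    where
    open Timing τ
    m∸n<p : ∀ s {t} → t < p → p ∸ suc s < p
    m∸n<p s {t} l = ≤-trans (s≤s (∸-monoʳ-≤ p (s≤s z≤n))) (≤-reflexive (m+[n∸m]≡n {1} (≤-trans (s≤s z≤n) l)))
    back : ∀ {s} → s < p → p ∸ suc (p ∸ suc s) ≡ s
    back {s} l = +-cancelʳ-≡ (suc (p ∸ suc s)) _ s (trans (m∸n+n≡m (m∸n<p s l)) (trans (sym (m+[n∸m]≡n l)) (sym (+-suc s _))))
    shift : ∀ d t → t + d < p → p ∸ suc (t + d) + d ≡ p ∸ suc t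
    shift d t l = +-cancelʳ-≡ (suc t) _ _ (trans (trans (+-assoc (p ∸ suc (t + d)) d (suc t)) (cong (p ∸ suc (t + d) +_) (trans (+-suc d t) (cong suc (+-comm d t))))) (trans (m∸n+n≡m l) (sym (m∸n+n≡m (≤-trans (s≤s (m≤m+n t d)) l)))))
    shift< : ∀ d t → t + d < p → p ∸ suc (t + d) + d < p
    shift< d t l = subst (_< p) (sym (shift d t l)) (m∸n<p t l)
    shX′ : ∀ d t → t + d < p → Σ ℕ λ k → xt (p ∸ suc (t + d)) + k * p ≡ xt (p ∸ suc t) + d * (p ∸ lam)
    shX′ d t l with shX d (p ∸ suc (t + d)) (shift< d t l)
    -- Adding d p to both sides turns - d lam into d (p - lam) and leaves the multiple d - k; that k
    -- ≤ d comes from lam ≤ p.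
    ... | k , e = d ∸ k , +-cancelʳ-≡ (k * p) _ _ (begin
      U + (d ∸ k) * p + k * p ≡⟨ +-assoc U _ _ ⟩
      U + ((d ∸ k) * p + k * p) ≡⟨ cong (U +_) (sym (*-distribʳ-+ p (d ∸ k) k)) ⟩
      U + (d ∸ k + k) * p ≡⟨ cong (λ j → U + j * p) (m∸n+n≡m k≤d) ⟩
      U + d * p ≡⟨ cong (λ j → U + d * j) (sym (m∸n+n≡m lam≤)) ⟩
      U + d * (p ∸ lam + lam) ≡⟨ (lin≡ (U ∷ d ∷ (p ∸ lam) ∷ lam ∷ (xt (p ∸ suc t)) ∷ k ∷ p ∷ []) (v0 :+ v1 :* (v2 :+ v3)) (v4 :+ v1 :* v2 :+ v5 :* v6) (v0 :+ v1 :* v3 ≐ v4 :+ v5 :* v6 by (sym e′)) refl) ⟩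
      xt (p ∸ suc t) + d * (p ∸ lam) + k * p ∎)
      where
      open ≡-Reasoning
      U = xt (p ∸ suc (t + d))
      e′ : xt (p ∸ suc t) + k * p ≡ U + d * lam
      e′ = trans (cong (λ s → xt s + k * p) (sym (shift d t l))) e
      k≤d : k ≤ d
      k≤d = ≤-pred (*-cancelʳ-< p k (suc d) (lin≤ (k ∷ p ∷ d ∷ (xt (p ∸ suc t)) ∷ U ∷ lam ∷ []) (# 1 :+ (v0 :* v1)) ((# 1 :+ v2) :* v1) (v3 :+ v0 :* v1 == v4 :+ v2 :* v5 by e′ & # 1 :+ v4 <= v1 by xt< _ (m∸n<p (t + d) l) & v2 :* v5 <= v2 :* v1 by *-monoʳ-≤ d lam≤) refl))

-- Links x → x + β and the end of the time interval

module Links (p q N α β : ℕ) (Y W : ℕ → ℕ) (plus neg : ℕ → Bool)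
  (L : Residues.Layout p q N α β Y W plus neg) where
  open Residues p q N α β Y W plus neg
  open Layout L

  Link : ℕ → ℕ → Set
  Link x x′ = x′ ≡ x + β ⊎ x′ + p ≡ x + β

  module Steps (τ : Timing p (p * q) Y W) (T m : ℕ) (T≤p : T ≤ p) (Tλ : T * Timing.lam τ ≡ β + m * p) where
    open Timing τ

    -- Since the clock is cut at p, a link either advances time by T or falls back by p - T. In the
    -- second case displacements are read from `x′` to `x`, which is why `backward` exchanges the
    -- two ends.
    link-time : ∀ x x′ → x < p → x′ < p → Link x x′ →
      (tm x + T < p × tm x′ ≡ tm x + T) ⊎ (p ≤ tm x + T × tm x′ + p ≡ tm x + T)
    link-time x x′ x<p x′<p lk with tm x + T <? p
    ... | yes l with shX T (tm x) l
    ...   | k , e = inj₁ (l , trans (cong tm (by lk)) (tm-xt _ l))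
      where
      e′ : xt (tm x + T) + k * p ≡ x + β + m * p
      e′ = trans e (trans (cong₂ _+_ (xt-tm x x<p) Tλ) (sym (+-assoc x β _)))
      z = xt (tm x + T)
      by : Link x x′ → x′ ≡ xt (tm x + T)
      by (inj₁ r) = sym (uniq k m (xt< _ l) x′<p (lin≡ (z ∷ k ∷ p ∷ x′ ∷ m ∷ x ∷ β ∷ []) (v0 :+ v1 :* v2) (v3 :+ v4 :* v2) (v0 :+ v1 :* v2 ≐ v5 :+ v6 :+ v4 :* v2 by e′ &ᵉ v5 :+ v6 ≐ v3 by (sym r)) refl))
      by (inj₂ r) = sym (uniq k (1 + m) (xt< _ l) x′<p (lin≡ (z ∷ k ∷ p ∷ x′ ∷ m ∷ x ∷ β ∷ []) (v0 :+ v1 :* v2) (v3 :+ (# 1 :+ v4) :* v2) (v0 :+ v1 :* v2 ≐ v5 :+ v6 :+ v4 :* v2 by e′ &ᵉ v5 :+ v6 ≐ v3 :+ v2 by (sym r)) refl))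
    link-time x x′ x<p x′<p lk | no ¬l with shX (p ∸ T) (tm x + T ∸ p) (subst (_< p) (sym s+d) (tm< x x<p))
      where
      s+d : tm x + T ∸ p + (p ∸ T) ≡ tm x
      s+d = lin≡ ((tm x + T ∸ p) ∷ (p ∸ T) ∷ (tm x) ∷ p ∷ T ∷ []) (v0 :+ v1) v2 (v0 :+ v3 ≐ v2 :+ v4 by m∸n+n≡m (≮⇒≥ ¬l) &ᵉ v1 :+ v4 ≐ v3 by m∸n+n≡m T≤p) refl
    ... | k , e = inj₂ (≮⇒≥ ¬l , trans (cong (λ z → tm z + p) (by lk)) (trans (cong (_+ p) (tm-xt s s<p)) (m∸n+n≡m (≮⇒≥ ¬l))))
      where
      s = tm x + T ∸ p
      d = p ∸ T
      s+d : s + d ≡ tm x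
      s+d = lin≡ (s ∷ d ∷ (tm x) ∷ p ∷ T ∷ []) (v0 :+ v1) v2 (v0 :+ v3 ≐ v2 :+ v4 by m∸n+n≡m (≮⇒≥ ¬l) &ᵉ v1 :+ v4 ≐ v3 by m∸n+n≡m T≤p) refl
      s<p : s < p
      s<p = lin≤ (s ∷ p ∷ d ∷ (tm x) ∷ []) (# 1 :+ v0) v1 (v0 :+ v2 == v3 by s+d & # 1 :+ v3 <= v1 by tm< x x<p) refl
      z = xt s
      e₁ : x + k * p ≡ z + d * lam
      e₁ = trans (cong (λ y → y + k * p) (trans (sym (xt-tm x x<p)) (cong xt (sym s+d)))) e
      e₂ : d * lam + T * lam ≡ lam * p
      e₂ = trans (sym (*-distribʳ-+ lam d T)) (trans (cong (_* lam) (m∸n+n≡m T≤p)) (*-comm p lam))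
      by : Link x x′ → x′ ≡ z
      by (inj₁ r) = sym (uniq lam (k + m) (xt< s s<p) x′<p (lin≡ (z ∷ lam ∷ p ∷ x′ ∷ k ∷ m ∷ d ∷ x ∷ T ∷ β ∷ []) (v0 :+ v1 :* v2) (v3 :+ (v4 :+ v5) :* v2) (v0 :+ v6 :* v1 ≐ v7 :+ v4 :* v2 by (sym e₁) &ᵉ v1 :* v2 ≐ v6 :* v1 :+ v8 :* v1 by (sym e₂) &ᵉ v8 :* v1 ≐ v9 :+ v5 :* v2 by Tλ &ᵉ v7 :+ v9 ≐ v3 by (sym r)) refl))
      by (inj₂ r) = sym (uniq lam (1 + (k + m)) (xt< s s<p) x′<p (lin≡ (z ∷ lam ∷ p ∷ x′ ∷ k ∷ m ∷ d ∷ x ∷ T ∷ β ∷ []) (v0 :+ v1 :* v2) (v3 :+ (# 1 :+ (v4 :+ v5)) :* v2) (v0 :+ v6 :* v1 ≐ v7 :+ v4 :* v2 by (sym e₁) &ᵉ v1 :* v2 ≐ v6 :* v1 :+ v8 :* v1 by (sym e₂) &ᵉ v8 :* v1 ≐ v9 :+ v5 :* v2 by Tλ &ᵉ v7 :+ v9 ≐ v3 :+ v2 by (sym r)) refl))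

    forward : ∀ x x′ → x < p → x′ < p → Link x x′ → tm x + T < p →
      Mod (p * q) (Y x′) (Y x + AY T) × Mod (p * q) (W x′) (W x + AW T)
    forward x x′ x<p x′<p lk l with link-time x x′ x<p x′<p lk
    ... | inj₂ (g , _) = ⊥-elim (<⇒≱ l g)
    ... | inj₁ (_ , e) = to Y (shY T (tm x) l) , to W (shW T (tm x) l)
      where
      to : ∀ (Z : ℕ → ℕ) {A} → Mod (p * q) (Z (xt (tm x + T))) (Z (xt (tm x)) + A) → Mod (p * q) (Z x′) (Z x + A)
      to Z {A} = subst₂ (λ u v → Mod (p * q) (Z u) (Z v + A)) (trans (cong xt (sym e)) (xt-tm x′ x′<p)) (xt-tm x x<p)

    backward : ∀ x x′ → x < p → x′ < p → Link x x′ → p ≤ tm x + T →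
      Mod (p * q) (Y x) (Y x′ + AY (p ∸ T)) × Mod (p * q) (W x) (W x′ + AW (p ∸ T))
    backward x x′ x<p x′<p lk g with link-time x x′ x<p x′<p lk
    ... | inj₁ (l , _) = ⊥-elim (<⇒≱ l g)
    ... | inj₂ (_ , e) = to Y (shY (p ∸ T) (tm x′) l) , to W (shW (p ∸ T) (tm x′) l)
      where
      e′ : tm x′ + (p ∸ T) ≡ tm x
      e′ = lin≡ ((tm x′) ∷ (p ∸ T) ∷ (tm x) ∷ p ∷ T ∷ []) (v0 :+ v1) v2 (v0 :+ v3 ≐ v2 :+ v4 by e &ᵉ v1 :+ v4 ≐ v3 by m∸n+n≡m T≤p) refl
      l : tm x′ + (p ∸ T) < p
      l = subst (_< p) (sym e′) (tm< x x<p)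
      to : ∀ (Z : ℕ → ℕ) {A} → Mod (p * q) (Z (xt (tm x′ + (p ∸ T)))) (Z (xt (tm x′)) + A) → Mod (p * q) (Z x) (Z x′ + A)
      to Z {A} = subst₂ (λ u v → Mod (p * q) (Z u) (Z v + A)) (trans (cong xt e′) (xt-tm x x<p)) (xt-tm x′ x′<p)

-- Passing from the residue x, at (y , w), to x + β, at (y′ , w′), changes y and w by vectors
-- modulo M that depend only on how the time moves; here B stands for β q and A for α q.
module Vectors (M A B : ℕ) (A≤B : A ≤ B) (A+2B<M : A + 2 * B < M) where
  Top None Below : ℕ → ℕ → Set
  Top y w = M ≤ y + A × M ≤ w + B
  None y w = y + A < M × w + B < M
  Below y w = y < M × w < M

  -- Both ends lie in the margins just below M, so neither coordinate can wrap and the drop B is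
  -- shared out between a and b.
  slow-derive : ∀ {a b y w y′ w′} → a < M → b < M → Mod M y (y′ + a) → Mod M w (w′ + b) →
    Top y w → Below y w → Top y′ w′ → y + w ≡ y′ + w′ + B → a + b ≡ B × a < A × b < B
  slow-derive {a} {b} {y} {w} {y′} {w′} _ _ (inj₁ e) (inj₁ f) _ (u , v) (t , t′) s =
    (lin≡ (a ∷ b ∷ B ∷ y′ ∷ y ∷ w′ ∷ w ∷ []) (v0 :+ v1) v2 (v3 :+ v0 ≐ v4 by (sym e) &ᵉ v5 :+ v1 ≐ v6 by (sym f) &ᵉ v4 :+ v6 ≐ v3 :+ v5 :+ v2 by s) refl) ,
    (lin≤ (a ∷ A ∷ y′ ∷ y ∷ M ∷ []) (# 1 :+ v0) v1 (v2 :+ v0 ==˘ v3 by e & # 1 :+ v3 <= v4 by u & v4 <= v2 :+ v1 by t) refl) , (lin≤ (b ∷ B ∷ w′ ∷ w ∷ M ∷ []) (# 1 :+ v0) v1 (v2 :+ v0 ==˘ v3 by f & # 1 :+ v3 <= v4 by v & v4 <= v2 :+ v1 by t′) refl)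
  slow-derive {a} {b} {y} {w} {y′} {w′} a<M b<M (inj₂ e) (inj₁ f) _ (u , v) (t , t′) s =
    (lin⊥ (y ∷ M ∷ y′ ∷ a ∷ w′ ∷ B ∷ w ∷ []) (v0 :+ v1 == v2 :+ v3 by e & v2 :+ v4 :+ v5 ==˘ v0 :+ v6 by s & # 1 :+ v6 <= v1 by v & v1 <= v4 :+ v5 by t′ & # 1 :+ v3 <= v1 by a<M) refl)
  slow-derive {a} {b} {y} {w} {y′} {w′} a<M b<M (inj₁ e) (inj₂ f) _ (u , v) (t , t′) s =
    (lin⊥ (w ∷ M ∷ w′ ∷ b ∷ y′ ∷ B ∷ y ∷ A ∷ []) (v0 :+ v1 == v2 :+ v3 by f & v4 :+ v2 :+ v5 ==˘ v6 :+ v0 by s & # 1 :+ v6 <= v1 by u & v1 <= v4 :+ v7 by t & # 1 :+ v3 <= v1 by b<M & v7 <= v5 by A≤B) refl)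
  slow-derive {a} {b} {y} {w} {y′} {w′} a<M b<M (inj₂ e) (inj₂ f) _ (u , v) (t , t′) s =
    (lin⊥ (y ∷ M ∷ y′ ∷ a ∷ w ∷ w′ ∷ b ∷ B ∷ []) (v0 :+ v1 == v2 :+ v3 by e & v4 :+ v1 == v5 :+ v6 by f & v2 :+ v5 :+ v7 ==˘ v0 :+ v4 by s & # 1 :+ v3 <= v1 by a<M & # 1 :+ v6 <= v1 by b<M) refl)

  module Slow {a b : ℕ} (sum : a + b ≡ B) (a<A : a < A) (b<B : b < B) where
    rise-none : ∀ {y w y′ w′} → Mod M y (y′ + a) → Mod M w (w′ + b) → y′ + w′ + B ≡ y + w + M → None y′ w′ → ⊥
    rise-none {y} {w} {y′} {w′} (inj₁ e) (inj₁ f) s (n , n′) = lin⊥ (y′ ∷ a ∷ y ∷ w′ ∷ b ∷ w ∷ M ∷ B ∷ A ∷ []) (v0 :+ v1 ==˘ v2 by e & v3 :+ v4 ==˘ v5 by f & v2 :+ v5 :+ v6 ==˘ v0 :+ v3 :+ v7 by s & # 1 :+ (v8 :+ # 2 :* v7) <= v6 by A+2B<M) refl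
    rise-none {y} {w} {y′} {w′} (inj₂ e) _ s (n , n′) = lin⊥ (y ∷ M ∷ y′ ∷ a ∷ A ∷ []) (v0 :+ v1 == v2 :+ v3 by e & # 1 :+ (v2 :+ v4) <= v1 by n & # 1 :+ v3 <= v4 by a<A) refl
    rise-none {y} {w} {y′} {w′} (inj₁ e) (inj₂ f) s (n , n′) = lin⊥ (w ∷ M ∷ w′ ∷ b ∷ B ∷ []) (v0 :+ v1 == v2 :+ v3 by f & # 1 :+ (v2 :+ v4) <= v1 by n′ & # 1 :+ v3 <= v4 by b<B) refl

    none-rise : ∀ {y w y′ w′} → Mod M y (y′ + a) → Mod M w (w′ + b) → y′ + w′ + B ≡ y + w + M → None y w → Top y′ w′ → ⊥
    none-rise {y} {w} {y′} {w′} (inj₁ e) _ s (n , n′) (t , t′) = lin⊥ (y′ ∷ a ∷ y ∷ A ∷ M ∷ []) (v0 :+ v1 ==˘ v2 by e & # 1 :+ (v2 :+ v3) <= v4 by n & v4 <= v0 :+ v3 by t) refl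
    none-rise {y} {w} {y′} {w′} (inj₂ e) (inj₁ f) s (n , n′) (t , t′) = lin⊥ (w′ ∷ b ∷ w ∷ B ∷ M ∷ []) (v0 :+ v1 ==˘ v2 by f & # 1 :+ (v2 :+ v3) <= v4 by n′ & v4 <= v0 :+ v3 by t′) refl
    none-rise {y} {w} {y′} {w′} (inj₂ e) (inj₂ f) s (n , n′) (t , t′) = lin⊥ (y ∷ M ∷ y′ ∷ a ∷ w ∷ w′ ∷ b ∷ B ∷ A ∷ []) (v0 :+ v1 == v2 :+ v3 by e & v4 :+ v1 == v5 :+ v6 by f & v2 :+ v5 :+ v7 == v0 :+ v4 :+ v1 by s & v3 :+ v6 == v7 by sum & # 1 :+ (v8 :+ # 2 :* v7) <= v1 by A+2B<M) refl

    -- Against so short a vector, a rise by 2 M - B means that both coordinates wrapped; they land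
    -- within a and b of M, hence in the top margins.
    rise-two : ∀ {y w y′ w′} → Mod M y (y′ + a) → Mod M w (w′ + b) → y′ + w′ + B ≡ y + w + 2 * M → Top y′ w′
    rise-two {y} {w} {y′} {w′} (inj₁ e) (inj₁ f) s = lin⊥ (y′ ∷ a ∷ y ∷ w′ ∷ b ∷ w ∷ M ∷ B ∷ A ∷ []) (v0 :+ v1 ==˘ v2 by e & v3 :+ v4 ==˘ v5 by f & v2 :+ v5 :+ # 2 :* v6 ==˘ v0 :+ v3 :+ v7 by s & 2 · # 1 :+ (v8 :+ # 2 :* v7) <= v6 by A+2B<M) refl
    rise-two {y} {w} {y′} {w′} (inj₂ e) (inj₁ f) s = lin⊥ (y′ ∷ a ∷ y ∷ M ∷ w′ ∷ b ∷ w ∷ B ∷ A ∷ []) (v0 :+ v1 ==˘ v2 :+ v3 by e & v4 :+ v5 ==˘ v6 by f & v2 :+ v6 :+ # 2 :* v3 ==˘ v0 :+ v4 :+ v7 by s & # 1 :+ (v8 :+ # 2 :* v7) <= v3 by A+2B<M) refl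
    rise-two {y} {w} {y′} {w′} (inj₁ e) (inj₂ f) s = lin⊥ (y′ ∷ a ∷ y ∷ w′ ∷ b ∷ w ∷ M ∷ B ∷ A ∷ []) (v0 :+ v1 ==˘ v2 by e & v3 :+ v4 ==˘ v5 :+ v6 by f & v2 :+ v5 :+ # 2 :* v6 ==˘ v0 :+ v3 :+ v7 by s & # 1 :+ (v8 :+ # 2 :* v7) <= v6 by A+2B<M) refl
    rise-two {y} {w} {y′} {w′} (inj₂ e) (inj₂ f) s = (lin≤ (M ∷ y′ ∷ A ∷ y ∷ a ∷ []) v0 (v1 :+ v2) (v3 :+ v0 == v1 :+ v4 by e & # 1 :+ v4 <= v2 by a<A) refl) , (lin≤ (M ∷ w′ ∷ B ∷ w ∷ b ∷ []) v0 (v1 :+ v2) (v3 :+ v0 == v1 :+ v4 by f & # 1 :+ v4 <= v2 by b<B) refl)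

    level-top : ∀ {y w y′ w′} → Mod M y (y′ + a) → Mod M w (w′ + b) → y + w ≡ y′ + w′ + B → Top y′ w′ → Top y w
    level-top {y} {w} {y′} {w′} (inj₁ e) (inj₁ f) s (t , t′) = (lin≤ (M ∷ y ∷ A ∷ y′ ∷ a ∷ []) v0 (v1 :+ v2) (v3 :+ v4 ==˘ v1 by e & v0 <= v3 :+ v2 by t) refl) , (lin≤ (M ∷ w ∷ B ∷ w′ ∷ b ∷ []) v0 (v1 :+ v2) (v3 :+ v4 ==˘ v1 by f & v0 <= v3 :+ v2 by t′) refl)
    level-top {y} {w} {y′} {w′} (inj₂ e) (inj₁ f) s (t , t′) = lin⊥ (y ∷ M ∷ y′ ∷ a ∷ w ∷ w′ ∷ b ∷ B ∷ A ∷ []) (v0 :+ v1 == v2 :+ v3 by e & v4 == v5 :+ v6 by f & v2 :+ v5 :+ v7 ==˘ v0 :+ v4 by s & v3 :+ v6 == v7 by sum & # 1 :+ (v8 :+ # 2 :* v7) <= v1 by A+2B<M) refl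
    level-top {y} {w} {y′} {w′} (inj₁ e) (inj₂ f) s (t , t′) = lin⊥ (y ∷ y′ ∷ a ∷ w ∷ M ∷ w′ ∷ b ∷ B ∷ A ∷ []) (v0 == v1 :+ v2 by e & v3 :+ v4 == v5 :+ v6 by f & v1 :+ v5 :+ v7 ==˘ v0 :+ v3 by s & v2 :+ v6 == v7 by sum & # 1 :+ (v8 :+ # 2 :* v7) <= v4 by A+2B<M) refl
    level-top {y} {w} {y′} {w′} (inj₂ e) (inj₂ f) s (t , t′) = lin⊥ (y ∷ M ∷ y′ ∷ a ∷ w ∷ w′ ∷ b ∷ B ∷ A ∷ []) (v0 :+ v1 == v2 :+ v3 by e & v4 :+ v1 == v5 :+ v6 by f & v2 :+ v5 :+ v7 ==˘ v0 :+ v4 by s & v3 :+ v6 == v7 by sum & 2 · # 1 :+ (v8 :+ # 2 :* v7) <= v1 by A+2B<M) refl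

    no-drop : ∀ {y w y′ w′} → Mod M y (y′ + a) → Mod M w (w′ + b) → y + w ≡ y′ + w′ + M + B → ⊥
    no-drop {y} {w} {y′} {w′} (inj₁ e) (inj₁ f) s = lin⊥ (y ∷ y′ ∷ a ∷ w ∷ w′ ∷ b ∷ M ∷ B ∷ A ∷ []) (v0 == v1 :+ v2 by e & v3 == v4 :+ v5 by f & v1 :+ v4 :+ v6 :+ v7 ==˘ v0 :+ v3 by s & v2 :+ v5 == v7 by sum & # 1 :+ (v8 :+ # 2 :* v7) <= v6 by A+2B<M) refl
    no-drop {y} {w} {y′} {w′} (inj₂ e) (inj₁ f) s = lin⊥ (y ∷ M ∷ y′ ∷ a ∷ w ∷ w′ ∷ b ∷ B ∷ A ∷ []) (v0 :+ v1 == v2 :+ v3 by e & v4 == v5 :+ v6 by f & v2 :+ v5 :+ v1 :+ v7 ==˘ v0 :+ v4 by s & v3 :+ v6 == v7 by sum & 2 · # 1 :+ (v8 :+ # 2 :* v7) <= v1 by A+2B<M) refl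
    no-drop {y} {w} {y′} {w′} (inj₁ e) (inj₂ f) s = lin⊥ (y ∷ y′ ∷ a ∷ w ∷ M ∷ w′ ∷ b ∷ B ∷ A ∷ []) (v0 == v1 :+ v2 by e & v3 :+ v4 == v5 :+ v6 by f & v1 :+ v5 :+ v4 :+ v7 ==˘ v0 :+ v3 by s & v2 :+ v6 == v7 by sum & 2 · # 1 :+ (v8 :+ # 2 :* v7) <= v4 by A+2B<M) refl
    no-drop {y} {w} {y′} {w′} (inj₂ e) (inj₂ f) s = lin⊥ (y ∷ M ∷ y′ ∷ a ∷ w ∷ w′ ∷ b ∷ B ∷ A ∷ []) (v0 :+ v1 == v2 :+ v3 by e & v4 :+ v1 == v5 :+ v6 by f & v2 :+ v5 :+ v1 :+ v7 ==˘ v0 :+ v4 by s & v3 :+ v6 == v7 by sum & 3 · # 1 :+ (v8 :+ # 2 :* v7) <= v1 by A+2B<M) refl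

  -- A wrap out of `None` would leave the coordinate below its top margin. So both coordinates
  -- simply rise, and a + b is the whole rise M - B.
  fast-derive : ∀ {a b y w y′ w′} → a < M → b < M → Mod M y′ (y + a) → Mod M w′ (w + b) →
    None y w → Top y′ w′ → y′ + w′ + B ≡ y + w + M → a + b + B ≡ M × 0 < a × 0 < b
  fast-derive {a} {b} {y} {w} {y′} {w′} _ _ (inj₁ e) (inj₁ f) (n , n′) (t , t′) s =
    (lin≡ (a ∷ b ∷ B ∷ M ∷ y ∷ y′ ∷ w ∷ w′ ∷ []) (v0 :+ v1 :+ v2) v3 (v4 :+ v0 ≐ v5 by (sym e) &ᵉ v6 :+ v1 ≐ v7 by (sym f) &ᵉ v5 :+ v7 :+ v2 ≐ v4 :+ v6 :+ v3 by s) refl) ,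
    (lin≤ (a ∷ y′ ∷ y ∷ A ∷ M ∷ []) (# 1 :+ (# 0)) v0 (v1 == v2 :+ v0 by e & # 1 :+ (v2 :+ v3) <= v4 by n & v4 <= v1 :+ v3 by t) refl) , (lin≤ (b ∷ w′ ∷ w ∷ B ∷ M ∷ []) (# 1 :+ (# 0)) v0 (v1 == v2 :+ v0 by f & # 1 :+ (v2 :+ v3) <= v4 by n′ & v4 <= v1 :+ v3 by t′) refl)
  fast-derive {a} {b} {y} {w} {y′} {w′} a<M b<M (inj₂ e) _ (n , n′) (t , t′) s = lin⊥ (y′ ∷ M ∷ y ∷ a ∷ A ∷ []) (v0 :+ v1 == v2 :+ v3 by e & # 1 :+ (v2 :+ v4) <= v1 by n & v1 <= v0 :+ v4 by t & # 1 :+ v3 <= v1 by a<M) refl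
  fast-derive {a} {b} {y} {w} {y′} {w′} a<M b<M _ (inj₂ f) (n , n′) (t , t′) s = lin⊥ (w′ ∷ M ∷ w ∷ b ∷ B ∷ []) (v0 :+ v1 == v2 :+ v3 by f & # 1 :+ (v2 :+ v4) <= v1 by n′ & v1 <= v0 :+ v4 by t′ & # 1 :+ v3 <= v1 by b<M) refl

  module Fast {a b : ℕ} (sum : a + b + B ≡ M) where
    -- The incompatibility of the two kinds. With exactly one wrap the sums do agree, but then the
    -- wrapped coordinate alone drops by at least B, more than its top margin allows.
    no-level : ∀ {y w y′ w′} → Mod M y′ (y + a) → Mod M w′ (w + b) → Top y w → Below y w → Top y′ w′ → Below y′ w′ →
      y + w ≡ y′ + w′ + B → ⊥
    no-level {y} {w} {y′} {w′} (inj₁ e) (inj₁ f) _ _ _ _ s = lin⊥ (y ∷ a ∷ y′ ∷ w ∷ b ∷ w′ ∷ B ∷ M ∷ A ∷ []) (v0 :+ v1 ==˘ v2 by e & v3 :+ v4 ==˘ v5 by f & v2 :+ v5 :+ v6 ==˘ v0 :+ v3 by s & v7 ==˘ v1 :+ v4 :+ v6 by sum & # 1 :+ (v8 :+ # 2 :* v6) <= v7 by A+2B<M) refl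
    no-level {y} {w} {y′} {w′} (inj₂ e) (inj₁ f) (t , t′) (u , u′) (v , v′) (x , x′) s = lin⊥ (w ∷ b ∷ w′ ∷ y′ ∷ B ∷ y ∷ A ∷ M ∷ []) (v0 :+ v1 ==˘ v2 by f & v3 :+ v2 :+ v4 ==˘ v5 :+ v0 by s & v6 <= v4 by A≤B & # 1 :+ v5 <= v7 by u & v7 <= v3 :+ v6 by v) refl
    no-level {y} {w} {y′} {w′} (inj₁ e) (inj₂ f) (t , t′) (u , u′) (v , v′) (x , x′) s = lin⊥ (y ∷ a ∷ y′ ∷ w′ ∷ B ∷ w ∷ M ∷ []) (v0 :+ v1 ==˘ v2 by e & v2 :+ v3 :+ v4 ==˘ v0 :+ v5 by s & # 1 :+ v5 <= v6 by u′ & v6 <= v3 :+ v4 by v′) refl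
    no-level {y} {w} {y′} {w′} (inj₂ e) (inj₂ f) (t , t′) _ _ (x , x′) s = lin⊥ (y′ ∷ M ∷ y ∷ a ∷ w′ ∷ w ∷ b ∷ B ∷ A ∷ []) (v0 :+ v1 == v2 :+ v3 by e & v4 :+ v1 == v5 :+ v6 by f & v2 :+ v5 == v0 :+ v4 :+ v7 by s & v3 :+ v6 :+ v7 == v1 by sum & # 1 :+ (v8 :+ # 2 :* v7) <= v1 by A+2B<M) refl

    no-rise-two : ∀ {y w y′ w′} → Mod M y′ (y + a) → Mod M w′ (w + b) → y′ + w′ + B ≡ y + w + 2 * M → ⊥
    no-rise-two {y} {w} {y′} {w′} e f s = lin⊥ (y′ ∷ y ∷ a ∷ w′ ∷ w ∷ b ∷ M ∷ B ∷ A ∷ []) (v0 <= v1 :+ v2 by low e & v3 <= v4 :+ v5 by low f & v1 :+ v4 :+ # 2 :* v6 ==˘ v0 :+ v3 :+ v7 by s & v2 :+ v5 :+ v7 == v6 by sum & # 1 :+ (v8 :+ # 2 :* v7) <= v6 by A+2B<M) refl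
      where
      low : ∀ {u v} → Mod M u v → u ≤ v
      low (inj₁ refl) = ≤-refl
      low (inj₂ refl) = m≤m+n _ M

    no-top-rise : ∀ {y w y′ w′} → Mod M y′ (y + a) → Mod M w′ (w + b) → Top y w → Below y′ w′ → y′ + w′ + B ≡ y + w + M → ⊥
    no-top-rise {y} {w} {y′} {w′} (inj₁ e) (inj₁ f) (t , t′) (x , x′) s = lin⊥ (y ∷ a ∷ y′ ∷ w ∷ b ∷ w′ ∷ M ∷ A ∷ B ∷ []) (v0 :+ v1 ==˘ v2 by e & v3 :+ v4 ==˘ v5 by f & v6 <= v0 :+ v7 by t & v6 <= v3 :+ v8 by t′ & # 1 :+ v2 <= v6 by x & # 1 :+ v5 <= v6 by x′ & v6 ==˘ v1 :+ v4 :+ v8 by sum & # 1 :+ (v7 :+ # 2 :* v8) <= v6 by A+2B<M) refl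
    no-top-rise {y} {w} {y′} {w′} (inj₂ e) (inj₁ f) (t , t′) (x , x′) s = lin⊥ (y′ ∷ M ∷ y ∷ a ∷ w′ ∷ w ∷ b ∷ B ∷ A ∷ []) (v0 :+ v1 == v2 :+ v3 by e & v4 == v5 :+ v6 by f & v2 :+ v5 :+ v1 ==˘ v0 :+ v4 :+ v7 by s & v3 :+ v6 :+ v7 == v1 by sum & # 1 :+ (v8 :+ # 2 :* v7) <= v1 by A+2B<M) refl
    no-top-rise {y} {w} {y′} {w′} (inj₁ e) (inj₂ f) (t , t′) (x , x′) s = lin⊥ (y′ ∷ y ∷ a ∷ w′ ∷ M ∷ w ∷ b ∷ B ∷ A ∷ []) (v0 == v1 :+ v2 by e & v3 :+ v4 == v5 :+ v6 by f & v1 :+ v5 :+ v4 ==˘ v0 :+ v3 :+ v7 by s & v2 :+ v6 :+ v7 == v4 by sum & # 1 :+ (v8 :+ # 2 :* v7) <= v4 by A+2B<M) refl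
    no-top-rise {y} {w} {y′} {w′} (inj₂ e) (inj₂ f) (t , t′) (x , x′) s = lin⊥ (y′ ∷ M ∷ y ∷ a ∷ w′ ∷ w ∷ b ∷ B ∷ A ∷ []) (v0 :+ v1 == v2 :+ v3 by e & v4 :+ v1 == v5 :+ v6 by f & v2 :+ v5 :+ v1 ==˘ v0 :+ v4 :+ v7 by s & v3 :+ v6 :+ v7 == v1 by sum & 2 · # 1 :+ (v8 :+ # 2 :* v7) <= v1 by A+2B<M) refl

    no-level-none : ∀ {y w y′ w′} → Mod M y′ (y + a) → Mod M w′ (w + b) → Top y w → None y′ w′ → y + w ≡ y′ + w′ + B → ⊥
    no-level-none {y} {w} {y′} {w′} (inj₁ e) _ (t , t′) (n , n′) s = lin⊥ (y ∷ a ∷ y′ ∷ M ∷ A ∷ []) (v0 :+ v1 ==˘ v2 by e & v3 <= v0 :+ v4 by t & # 1 :+ (v2 :+ v4) <= v3 by n) refl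
    no-level-none {y} {w} {y′} {w′} (inj₂ e) (inj₁ f) (t , t′) (n , n′) s = lin⊥ (w ∷ b ∷ w′ ∷ M ∷ B ∷ []) (v0 :+ v1 ==˘ v2 by f & v3 <= v0 :+ v4 by t′ & # 1 :+ (v2 :+ v4) <= v3 by n′) refl
    no-level-none {y} {w} {y′} {w′} (inj₂ e) (inj₂ f) (t , t′) (n , n′) s = lin⊥ (y′ ∷ M ∷ y ∷ a ∷ w′ ∷ w ∷ b ∷ B ∷ A ∷ []) (v0 :+ v1 == v2 :+ v3 by e & v4 :+ v1 == v5 :+ v6 by f & v2 :+ v5 == v0 :+ v4 :+ v7 by s & v3 :+ v6 :+ v7 == v1 by sum & # 1 :+ (v8 :+ # 2 :* v7) <= v1 by A+2B<M) refl

    exact-rise : ∀ {y w y′ w′} → Mod M y′ (y + a) → Mod M w′ (w + b) → y′ + w′ + B ≡ y + w + M → y′ ≡ y + a × w′ ≡ w + b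
    exact-rise (inj₁ e) (inj₁ f) _ = e , f
    exact-rise {y} {w} {y′} {w′} (inj₂ e) (inj₁ f) s = lin⊥ (y′ ∷ M ∷ y ∷ a ∷ w′ ∷ w ∷ b ∷ B ∷ A ∷ []) (v0 :+ v1 == v2 :+ v3 by e & v4 == v5 :+ v6 by f & v2 :+ v5 :+ v1 ==˘ v0 :+ v4 :+ v7 by s & v3 :+ v6 :+ v7 == v1 by sum & # 1 :+ (v8 :+ # 2 :* v7) <= v1 by A+2B<M) refl
    exact-rise {y} {w} {y′} {w′} (inj₁ e) (inj₂ f) s = lin⊥ (y′ ∷ y ∷ a ∷ w′ ∷ M ∷ w ∷ b ∷ B ∷ A ∷ []) (v0 == v1 :+ v2 by e & v3 :+ v4 == v5 :+ v6 by f & v1 :+ v5 :+ v4 ==˘ v0 :+ v3 :+ v7 by s & v2 :+ v6 :+ v7 == v4 by sum & # 1 :+ (v8 :+ # 2 :* v7) <= v4 by A+2B<M) refl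
    exact-rise {y} {w} {y′} {w′} (inj₂ e) (inj₂ f) s = lin⊥ (y′ ∷ M ∷ y ∷ a ∷ w′ ∷ w ∷ b ∷ B ∷ A ∷ []) (v0 :+ v1 == v2 :+ v3 by e & v4 :+ v1 == v5 :+ v6 by f & v2 :+ v5 :+ v1 ==˘ v0 :+ v4 :+ v7 by s & v3 :+ v6 :+ v7 == v1 by sum & 2 · # 1 :+ (v8 :+ # 2 :* v7) <= v1 by A+2B<M) refl

    exact-drop : ∀ {y w y′ w′} → Mod M y′ (y + a) → Mod M w′ (w + b) → y + w ≡ y′ + w′ + M + B → y′ + M ≡ y + a × w′ + M ≡ w + b
    exact-drop (inj₂ e) (inj₂ f) _ = e , f
    exact-drop {y} {w} {y′} {w′} (inj₁ e) (inj₁ f) s = lin⊥ (y ∷ a ∷ y′ ∷ w ∷ b ∷ w′ ∷ M ∷ B ∷ A ∷ []) (v0 :+ v1 ==˘ v2 by e & v3 :+ v4 ==˘ v5 by f & v2 :+ v5 :+ v6 :+ v7 ==˘ v0 :+ v3 by s & v6 ==˘ v1 :+ v4 :+ v7 by sum & 2 · # 1 :+ (v8 :+ # 2 :* v7) <= v6 by A+2B<M) refl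
    exact-drop {y} {w} {y′} {w′} (inj₂ e) (inj₁ f) s = lin⊥ (y ∷ a ∷ y′ ∷ M ∷ w ∷ b ∷ w′ ∷ B ∷ A ∷ []) (v0 :+ v1 ==˘ v2 :+ v3 by e & v4 :+ v5 ==˘ v6 by f & v2 :+ v6 :+ v3 :+ v7 ==˘ v0 :+ v4 by s & v3 ==˘ v1 :+ v5 :+ v7 by sum & # 1 :+ (v8 :+ # 2 :* v7) <= v3 by A+2B<M) refl
    exact-drop {y} {w} {y′} {w′} (inj₁ e) (inj₂ f) s = lin⊥ (y ∷ a ∷ y′ ∷ w ∷ b ∷ w′ ∷ M ∷ B ∷ A ∷ []) (v0 :+ v1 ==˘ v2 by e & v3 :+ v4 ==˘ v5 :+ v6 by f & v2 :+ v5 :+ v6 :+ v7 ==˘ v0 :+ v3 by s & v6 ==˘ v1 :+ v4 :+ v7 by sum & # 1 :+ (v8 :+ # 2 :* v7) <= v6 by A+2B<M) refl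

-- The two kinds of links, and the exceptions caused by crossings outside V

module Mixed (p q N α β : ℕ) (Y W : ℕ → ℕ) (plus neg : ℕ → Bool)
  (L : Residues.Layout p q N α β Y W plus neg) (α≤β : α ≤ β) (3β<p : 3 * β + 1 ≤ p) (reg : 2 * p + 1 ≤ 6 * α + 3 * β)
  (big : 2 * p + 1 + 3 * cnt neg p ≤ 3 * cnt plus p)
  (chain₀ : Residues.Chain p q N α β Y W plus neg) (double₀ : Residues.Double p q N α β Y W plus neg)
  (τ : Timing p (p * q) Y W) (T m : ℕ) (T≤p : T ≤ p) (Tλ : T * Timing.lam τ ≡ β + m * p) where
  open Residues p q N α β Y W plus neg
  open Layout L
  open Large L α≤β 3β<p reg big hiding (chain; double)
  open Links p q N α β Y W plus neg L
  open Steps τ T m T≤p Tλ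
  open Timing τ
  open Double double₀ using (y; y≥; y<; s; t; s′; t′)
  open Chain chain₀ using (u; u≡; x<α; s₀; s₁; y₁; w₁; s₂; t₂; s₃; t₃) renaming (x to c)

  A≤B : α * q ≤ β * q
  A≤B = scaleS q α≤β
  A+2B<M : α * q + 2 * (β * q) < p * q
  A+2B<M = lin≤ (α ∷ q ∷ β ∷ p ∷ []) (# 1 :+ (v0 :* v1 :+ # 2 :* (v2 :* v1))) (v3 :* v1) ((# 3 :* v2 :+ # 1) :* v1 <= v3 :* v1 by scaleS q 3β<p & # 1 :+ # 0 <= v1 by q-pos & v0 :* v1 <= v2 :* v1 by A≤B) refl
  open Vectors (p * q) (α * q) (β * q) A≤B A+2B<M

  below : ∀ x → x < p → Below (Y x) (W x)
  below x l = Y< x l , W< x l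

  level : ∀ {x y} → x + β ≡ y → S₂ x → S₂ y → Y x + W x ≡ Y y + W y + β * q
  level {x} refl a b = lin≡ ((Y x) ∷ (W x) ∷ (Y (x + β)) ∷ (W (x + β)) ∷ β ∷ q ∷ x ∷ N ∷ p ∷ []) (v0 :+ v1) (v2 :+ v3 :+ v4 :* v5) (v6 :* v5 :+ v0 :+ v1 ≐ v7 :+ # 2 :* (v8 :* v5) by a &ᵉ v7 :+ # 2 :* (v8 :* v5) ≐ (v6 :+ v4) :* v5 :+ v2 :+ v3 by (sym b)) refl

  y<p : y < p
  y<p = ≤-trans (s≤s (m≤m+n y β)) y<
  c+β<p : c + β < p
  c+β<p = lin≤ (c ∷ β ∷ p ∷ α ∷ []) (# 1 :+ (v0 :+ v1)) v2 (2 · # 1 :+ v0 <= v3 by x<α & 2 · v3 <= v1 by α≤β & # 3 :* v1 :+ # 1 <= v2 by 3β<p) refl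
  c<p : c < p
  c<p = lin≤ (c ∷ p ∷ α ∷ β ∷ []) (# 1 :+ v0) v1 (3 · # 1 :+ v0 <= v2 by x<α & 3 · v2 <= v3 by α≤β & # 3 :* v3 :+ # 1 <= v1 by 3β<p) refl
  c+2β<p : c + 2 * β < p
  c+2β<p = lin≤ (c ∷ β ∷ p ∷ α ∷ []) (# 1 :+ (v0 :+ # 2 :* v1)) v2 (# 1 :+ v0 <= v3 by x<α & v3 <= v1 by α≤β & # 3 :* v1 :+ # 1 <= v2 by 3β<p) refl
  u<p : u < p
  u<p = lin≤ (u ∷ p ∷ c ∷ α ∷ β ∷ []) (# 1 :+ v0) v1 (# 1 :+ v2 <= v3 by x<α & v3 <= v4 by α≤β & v0 :+ v4 == v2 :+ v1 by u≡) refl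

  rise₀ : Y (c + β) + W (c + β) + β * q ≡ Y c + W c + p * q
  rise₀ = lin≡ ((Y (c + β)) ∷ (W (c + β)) ∷ β ∷ q ∷ (Y c) ∷ (W c) ∷ p ∷ N ∷ c ∷ []) (v0 :+ v1 :+ v2 :* v3) (v4 :+ v5 :+ v6 :* v3) (v7 ≐ v8 :* v3 :+ v4 :+ v5 by (sym s₀) &ᵉ (v8 :+ v2) :* v3 :+ v0 :+ v1 ≐ v7 :+ v6 :* v3 by s₁) refl
  rise₁ : Y (c + 2 * β) + W (c + 2 * β) + β * q ≡ Y (c + β) + W (c + β) + p * q
  rise₁ = lin≡ ((Y (c + 2 * β)) ∷ (W (c + 2 * β)) ∷ β ∷ q ∷ (Y (c + β)) ∷ (W (c + β)) ∷ p ∷ N ∷ c ∷ []) (v0 :+ v1 :+ v2 :* v3) (v4 :+ v5 :+ v6 :* v3) (v7 :+ v6 :* v3 ≐ (v8 :+ v2) :* v3 :+ v4 :+ v5 by (sym s₁) &ᵉ (v8 :+ # 2 :* v2) :* v3 :+ v0 :+ v1 ≐ v7 :+ # 2 :* (v6 :* v3) by s₂) refl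
  drop₂ : Y u + W u ≡ Y c + W c + p * q + β * q
  drop₂ = lin≡ ((Y u) ∷ (W u) ∷ (Y c) ∷ (W c) ∷ p ∷ q ∷ β ∷ c ∷ u ∷ N ∷ []) (v0 :+ v1) (v2 :+ v3 :+ v4 :* v5 :+ v6 :* v5) ((v7 :+ v4) :* v5 ≐ (v8 :+ v6) :* v5 by (sym (cong (_* q) u≡)) &ᵉ v9 ≐ v7 :* v5 :+ v2 :+ v3 by (sym s₀) &ᵉ v8 :* v5 :+ v0 :+ v1 ≐ v9 :+ # 2 :* (v4 :* v5) by s₃) refl

  link₁₂ : Link (c + β) (c + 2 * β)
  link₁₂ = inj₁ (lin≡ (c ∷ β ∷ []) (v0 :+ # 2 :* v1) (v0 :+ v1 :+ v1) trivialᵉ refl)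

  module Crossing (cross : p ≤ tm y + T) where

    a b : ℕ
    a = AY (p ∸ T)
    b = AW (p ∸ T)

    slow : a + b ≡ β * q × a < α * q × b < β * q
    slow = let (e , f) = backward y (y + β) y<p y< (inj₁ refl) cross in slow-derive (AY< (p ∸ T)) (AW< (p ∸ T)) e f t (below y y<p) t′ (level refl s s′)

    open Slow {a} {b} (proj₁ slow) (proj₁ (proj₂ slow)) (proj₂ (proj₂ slow))

    -- The short vector can neither lower y + w by M + B, nor raise it by M - B into `None`, nor out
    -- of `None` into a top. So no link of the chain crosses.
    nc-u : tm u + T < p
    nc-u = ≰⇒> λ g → let (e , f) = backward u c u<p c<p (inj₂ (sym u≡)) g in no-drop e f drop₂
    nc-c : tm c + T < p
    nc-c = ≰⇒> λ g → let (e , f) = backward c (c + β) c<p c+β<p (inj₁ refl) g in rise-none e f rise₀ (y₁ , w₁)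
    nc-c₁ : tm (c + β) + T < p
    nc-c₁ = ≰⇒> λ g → let (e , f) = backward (c + β) (c + 2 * β) c+β<p c+2β<p link₁₂ g in none-rise e f rise₁ (y₁ , w₁) t₂

    step : ∀ x x′ → x < p → x′ < p → Link x x′ → tm x + T < p → tm x′ ≡ tm x + T
    step x x′ x<p x′<p lk l with link-time x x′ x<p x′<p lk
    ... | inj₁ (_ , e) = e
    ... | inj₂ (g , _) = ⊥-elim (<⇒≱ l g)

    wrap : ∀ x x′ → x < p → x′ < p → Link x x′ → p ≤ tm x + T → tm x′ + p ≡ tm x + T
    wrap x x′ x<p x′<p lk g with link-time x x′ x<p x′<p lk
    ... | inj₁ (l , _) = ⊥-elim (<⇒≱ l g)
    ... | inj₂ (_ , e) = e

    -- The three chain links follow one another in time without passing its end.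
    3T<p : 3 * T < p
    3T<p = lin≤ (T ∷ p ∷ (tm u) ∷ (tm c) ∷ (tm (c + β)) ∷ []) (# 1 :+ (# 3 :* v0)) v1 (v2 :+ v0 ==˘ v3 by step u c u<p c<p (inj₂ (sym u≡)) nc-u & v3 :+ v0 ==˘ v4 by step c (c + β) c<p c+β<p (inj₁ refl) nc-c & # 1 :+ (v4 :+ v0) <= v1 by nc-c₁) refl

    a′ b′ : ℕ
    a′ = AY T
    b′ = AW T

    fast : a′ + b′ + β * q ≡ p * q × 0 < a′ × 0 < b′
    fast = let (e , f) = forward (c + β) (c + 2 * β) c+β<p c+2β<p link₁₂ nc-c₁ in fast-derive (AY< T) (AW< T) e f (y₁ , w₁) t₂ rise₁

    open Fast {a′} {b′} (proj₁ fast)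

    no-double : ∀ x x′ → x < p → x′ < p → Link x x′ → tm x + T < p → Tops x → Tops x′ → Y x + W x ≡ Y x′ + W x′ + β * q → ⊥
    no-double x x′ x<p x′<p lk l tx tx′ e with forward x x′ x<p x′<p lk l
    ... | f , g = no-level f g tx (below x x<p) tx′ (below x′ x′<p) e

    V I : ℕ → Bool
    V x = ⌊ α + β ≤? x ⌋ ∧ ⌊ x + β <? p ⌋
    I x = ⌊ p ≤? tm x + T ⌋

    V⁺ : ∀ {x} → α + β ≤ x → x + β < p → V x ≡ true
    V⁺ {x} l r = ∧-intro (dec-intro {d = α + β ≤? x} l) (dec-intro {d = x + β <? p} r)
    V⁻ : ∀ {x} → V x ≡ true → α + β ≤ x × x + β < p
    V⁻ {x} e = let (d , d′) = ∧-true {⌊ α + β ≤? x ⌋} e in dec-true {d = α + β ≤? x} d , dec-true {d = x + β <? p} d′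
    I⁻ : ∀ {x} → I x ≡ true → p ≤ tm x + T
    I⁻ {x} e = dec-true {d = p ≤? tm x + T} e
    ¬I⁻ : ∀ {x} → I x ≡ false → tm x + T < p
    ¬I⁻ {x} e = ≰⇒> (dec-false {d = p ≤? tm x + T} e)

    upper-good : ∀ x → x < p → α + β ≤ x → exc x ≡ false → S₂ x × Tops x
    upper-good x x<p l e with bool? (plus x)
    ... | inj₁ h = upper-plus x x<p l h
    ... | inj₂ h = T≢F (upper-exc x l h) e

    lower-good : ∀ x → x < α → exc x ≡ false → S₀ x ⊎ (S₁ x × Tops x)
    lower-good x l e with bool? (plus x)
    ... | inj₂ h = T≢F (lower-exc x l h) e
    ... | inj₁ h with plus⁻ x (lin≤ (x ∷ p ∷ α ∷ β ∷ []) (# 1 :+ v0) v1 (3 · # 1 :+ v0 <= v2 by l & 3 · v2 <= v3 by α≤β & # 3 :* v3 :+ # 1 <= v1 by 3β<p) refl) h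
    ...   | inj₁ (_ , _ , s) = s
    ...   | inj₂ (g , _) = lin⊥ (α ∷ β ∷ x ∷ []) (v0 :+ v1 <= v2 by g & # 1 :+ v2 <= v0 by l) refl

    mid-good : ∀ x → x < p → β ≤ x → x < α + β → exc x ≡ false → (S₁ x × None (Y x) (W x)) ⊎ S₂ x
    mid-good x x<p l r e with bool? (neg x)
    ... | inj₁ h = T≢F (mid-exc x x<p h) e
    ... | inj₂ h = ¬neg⁻ x x<p (≤-trans α≤β l) l r h

    -- Stated for an integer z because a residue e < α with one wrap is a top only when read as e +
    -- p.
    Lifted : ℕ → Set
    Lifted z = Σ ℕ λ y → Σ ℕ λ w → z * q + y + w ≡ N + 2 * (p * q) × Top y w × Below y w

    -- What is known of an exception found two links after, respectively one link before, a crossing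
    -- residue. Such exceptions may share a moment of time, so more than the time is recorded to
    -- tell them apart.
    Right Left : ℕ → Set
    Right w = (Σ ℕ λ z → z + β ≡ w × Lifted z) ⊎ (β ≤ w × w < α + β)
    Left w = Lifted (w + β) × (w < α ⊎ α + β ≤ w)

    -- Two tops at distance 2 β would need y + w to drop by 2 B, while the margins leave less than A
    -- + B ≤ 2 B. The remaining combinations disagree about the block containing w.
    clash-lr : ∀ {w} → Right w → Left w → ⊥
    clash-lr {w} (inj₁ (z , refl , y , w₁ , e , (t , t′) , (v , v′))) ((y′ , w′ , e′ , (t″ , t‴) , _) , _) =
      (lin⊥ (N ∷ p ∷ q ∷ z ∷ y ∷ w₁ ∷ β ∷ y′ ∷ w′ ∷ α ∷ []) (v0 :+ # 2 :* (v1 :* v2) ==˘ v3 :* v2 :+ v4 :+ v5 by e & (v3 :+ v6 :+ v6) :* v2 :+ v7 :+ v8 == v0 :+ # 2 :* (v1 :* v2) by e′ & # 1 :+ v4 <= v1 :* v2 by v & # 1 :+ v5 <= v1 :* v2 by v′ & v1 :* v2 <= v7 :+ v9 :* v2 by t″ & v1 :* v2 <= v8 :+ v6 :* v2 by t‴ & v9 :* v2 <= v6 :* v2 by A≤B) refl)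
    clash-lr {w} (inj₂ (l , r)) (_ , inj₁ h) = lin⊥ (β ∷ w ∷ α ∷ []) (v0 <= v1 by l & # 1 :+ v1 <= v2 by h & v2 <= v0 by α≤β) refl
    clash-lr {w} (inj₂ (l , r)) (_ , inj₂ h) = lin⊥ (w ∷ α ∷ β ∷ []) (# 1 :+ v0 <= v1 :+ v2 by r & v1 :+ v2 <= v0 by h) refl

    -- Where the exception charged to a crossing residue e may sit: at e, one link later (past the
    -- end of time), two links later, or one link earlier.
    Near : ℕ → ℕ → Set
    Near e w = tm w ≡ tm e ⊎ tm w + p ≡ tm e + T ⊎ (tm w + p ≡ tm e + 2 * T × Right w) ⊎ (tm w + T ≡ tm e × Left w)

    module Event (e : ℕ) (e<p : e < p) (Ie : p ≤ tm e + T) where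
      Goal : Set
      Goal = Σ ℕ λ w → w < p × exc w ≡ true × Near e w

      here : exc e ≡ true → Goal
      here h = e , e<p , h , inj₁ refl

      next : ∀ v → v < p → Link e v → exc v ≡ true → Goal
      next v v<p lk h = v , v<p , h , inj₂ (inj₁ (wrap e v e<p v<p lk Ie))

      -- A residue reached by a crossing link is among the first T moments, and 3 T < p, so its own
      -- link does not cross.
      after : ∀ v → v < p → Link e v → tm v + T < p
      after v v<p lk = lin≤ ((tm v) ∷ T ∷ p ∷ (tm e) ∷ []) (# 1 :+ (v0 :+ v1)) v2 (2 · v0 :+ v2 == v3 :+ v1 by wrap e v e<p v<p lk Ie & 2 · # 1 :+ v3 <= v2 by tm< e e<p & # 1 :+ # 3 :* v1 <= v2 by 3T<p) refl

      right : ∀ v w → v < p → w < p → Link e v → Link v w → Right w → exc w ≡ true → Goal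
      right v w v<p w<p lk lk′ r h = w , w<p , h , inj₂ (inj₂ (inj₁ (
        (lin≡ ((tm w) ∷ p ∷ (tm e) ∷ T ∷ (tm v) ∷ []) (v0 :+ v1) (v2 :+ # 2 :* v3) (v4 :+ v1 ≐ v2 :+ v3 by wrap e v e<p v<p lk Ie &ᵉ v0 ≐ v4 :+ v3 by step v w v<p w<p lk′ (after v v<p lk)) refl) , r)))

      before : ∀ w → w < p → Link w e → tm w + T < p × tm w + T ≡ tm e
      before w w<p lk with link-time w e w<p e<p lk
      ... | inj₁ (l , h) = l , sym h
      ... | inj₂ (g , h) = lin⊥ ((tm e) ∷ p ∷ (tm w) ∷ T ∷ []) (2 · v0 :+ v1 == v2 :+ v3 by h & v1 <= v0 :+ v3 by Ie & 2 · # 1 :+ v2 <= v1 by tm< w w<p & # 1 :+ # 3 :* v3 <= v1 by 3T<p) refl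

      left : ∀ w → w < p → Link w e → Left w → exc w ≡ true → Goal
      left w w<p lk l h = w , w<p , h , inj₂ (inj₂ (inj₂ (proj₂ (before w w<p lk) , l)))

      lifted : ∀ z → z * q + Y e + W e ≡ N + 2 * (p * q) → Tops e → Lifted z
      lifted z h t = Y e , W e , h , t , below e e<p

      top-next : ∀ v w → v < p → w < p → Link e v → v + β ≡ w → α + β ≤ w → S₂ v → Tops v → Goal
      top-next v w v<p w<p lk r w≥ sv tv with bool? (exc w)
      ... | inj₁ h = right v w v<p w<p lk (inj₁ (sym r)) (inj₁ (v , r , Y v , W v , sv , tv , below v v<p)) h
      ... | inj₂ h with upper-good w w<p w≥ h
      ...   | sw , tw = ⊥-elim (no-double v w v<p w<p (inj₁ (sym r)) (after v v<p lk) tv tw (level r sv sw))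

      -- A regular e with one wrap is a top as e + p; the non-crossing link into it then makes e - β
      -- exceptional. A regular e without wrap is followed by an exception at e + β, or by a top
      -- there and hence an exception at e + 2 β.
      zone₁ : e < α → Goal
      zone₁ l with bool? (exc e)
      ... | inj₁ h = here h
      ... | inj₂ h with lower-good e l h
      ...   | inj₂ (s₁ , te) = go
        where
        w = e + p-β
        w<p : w < p
        w<p = lin≤ (e ∷ p-β ∷ p ∷ β ∷ α ∷ []) (# 1 :+ (v0 :+ v1)) v2 (v1 :+ v3 == v2 by p-β+ & # 1 :+ v0 <= v4 by l & v4 <= v3 by α≤β) refl
        w+β : w + β ≡ e + p
        w+β = lin≡ (e ∷ p-β ∷ β ∷ p ∷ []) (v0 :+ v1 :+ v2) (v0 :+ v3) (v1 :+ v2 ≐ v3 by p-β+) refl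
        lk : Link w e
        lk = inj₂ (sym w+β)
        w≥ : α + β ≤ w
        w≥ = lin≤ (α ∷ β ∷ e ∷ p-β ∷ p ∷ []) (v0 :+ v1) (v2 :+ v3) (v4 ==˘ v3 :+ v1 by p-β+ & v0 <= v1 by α≤β & # 3 :* v1 :+ # 1 <= v4 by 3β<p) refl
        bad : exc w ≡ true → Goal
        bad = left w w<p lk (lifted (w + β) (lin≡ (e ∷ p-β ∷ β ∷ q ∷ (Y e) ∷ (W e) ∷ N ∷ p ∷ []) ((v0 :+ v1 :+ v2) :* v3 :+ v4 :+ v5) (v6 :+ # 2 :* (v7 :* v3)) (v0 :* v3 :+ v4 :+ v5 ≐ v6 :+ v7 :* v3 by s₁ &ᵉ (v1 :+ v2) :* v3 ≐ v7 :* v3 by cong (_* q) p-β+) refl) te , inj₂ w≥)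
        good : S₂ w × Tops w → ⊥
        good (sw , tw) = no-double w e w<p e<p lk (proj₁ (before w w<p lk)) tw te (lin≡ ((Y w) ∷ (W w) ∷ (Y e) ∷ (W e) ∷ β ∷ q ∷ N ∷ p ∷ e ∷ p-β ∷ []) (v0 :+ v1) (v2 :+ v3 :+ v4 :* v5) (v6 :+ v7 :* v5 ≐ v8 :* v5 :+ v2 :+ v3 by (sym s₁) &ᵉ (v8 :+ v9) :* v5 :+ v0 :+ v1 ≐ v6 :+ # 2 :* (v7 :* v5) by sw &ᵉ v7 :* v5 ≐ (v9 :+ v4) :* v5 by (sym (cong (_* q) p-β+))) refl)
        go : Goal
        go = [ bad , (λ h → ⊥-elim (good (upper-good w w<p w≥ h))) ]′ (bool? (exc w))
      ...   | inj₁ s₀ with bool? (exc (e + β))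
      ...     | inj₁ h₁ = next (e + β) (lin≤ (e ∷ β ∷ p ∷ α ∷ []) (# 1 :+ (v0 :+ v1)) v2 (2 · # 1 :+ v0 <= v3 by l & 2 · v3 <= v1 by α≤β & # 3 :* v1 :+ # 1 <= v2 by 3β<p) refl) (inj₁ refl) h₁
      ...     | inj₂ h₁ with mid-good (e + β) (lin≤ (e ∷ β ∷ p ∷ α ∷ []) (# 1 :+ (v0 :+ v1)) v2 (2 · # 1 :+ v0 <= v3 by l & 2 · v3 <= v1 by α≤β & # 3 :* v1 :+ # 1 <= v2 by 3β<p) refl) (m≤n+m β e) (+-monoˡ-< β l) h₁
                           | backward e (e + β) e<p (lin≤ (e ∷ β ∷ p ∷ α ∷ []) (# 1 :+ (v0 :+ v1)) v2 (2 · # 1 :+ v0 <= v3 by l & 2 · v3 <= v1 by α≤β & # 3 :* v1 :+ # 1 <= v2 by 3β<p) refl) (inj₁ refl) Ie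
      ...       | inj₁ (s₁ , n) | f , g = ⊥-elim (rise-none f g (lin≡ ((Y (e + β)) ∷ (W (e + β)) ∷ β ∷ q ∷ (Y e) ∷ (W e) ∷ p ∷ N ∷ e ∷ []) (v0 :+ v1 :+ v2 :* v3) (v4 :+ v5 :+ v6 :* v3) (v7 ≐ v8 :* v3 :+ v4 :+ v5 by (sym s₀) &ᵉ (v8 :+ v2) :* v3 :+ v0 :+ v1 ≐ v7 :+ v6 :* v3 by s₁) refl) n)
      ...       | inj₂ s₂ | f , g = top-next (e + β) (e + 2 * β) (lin≤ (e ∷ β ∷ p ∷ α ∷ []) (# 1 :+ (v0 :+ v1)) v2 (2 · # 1 :+ v0 <= v3 by l & 2 · v3 <= v1 by α≤β & # 3 :* v1 :+ # 1 <= v2 by 3β<p) refl) (lin≤ (e ∷ β ∷ p ∷ α ∷ []) (# 1 :+ (v0 :+ # 2 :* v1)) v2 (# 1 :+ v0 <= v3 by l & v3 <= v1 by α≤β & # 3 :* v1 :+ # 1 <= v2 by 3β<p) refl) (inj₁ refl) (lin≡ (e ∷ β ∷ []) (v0 :+ v1 :+ v1) (v0 :+ # 2 :* v1) trivialᵉ refl) (lin≤ (α ∷ β ∷ e ∷ []) (v0 :+ v1) (v2 :+ # 2 :* v1) (v0 <= v1 by α≤β) refl) s₂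
                  (rise-two f g (lin≡ ((Y (e + β)) ∷ (W (e + β)) ∷ β ∷ q ∷ (Y e) ∷ (W e) ∷ p ∷ N ∷ e ∷ []) (v0 :+ v1 :+ v2 :* v3) (v4 :+ v5 :+ # 2 :* (v6 :* v3)) (v7 ≐ v8 :* v3 :+ v4 :+ v5 by (sym s₀) &ᵉ (v8 :+ v2) :* v3 :+ v0 :+ v1 ≐ v7 :+ # 2 :* (v6 :* v3) by s₂) refl))

      -- Here e + β and e + 2 β both lie in the top zone, and the link between them does not cross,
      -- so they cannot both be regular.
      zone₂ : α ≤ e → e < β → Goal
      zone₂ l r with bool? (exc (e + β))
      ... | inj₁ h = next (e + β) (lin≤ (e ∷ β ∷ p ∷ []) (# 1 :+ (v0 :+ v1)) v2 (2 · # 1 :+ v0 <= v1 by r & # 3 :* v1 :+ # 1 <= v2 by 3β<p) refl) (inj₁ refl) h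
      ... | inj₂ h with upper-good (e + β) (lin≤ (e ∷ β ∷ p ∷ []) (# 1 :+ (v0 :+ v1)) v2 (2 · # 1 :+ v0 <= v1 by r & # 3 :* v1 :+ # 1 <= v2 by 3β<p) refl) (+-monoˡ-≤ β l) h
      ...   | s , t = top-next (e + β) (e + 2 * β) (lin≤ (e ∷ β ∷ p ∷ []) (# 1 :+ (v0 :+ v1)) v2 (2 · # 1 :+ v0 <= v1 by r & # 3 :* v1 :+ # 1 <= v2 by 3β<p) refl) (lin≤ (e ∷ β ∷ p ∷ []) (# 1 :+ (v0 :+ # 2 :* v1)) v2 (# 1 :+ v0 <= v1 by r & # 3 :* v1 :+ # 1 <= v2 by 3β<p) refl) (inj₁ refl) (lin≡ (e ∷ β ∷ []) (v0 :+ v1 :+ v1) (v0 :+ # 2 :* v1) trivialᵉ refl) (lin≤ (α ∷ β ∷ e ∷ []) (v0 :+ v1) (v2 :+ # 2 :* v1) (v0 <= v1 by α≤β) refl) s t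

      -- If e and e + β are regular, the short vector makes e a top as well. The fast vector admits
      -- no regular predecessor below α for such a top, so e - β is the exception.
      zone₃ : β ≤ e → e < α + β → Goal
      zone₃ l r with bool? (exc e) | bool? (exc (e + β))
      ... | inj₁ h | _ = here h
      ... | _ | inj₁ h = next (e + β) (lin≤ (e ∷ β ∷ p ∷ α ∷ []) (# 1 :+ (v0 :+ v1)) v2 (# 1 :+ v0 <= v3 :+ v1 by r & v3 <= v1 by α≤β & # 3 :* v1 :+ # 1 <= v2 by 3β<p) refl) (inj₁ refl) h
      ... | inj₂ h | inj₂ h′ with upper-good (e + β) (lin≤ (e ∷ β ∷ p ∷ α ∷ []) (# 1 :+ (v0 :+ v1)) v2 (# 1 :+ v0 <= v3 :+ v1 by r & v3 <= v1 by α≤β & # 3 :* v1 :+ # 1 <= v2 by 3β<p) refl) (lin≤ (α ∷ β ∷ e ∷ []) (v0 :+ v1) (v2 :+ v1) (v1 <= v2 by l & v0 <= v1 by α≤β) refl) h′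
                                | backward e (e + β) e<p (lin≤ (e ∷ β ∷ p ∷ α ∷ []) (# 1 :+ (v0 :+ v1)) v2 (# 1 :+ v0 <= v3 :+ v1 by r & v3 <= v1 by α≤β & # 3 :* v1 :+ # 1 <= v2 by 3β<p) refl) (inj₁ refl) Ie
                                | mid-good e e<p l r h
      ...   | s , t | f , g | inj₁ (s₁ , n) = ⊥-elim (none-rise f g (lin≡ ((Y (e + β)) ∷ (W (e + β)) ∷ β ∷ q ∷ (Y e) ∷ (W e) ∷ p ∷ N ∷ e ∷ []) (v0 :+ v1 :+ v2 :* v3) (v4 :+ v5 :+ v6 :* v3) (v7 :+ v6 :* v3 ≐ v8 :* v3 :+ v4 :+ v5 by (sym s₁) &ᵉ (v8 :+ v2) :* v3 :+ v0 :+ v1 ≐ v7 :+ # 2 :* (v6 :* v3) by s) refl) n t)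
      ...   | s , t | f , g | inj₂ s₂ = go
        where
        te : Tops e
        te = level-top f g (level refl s₂ s) t
        w = e ∸ β
        w+β : w + β ≡ e
        w+β = m∸n+n≡m l
        w<α : w < α
        w<α = lin≤ (w ∷ α ∷ β ∷ e ∷ []) (# 1 :+ v0) v1 (v0 :+ v2 == v3 by w+β & # 1 :+ v3 <= v1 :+ v2 by r) refl
        w<p : w < p
        w<p = lin≤ (w ∷ p ∷ α ∷ β ∷ []) (# 1 :+ v0) v1 (3 · # 1 :+ v0 <= v2 by w<α & 3 · v2 <= v3 by α≤β & # 3 :* v3 :+ # 1 <= v1 by 3β<p) refl
        lk : Link w e
        lk = inj₁ (sym w+β)
        good : S₀ w ⊎ (S₁ w × Tops w) → Mod (p * q) (Y e) (Y w + AY T) × Mod (p * q) (W e) (W w + AW T) → ⊥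
        good (inj₁ s₀) (f , g) = no-rise-two f g (lin≡ ((Y e) ∷ (W e) ∷ β ∷ q ∷ (Y w) ∷ (W w) ∷ p ∷ N ∷ w ∷ e ∷ []) (v0 :+ v1 :+ v2 :* v3) (v4 :+ v5 :+ # 2 :* (v6 :* v3)) (v7 ≐ v8 :* v3 :+ v4 :+ v5 by (sym s₀) &ᵉ v9 :* v3 :+ v0 :+ v1 ≐ v7 :+ # 2 :* (v6 :* v3) by s₂ &ᵉ (v8 :+ v2) :* v3 ≐ v9 :* v3 by cong (_* q) w+β) refl)
        good (inj₂ (s₁ , t)) (f , g) = no-top-rise f g t (below e e<p) (lin≡ ((Y e) ∷ (W e) ∷ β ∷ q ∷ (Y w) ∷ (W w) ∷ p ∷ N ∷ w ∷ e ∷ []) (v0 :+ v1 :+ v2 :* v3) (v4 :+ v5 :+ v6 :* v3) (v7 :+ v6 :* v3 ≐ v8 :* v3 :+ v4 :+ v5 by (sym s₁) &ᵉ v9 :* v3 :+ v0 :+ v1 ≐ v7 :+ # 2 :* (v6 :* v3) by s₂ &ᵉ (v8 :+ v2) :* v3 ≐ v9 :* v3 by cong (_* q) w+β) refl)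
        go : Goal
        go = [ left w w<p lk (lifted (w + β) (trans (cong (λ z → z * q + Y e + W e) w+β) s₂) te , inj₁ w<α)
             , (λ h → ⊥-elim (good (lower-good w w<α h) (forward w e w<p e<p lk (proj₁ (before w w<p lk))))) ]′ (bool? (exc w))

      -- The link ends at z = e + β - p < α. A regular z without wrap would be a drop by M + B,
      -- impossible for the short vector; one with a wrap is a top, and no regular middle residue
      -- can follow it at z + β.
      zone₄ : p ≤ e + β → α + β ≤ e → e < α + 2 * β → Goal
      zone₄ l r u with bool? (exc e)
      ... | inj₁ h = here h
      ... | inj₂ h = go (upper-good e e<p r h)
        where
        z = e + β ∸ p
        z+p : z + p ≡ e + β
        z+p = m∸n+n≡m l
        z<α : z < α
        z<α = lin≤ (z ∷ α ∷ p ∷ e ∷ β ∷ []) (# 1 :+ v0) v1 (v0 :+ v2 == v3 :+ v4 by z+p & # 1 :+ v3 <= v1 :+ # 2 :* v4 by u & # 3 :* v4 :+ # 1 <= v2 by 3β<p) refl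
        z<p : z < p
        z<p = lin≤ (z ∷ p ∷ α ∷ β ∷ []) (# 1 :+ v0) v1 (3 · # 1 :+ v0 <= v2 by z<α & 3 · v2 <= v3 by α≤β & # 3 :* v3 :+ # 1 <= v1 by 3β<p) refl
        lk : Link e z
        lk = inj₂ z+p
        z+β<p : z + β < p
        z+β<p = lin≤ (z ∷ β ∷ p ∷ α ∷ []) (# 1 :+ (v0 :+ v1)) v2 (2 · # 1 :+ v0 <= v3 by z<α & 2 · v3 <= v1 by α≤β & # 3 :* v1 :+ # 1 <= v2 by 3β<p) refl
        mid-bad : S₁ z → Tops z → (S₁ (z + β) × None (Y (z + β)) (W (z + β))) ⊎ S₂ (z + β) →
          Mod (p * q) (Y (z + β)) (Y z + AY T) × Mod (p * q) (W (z + β)) (W z + AW T) → ⊥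
        mid-bad s₁ t₁ (inj₁ (s₁′ , n)) (f , g) = no-level-none f g t₁ n (lin≡ ((Y z) ∷ (W z) ∷ (Y (z + β)) ∷ (W (z + β)) ∷ β ∷ q ∷ z ∷ N ∷ p ∷ []) (v0 :+ v1) (v2 :+ v3 :+ v4 :* v5) (v6 :* v5 :+ v0 :+ v1 ≐ v7 :+ v8 :* v5 by s₁ &ᵉ v7 :+ v8 :* v5 ≐ (v6 :+ v4) :* v5 :+ v2 :+ v3 by (sym s₁′)) refl)
        mid-bad s₁ t₁ (inj₂ s₂) (f , g) = no-top-rise f g t₁ (below (z + β) z+β<p) (lin≡ ((Y (z + β)) ∷ (W (z + β)) ∷ β ∷ q ∷ (Y z) ∷ (W z) ∷ p ∷ N ∷ z ∷ []) (v0 :+ v1 :+ v2 :* v3) (v4 :+ v5 :+ v6 :* v3) (v7 :+ v6 :* v3 ≐ v8 :* v3 :+ v4 :+ v5 by (sym s₁) &ᵉ (v8 :+ v2) :* v3 :+ v0 :+ v1 ≐ v7 :+ # 2 :* (v6 :* v3) by s₂) refl)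
        tail : S₂ e → S₀ z ⊎ (S₁ z × Tops z) → Mod (p * q) (Y e) (Y z + AY (p ∸ T)) × Mod (p * q) (W e) (W z + AW (p ∸ T)) → Goal
        tail s (inj₁ s₀) (f , g) = ⊥-elim (no-drop f g (lin≡ ((Y e) ∷ (W e) ∷ (Y z) ∷ (W z) ∷ p ∷ q ∷ β ∷ e ∷ N ∷ z ∷ []) (v0 :+ v1) (v2 :+ v3 :+ v4 :* v5 :+ v6 :* v5) (v7 :* v5 :+ v0 :+ v1 ≐ v8 :+ # 2 :* (v4 :* v5) by s &ᵉ v8 ≐ v9 :* v5 :+ v2 :+ v3 by (sym s₀) &ᵉ (v9 :+ v4) :* v5 ≐ (v7 :+ v6) :* v5 by cong (_* q) z+p) refl))
        tail s (inj₂ (s₁ , t₁)) _ =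
          [ right z (z + β) z<p z+β<p lk (inj₁ refl) (inj₂ (m≤n+m β z , +-monoˡ-< β z<α))
          , (λ h → ⊥-elim (mid-bad s₁ t₁ (mid-good (z + β) z+β<p (m≤n+m β z) (+-monoˡ-< β z<α) h)
              (forward z (z + β) z<p z+β<p (inj₁ refl) (after z z<p lk)))) ]′ (bool? (exc (z + β)))
        go : S₂ e × Tops e → Goal
        go (s , t) = [ next z z<p lk , (λ h → tail s (lower-good z z<α h) (backward e z e<p z<p lk Ie)) ]′ (bool? (exc z))

      zone₅ : α + 2 * β ≤ e → Goal
      zone₅ l with bool? (exc e)
      ... | inj₁ h = here h
      ... | inj₂ h = go (upper-good e e<p (lin≤ (α ∷ β ∷ e ∷ []) (v0 :+ v1) v2 (v0 :+ # 2 :* v1 <= v2 by l) refl) h)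
        where
        w = e ∸ β
        w+β : w + β ≡ e
        w+β = m∸n+n≡m {e} {β} (lin≤* (β ∷ e ∷ α ∷ []) 2 v0 v1 (v2 :+ # 2 :* v0 <= v1 by l) refl)
        w≥ : α + β ≤ w
        w≥ = lin≤ (α ∷ β ∷ w ∷ e ∷ []) (v0 :+ v1) v2 (v3 ==˘ v2 :+ v1 by w+β & v0 :+ # 2 :* v1 <= v3 by l) refl
        w<p : w < p
        w<p = lin≤ (w ∷ p ∷ β ∷ e ∷ []) (# 1 :+ v0) v1 (v0 :+ v2 == v3 by w+β & # 1 :+ v3 <= v1 by e<p) refl
        lk : Link w e
        lk = inj₁ (sym w+β)
        go : S₂ e × Tops e → Goal
        go (s , t) =
          [ left w w<p lk (lifted (w + β) (trans (cong (λ z → z * q + Y e + W e) w+β) s) t , inj₂ w≥)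
          , (λ h → let (sw , tw) = upper-good w w<p w≥ h in
              ⊥-elim (no-double w e w<p e<p lk (proj₁ (before w w<p lk)) tw t (level w+β sw s))) ]′ (bool? (exc w))

      event : V e ≡ false → Goal
      event ¬V with e <? α | e <? β | e <? α + β | p ≤? e + β | e <? α + 2 * β
      ... | yes h | _ | _ | _ | _ = zone₁ h
      ... | no h | yes h′ | _ | _ | _ = zone₂ (≮⇒≥ h) h′
      ... | no h | no h′ | yes h″ | _ | _ = zone₃ (≮⇒≥ h′) h″
      ... | no h | no h′ | no h″ | yes g | yes r = zone₄ g (≮⇒≥ h″) r
      ... | no h | no h′ | no h″ | yes g | no r = zone₅ (≮⇒≥ r)
      ... | no h | no h′ | no h″ | no g | _ = T≢F (V⁺ (≮⇒≥ h″) (≰⇒> g)) ¬V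

mod-lift : ∀ {p z u} k l → z < p → u < 2 * p → z + k * p ≡ u + l * p → Mod p z u
mod-lift {p} {z} {u} k l z<p u<2p e with u <? p
... | yes u<p = inj₁ (uniq k l z<p u<p e)
... | no ¬u<p = inj₂ (trans (cong (_+ p) (uniq k (1 + l) z<p w<p e′)) w+p)
  where
  w = u ∸ p
  w+p : w + p ≡ u
  w+p = m∸n+n≡m (≮⇒≥ ¬u<p)
  w<p : w < p
  w<p = lin≤ (w ∷ p ∷ u ∷ []) (# 1 :+ v0) v1 (v0 :+ v1 == v2 by w+p & # 1 :+ v2 <= # 2 :* v1 by u<2p) refl
  e′ : z + k * p ≡ w + (1 + l) * p
  e′ = lin≡ (z ∷ k ∷ p ∷ w ∷ l ∷ u ∷ []) (v0 :+ v1 :* v2) (v3 :+ (# 1 :+ v4) :* v2) (v0 :+ v1 :* v2 ≐ v5 :+ v4 :* v2 by e &ᵉ v5 ≐ v3 :+ v2 by (sym w+p)) refl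

-- Comparing the block V with the set I of crossing residues

module Count (p q N α β : ℕ) (Y W : ℕ → ℕ) (plus neg : ℕ → Bool)
  (L : Residues.Layout p q N α β Y W plus neg) (α≤β : α ≤ β) (3β<p : 3 * β + 1 ≤ p) (reg : 2 * p + 1 ≤ 6 * α + 3 * β)
  (big : 2 * p + 1 + 3 * cnt neg p ≤ 3 * cnt plus p)
  (chain₀ : Residues.Chain p q N α β Y W plus neg) (double₀ : Residues.Double p q N α β Y W plus neg)
  (τ : Timing p (p * q) Y W) (T m : ℕ) (T≤p : T ≤ p) (Tλ : T * Timing.lam τ ≡ β + m * p)
  (cross : p ≤ Timing.tm τ (Residues.Double.y double₀) + T) (lam≢β : Timing.lam τ ≢ β) where
  open Residues p q N α β Y W plus neg
  open Layout L
  open Large L α≤β 3β<p reg big hiding (chain; double)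
  open Links p q N α β Y W plus neg L
  open Timing τ
  open Mixed p q N α β Y W plus neg L α≤β 3β<p reg big chain₀ double₀ τ T m T≤p Tλ
  open Crossing cross


  VI V∖I I∖V : ℕ → Bool
  VI x = V x ∧ I x
  V∖I x = V x ∧ not (I x)
  I∖V x = I x ∧ not (V x)

  D : ℕ
  D = p ∸ (α + 2 * β)
  D≡ : D + (α + 2 * β) ≡ p
  D≡ = m∸n+n≡m (lin≤ (α ∷ β ∷ p ∷ []) (v0 :+ # 2 :* v1) v2 (v0 <= v1 by α≤β & # 3 :* v1 :+ # 1 <= v2 by 3β<p) refl)
  X<D : 3 * X + 1 ≤ D
  X<D = lin≤ (X ∷ D ∷ p ∷ α ∷ β ∷ []) (# 3 :* v0 :+ # 1) v1 (v2 ==˘ v1 :+ (v3 :+ # 2 :* v4) by D≡ & # 3 :* v0 :+ # 3 :* v4 :+ # 1 <= v2 by X-small & v3 <= v4 by α≤β) refl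
  3D<p : 3 * D < p
  3D<p = lin≤ (D ∷ p ∷ α ∷ β ∷ []) (# 1 :+ (# 3 :* v0)) v1 (3 · v0 :+ (v2 :+ # 2 :* v3) == v1 by D≡ & # 2 :* v1 :+ # 1 <= # 6 :* v2 :+ # 3 :* v3 by reg & 3 · v2 <= v3 by α≤β) refl
  β>0 : 0 < β
  β>0 = lin≤* (β ∷ p ∷ α ∷ []) 3 (# 1 :+ (# 0)) v0 (# 2 :* v1 :+ # 1 <= # 6 :* v2 :+ # 3 :* v0 by reg & 6 · v2 <= v0 by α≤β & 2 · # 3 :* v0 :+ # 1 <= v1 by 3β<p) refl

  private
    -- Marks the y to which y - β is already charged. Such a y, if itself exceptional, is charged to
    -- y + β instead.
    spoilt : ℕ → Bool
    spoilt y = V∖I (y ∸ β) ∧ plus (y ∸ β)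

    Pick : ℕ → ℕ → Set
    Pick y w = (w ≡ y × spoilt y ≡ false) ⊎ (w ≡ y + β × plus y ≡ true) ⊎ (w ≡ y + β × spoilt y ≡ true × plus y ≡ false)

  -- A non-crossing link cannot join two tops, so for each such y one of y and y + β is exceptional.
  -- The choice recorded by `Pick` keeps the charges distinct.
  |V∖I| : cnt V∖I p ≤ X
  |V∖I| = cnt-inj Pick p p total inj
    where
    total : ∀ y → y < p → V∖I y ≡ true → Σ ℕ λ w → w < p × exc w ≡ true × Pick y w
    total y y<p e with bool? (plus y) | bool? (spoilt y)
    ... | inj₂ h | inj₂ h′ = y , y<p , upper-exc y (proj₁ (V⁻ (proj₁ (∧-true {V y} e)))) h , inj₁ (refl , h′)
    ... | inj₁ h | _ = y + β , proj₂ v , exc-next , inj₂ (inj₁ (refl , h))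
      where
      v = V⁻ (proj₁ (∧-true {V y} e))
      exc-next : exc (y + β) ≡ true
      exc-next with bool? (exc (y + β))
      ... | inj₁ k = k
      ... | inj₂ k = let (s , t) = upper-plus y y<p (proj₁ v) h
                         (s′ , t′) = upper-good (y + β) (proj₂ v) (≤-trans (proj₁ v) (m≤m+n y β)) k
                     in ⊥-elim (no-double y (y + β) y<p (proj₂ v) (inj₁ refl) (¬I⁻ (not-true (proj₂ (∧-true {V y} e)))) t t′ (level refl s s′))
    ... | inj₂ h | inj₁ h′ = y + β , proj₂ v , exc-next , inj₂ (inj₂ (refl , h′ , h))
      where
      v = V⁻ (proj₁ (∧-true {V y} e))
      z = y ∸ β
      z+β : z + β ≡ y
      z+β = m∸n+n≡m (≤-trans (m≤n+m β α) (proj₁ v))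
      z<p : z < p
      z<p = ≤-trans (s≤s (m∸n≤m y β)) y<p
      vz = V⁻ (proj₁ (∧-true {V z} (proj₁ (∧-true {V∖I z} h′))))
      exc-next : exc (y + β) ≡ true
      exc-next with bool? (exc (y + β))
      ... | inj₁ k = k
      -- Here y - β and y + β would be tops at distance 2 β, too far apart for the margins.
      ... | inj₂ k = let (s , t , t₁) = upper-plus z z<p (proj₁ vz) (proj₂ (∧-true {V∖I z} h′))
                         (s′ , t′ , t₁′) = upper-good (y + β) (proj₂ v) (≤-trans (proj₁ v) (m≤m+n y β)) k
                     in (lin⊥ (N ∷ p ∷ q ∷ z ∷ (Y z) ∷ (W z) ∷ y ∷ β ∷ (Y (y + β)) ∷ (W (y + β)) ∷ α ∷ []) (v0 :+ # 2 :* (v1 :* v2) ==˘ v3 :* v2 :+ v4 :+ v5 by s & (v6 :+ v7) :* v2 :+ v8 :+ v9 == v0 :+ # 2 :* (v1 :* v2) by s′ & (v3 :+ v7) :* v2 == v6 :* v2 by cong (_* q) z+β & v1 :* v2 <= v8 :+ v10 :* v2 by t′ & v1 :* v2 <= v9 :+ v7 :* v2 by t₁′ & # 1 :+ v4 <= v1 :* v2 by Y< z z<p & # 1 :+ v5 <= v1 :* v2 by W< z z<p & v10 :* v2 <= v7 :* v2 by A≤B) refl)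
    cross-out : ∀ y y′ → V∖I y ≡ true → V∖I y′ ≡ true → y ≡ y′ + β → spoilt y ≡ false → plus y′ ≡ true → ⊥
    cross-out y y′ e e′ refl h k rewrite m+n∸n≡m y′ β = T≢F (∧-intro e′ k) h
    -- Three members z, z + β, z + 2 β of V would need D > 2 β, against 6 α + 3 β > 2 p and α ≤ β.
    far-out : ∀ y y′ → V∖I y ≡ true → V∖I y′ ≡ true → y ≡ y′ + β → spoilt y′ ≡ true → ⊥
    far-out y y′ e e′ r h = lin⊥ (y′ ∷ β ∷ y ∷ p ∷ z ∷ α ∷ []) (3 · v0 :+ v1 ==˘ v2 by r & 3 · # 1 :+ (v2 :+ v1) <= v3 by proj₂ (V⁻ (proj₁ (∧-true {V y} e))) & 3 · v4 :+ v1 == v0 by z+β & 3 · v5 :+ v1 <= v4 by proj₁ vz & 2 · # 2 :* v3 :+ # 1 <= # 6 :* v5 :+ # 3 :* v1 by reg & 9 · v5 <= v1 by α≤β & # 3 :* v1 :+ # 1 <= v3 by 3β<p) refl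
      where
      z = y′ ∸ β
      z+β : z + β ≡ y′
      z+β = m∸n+n≡m (≤-trans (m≤n+m β α) (proj₁ (V⁻ (proj₁ (∧-true {V y′} e′)))))
      vz = V⁻ (proj₁ (∧-true {V z} (proj₁ (∧-true {V∖I z} h))))
    inj : ∀ y y′ w → y < p → y′ < p → V∖I y ≡ true → V∖I y′ ≡ true → w < p → Pick y w → Pick y′ w → y ≡ y′
    inj y y′ w _ _ e e′ _ (inj₁ (r , _)) (inj₁ (r′ , _)) = trans (sym r) r′
    inj y y′ w _ _ e e′ _ (inj₁ (r , h)) (inj₂ (inj₁ (r′ , k))) = ⊥-elim (cross-out y y′ e e′ (trans (sym r) r′) h k)
    inj y y′ w _ _ e e′ _ (inj₁ (r , _)) (inj₂ (inj₂ (r′ , k , _))) = ⊥-elim (far-out y y′ e e′ (trans (sym r) r′) k)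
    inj y y′ w _ _ e e′ _ (inj₂ (inj₁ (r , k))) (inj₁ (r′ , h)) = ⊥-elim (cross-out y′ y e′ e (trans (sym r′) r) h k)
    inj y y′ w _ _ e e′ _ (inj₂ (inj₂ (r , k , _))) (inj₁ (r′ , _)) = ⊥-elim (far-out y′ y e′ e (trans (sym r′) r) k)
    inj y y′ w _ _ e e′ _ (inj₂ (inj₁ (r , _))) (inj₂ (inj₁ (r′ , _))) = shift-inj β y y′ w r r′
    inj y y′ w _ _ e e′ _ (inj₂ (inj₁ (r , _))) (inj₂ (inj₂ (r′ , _))) = shift-inj β y y′ w r r′
    inj y y′ w _ _ e e′ _ (inj₂ (inj₂ (r , _))) (inj₂ (inj₁ (r′ , _))) = shift-inj β y y′ w r r′
    inj y y′ w _ _ e e′ _ (inj₂ (inj₂ (r , _))) (inj₂ (inj₂ (r′ , _))) = shift-inj β y y′ w r r′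

  tm-inj : ∀ x x′ → x < p → x′ < p → tm x ≡ tm x′ → x ≡ x′
  tm-inj x x′ l l′ e = trans (sym (xt-tm x l)) (trans (cong xt e) (xt-tm x′ l′))

  -- The kinds of `Near` occupy different ranges of time because 3 T < p, except for two links later
  -- against one link earlier, which `clash-lr` separates.
  |I∖V| : cnt I∖V p ≤ X
  |I∖V| = cnt-inj Near p p (λ e e<p h → Event.event e e<p (I⁻ (proj₁ (∧-true {I e} h))) (not-true (proj₂ (∧-true {I e} h)))) inj
    where
    inj : ∀ e e′ w → e < p → e′ < p → I∖V e ≡ true → I∖V e′ ≡ true → w < p → Near e w → Near e′ w → e ≡ e′
    inj e e′ w l l′ h h′ w<p n n′ = tm-inj e e′ l l′ (times n n′)
      where
      i : p ≤ tm e + T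
      i = I⁻ (proj₁ (∧-true {I e} h))
      i′ : p ≤ tm e′ + T
      i′ = I⁻ (proj₁ (∧-true {I e′} h′))
      te = tm< e l
      te′ = tm< e′ l′
      times : Near e w → Near e′ w → tm e ≡ tm e′
      times (inj₁ r) (inj₁ r′) = trans (sym r) r′
      times (inj₁ r) (inj₂ (inj₁ r′)) = lin⊥ ((tm e) ∷ (tm w) ∷ p ∷ (tm e′) ∷ T ∷ []) (v0 ==˘ v1 by r & 2 · v1 :+ v2 == v3 :+ v4 by r′ & v2 <= v0 :+ v4 by i & 2 · # 1 :+ v3 <= v2 by te′ & # 1 :+ # 3 :* v4 <= v2 by 3T<p) refl
      times (inj₁ r) (inj₂ (inj₂ (inj₁ (r′ , _)))) = lin⊥ ((tm e) ∷ (tm w) ∷ p ∷ (tm e′) ∷ T ∷ []) (v0 ==˘ v1 by r & v1 :+ v2 == v3 :+ # 2 :* v4 by r′ & v2 <= v0 :+ v4 by i & # 1 :+ v3 <= v2 by te′ & # 1 :+ # 3 :* v4 <= v2 by 3T<p) refl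
      times (inj₁ r) (inj₂ (inj₂ (inj₂ (r′ , _)))) = lin⊥ ((tm e) ∷ (tm w) ∷ T ∷ (tm e′) ∷ p ∷ []) (v0 ==˘ v1 by r & v1 :+ v2 == v3 by r′ & v4 <= v0 :+ v2 by i & # 1 :+ v3 <= v4 by te′) refl
      times (inj₂ (inj₁ r)) (inj₁ r′) = lin⊥ ((tm w) ∷ p ∷ (tm e) ∷ T ∷ (tm e′) ∷ []) (2 · v0 :+ v1 == v2 :+ v3 by r & v4 ==˘ v0 by r′ & v1 <= v4 :+ v3 by i′ & 2 · # 1 :+ v2 <= v1 by te & # 1 :+ # 3 :* v3 <= v1 by 3T<p) refl
      times (inj₂ (inj₁ r)) (inj₂ (inj₁ r′)) = lin≡ ((tm e) ∷ (tm e′) ∷ T ∷ (tm w) ∷ p ∷ []) v0 v1 (v0 :+ v2 ≐ v3 :+ v4 by (sym r) &ᵉ v3 :+ v4 ≐ v1 :+ v2 by r′) refl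
      times (inj₂ (inj₁ r)) (inj₂ (inj₂ (inj₁ (r′ , _)))) = lin⊥ ((tm w) ∷ p ∷ (tm e) ∷ T ∷ (tm e′) ∷ []) (v0 :+ v1 == v2 :+ v3 by r & v4 :+ # 2 :* v3 ==˘ v0 :+ v1 by r′ & # 1 :+ v2 <= v1 by te & v1 <= v4 :+ v3 by i′) refl
      times (inj₂ (inj₁ r)) (inj₂ (inj₂ (inj₂ (r′ , _)))) = lin⊥ ((tm w) ∷ p ∷ (tm e) ∷ T ∷ (tm e′) ∷ []) (v0 :+ v1 == v2 :+ v3 by r & v4 ==˘ v0 :+ v3 by r′ & # 1 :+ v2 <= v1 by te & v1 <= v4 :+ v3 by i′ & # 1 :+ # 3 :* v3 <= v1 by 3T<p) refl
      times (inj₂ (inj₂ (inj₁ (r , _)))) (inj₁ r′) = lin⊥ ((tm w) ∷ p ∷ (tm e) ∷ T ∷ (tm e′) ∷ []) (v0 :+ v1 == v2 :+ # 2 :* v3 by r & v4 ==˘ v0 by r′ & # 1 :+ v2 <= v1 by te & v1 <= v4 :+ v3 by i′ & # 1 :+ # 3 :* v3 <= v1 by 3T<p) refl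
      times (inj₂ (inj₂ (inj₁ (r , _)))) (inj₂ (inj₁ r′)) = lin⊥ ((tm e) ∷ T ∷ (tm w) ∷ p ∷ (tm e′) ∷ []) (v0 :+ # 2 :* v1 ==˘ v2 :+ v3 by r & v2 :+ v3 == v4 :+ v1 by r′ & v3 <= v0 :+ v1 by i & # 1 :+ v4 <= v3 by te′) refl
      times (inj₂ (inj₂ (inj₁ (r , _)))) (inj₂ (inj₂ (inj₁ (r′ , _)))) = lin≡ ((tm e) ∷ (tm e′) ∷ T ∷ (tm w) ∷ p ∷ []) v0 v1 (v0 :+ # 2 :* v2 ≐ v3 :+ v4 by (sym r) &ᵉ v3 :+ v4 ≐ v1 :+ # 2 :* v2 by r′) refl
      times (inj₂ (inj₂ (inj₁ (_ , r)))) (inj₂ (inj₂ (inj₂ (_ , r′)))) = ⊥-elim (clash-lr r r′)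
      times (inj₂ (inj₂ (inj₂ (r , _)))) (inj₁ r′) = lin⊥ ((tm w) ∷ T ∷ (tm e) ∷ (tm e′) ∷ p ∷ []) (v0 :+ v1 == v2 by r & v3 ==˘ v0 by r′ & # 1 :+ v2 <= v4 by te & v4 <= v3 :+ v1 by i′) refl
      times (inj₂ (inj₂ (inj₂ (r , _)))) (inj₂ (inj₁ r′)) = lin⊥ ((tm e) ∷ (tm w) ∷ T ∷ p ∷ (tm e′) ∷ []) (v0 ==˘ v1 :+ v2 by r & v1 :+ v3 == v4 :+ v2 by r′ & # 1 :+ v4 <= v3 by te′ & v3 <= v0 :+ v2 by i & # 1 :+ # 3 :* v2 <= v3 by 3T<p) refl
      times (inj₂ (inj₂ (inj₂ (_ , r)))) (inj₂ (inj₂ (inj₁ (_ , r′)))) = ⊥-elim (clash-lr r′ r)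
      times (inj₂ (inj₂ (inj₂ (r , _)))) (inj₂ (inj₂ (inj₂ (r′ , _)))) = trans (sym r) r′

  |V|≥ : D ≤ cnt V p
  |V|≥ = ≤cnt V (λ i y → y ≡ α + β + i) D p total λ i i′ y _ _ _ r r′ → +-cancelˡ-≡ (α + β) i i′ (trans (sym r) r′)
    where
    total : ∀ i → i < D → Σ ℕ λ y → y < p × V y ≡ true × y ≡ α + β + i
    total i l = α + β + i , (lin≤ (α ∷ β ∷ i ∷ p ∷ D ∷ []) (# 1 :+ (v0 :+ v1 :+ v2)) v3 (# 1 :+ v2 <= v4 by l & v4 :+ (v0 :+ # 2 :* v1) == v3 by D≡) refl) , V⁺ (m≤m+n (α + β) i) (lin≤ (α ∷ β ∷ i ∷ p ∷ D ∷ []) (# 1 :+ (v0 :+ v1 :+ v2 :+ v1)) v3 (# 1 :+ v2 <= v4 by l & v4 :+ (v0 :+ # 2 :* v1) == v3 by D≡) refl) , refl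

  |V|≤ : cnt V p ≤ D
  |V|≤ = cnt≤ V (λ y i → y ≡ α + β + i) p D total λ y y′ i _ _ _ _ r r′ → trans r (sym r′)
    where
    total : ∀ y → y < p → V y ≡ true → Σ ℕ λ i → i < D × y ≡ α + β + i
    total y _ e = i , (lin≤ (i ∷ D ∷ α ∷ β ∷ y ∷ p ∷ []) (# 1 :+ v0) v1 (v2 :+ v3 :+ v0 == v4 by m+[n∸m]≡n l & # 1 :+ (v4 :+ v3) <= v5 by r & v5 ==˘ v1 :+ (v2 :+ # 2 :* v3) by D≡) refl) , sym (m+[n∸m]≡n l)
      where
      l = proj₁ (V⁻ e)
      r = proj₂ (V⁻ e)
      i = y ∸ (α + β)

  |VI| : D ≤ cnt VI p + X
  |VI| = lin≤ (D ∷ (cnt VI p) ∷ X ∷ (cnt V p) ∷ (cnt V∖I p) ∷ []) v0 (v1 :+ v2) (v0 <= v3 by |V|≥ & v3 == v1 :+ v4 by cnt-split V I p & v4 <= v2 by |V∖I|) refl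

cancel-mod : ∀ {M u v} k l → u < v + 2 * M → v < u + M → u + k * M ≡ v + l * M → u ≡ v ⊎ u ≡ v + M
cancel-mod {M} {u} {v} zero zero _ _ e = inj₁ (lin≡ (u ∷ v ∷ []) v0 v1 (v0 :+ # 0 ≐ v1 :+ # 0 by e) refl)
cancel-mod {M} {u} {v} zero (suc zero) _ _ e = inj₂ (lin≡ (u ∷ v ∷ M ∷ []) v0 (v1 :+ v2) (v0 :+ # 0 ≐ v1 :+ # 1 :* v2 by e) refl)
cancel-mod {M} {u} {v} zero (suc (suc l)) h _ e = lin⊥ (v ∷ l ∷ M ∷ u ∷ []) (v0 :+ (# 2 :+ v1) :* v2 ==˘ v3 :+ # 0 by e & # 1 :+ v3 <= v0 :+ # 2 :* v2 by h) refl
cancel-mod {M} {u} {v} (suc k) zero _ h e = lin⊥ (u ∷ k ∷ M ∷ v ∷ []) (v0 :+ (# 1 :+ v1) :* v2 == v3 :+ # 0 by e & # 1 :+ v3 <= v0 :+ v2 by h) refl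
cancel-mod {M} {u} {v} (suc k) (suc l) h h′ e = cancel-mod k l h h′ (lin≡ (u ∷ k ∷ M ∷ v ∷ l ∷ []) (v0 :+ v1 :* v2) (v3 :+ v4 :* v2) (v0 :+ (# 1 :+ v1) :* v2 ≐ v3 :+ (# 1 :+ v4) :* v2 by e) refl)

-- Moving V along time: no value of the step survives

module Final (p q N α β : ℕ) (Y W : ℕ → ℕ) (plus neg : ℕ → Bool)
  (L : Residues.Layout p q N α β Y W plus neg) (α≤β : α ≤ β) (3β<p : 3 * β + 1 ≤ p) (reg : 2 * p + 1 ≤ 6 * α + 3 * β)
  (big : 2 * p + 1 + 3 * cnt neg p ≤ 3 * cnt plus p)
  (chain₀ : Residues.Chain p q N α β Y W plus neg) (double₀ : Residues.Double p q N α β Y W plus neg)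
  (τ : Timing p (p * q) Y W) (T m : ℕ) (T≤p : T ≤ p) (Tλ : T * Timing.lam τ ≡ β + m * p)
  (cross : p ≤ Timing.tm τ (Residues.Double.y double₀) + T) (lam≢β : Timing.lam τ ≢ β) (α≥2 : 2 ≤ α) where
  open Residues p q N α β Y W plus neg
  open Layout L
  open Large L α≤β 3β<p reg big hiding (chain; double)
  open Links p q N α β Y W plus neg L
  open Timing τ
  open Mixed p q N α β Y W plus neg L α≤β 3β<p reg big chain₀ double₀ τ T m T≤p Tλ
  open Crossing cross
  open Count p q N α β Y W plus neg L α≤β 3β<p reg big chain₀ double₀ τ T m T≤p Tλ cross lam≢β



  T≢0 : 0 < T
  T≢0 = T>0 T Tλ
    where
    T>0 : ∀ T → T * lam ≡ β + m * p → 0 < T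
    T>0 zero e = lin⊥ (β ∷ m ∷ p ∷ []) (v0 :+ v1 :* v2 ==˘ # 0 by e & # 1 :+ # 0 <= v0 by β>0) refl
    T>0 (suc T) _ = s≤s z≤n

  -- j steps of time move every residue by at least D, the length of V, around the circle
  Apart : ℕ → Set
  Apart j = ∀ t → t + j < p → V (xt t) ≡ true → V (xt (t + j)) ≡ true → ⊥

  -- The crossing times are the last T. From each of them a move by j, forward if possible and
  -- backward otherwise, stays among them when 2 j ≤ T, while `Apart` takes it out of V. Both kinds
  -- of move inject into I outside V.
  |VI|-far : ∀ j → Apart j → 2 * j ≤ T → cnt VI p ≤ X + X
  |VI|-far j apart 2j≤T = lin≤ ((cnt VI p) ∷ X ∷ (cnt VI₁ p) ∷ (cnt VI₂ p) ∷ []) v0 (v1 :+ v1) (v0 == v2 :+ v3 by cnt-split VI fits p & v2 <= v1 by ≤-trans h₁ |I∖V| & v3 <= v1 by ≤-trans h₂ |I∖V|) refl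
    where
    fits VI₁ VI₂ : ℕ → Bool
    fits x = ⌊ tm x + j <? p ⌋
    VI₁ x = VI x ∧ fits x
    VI₂ x = VI x ∧ not (fits x)
    notV : ∀ {x} → (V x ≡ true → ⊥) → not (V x) ≡ true
    notV {x} f with V x
    ... | true = ⊥-elim (f refl)
    ... | false = refl
    h₁ : cnt VI₁ p ≤ cnt I∖V p
    h₁ = cnt-inj (λ x y → tm y ≡ tm x + j) p p total
      λ x x′ y l l′ _ _ _ r r′ → tm-inj x x′ l l′ (+-cancelʳ-≡ j _ _ (trans (sym r) r′))
      where
      total : ∀ x → x < p → VI₁ x ≡ true → Σ ℕ λ y → y < p × I∖V y ≡ true × tm y ≡ tm x + j
      total x x<p e = y , xt< _ l , ∧-intro (dec-intro {d = p ≤? tm y + T} (subst (λ s → p ≤ s + T) (sym tm-y) (lin≤ (p ∷ (tm x) ∷ j ∷ T ∷ []) v0 (v1 :+ v2 :+ v3) (v0 <= v1 :+ v3 by I⁻ (proj₂ (∧-true {V x} vi))) refl))) (notV (apart (tm x) l (trans (cong V (xt-tm x x<p)) (proj₁ (∧-true {V x} vi))))) , tm-y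
        where
        vi = proj₁ (∧-true {VI x} e)
        l = dec-true {d = tm x + j <? p} (proj₂ (∧-true {VI x} e))
        y = xt (tm x + j)
        tm-y : tm y ≡ tm x + j
        tm-y = tm-xt _ l
    h₂ : cnt VI₂ p ≤ cnt I∖V p
    h₂ = cnt-inj (λ x y → tm y + j ≡ tm x) p p total
      λ x x′ y l l′ _ _ _ r r′ → tm-inj x x′ l l′ (trans (sym r) r′)
      where
      total : ∀ x → x < p → VI₂ x ≡ true → Σ ℕ λ y → y < p × I∖V y ≡ true × tm y + j ≡ tm x
      total x x<p e = y , xt< _ s<p , ∧-intro (dec-intro {d = p ≤? tm y + T} (subst (λ s → p ≤ s + T) (sym tm-y) (lin≤ (p ∷ s ∷ T ∷ (tm x) ∷ j ∷ []) v0 (v1 :+ v2) (v3 ==˘ v1 :+ v4 by s+j & v0 <= v3 :+ v4 by late & # 2 :* v4 <= v2 by 2j≤T) refl))) (notV λ v → apart s l v (trans (cong V (trans (cong xt s+j) (xt-tm x x<p))) (proj₁ (∧-true {V x} vi)))) , trans (cong (_+ j) tm-y) s+j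
        where
        vi = proj₁ (∧-true {VI x} e)
        late : p ≤ tm x + j
        late = ≮⇒≥ (dec-false {d = tm x + j <? p} (not-true (proj₂ (∧-true {VI x} e))))
        s = tm x ∸ j
        s+j : s + j ≡ tm x
        s+j = m∸n+n≡m {tm x} {j} (lin≤* (j ∷ (tm x) ∷ p ∷ T ∷ []) 5 v0 v1 (v2 <= v1 :+ v0 by late & 3 · # 2 :* v0 <= v3 by 2j≤T & # 1 :+ # 3 :* v3 <= v2 by 3T<p) refl)
        l : s + j < p
        l = subst (_< p) (sym s+j) (tm< x x<p)
        s<p : s < p
        s<p = ≤-trans (s≤s (m≤m+n s j)) l
        y = xt s
        tm-y : tm y ≡ s
        tm-y = tm-xt s s<p

  -- When T < 2 j, the crossing times with equal offset modulo j come at most in pairs at distance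
  -- j, and V contains at most one of each pair.
  |VI|-near : ∀ j → Apart j → T < 2 * j → cnt VI p ≤ j
  |VI|-near j apart T<2j = cnt≤ VI R p j total inj
    where
    R : ℕ → ℕ → Set
    R x i = tm x + T ≡ p + i ⊎ tm x + T ≡ p + j + i
    total : ∀ x → x < p → VI x ≡ true → Σ ℕ λ i → i < j × R x i
    total x x<p e with p + j ≤? tm x + T
    ... | yes g = tm x + T ∸ (p + j) , (lin≤ ((tm x + T ∸ (p + j)) ∷ j ∷ p ∷ (tm x) ∷ T ∷ []) (# 1 :+ v0) v1 (v2 :+ v1 :+ v0 == v3 :+ v4 by r & # 1 :+ v4 <= # 2 :* v1 by T<2j & # 1 :+ v3 <= v2 by tm< x x<p) refl) , inj₂ (sym r)
      where
      r : p + j + (tm x + T ∸ (p + j)) ≡ tm x + T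
      r = m+[n∸m]≡n g
    ... | no g = tm x + T ∸ p , (lin≤ ((tm x + T ∸ p) ∷ j ∷ p ∷ (tm x) ∷ T ∷ []) (# 1 :+ v0) v1 (v2 :+ v0 == v3 :+ v4 by r & # 1 :+ (v3 :+ v4) <= v2 :+ v1 by ≰⇒> g) refl) , inj₁ (sym r)
      where
      r : p + (tm x + T ∸ p) ≡ tm x + T
      r = m+[n∸m]≡n (I⁻ (proj₂ (∧-true {V x} e)))
    one-apart : ∀ x x′ → x < p → x′ < p → VI x ≡ true → VI x′ ≡ true → tm x′ ≡ tm x + j → ⊥
    one-apart x x′ l l′ e e′ h = apart (tm x) (subst (_< p) h (tm< x′ l′)) (trans (cong V (xt-tm x l)) (proj₁ (∧-true {V x} e)))
      (trans (cong V (trans (cong xt (sym h)) (xt-tm x′ l′))) (proj₁ (∧-true {V x′} e′)))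
    inj : ∀ x x′ i → x < p → x′ < p → VI x ≡ true → VI x′ ≡ true → R x i → R x′ i → x ≡ x′
    inj x x′ i l l′ _ _ (inj₁ r) (inj₁ r′) = tm-inj x x′ l l′ (+-cancelʳ-≡ T _ _ (trans r (sym r′)))
    inj x x′ i l l′ _ _ (inj₂ r) (inj₂ r′) = tm-inj x x′ l l′ (+-cancelʳ-≡ T _ _ (trans r (sym r′)))
    inj x x′ i l l′ e e′ (inj₁ r) (inj₂ r′) = ⊥-elim (one-apart x x′ l l′ e e′ (lin≡ ((tm x′) ∷ (tm x) ∷ j ∷ p ∷ i ∷ T ∷ []) v0 (v1 :+ v2) (v3 :+ v4 ≐ v1 :+ v5 by (sym r) &ᵉ v0 :+ v5 ≐ v3 :+ v2 :+ v4 by r′) refl))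
    inj x x′ i l l′ e e′ (inj₂ r) (inj₁ r′) = ⊥-elim (one-apart x′ x l′ l e′ e (lin≡ ((tm x) ∷ (tm x′) ∷ j ∷ T ∷ p ∷ i ∷ []) v0 (v1 :+ v2) (v0 :+ v3 ≐ v4 :+ v2 :+ v5 by r &ᵉ v4 :+ v5 ≐ v1 :+ v3 by (sym r′)) refl))

  -- The case 2 j ≤ T would give D ≤ 3 X, so the second count applies.
  spread : ∀ j → Apart j → D ≤ X + j × T < 2 * j
  spread j apart with 2 * j ≤? T
  ... | yes h = lin⊥ ((cnt VI p) ∷ X ∷ D ∷ []) (v0 <= v1 :+ v1 by |VI|-far j apart h & v2 <= v0 :+ v1 by |VI| & # 3 :* v1 :+ # 1 <= v2 by X<D) refl
  ... | no h = (lin≤ (D ∷ X ∷ j ∷ (cnt VI p) ∷ []) v0 (v1 :+ v2) (v3 <= v2 by |VI|-near j apart (≰⇒> h) & v0 <= v3 :+ v1 by |VI|) refl) , ≰⇒> h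

  -- The direction is left open so that increasing and decreasing progressions share `small-step`.
  Moves : ℕ → ℕ → Set
  Moves j s = ∀ t → t + j < p → Mod p (xt (t + j)) (xt t + s) ⊎ Mod p (xt t) (xt (t + j) + s)

  -- V is an interval of length D on a circle of length p; rotating it by at least D and at most p -
  -- D makes it disjoint from itself.
  moves-apart : ∀ j s → D ≤ s → s + D ≤ p → Moves j s → Apart j
  moves-apart j s D≤s s≤ sh t l v v′ = go (sh t l)
    where
    a₁ = proj₁ (V⁻ v)
    a₂ = proj₂ (V⁻ v)
    b₁ = proj₁ (V⁻ v′)
    b₂ = proj₂ (V⁻ v′)
    go : Mod p (xt (t + j)) (xt t + s) ⊎ Mod p (xt t) (xt (t + j) + s) → ⊥
    go (inj₁ (inj₁ e)) = lin⊥ ((xt t) ∷ s ∷ (xt (t + j)) ∷ α ∷ β ∷ p ∷ D ∷ []) (v0 :+ v1 ==˘ v2 by e & v3 :+ v4 <= v0 by a₁ & # 1 :+ (v2 :+ v4) <= v5 by b₂ & v6 <= v1 by D≤s & v5 ==˘ v6 :+ (v3 :+ # 2 :* v4) by D≡) refl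
    go (inj₁ (inj₂ e)) = lin⊥ ((xt (t + j)) ∷ p ∷ (xt t) ∷ s ∷ β ∷ α ∷ D ∷ []) (v0 :+ v1 == v2 :+ v3 by e & # 1 :+ (v2 :+ v4) <= v1 by a₂ & v5 :+ v4 <= v0 by b₁ & v3 :+ v6 <= v1 by s≤ & v1 ==˘ v6 :+ (v5 :+ # 2 :* v4) by D≡) refl
    go (inj₂ (inj₁ e)) = lin⊥ ((xt (t + j)) ∷ s ∷ (xt t) ∷ α ∷ β ∷ p ∷ D ∷ []) (v0 :+ v1 ==˘ v2 by e & v3 :+ v4 <= v0 by b₁ & # 1 :+ (v2 :+ v4) <= v5 by a₂ & v6 <= v1 by D≤s & v5 ==˘ v6 :+ (v3 :+ # 2 :* v4) by D≡) refl
    go (inj₂ (inj₂ e)) = lin⊥ ((xt t) ∷ p ∷ (xt (t + j)) ∷ s ∷ β ∷ α ∷ D ∷ []) (v0 :+ v1 == v2 :+ v3 by e & # 1 :+ (v2 :+ v4) <= v1 by b₂ & v5 :+ v4 <= v0 by a₁ & v3 :+ v6 <= v1 by s≤ & v1 ==˘ v6 :+ (v5 :+ # 2 :* v4) by D≡) refl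

  -- A single step already clears V, which forces T = 1 and hence lam = β.
  far-step : D ≤ lam → lam + D ≤ p → ⊥
  far-step h h′ = lam≢β (≤-antisym (fits m lamβ) (lin≤ (β ∷ lam ∷ m ∷ p ∷ []) v0 v1 (v0 :+ v2 :* v3 ==˘ v1 by lamβ) refl))
    where
    sh : Moves 1 lam
    sh t l with shX 1 t l
    ... | k , e = inj₁ (mod-lift k 0 (xt< _ l) (lin≤ ((xt t) ∷ lam ∷ p ∷ D ∷ X ∷ []) (# 1 :+ (v0 :+ v1)) (# 2 :* v2) (# 1 :+ v0 <= v2 by xt< t (≤-trans (s≤s (m≤m+n t 1)) l) & v1 :+ v3 <= v2 by h′ & # 3 :* v4 :+ # 1 <= v3 by X<D) refl) (lin≡ ((xt (t + 1)) ∷ k ∷ p ∷ (xt t) ∷ lam ∷ []) (v0 :+ v1 :* v2) (v3 :+ v4 :+ # 0) (v0 :+ v1 :* v2 ≐ v3 :+ # 1 :* v4 by e) refl))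
    T<2 = proj₂ (spread 1 (moves-apart 1 lam h h′ sh))
    T≡1 : T ≡ 1
    T≡1 = ≤-antisym (lin≤ (T ∷ []) v0 (# 1) (# 1 :+ v0 <= # 2 by T<2) refl) (lin≤ (T ∷ []) (# 1) v0 (# 1 :+ # 0 <= v0 by T≢0) refl)
    lamβ : lam ≡ β + m * p
    lamβ = trans (sym (+-identityʳ lam)) (trans (cong (_* lam) (sym T≡1)) Tλ)
    fits : ∀ m → lam ≡ β + m * p → lam ≤ β
    fits zero e = lin≤ (lam ∷ β ∷ []) v0 v1 (v0 == v1 :+ # 0 by e) refl
    fits (suc m) e = lin⊥ (β ∷ m ∷ p ∷ lam ∷ []) (v0 :+ (# 1 :+ v1) :* v2 ==˘ v3 by e & # 1 :+ # 0 <= v0 by β>0 & v3 <= v2 by lam≤) refl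

  ceiling : ∀ ℓ → 0 < ℓ → Σ ℕ λ d → D ≤ suc d * ℓ × d * ℓ < D
  ceiling ℓ 0<ℓ = d , (lin≤ (D ∷ d ∷ ℓ ∷ D′ ∷ (D′ % ℓ) ∷ []) v0 ((# 1 :+ v1) :* v2) (v3 == v4 :+ v1 :* v2 by spec & # 1 :+ v4 <= v2 by m%n<n D′ ℓ & v0 ==˘ # 1 :+ v3 by D≡′) refl) , (lin≤ (d ∷ ℓ ∷ D ∷ (D′ % ℓ) ∷ D′ ∷ []) (# 1 :+ (v0 :* v1)) v2 (v3 :+ v0 :* v1 ==˘ v4 by spec & # 1 :+ v4 == v2 by D≡′) refl)
    where
    instance
      ℓ≢0 : NonZero ℓ
      ℓ≢0 = >-nonZero 0<ℓ
    D′ = D ∸ 1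
    D≡′ : 1 + D′ ≡ D
    D≡′ = m+[n∸m]≡n {1} (lin≤ (D ∷ X ∷ []) (# 1) v0 (# 3 :* v1 :+ # 1 <= v0 by X<D) refl)
    d = D′ / ℓ
    spec : D′ ≡ D′ % ℓ + d * ℓ
    spec = m≡m%n+[m/n]*n D′ ℓ

  -- The least j with j ℓ ≥ D satisfies j ℓ < 2 D < p - D, so j steps clear V and D ≤ X + j. But X <
  -- D / 3 and j - 1 < D / ℓ ≤ D / 2. For ℓ = 1 the count would give nothing, as j = D.
  small-step : ∀ ℓ → 2 ≤ ℓ → ℓ < D → (∀ j → j * ℓ < 2 * D → Moves j (j * ℓ)) → ⊥
  small-step ℓ 2≤ℓ ℓ<D sh = go (ceiling ℓ (≤-trans (s≤s z≤n) 2≤ℓ))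
    where
    go : (Σ ℕ λ d → D ≤ suc d * ℓ × d * ℓ < D) → ⊥
    go (d , lo , hi) = lin⊥ (D ∷ X ∷ d ∷ ℓ ∷ []) (6 · v0 <= v1 :+ (# 1 :+ v2) by proj₁ (spread (suc d) (moves-apart (suc d) (suc d * ℓ) lo fits (sh (suc d) <2D))) & 2 · # 3 :* v1 :+ # 1 <= v0 by X<D & 3 · # 1 :+ v2 :* v3 <= v0 by hi & 3 · v2 :* # 2 <= v2 :* v3 by *-monoʳ-≤ d 2≤ℓ & # 1 :+ v3 <= v0 by ℓ<D & # 2 <= v3 by 2≤ℓ) refl
      where
      <2D : suc d * ℓ < 2 * D
      <2D = lin≤ (d ∷ ℓ ∷ D ∷ []) (# 1 :+ ((# 1 :+ v0) :* v1)) (# 2 :* v2) (# 1 :+ v0 :* v1 <= v2 by hi & # 1 :+ v1 <= v2 by ℓ<D) refl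
      fits : suc d * ℓ + D ≤ p
      fits = lin≤ (d ∷ ℓ ∷ D ∷ p ∷ []) ((# 1 :+ v0) :* v1 :+ v2) v3 (# 1 :+ ((# 1 :+ v0) :* v1) <= # 2 :* v2 by <2D & # 1 :+ # 3 :* v2 <= v3 by 3D<p) refl

  up-step : 2 ≤ lam → lam < D → ⊥
  up-step l u = small-step lam l u sh
    where
    sh : ∀ j → j * lam < 2 * D → Moves j (j * lam)
    sh j b t l with shX j t l
    ... | k , e = inj₁ (mod-lift k 0 (xt< _ l) (lin≤* ((xt t) ∷ j ∷ lam ∷ p ∷ D ∷ []) 2 (# 1 :+ (v0 :+ v1 :* v2)) (# 2 :* v3) (2 · # 1 :+ v0 <= v3 by xt< t (≤-trans (s≤s (m≤m+n t j)) l) & 3 · # 1 :+ v1 :* v2 <= # 2 :* v4 by b & 2 · # 1 :+ # 3 :* v4 <= v3 by 3D<p) refl) (lin≡ ((xt (t + j)) ∷ k ∷ p ∷ (xt t) ∷ j ∷ lam ∷ []) (v0 :+ v1 :* v2) (v3 :+ v4 :* v5 :+ # 0) (v0 :+ v1 :* v2 ≐ v3 :+ v4 :* v5 by e) refl))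

  down-step : ∀ ℓ → ℓ + lam ≡ p → 2 ≤ ℓ → ℓ < D → ⊥
  down-step ℓ ℓ+ l u = small-step ℓ l u sh
    where
    sh : ∀ j → j * ℓ < 2 * D → Moves j (j * ℓ)
    sh j b t l with shX j t l
    ... | k , e = inj₂ (mod-lift j k (xt< t (≤-trans (s≤s (m≤m+n t j)) l)) (lin≤* ((xt (t + j)) ∷ j ∷ ℓ ∷ p ∷ D ∷ []) 2 (# 1 :+ (v0 :+ v1 :* v2)) (# 2 :* v3) (2 · # 1 :+ v0 <= v3 by xt< _ l & 3 · # 1 :+ v1 :* v2 <= # 2 :* v4 by b & 2 · # 1 :+ # 3 :* v4 <= v3 by 3D<p) refl)
      (lin≡ ((xt t) ∷ j ∷ p ∷ (xt (t + j)) ∷ ℓ ∷ k ∷ lam ∷ []) (v0 :+ v1 :* v2) (v3 :+ v1 :* v4 :+ v5 :* v2) (v0 :+ v1 :* v6 ≐ v3 :+ v5 :* v2 by (sym e) &ᵉ v1 :* v2 ≐ v1 :* (v4 :+ v6) by (sym (cong (j *_) ℓ+))) refl))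

  -- Now T lam ≡ β reads T + β ≡ 0 modulo p, impossible for 0 < T + β < p.
  unit-down : 1 + lam ≡ p → ⊥
  unit-down e = lin⊥ (T ∷ β ∷ []) (v0 :+ v1 == # 0 by uniq 0 0 T+β<p 0<p z & # 1 :+ # 0 <= v1 by β>0) refl
    where
    T+β<p : T + β < p
    T+β<p = lin≤* (T ∷ β ∷ p ∷ []) 3 (# 1 :+ (v0 :+ v1)) v2 (2 · # 1 :+ # 3 :* v0 <= v2 by 3T<p & # 3 :* v1 :+ # 1 <= v2 by 3β<p) refl
    0<p : 0 < p
    0<p = ≤-trans (s≤s z≤n) T+β<p
    eq : T + β + m * p ≡ T * p
    eq = lin≡ (T ∷ β ∷ m ∷ p ∷ lam ∷ []) (v0 :+ v1 :+ v2 :* v3) (v0 :* v3) (v1 :+ v2 :* v3 ≐ v0 :* v4 by (sym Tλ) &ᵉ v0 :* (# 1 :+ v4) ≐ v0 :* v3 by cong (T *_) e) refl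
    z : T + β + 0 * p ≡ 0 + 0 * p
    z = cong (_+ 0) (uniq m T T+β<p 0<p eq)

  -- Step one: time follows the cyclic order of the residues

  module Unit (lam≡1 : lam ≡ 1) where
    open Chain chain₀ using (u; u≡; s₀; s₁; y₁; w₁; s₂; t₂; s₃; t₃) renaming (x to c)

    T≡β : T ≡ β
    T≡β = go m (trans (sym (*-identityʳ T)) (trans (cong (T *_) (sym lam≡1)) Tλ))
      where
      go : ∀ m → T ≡ β + m * p → T ≡ β
      go zero e = lin≡ (T ∷ β ∷ []) v0 v1 (v0 ≐ v1 :+ # 0 by e) refl
      go (suc m) e = lin⊥ (β ∷ m ∷ p ∷ T ∷ []) (v0 :+ (# 1 :+ v1) :* v2 ==˘ v3 by e & # 1 :+ # 3 :* v3 <= v2 by 3T<p & # 1 :+ # 0 <= v0 by β>0) refl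

    -- The residue at time 0. The crossing residues are the β residues cyclically before it, so the
    -- agreement of V with I forces ξ ≈ p - β and D ≈ β, both up to X.
    ξ : ℕ
    ξ = xt 0
    0<p : 0 < p
    0<p = ≤-trans (s≤s z≤n) 3T<p
    ξ<p : ξ < p
    ξ<p = xt< 0 0<p

    at : ∀ d x k → d < p → x < p → ξ + d ≡ x + k * p → tm x ≡ d
    at d x k d<p x<p e with shX d 0 d<p
    ... | k′ , h = trans (cong tm (sym (uniq k′ k (xt< d d<p) x<p (trans h (trans (cong (λ l → ξ + d * l) lam≡1) (trans (cong (ξ +_) (*-identityʳ d)) e)))))) (tm-xt d d<p)

    tm-low : ∀ x → ξ ≤ x → x < p → tm x + ξ ≡ x
    tm-low x l x<p = trans (cong (_+ ξ) (at (x ∸ ξ) x 0 (≤-trans (s≤s (m∸n≤m x ξ)) x<p) x<p (trans (m+[n∸m]≡n l) (sym (+-identityʳ x))))) (m∸n+n≡m l)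

    tm-high : ∀ x → x < ξ → tm x + ξ ≡ x + p
    tm-high x l = trans (cong (_+ ξ) (at (x + p ∸ ξ) x 1 d<p (<-trans l ξ<p) (trans (m+[n∸m]≡n ξ≤) (lin≡ (x ∷ p ∷ []) (v0 :+ v1) (v0 :+ # 1 :* v1) trivialᵉ refl)))) (m∸n+n≡m ξ≤)
      where
      ξ≤ : ξ ≤ x + p
      ξ≤ = ≤-trans (<⇒≤ ξ<p) (m≤n+m p x)
      d<p : x + p ∸ ξ < p
      d<p = lin≤ ((x + p ∸ ξ) ∷ p ∷ ξ ∷ x ∷ []) (# 1 :+ v0) v1 (v0 :+ v2 == v3 :+ v1 by m∸n+n≡m ξ≤ & # 1 :+ v3 <= v2 by l) refl

    -- For larger ξ the X + 1 residues from p - β on would all be crossing, yet beyond the end of V.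
    ξ-upper : ξ + β ≤ p + X
    ξ-upper = ≮⇒≥ λ h → <-irrefl refl (≤-trans (≤cnt I∖V (λ i y → y + β ≡ p + i) (suc X) p (total h)
      λ i i′ y _ _ _ r r′ → +-cancelˡ-≡ p i i′ (trans (sym r) r′)) |I∖V|)
      where
      total : p + X < ξ + β → ∀ i → i < suc X → Σ ℕ λ y → y < p × I∖V y ≡ true × y + β ≡ p + i
      total h i l = y , y-in , ∧-intro (dec-intro {d = p ≤? tm y + T} (lin≤ (p ∷ (tm y) ∷ T ∷ y ∷ ξ ∷ β ∷ []) v0 (v1 :+ v2) (v3 :+ v0 ==˘ v1 :+ v4 by tm-high y y<ξ & v5 ==˘ v2 by T≡β & v4 <= v3 :+ v5 by ξ≤) refl)) (notV y refl) , e
        where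
        y = p-β + i
        e : y + β ≡ p + i
        e = lin≡ (p-β ∷ i ∷ β ∷ p ∷ []) (v0 :+ v1 :+ v2) (v3 :+ v1) (v0 :+ v2 ≐ v3 by p-β+) refl
        y<ξ : y < ξ
        y<ξ = lin≤ (y ∷ ξ ∷ β ∷ p ∷ i ∷ X ∷ []) (# 1 :+ v0) v1 (v0 :+ v2 == v3 :+ v4 by e & # 1 :+ v4 <= # 1 :+ v5 by l & # 1 :+ (v3 :+ v5) <= v1 :+ v2 by h) refl
        y-in : y < p
        y-in = <-trans y<ξ ξ<p
        ξ≤ : ξ ≤ y + β
        ξ≤ = lin≤ (ξ ∷ y ∷ β ∷ p ∷ i ∷ []) v0 (v1 :+ v2) (v3 :+ v4 ==˘ v1 :+ v2 by e & # 1 :+ v0 <= v3 by ξ<p) refl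
        notV : ∀ z → z ≡ y → not (V z) ≡ true
        notV z refl with bool? (V z)
        ... | inj₂ v rewrite v = refl
        ... | inj₁ v = lin⊥ (y ∷ β ∷ p ∷ i ∷ []) (# 1 :+ (v0 :+ v1) <= v2 by proj₂ (V⁻ v) & v2 :+ v3 ==˘ v0 :+ v1 by e) refl
    ξ-lower : p ≤ ξ + β + X
    ξ-lower = ≮⇒≥ λ h → <-irrefl refl (≤-trans (≤cnt V∖I (λ i y → y + β + suc i ≡ p) (suc X) p (total h)
      λ i i′ y _ _ _ r r′ → suc-injective (+-cancelˡ-≡ (y + β) (suc i) (suc i′) (trans r (sym r′)))) |V∖I|)
      where
      total : ξ + β + X < p → ∀ i → i < suc X → Σ ℕ λ y → y < p × V∖I y ≡ true × y + β + suc i ≡ p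
      total h i l = y , y-in , ∧-intro (V⁺ (lin≤ (α ∷ β ∷ y ∷ p ∷ i ∷ X ∷ D ∷ []) (v0 :+ v1) v2 (v3 ==˘ v2 :+ v1 :+ (# 1 :+ v4) by e & # 1 :+ v4 <= # 1 :+ v5 by l & # 3 :* v5 :+ # 1 <= v6 by X<D & v6 :+ (v0 :+ # 2 :* v1) == v3 by D≡) refl) (lin≤ (y ∷ β ∷ p ∷ i ∷ []) (# 1 :+ (v0 :+ v1)) v2 (v0 :+ v1 :+ (# 1 :+ v3) == v2 by e) refl)) (not-intro notI) , e
        where
        y = p ∸ (β + suc i)
        e : y + β + suc i ≡ p
        e = trans (+-assoc y β (suc i)) (m∸n+n≡m (lin≤ (β ∷ i ∷ p ∷ X ∷ D ∷ α ∷ []) (v0 :+ (# 1 :+ v1)) v2 (# 1 :+ v1 <= # 1 :+ v3 by l & # 3 :* v3 :+ # 1 <= v4 by X<D & v4 :+ (v5 :+ # 2 :* v0) == v2 by D≡) refl))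
        y-in : y < p
        y-in = lin≤ (y ∷ p ∷ β ∷ i ∷ []) (# 1 :+ v0) v1 (v0 :+ v2 :+ (# 1 :+ v3) == v1 by e) refl
        notI : I y ≡ false
        notI with bool? (I y)
        ... | inj₂ v = v
        ... | inj₁ v = lin⊥ (p ∷ (tm y) ∷ T ∷ ξ ∷ y ∷ β ∷ i ∷ []) (v0 <= v1 :+ v2 by I⁻ v & v1 :+ v3 == v4 by tm-low y ξ≤y y-in & v2 == v5 by T≡β & v4 :+ v5 :+ (# 1 :+ v6) == v0 by e) refl
          where
          ξ≤y : ξ ≤ y
          ξ≤y = lin≤ (ξ ∷ y ∷ p ∷ β ∷ i ∷ X ∷ []) v0 v1 (v2 ==˘ v1 :+ v3 :+ (# 1 :+ v4) by e & # 1 :+ v4 <= # 1 :+ v5 by l & # 1 :+ (v0 :+ v3 :+ v5) <= v2 by h) refl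

    β≤D+X : β ≤ D + X
    β≤D+X = lin≤ (β ∷ D ∷ X ∷ (cnt I p) ∷ (cnt (λ x → I x ∧ V x) p) ∷ (cnt I∖V p) ∷ []) v0 (v1 :+ v2) (v0 <= v3 by β≤I & v3 == v4 :+ v5 by cnt-split I V p & v5 <= v2 by |I∖V| & v4 <= v1 by ≤-trans (cnt-⊆ _ V p λ x _ e → proj₂ (∧-true {I x} e)) |V|≤) refl
      where
      β≤I : β ≤ cnt I p
      β≤I = ≤cnt I (λ i y → tm y ≡ p-β + i) β p total λ i i′ y _ _ _ r r′ → +-cancelˡ-≡ p-β i i′ (trans (sym r) r′)
        where
        total : ∀ i → i < β → Σ ℕ λ y → y < p × I y ≡ true × tm y ≡ p-β + i
        total i l = y , xt< _ s<p , dec-intro {d = p ≤? tm y + T} (subst (λ s → p ≤ s + T) (sym (tm-xt _ s<p)) (lin≤ (p ∷ p-β ∷ i ∷ T ∷ β ∷ []) v0 (v1 :+ v2 :+ v3) (v4 ==˘ v3 by T≡β & v0 ==˘ v1 :+ v4 by p-β+) refl)) , tm-xt _ s<p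
          where
          s<p : p-β + i < p
          s<p = lin≤ (p-β ∷ i ∷ p ∷ β ∷ []) (# 1 :+ (v0 :+ v1)) v2 (# 1 :+ v1 <= v3 by l & v0 :+ v3 == v2 by p-β+) refl
          y = xt (p-β + i)

    D≤β+X : D ≤ β + X
    D≤β+X = lin≤ (D ∷ β ∷ X ∷ (cnt VI p) ∷ []) v0 (v1 :+ v2) (v0 <= v3 :+ v2 by |VI| & v3 <= v1 by ≤-trans (cnt-⊆ VI I p λ x _ e → proj₂ (∧-true {V x} e)) I≤β) refl
      where
      I≤β : cnt I p ≤ β
      I≤β = cnt≤ I (λ y i → tm y + T ≡ p + i) p β total λ y y′ i l l′ _ _ r r′ → tm-inj y y′ l l′ (+-cancelʳ-≡ T _ _ (trans r (sym r′)))
        where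
        total : ∀ y → y < p → I y ≡ true → Σ ℕ λ i → i < β × tm y + T ≡ p + i
        total y l e = i , (lin≤ (i ∷ β ∷ p ∷ (tm y) ∷ T ∷ []) (# 1 :+ v0) v1 (v2 :+ v0 == v3 :+ v4 by r & v4 == v1 by T≡β & # 1 :+ v3 <= v2 by tm< y l) refl) , sym r
          where
          i = tm y + T ∸ p
          r : p + i ≡ tm y + T
          r = m+[n∸m]≡n (I⁻ e)

    -- The constant serves `not-both`: with M = p q and B = β q it says M + B ≤ 3 (M - 2 B), which
    -- is what contradicts `third`.
    7β≤2p : 7 * β ≤ 2 * p
    7β≤2p = lin≤* (β ∷ p ∷ D ∷ X ∷ α ∷ []) 3 (# 7 :* v0) (# 2 :* v1) (6 · v0 <= v2 :+ v3 by β≤D+X & 6 · v2 :+ (v4 :+ # 2 :* v0) == v1 by D≡ & 2 · # 3 :* v3 :+ # 3 :* v0 :+ # 1 <= v1 by X-small & # 2 :* v1 :+ # 1 <= # 6 :* v4 :+ # 3 :* v0 by reg) refl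

    7β≤2M : 7 * (β * q) ≤ 2 * (p * q)
    7β≤2M = lin≤ (β ∷ q ∷ p ∷ []) (# 7 :* (v0 :* v1)) (# 2 :* (v2 :* v1)) (# 7 :* v0 :* v1 <= # 2 :* v2 :* v1 by scaleS q 7β≤2p) refl

    open Steps τ T m T≤p Tλ using (forward)
    open Vectors (p * q) (α * q) (β * q) A≤B A+2B<M
    open Fast {a′} {b′} (proj₁ fast)

    -- The chain u, c, c + β, c + 2 β starts at a top and each coordinate wraps once along it, so Y
    -- u + 3 a′ < 2 M, and likewise for W.
    third : 3 * a′ < p * q + α * q × 3 * b′ < p * q + β * q
    third =
      (lin≤ (a′ ∷ p ∷ q ∷ α ∷ (Y u) ∷ (Y c) ∷ (Y (c + β)) ∷ (Y (c + 2 * β)) ∷ []) (# 1 :+ (# 3 :* v0)) (v1 :* v2 :+ v3 :* v2) (v4 :+ v0 ==˘ v5 :+ v1 :* v2 by e₁ & v5 :+ v0 ==˘ v6 by e₂ & v6 :+ v0 ==˘ v7 by e₃ & # 1 :+ v7 <= v1 :* v2 by Y< (c + 2 * β) c+2β<p & v1 :* v2 <= v4 :+ v3 :* v2 by proj₁ t₃) refl) ,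
      (lin≤ (b′ ∷ p ∷ q ∷ β ∷ (W u) ∷ (W c) ∷ (W (c + β)) ∷ (W (c + 2 * β)) ∷ []) (# 1 :+ (# 3 :* v0)) (v1 :* v2 :+ v3 :* v2) (v4 :+ v0 ==˘ v5 :+ v1 :* v2 by f₁ & v5 :+ v0 ==˘ v6 by f₂ & v6 :+ v0 ==˘ v7 by f₃ & # 1 :+ v7 <= v1 :* v2 by W< (c + 2 * β) c+2β<p & v1 :* v2 <= v4 :+ v3 :* v2 by proj₂ t₃) refl)
      where
      d = forward u c u<p c<p (inj₂ (sym u≡)) nc-u
      r = forward c (c + β) c<p c+β<p (inj₁ refl) nc-c
      r′ = forward (c + β) (c + 2 * β) c+β<p c+2β<p link₁₂ nc-c₁
      e₁ : Y c + p * q ≡ Y u + a′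
      e₁ = proj₁ (exact-drop (proj₁ d) (proj₂ d) drop₂)
      f₁ : W c + p * q ≡ W u + b′
      f₁ = proj₂ (exact-drop (proj₁ d) (proj₂ d) drop₂)
      e₂ : Y (c + β) ≡ Y c + a′
      e₂ = proj₁ (exact-rise (proj₁ r) (proj₂ r) rise₀)
      f₂ : W (c + β) ≡ W c + b′
      f₂ = proj₂ (exact-rise (proj₁ r) (proj₂ r) rise₀)
      e₃ : Y (c + 2 * β) ≡ Y (c + β) + a′
      e₃ = proj₁ (exact-rise (proj₁ r′) (proj₂ r′) rise₁)
      f₃ : W (c + 2 * β) ≡ W (c + β) + b′
      f₃ = proj₂ (exact-rise (proj₁ r′) (proj₂ r′) rise₁)

    -- A pair of tops at distance h whose distance in time is also h, that is, not separated by ξ.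
    record Pair (h : ℕ) : Set where
      field
        x x′ t : ℕ
        t+h<p : t + h < p
        x≡ : x ≡ xt t
        x′≡ : x′ ≡ xt (t + h)
        gap : x + h ≡ x′
        s : S₂ x
        s′ : S₂ x′
        top : Tops x
        top′ : Tops x′

    mod-k : ∀ {M u v} → Mod M u v → Σ ℕ λ k → u + k * M ≡ v
    mod-k (inj₁ refl) = 0 , +-identityʳ _
    mod-k {M} {u} (inj₂ refl) = 1 , cong (u +_) (+-identityʳ M)

    -- Two such pairs would decompose the vector of β steps into two short ones.
    not-both : ∀ h h′ → h + h′ ≡ β → Pair h → Pair h′ → ⊥
    not-both h h′ h+h′ P P′ = go (cY (AY< T) (proj₁ P.top) (proj₁ P′.top) (proj₁ P.top′) (proj₁ P′.top′)) (cW (AW< T) (proj₂ P.top) (proj₂ P′.top) (proj₂ P.top′) (proj₂ P′.top′))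
      where
      module P = Pair P
      module P′ = Pair P′
      time : ∀ {x t} → x ≡ xt t → t < p → x < p
      time {t = t} e l = subst (_< p) (sym e) (xt< t l)
      lt : ∀ {t d} → t + d < p → t < p
      lt {t} {d} l = ≤-trans (s≤s (m≤m+n t d)) l
      x<p = time P.x≡ (lt P.t+h<p)
      y-in₂ = time P′.x≡ (lt P′.t+h<p)
      x′<p = time P.x′≡ P.t+h<p
      y′<p = time P′.x′≡ P′.t+h<p
      β<p : h + h′ < p
      β<p = lin≤ (h ∷ h′ ∷ p ∷ β ∷ []) (# 1 :+ (v0 :+ v1)) v2 (v0 :+ v1 == v3 by h+h′ & # 3 :* v3 :+ # 1 <= v2 by 3β<p) refl
      module Coord (Z : ℕ → ℕ) (Z< : ∀ x → x < p → Z x < p * q) (A : ℕ → ℕ)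
        (sh : ∀ d t → t + d < p → Mod (p * q) (Z (xt (t + d))) (Z (xt t) + A d)) (C : ℕ) (2C<M : 2 * C < p * q) where
        -- Displacements do not depend on the starting time, so the one over T = h + h′ units is
        -- congruent to the sum of the differences across the two pairs.
        compose : Σ ℕ λ k → Σ ℕ λ l → A T + (Z P.x + Z P′.x) + k * (p * q) ≡ Z P.x′ + Z P′.x′ + l * (p * q)
        compose = k₃ + k₄ , k₁ + k₂ + k₅ ,
          (lin≡ ((A T) ∷ (Z P.x) ∷ (Z P′.x) ∷ k₃ ∷ k₄ ∷ p ∷ q ∷ (Z P.x′) ∷ (Z P′.x′) ∷ k₁ ∷ k₂ ∷ k₅ ∷ (A h) ∷ (A h′) ∷ z₁ ∷ z₀ ∷ z₂ ∷ []) (v0 :+ (v1 :+ v2) :+ (v3 :+ v4) :* (v5 :* v6)) (v7 :+ v8 :+ (v9 :+ v10 :+ v11) :* (v5 :* v6)) (v1 :+ v12 ≐ v7 :+ v9 :* (v5 :* v6) by (sym e₁) &ᵉ v2 :+ v13 ≐ v8 :+ v10 :* (v5 :* v6) by (sym e₂) &ᵉ v14 :+ v3 :* (v5 :* v6) ≐ v15 :+ v12 by e₃ &ᵉ v16 :+ v4 :* (v5 :* v6) ≐ v14 :+ v13 by e₄ &ᵉ v15 :+ v0 ≐ v16 :+ v11 :* (v5 :* v6) by (sym e₅)) refl)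
          where
          z₀ z₁ z₂ : ℕ
          z₀ = Z (xt 0)
          z₁ = Z (xt h)
          z₂ = Z (xt (h + h′))
          m₁ = mod-k (sh h P.t P.t+h<p)
          m₂ = mod-k (sh h′ P′.t P′.t+h<p)
          m₃ = mod-k (sh h 0 (lt β<p))
          m₄ = mod-k (sh h′ h β<p)
          m₅ = mod-k (sh (h + h′) 0 β<p)
          k₁ k₂ k₃ k₄ k₅ : ℕ
          k₁ = proj₁ m₁
          k₂ = proj₁ m₂
          k₃ = proj₁ m₃
          k₄ = proj₁ m₄
          k₅ = proj₁ m₅
          e₁ : Z P.x′ + k₁ * (p * q) ≡ Z P.x + A h
          e₁ = subst₂ (λ u v → Z u + k₁ * (p * q) ≡ Z v + A h) (sym P.x′≡) (sym P.x≡) (proj₂ m₁)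
          e₂ : Z P′.x′ + k₂ * (p * q) ≡ Z P′.x + A h′
          e₂ = subst₂ (λ u v → Z u + k₂ * (p * q) ≡ Z v + A h′) (sym P′.x′≡) (sym P′.x≡) (proj₂ m₂)
          e₃ : z₁ + k₃ * (p * q) ≡ z₀ + A h
          e₃ = proj₂ m₃
          e₄ : z₂ + k₄ * (p * q) ≡ z₁ + A h′
          e₄ = proj₂ m₄
          e₅ : z₂ + k₅ * (p * q) ≡ z₀ + A T
          e₅ = subst (λ d → z₂ + k₅ * (p * q) ≡ z₀ + A d) (trans h+h′ (sym T≡β)) (proj₂ m₅)
        split : A T < p * q → p * q ≤ Z P.x + C → p * q ≤ Z P′.x + C → p * q ≤ Z P.x′ + C → p * q ≤ Z P′.x′ + C →
          A T + (Z P.x + Z P′.x) ≡ Z P.x′ + Z P′.x′ ⊎ A T + (Z P.x + Z P′.x) ≡ Z P.x′ + Z P′.x′ + p * q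
        split A< a₁ a₂ a₃ a₄ = cancel-mod (proj₁ compose) (proj₁ (proj₂ compose))
          (lin≤ ((A T) ∷ (Z P.x) ∷ (Z P′.x) ∷ (Z P.x′) ∷ (Z P′.x′) ∷ p ∷ q ∷ C ∷ []) (# 1 :+ (v0 :+ (v1 :+ v2))) (v3 :+ v4 :+ # 2 :* (v5 :* v6)) (# 1 :+ v0 <= v5 :* v6 by A< & # 1 :+ v1 <= v5 :* v6 by Z< P.x x<p & # 1 :+ v2 <= v5 :* v6 by Z< P′.x y-in₂ & v5 :* v6 <= v3 :+ v7 by a₃ & v5 :* v6 <= v4 :+ v7 by a₄ & # 1 :+ # 2 :* v7 <= v5 :* v6 by 2C<M) refl)
          (lin≤ ((Z P.x′) ∷ (Z P′.x′) ∷ (A T) ∷ (Z P.x) ∷ (Z P′.x) ∷ p ∷ q ∷ C ∷ []) (# 1 :+ (v0 :+ v1)) (v2 :+ (v3 :+ v4) :+ v5 :* v6) (# 1 :+ v0 <= v5 :* v6 by Z< P.x′ x′<p & # 1 :+ v1 <= v5 :* v6 by Z< P′.x′ y′<p & v5 :* v6 <= v3 :+ v7 by a₁ & v5 :* v6 <= v4 :+ v7 by a₂ & # 1 :+ # 2 :* v7 <= v5 :* v6 by 2C<M) refl) (proj₂ (proj₂ compose))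
      cY = Coord.split Y Y< AY shY (α * q) (lin≤ (α ∷ q ∷ p ∷ β ∷ []) (# 1 :+ (# 2 :* (v0 :* v1))) (v2 :* v1) (# 1 :+ (v0 :* v1 :+ # 2 :* (v3 :* v1)) <= v2 :* v1 by A+2B<M & v0 :* v1 <= v3 :* v1 by A≤B) refl)
      cW = Coord.split W W< AW shW (β * q) (lin≤ (β ∷ q ∷ p ∷ α ∷ []) (# 1 :+ (# 2 :* (v0 :* v1))) (v2 :* v1) (# 1 :+ (v3 :* v1 :+ # 2 :* (v0 :* v1)) <= v2 :* v1 by A+2B<M) refl)
      drop : ∀ {h} (P : Pair h) → Y (Pair.x P) + W (Pair.x P) ≡ Y (Pair.x′ P) + W (Pair.x′ P) + h * q
      drop {h} record { x = x ; x′ = x′ ; gap = gap ; s = s ; s′ = s′ } = lin≡ ((Y x) ∷ (W x) ∷ (Y x′) ∷ (W x′) ∷ h ∷ q ∷ x ∷ N ∷ p ∷ x′ ∷ []) (v0 :+ v1) (v2 :+ v3 :+ v4 :* v5) (v6 :* v5 :+ v0 :+ v1 ≐ v7 :+ # 2 :* (v8 :* v5) by s &ᵉ v7 :+ # 2 :* (v8 :* v5) ≐ v9 :* v5 :+ v2 :+ v3 by (sym s′) &ᵉ v9 :* v5 ≐ (v6 :+ v4) :* v5 by (sym (cong (_* q) gap))) refl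
      total : Y P.x + Y P′.x + (W P.x + W P′.x) ≡ Y P.x′ + Y P′.x′ + (W P.x′ + W P′.x′) + β * q
      total = lin≡ ((Y P.x) ∷ (Y P′.x) ∷ (W P.x) ∷ (W P′.x) ∷ (Y P.x′) ∷ (Y P′.x′) ∷ (W P.x′) ∷ (W P′.x′) ∷ β ∷ q ∷ h ∷ h′ ∷ []) (v0 :+ v1 :+ (v2 :+ v3)) (v4 :+ v5 :+ (v6 :+ v7) :+ v8 :* v9) (v0 :+ v2 ≐ v4 :+ v6 :+ v10 :* v9 by drop P &ᵉ v1 :+ v3 ≐ v5 :+ v7 :+ v11 :* v9 by drop P′ &ᵉ (v10 :+ v11) :* v9 ≐ v8 :* v9 by cong (_* q) h+h′) refl
      go : AY T + (Y P.x + Y P′.x) ≡ Y P.x′ + Y P′.x′ ⊎ AY T + (Y P.x + Y P′.x) ≡ Y P.x′ + Y P′.x′ + p * q →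
           AW T + (W P.x + W P′.x) ≡ W P.x′ + W P′.x′ ⊎ AW T + (W P.x + W P′.x) ≡ W P.x′ + W P′.x′ + p * q → ⊥
      -- The two pairs together lower Y + W by B. Equal wraps in both coordinates would thus make a′
      -- + b′ + B equal to 0 or to 2 M instead of M.
      go (inj₁ e) (inj₁ f) = lin⊥ (a′ ∷ (Y P.x) ∷ (Y P′.x) ∷ (Y P.x′) ∷ (Y P′.x′) ∷ b′ ∷ (W P.x) ∷ (W P′.x) ∷ (W P.x′) ∷ (W P′.x′) ∷ β ∷ q ∷ p ∷ N ∷ []) (v0 :+ (v1 :+ v2) == v3 :+ v4 by e & v5 :+ (v6 :+ v7) == v8 :+ v9 by f & v3 :+ v4 :+ (v8 :+ v9) :+ v10 :* v11 ==˘ v1 :+ v2 :+ (v6 :+ v7) by total & v12 :* v11 ==˘ v0 :+ v5 :+ v10 :* v11 by proj₁ fast & # 1 :+ v13 <= v12 :* v11 by N<) refl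
      go (inj₂ e) (inj₂ f) = lin⊥ ((Y P.x′) ∷ (Y P′.x′) ∷ p ∷ q ∷ a′ ∷ (Y P.x) ∷ (Y P′.x) ∷ (W P.x′) ∷ (W P′.x′) ∷ b′ ∷ (W P.x) ∷ (W P′.x) ∷ β ∷ N ∷ []) (v0 :+ v1 :+ v2 :* v3 ==˘ v4 :+ (v5 :+ v6) by e & v7 :+ v8 :+ v2 :* v3 ==˘ v9 :+ (v10 :+ v11) by f & v5 :+ v6 :+ (v10 :+ v11) == v0 :+ v1 :+ (v7 :+ v8) :+ v12 :* v3 by total & v4 :+ v9 :+ v12 :* v3 == v2 :* v3 by proj₁ fast & # 1 :+ v13 <= v2 :* v3 by N<) refl
      -- A wrap in one coordinate only makes its displacement exceed M minus twice the margin, too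
      -- much for `third`.
      go (inj₂ e) (inj₁ f) = lin⊥ ((Y P.x′) ∷ (Y P′.x′) ∷ p ∷ q ∷ a′ ∷ (Y P.x) ∷ (Y P′.x) ∷ α ∷ β ∷ []) (3 · v0 :+ v1 :+ v2 :* v3 ==˘ v4 :+ (v5 :+ v6) by e & 3 · # 1 :+ v5 <= v2 :* v3 by Y< P.x x<p & 3 · # 1 :+ v6 <= v2 :* v3 by Y< P′.x y-in₂ & 3 · v2 :* v3 <= v0 :+ v7 :* v3 by proj₁ P.top′ & 3 · v2 :* v3 <= v1 :+ v7 :* v3 by proj₁ P′.top′ & # 1 :+ # 3 :* v4 <= v2 :* v3 :+ v7 :* v3 by proj₁ third & # 7 :* (v8 :* v3) <= # 2 :* (v2 :* v3) by 7β≤2M & 7 · v7 :* v3 <= v8 :* v3 by A≤B) refl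
      go (inj₁ e) (inj₂ f) = lin⊥ ((W P.x′) ∷ (W P′.x′) ∷ p ∷ q ∷ b′ ∷ (W P.x) ∷ (W P′.x) ∷ β ∷ []) (3 · v0 :+ v1 :+ v2 :* v3 ==˘ v4 :+ (v5 :+ v6) by f & 3 · # 1 :+ v5 <= v2 :* v3 by W< P.x x<p & 3 · # 1 :+ v6 <= v2 :* v3 by W< P′.x y-in₂ & 3 · v2 :* v3 <= v0 :+ v7 :* v3 by proj₂ P.top′ & 3 · v2 :* v3 <= v1 :+ v7 :* v3 by proj₂ P′.top′ & # 1 :+ # 3 :* v4 <= v2 :* v3 :+ v7 :* v3 by proj₂ third & # 7 :* (v7 :* v3) <= # 2 :* (v2 :* v3) by 7β≤2M) refl

    pair? : ℕ → ℕ → Bool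
    pair? h x = (⌊ α + β ≤? x ⌋ ∧ ⌊ x + h <? p ⌋) ∧ (⌊ tm (x + h) ≟ tm x + h ⌋ ∧ (plus x ∧ plus (x + h)))

    pair⁻ : ∀ h x → x < p → pair? h x ≡ true → Pair h
    pair⁻ h x x<p e = record
      { x = x ; x′ = x + h ; t = tm x ; t+h<p = subst (_< p) tm≡ (tm< (x + h) x+h<p) ; x≡ = sym (xt-tm x x<p)
      ; x′≡ = trans (sym (xt-tm (x + h) x+h<p)) (cong xt tm≡) ; gap = refl
      ; s = proj₁ lo ; s′ = proj₁ hi ; top = proj₂ lo ; top′ = proj₂ hi }
      where
      e₁ = ∧-true {⌊ α + β ≤? x ⌋ ∧ ⌊ x + h <? p ⌋} e
      e₂ = ∧-true {⌊ α + β ≤? x ⌋} (proj₁ e₁)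
      e₃ = ∧-true {⌊ tm (x + h) ≟ tm x + h ⌋} (proj₂ e₁)
      e₄ = ∧-true {plus x} (proj₂ e₃)
      x≥ = dec-true {d = α + β ≤? x} (proj₁ e₂)
      x+h<p = dec-true {d = x + h <? p} (proj₂ e₂)
      tm≡ = dec-true {d = tm (x + h) ≟ tm x + h} (proj₁ e₃)
      lo = upper-plus x x<p x≥ (proj₁ e₄)
      hi = upper-plus (x + h) x+h<p (≤-trans x≥ (m≤m+n x h)) (proj₂ e₄)

    Clear : ℕ → Set
    Clear h = ∀ x → x < p → pair? h x ≡ false

    clear-one : ∀ h h′ → h + h′ ≡ β → Clear h ⊎ Clear h′
    clear-one h h′ e with search (pair? h) p | search (pair? h′) p
    ... | inj₂ n | _ = inj₁ n
    ... | _ | inj₂ n = inj₂ n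
    ... | inj₁ (x , l , k) | inj₁ (x′ , l′ , k′) = ⊥-elim (not-both h h′ e (pair⁻ h x l k) (pair⁻ h′ x′ l′ k′))

    -- Cut at ξ, the top zone falls into two segments of length about β, in each of which distance
    -- in time equals distance. Without pairs at distance h ≈ β / 2 each segment needs about β / 2
    -- exceptions.
    module Segments (h : ℕ) (clear : Clear h) (h≤ : 2 * h ≤ β + 1) (≤h : β ≤ 2 * h + 1) where
      spoil : ∀ x → α + β ≤ x → x + h < p → tm (x + h) ≡ tm x + h → exc x ≡ true ⊎ exc (x + h) ≡ true
      spoil x l r e with bool? (plus x) | bool? (plus (x + h))
      ... | inj₂ k | _ = inj₁ (upper-exc x l k)
      ... | _ | inj₂ k = inj₂ (upper-exc (x + h) (≤-trans l (m≤m+n x h)) k)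
      ... | inj₁ k | inj₁ k′ = T≢F (∧-intro {⌊ α + β ≤? x ⌋ ∧ ⌊ x + h <? p ⌋} (∧-intro (dec-intro {d = α + β ≤? x} l) (dec-intro {d = x + h <? p} r)) (∧-intro (dec-intro {d = tm (x + h) ≟ tm x + h} e) (∧-intro k k′))) (clear x (≤-trans (s≤s (m≤m+n x h)) r))

      inside : ℕ → ℕ → ℕ → Bool
      inside A B x = exc x ∧ within A B x

      same-side : ∀ {A B} x → A ≤ x → x + h < B → B ≤ p → ξ ≤ A ⊎ B ≤ ξ → tm (x + h) ≡ tm x + h
      same-side {A} {B} x l r B≤p (inj₁ g) = lin≡ ((tm (x + h)) ∷ (tm x) ∷ h ∷ x ∷ ξ ∷ []) v0 (v1 :+ v2) (v3 ≐ v1 :+ v4 by (sym (tm-low x ξ≤x x<p)) &ᵉ v0 :+ v4 ≐ v3 :+ v2 by tm-low (x + h) (≤-trans ξ≤x (m≤m+n x h)) x+h<p) refl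
        where
        ξ≤x : ξ ≤ x
        ξ≤x = ≤-trans g l
        x+h<p : x + h < p
        x+h<p = ≤-trans r B≤p
        x<p : x < p
        x<p = ≤-trans (s≤s (m≤m+n x h)) x+h<p
      same-side {A} {B} x l r B≤p (inj₂ g) = lin≡ ((tm (x + h)) ∷ (tm x) ∷ h ∷ x ∷ p ∷ ξ ∷ []) v0 (v1 :+ v2) (v3 :+ v4 ≐ v1 :+ v5 by (sym (tm-high x (≤-trans (s≤s (m≤m+n x h)) x+h<ξ))) &ᵉ v0 :+ v5 ≐ v3 :+ v2 :+ v4 by tm-high (x + h) x+h<ξ) refl
        where
        x+h<ξ : x + h < ξ
        x+h<ξ = ≤-trans r g

      -- There are k pairs at distance h inside the segment, disjoint because k ≤ h, and each
      -- contains an exception.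
      enough : ∀ A B k → α + β ≤ A → B ≤ p → ξ ≤ A ⊎ B ≤ ξ → k ≤ h → A + k + h ≤ B → k ≤ cnt (inside A B) p
      enough A B k lo B≤p side k≤h fits = ≤cnt (inside A B) (λ i y → y ≡ A + i ⊎ y ≡ A + i + h) k p total inj
        where
        total : ∀ i → i < k → Σ ℕ λ y → y < p × inside A B y ≡ true × (y ≡ A + i ⊎ y ≡ A + i + h)
        total i l = [ (λ e → A + i , (lin≤ (A ∷ i ∷ p ∷ k ∷ h ∷ B ∷ []) (# 1 :+ (v0 :+ v1)) v2 (# 1 :+ v1 <= v3 by l & v0 :+ v3 :+ v4 <= v5 by fits & v5 <= v2 by B≤p) refl) , ∧-intro e (within⁺ (m≤m+n A i) (lin≤ (A ∷ i ∷ B ∷ k ∷ h ∷ []) (# 1 :+ (v0 :+ v1)) v2 (# 1 :+ v1 <= v3 by l & v0 :+ v3 :+ v4 <= v2 by fits) refl)) , inj₁ refl)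
                    , (λ e → A + i + h , (lin≤ (A ∷ i ∷ h ∷ p ∷ k ∷ B ∷ []) (# 1 :+ (v0 :+ v1 :+ v2)) v3 (# 1 :+ v1 <= v4 by l & v0 :+ v4 :+ v2 <= v5 by fits & v5 <= v3 by B≤p) refl) , ∧-intro e (within⁺ (≤-trans (m≤m+n A i) (m≤m+n (A + i) h)) <B) , inj₂ refl) ]′
                    (spoil (A + i) (≤-trans lo (m≤m+n A i)) (≤-trans <B B≤p) (same-side (A + i) (m≤m+n A i) <B B≤p side))
          where
          <B : A + i + h < B
          <B = lin≤ (A ∷ i ∷ h ∷ B ∷ k ∷ []) (# 1 :+ (v0 :+ v1 :+ v2)) v3 (# 1 :+ v1 <= v4 by l & v0 :+ v4 :+ v2 <= v3 by fits) refl
        inj : ∀ i i′ y → i < k → i′ < k → y < p → (y ≡ A + i ⊎ y ≡ A + i + h) → (y ≡ A + i′ ⊎ y ≡ A + i′ + h) → i ≡ i′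
        inj i i′ y _ _ _ (inj₁ r) (inj₁ r′) = +-cancelˡ-≡ A i i′ (trans (sym r) r′)
        inj i i′ y _ _ _ (inj₂ r) (inj₂ r′) = +-cancelˡ-≡ A i i′ (+-cancelʳ-≡ h _ _ (trans (sym r) r′))
        inj i i′ y l _ _ (inj₁ r) (inj₂ r′) = lin⊥ (y ∷ A ∷ i ∷ i′ ∷ h ∷ k ∷ []) (v0 == v1 :+ v2 by r & v1 :+ v3 :+ v4 ==˘ v0 by r′ & # 1 :+ v2 <= v5 by l & v5 <= v4 by k≤h) refl
        inj i i′ y _ l _ (inj₂ r) (inj₁ r′) = lin⊥ (A ∷ i ∷ h ∷ y ∷ i′ ∷ k ∷ []) (v0 :+ v1 :+ v2 ==˘ v3 by r & v3 == v0 :+ v4 by r′ & # 1 :+ v4 <= v5 by l & v5 <= v2 by k≤h) refl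

      -- Three ranges of the length B - A: below h no exception is forced; between h and 2 h the
      -- excess over h is forced; from 2 h on, h exceptions are.
      Size : ℕ → ℕ → ℕ → Set
      Size A B e = (B < A + h) ⊎ (B ≤ A + h + e × B < A + 2 * h) ⊎ (A + 2 * h ≤ B × h ≤ e)

      size : ∀ A B → α + β ≤ A → B ≤ p → ξ ≤ A ⊎ B ≤ ξ → Size A B (cnt (inside A B) p)
      size A B lo B≤p side with A + h ≤? B | A + 2 * h ≤? B
      ... | no n | _ = inj₁ (≰⇒> n)
      ... | yes g | yes g′ = inj₂ (inj₂ (g′ , enough A B h lo B≤p side ≤-refl (lin≤ (A ∷ h ∷ B ∷ []) (v0 :+ v1 :+ v1) v2 (v0 :+ # 2 :* v1 <= v2 by g′) refl)))
      ... | yes g | no n = inj₂ (inj₁ ((lin≤ (B ∷ A ∷ h ∷ (cnt (inside A B) p) ∷ k ∷ []) v0 (v1 :+ v2 :+ v3) (v4 <= v3 by k≤ & v0 ==˘ v1 :+ v2 :+ v4 by e) refl) , ≰⇒> n))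
        where
        k = B ∸ (A + h)
        e : A + h + k ≡ B
        e = m+[n∸m]≡n g
        k≤ : k ≤ cnt (inside A B) p
        k≤ = enough A B k lo B≤p side (lin≤ (k ∷ h ∷ A ∷ B ∷ []) v0 v1 (v2 :+ v1 :+ v0 == v3 by e & # 1 :+ v3 <= v2 :+ # 2 :* v1 by ≰⇒> n) refl) (lin≤ (A ∷ k ∷ h ∷ B ∷ []) (v0 :+ v1 :+ v2) v3 (v0 :+ v2 :+ v1 == v3 by e) refl)

      contradiction : ⊥
      contradiction = go (size (α + β) ξ ≤-refl (<⇒≤ ξ<p) (inj₂ ≤-refl)) (size ξ p ξ≥ ≤-refl (inj₁ ≤-refl))
        where
        e₁ e₂ : ℕ
        e₁ = cnt (inside (α + β) ξ) p
        e₂ = cnt (inside ξ p) p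
        ξ≥ : α + β ≤ ξ
        ξ≥ = lin≤ (α ∷ β ∷ ξ ∷ p ∷ X ∷ D ∷ []) (v0 :+ v1) v2 (v3 <= v2 :+ v1 :+ v4 by ξ-lower & # 3 :* v4 :+ # 1 <= v5 by X<D & v5 :+ (v0 :+ # 2 :* v1) == v3 by D≡) refl
        both : e₁ + e₂ ≤ X
        both = lin≤ (e₁ ∷ e₂ ∷ X ∷ (cnt (λ x → exc x ∧ ⌊ x <? ξ ⌋) p) ∷ (cnt (λ x → exc x ∧ not ⌊ x <? ξ ⌋) p) ∷ []) (v0 :+ v1) v2 (v3 :+ v4 ==˘ v2 by cnt-split exc (λ x → ⌊ x <? ξ ⌋) p & v0 <= v3 by f₁ & v1 <= v4 by f₂) refl
          where
          f₁ : e₁ ≤ cnt (λ x → exc x ∧ ⌊ x <? ξ ⌋) p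
          f₁ = cnt-⊆ _ _ p λ x _ e → let (k , w) = ∧-true {exc x} e in ∧-intro k (dec-intro {d = x <? ξ} (proj₂ (within⁻ {α + β} {ξ} {x} w)))
          not< : ∀ x → ξ ≤ x → not ⌊ x <? ξ ⌋ ≡ true
          not< x l with x <? ξ
          ... | yes g = ⊥-elim (<⇒≱ g l)
          ... | no _ = refl
          f₂ : e₂ ≤ cnt (λ x → exc x ∧ not ⌊ x <? ξ ⌋) p
          f₂ = cnt-⊆ _ _ p λ x _ e → let (k , w) = ∧-true {exc x} e in ∧-intro k (not< x (proj₁ (within⁻ {ξ} {p} {x} w)))
        go : Size (α + β) ξ e₁ → Size ξ p e₂ → ⊥
        -- The two lengths add up to D + β, where D and β differ by at most X < D / 3, and e₁ + e₂ ≤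
        -- X. The hypothesis α ≥ 2 absorbs the rounding of h against β / 2.
        go (inj₁ a) (inj₁ b) = lin⊥ (ξ ∷ α ∷ β ∷ h ∷ p ∷ D ∷ X ∷ []) (# 1 :+ v0 <= v1 :+ v2 :+ v3 by a & # 1 :+ v4 <= v0 :+ v3 by b & # 2 :* v3 <= v2 :+ # 1 by h≤ & v5 :+ (v1 :+ # 2 :* v2) == v4 by D≡ & # 3 :* v6 :+ # 1 <= v5 by X<D) refl
        go (inj₁ a) (inj₂ (inj₁ (b , _))) = lin⊥ (ξ ∷ α ∷ β ∷ h ∷ D ∷ p ∷ X ∷ []) (2 · # 1 :+ v0 <= v1 :+ v2 :+ v3 by a & # 2 :* v3 <= v2 :+ # 1 by h≤ & 2 · v4 :+ (v1 :+ # 2 :* v2) == v5 by D≡ & # 3 :* v6 :+ # 1 <= v4 by X<D & 2 · v5 <= v0 :+ v2 :+ v6 by ξ-lower & v2 <= v4 :+ v6 by β≤D+X) refl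
        go (inj₁ a) (inj₂ (inj₂ (b , b′))) = lin⊥ (ξ ∷ α ∷ β ∷ h ∷ e₂ ∷ e₁ ∷ X ∷ D ∷ p ∷ []) (4 · # 1 :+ v0 <= v1 :+ v2 :+ v3 by a & 4 · v3 <= v4 by b′ & 4 · v5 :+ v4 <= v6 by both & 4 · v7 :+ (v1 :+ # 2 :* v2) == v8 by D≡ & 3 · # 3 :* v6 :+ # 1 <= v7 by X<D & 4 · v8 <= v0 :+ v2 :+ v6 by ξ-lower & v2 <= v7 :+ v6 by β≤D+X & # 2 <= v1 by α≥2 & v1 <= v2 by α≤β) refl
        go (inj₂ (inj₁ (a , _))) (inj₁ b) = lin⊥ (ξ ∷ α ∷ β ∷ h ∷ e₁ ∷ p ∷ e₂ ∷ X ∷ D ∷ []) (v0 <= v1 :+ v2 :+ v3 :+ v4 by a & 3 · # 1 :+ v5 <= v0 :+ v3 by b & v4 :+ v6 <= v7 by both & 2 · # 2 :* v3 <= v2 :+ # 1 by h≤ & v8 :+ (v1 :+ # 2 :* v2) == v5 by D≡ & # 3 :* v7 :+ # 1 <= v8 by X<D & 2 · v0 :+ v2 <= v5 :+ v7 by ξ-upper & # 2 <= v1 by α≥2 & v1 <= v2 by α≤β) refl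
        go (inj₂ (inj₁ (a , _))) (inj₂ (inj₁ (b , _))) = lin⊥ (ξ ∷ α ∷ β ∷ h ∷ e₁ ∷ p ∷ e₂ ∷ X ∷ D ∷ []) (2 · v0 <= v1 :+ v2 :+ v3 :+ v4 by a & 2 · v5 <= v0 :+ v3 :+ v6 by b & 2 · v4 :+ v6 <= v7 by both & 2 · # 2 :* v3 <= v2 :+ # 1 by h≤ & 2 · v8 :+ (v1 :+ # 2 :* v2) == v5 by D≡ & # 3 :* v7 :+ # 1 <= v8 by X<D & v2 <= v8 :+ v7 by β≤D+X & # 2 <= v1 by α≥2 & v1 <= v2 by α≤β) refl
        go (inj₂ (inj₁ (a , _))) (inj₂ (inj₂ (b , b′))) = lin⊥ (ξ ∷ α ∷ β ∷ h ∷ e₁ ∷ e₂ ∷ X ∷ D ∷ p ∷ []) (4 · v0 <= v1 :+ v2 :+ v3 :+ v4 by a & 4 · v3 <= v5 by b′ & 4 · v4 :+ v5 <= v6 by both & 4 · v7 :+ (v1 :+ # 2 :* v2) == v8 by D≡ & 3 · # 3 :* v6 :+ # 1 <= v7 by X<D & 4 · v8 <= v0 :+ v2 :+ v6 by ξ-lower & v2 <= v7 :+ v6 by β≤D+X & # 2 <= v1 by α≥2 & v1 <= v2 by α≤β) refl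
        go (inj₂ (inj₂ (a , a′))) (inj₁ b) = lin⊥ (h ∷ e₁ ∷ p ∷ ξ ∷ e₂ ∷ X ∷ D ∷ β ∷ []) (v0 <= v1 by a′ & # 1 :+ v2 <= v3 :+ v0 by b & v1 :+ v4 <= v5 by both & # 3 :* v5 :+ # 1 <= v6 by X<D & v3 :+ v7 <= v2 :+ v5 by ξ-upper & v6 <= v7 :+ v5 by D≤β+X) refl
        go (inj₂ (inj₂ (a , a′))) (inj₂ (inj₁ (b , b′))) = lin⊥ (h ∷ e₁ ∷ p ∷ ξ ∷ e₂ ∷ X ∷ D ∷ β ∷ []) (v0 <= v1 by a′ & v2 <= v3 :+ v0 :+ v4 by b & v1 :+ v4 <= v5 by both & # 3 :* v5 :+ # 1 <= v6 by X<D & v3 :+ v7 <= v2 :+ v5 by ξ-upper & v6 <= v7 :+ v5 by D≤β+X) refl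
        go (inj₂ (inj₂ (a , a′))) (inj₂ (inj₂ (b , b′))) = lin⊥ (h ∷ e₁ ∷ e₂ ∷ X ∷ β ∷ D ∷ α ∷ []) (2 · v0 <= v1 by a′ & 2 · v0 <= v2 by b′ & 2 · v1 :+ v2 <= v3 by both & 2 · v4 <= # 2 :* v0 :+ # 1 by ≤h & # 3 :* v3 :+ # 1 <= v5 by X<D & v5 <= v4 :+ v3 by D≤β+X & # 2 <= v6 by α≥2 & v6 <= v4 by α≤β) refl

    contradiction : ⊥
    contradiction = go (clear-one h h′ h+h′)
      where
      h h′ : ℕ
      h = ⌊ β /2⌋
      h′ = ⌈ β /2⌉
      h+h′ : h + h′ ≡ β
      h+h′ = ⌊n/2⌋+⌈n/2⌉≡n β
      h≤h′ : h ≤ h′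
      h≤h′ = ⌊n/2⌋≤⌈n/2⌉ β
      h′≤h+1 : h′ ≤ suc h
      h′≤h+1 = half β
        where
        half : ∀ n → ⌈ n /2⌉ ≤ suc ⌊ n /2⌋
        half zero = z≤n
        half (suc zero) = s≤s z≤n
        half (suc (suc n)) = s≤s (half n)
      go : Clear h ⊎ Clear h′ → ⊥
      go (inj₁ k) = Segments.contradiction h k (lin≤ (h ∷ β ∷ h′ ∷ []) (# 2 :* v0) (v1 :+ # 1) (v0 :+ v2 == v1 by h+h′ & v0 <= v2 by h≤h′) refl) (lin≤ (β ∷ h ∷ h′ ∷ []) v0 (# 2 :* v1 :+ # 1) (v0 ==˘ v1 :+ v2 by h+h′ & v2 <= # 1 :+ v1 by h′≤h+1) refl)
      go (inj₂ k) = Segments.contradiction h′ k (lin≤ (h′ ∷ β ∷ h ∷ []) (# 2 :* v0) (v1 :+ # 1) (v2 :+ v0 == v1 by h+h′ & v0 <= # 1 :+ v2 by h′≤h+1) refl) (lin≤ (β ∷ h′ ∷ h ∷ []) v0 (# 2 :* v1 :+ # 1) (v0 ==˘ v2 :+ v1 by h+h′ & v2 <= v1 by h≤h′) refl)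

  -- The distinction is by the distance of lam from the multiples of p: at least D, between 2 and D
  -- on either side, 1 on either side, or 0.
  refuted : ⊥
  refuted with D ≤? lam | lam + D ≤? p
  ... | yes l | yes r = far-step l r
  ... | no l | _ = up lam refl (≰⇒> l)
    where
    up : ∀ k → lam ≡ k → lam < D → ⊥
    up zero e _ = lin⊥ (β ∷ m ∷ p ∷ T ∷ lam ∷ []) (v0 :+ v1 :* v2 ==˘ v3 :* v4 by Tλ & v3 :* v4 == # 0 by trans (cong (T *_) e) (*-zeroʳ T) & # 1 :+ # 0 <= v0 by β>0) refl
    up (suc zero) e _ = Unit.contradiction e
    up (suc (suc k)) e h = up-step (subst (2 ≤_) (sym e) (s≤s (s≤s z≤n))) h
  ... | yes l | no r = down (p ∸ lam) (m∸n+n≡m lam≤) (≰⇒> r)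
    where
    down : ∀ ℓ → ℓ + lam ≡ p → p < lam + D → ⊥
    down zero e _ = lin⊥ (β ∷ []) (v0 == # 0 by uniq 0 0 β<p 0<p (cong (_+ 0) (uniq m T β<p 0<p eq)) & # 1 :+ # 0 <= v0 by β>0) refl
      where
      β<p : β < p
      β<p = lin≤ (β ∷ p ∷ []) (# 1 :+ v0) v1 (# 3 :* v0 :+ # 1 <= v1 by 3β<p) refl
      0<p : 0 < p
      0<p = ≤-trans (s≤s z≤n) β<p
      eq : β + m * p ≡ T * p
      eq = trans (sym Tλ) (cong (T *_) e)
    down (suc zero) e _ = unit-down e
    down (suc (suc ℓ)) e h = down-step (suc (suc ℓ)) e (s≤s (s≤s z≤n)) (lin≤ (ℓ ∷ D ∷ lam ∷ p ∷ []) (# 1 :+ (# 2 :+ v0)) v1 (# 2 :+ v0 :+ v2 == v3 by e & # 1 :+ v3 <= v2 :+ v1 by h) refl)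

-- The bound 2 p / 3 for a layout with a clock

module Beiter {p q N α β : ℕ} {Y W : ℕ → ℕ} {plus neg : ℕ → Bool}
  (L : Residues.Layout p q N α β Y W plus neg) (α≤β : α ≤ β) (2≤α : 2 ≤ α) (α+β≤p : α + β ≤ p)
  (τ : Timing p (p * q) Y W) (lam≢β : Timing.lam τ ≢ β) (opp≢β : p ∸ Timing.lam τ ≢ β) where
  open Residues p q N α β Y W plus neg
  open Layout L
  open Timing τ

  β<p : β < p
  β<p = lin≤ (β ∷ p ∷ α ∷ []) (# 1 :+ v0) v1 (v2 :+ v0 <= v1 by α+β≤p & # 2 <= v2 by 2≤α) refl

  -- T is the time at which a clock started at `xt 0` shows the residue of `xt 0` + β.
  stride : Σ ℕ λ T → T ≤ p × Σ ℕ λ m → T * lam ≡ β + m * p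
  stride with xt 0 + β <? p
  ... | yes l = T , <⇒≤ (tm< _ l) , proj₁ sh , +-cancelˡ-≡ (xt 0) _ _ (trans (sym (proj₂ sh)) (trans (cong (_+ proj₁ sh * p) (xt-tm _ l)) (+-assoc (xt 0) β _)))
    where
    T = tm (xt 0 + β)
    sh = shX T 0 (tm< _ l)
  ... | no ¬l = T , <⇒≤ (tm< x x<p) , fix (proj₁ sh) (trans (sym (proj₂ sh)) (cong (_+ proj₁ sh * p) (xt-tm x x<p)))
    where
    x = xt 0 + β ∸ p
    x+p : x + p ≡ xt 0 + β
    x+p = m∸n+n≡m (≮⇒≥ ¬l)
    0<p : 0 < p
    0<p = ≤-trans (s≤s z≤n) β<p
    x<p : x < p
    x<p = lin≤ (x ∷ p ∷ (xt 0) ∷ β ∷ []) (# 1 :+ v0) v1 (v0 :+ v1 == v2 :+ v3 by x+p & # 1 :+ v2 <= v1 by xt< 0 0<p & # 1 :+ v3 <= v1 by β<p) refl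
    T = tm x
    sh = shX T 0 (tm< x x<p)
    fix : ∀ k → xt 0 + T * lam ≡ x + k * p → Σ ℕ λ m → T * lam ≡ β + m * p
    fix zero e = lin⊥ ((xt 0) ∷ T ∷ lam ∷ x ∷ p ∷ β ∷ []) (v0 :+ v1 :* v2 == v3 :+ # 0 by e & v3 :+ v4 == v0 :+ v5 by x+p & # 1 :+ v5 <= v4 by β<p) refl
    fix (suc k) e = k , (lin≡ (T ∷ lam ∷ β ∷ k ∷ p ∷ (xt 0) ∷ x ∷ []) (v0 :* v1) (v2 :+ v3 :* v4) (v5 :+ v0 :* v1 ≐ v6 :+ (# 1 :+ v3) :* v4 by e &ᵉ v6 :+ v4 ≐ v5 :+ v2 by x+p) refl)

  bound : 3 * cnt plus p ≤ 2 * p + 3 * cnt neg p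
  bound with 3 * β + 1 ≤? p | 2 * p + 1 ≤? 6 * α + 3 * β | 2 * p + 1 + 3 * cnt neg p ≤? 3 * cnt plus p
  ... | no h | _ | _ = lin≤ ((cnt plus p) ∷ p ∷ (cnt neg p) ∷ β ∷ []) (# 3 :* v0) (# 2 :* v1 :+ # 3 :* v2) (# 1 :+ v1 <= # 3 :* v3 :+ # 1 by ≰⇒> h & 3 · v0 :+ v3 <= v1 by Easy.plus≤′ L α≤β α+β≤p) refl
  ... | _ | no h | _ = lin≤ ((cnt plus p) ∷ p ∷ (cnt neg p) ∷ α ∷ β ∷ []) (# 3 :* v0) (# 2 :* v1 :+ # 3 :* v2) (# 1 :+ (# 6 :* v3 :+ # 3 :* v4) <= # 2 :* v1 :+ # 1 by ≰⇒> h & 3 · v0 <= v3 :+ (v3 :+ v4) by Easy.plus≤ L α≤β α+β≤p) refl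
  ... | _ | _ | no h = lin≤ ((cnt plus p) ∷ p ∷ (cnt neg p) ∷ []) (# 3 :* v0) (# 2 :* v1 :+ # 3 :* v2) (# 1 :+ # 3 :* v0 <= # 2 :* v1 :+ # 1 :+ # 3 :* v2 by ≰⇒> h) refl
  ... | yes 3β<p | yes reg | yes big = ⊥-elim (go (Large.double L α≤β 3β<p reg big) stride)
    where
    go : Double → (Σ ℕ λ T → T ≤ p × Σ ℕ λ m → T * lam ≡ β + m * p) → ⊥
    go db (T , T≤p , m , Tλ) with p ≤? tm (Double.y db) + T
    ... | yes cross = Final.refuted p q N α β Y W plus neg L α≤β 3β<p reg big (Large.chain L α≤β 3β<p reg big) db τ T m T≤p Tλ cross lam≢β 2≤α
    -- The link of the double does not cross, so time is reversed; the same link then does, and the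
    -- steps to exclude become ± β again.
    ... | no ¬cross = Final.refuted p q N α β Y W plus neg L α≤β 3β<p reg big (Large.chain L α≤β 3β<p reg big) db
          (reverse Y< W< τ) T′ m′ (m∸n≤m p T) Tλ′ cross′ opp≢β 2≤α
      where
      y = Double.y db
      T′ lam′ m′ : ℕ
      T′ = p ∸ T
      lam′ = p ∸ lam
      -- From (p - T) (p - lam) = p (p - lam - T) + T lam.
      m′ = p + m ∸ (lam + T)
      T+ : T′ + T ≡ p
      T+ = m∸n+n≡m T≤p
      lam+ : lam′ + lam ≡ p
      lam+ = m∸n+n≡m lam≤
      square : T′ * lam′ + (lam + T) * p ≡ β + (p + m) * p
      square = lin≡ (T′ ∷ lam′ ∷ lam ∷ T ∷ p ∷ β ∷ m ∷ []) (v0 :* v1 :+ (v2 :+ v3) :* v4) (v5 :+ (v4 :+ v6) :* v4) (v3 :* v2 ≐ v5 :+ v6 :* v4 by Tλ &ᵉ v0 :* (v1 :+ v2) ≐ v0 :* v4 by cong (T′ *_) lam+ &ᵉ v2 :* v4 ≐ v2 :* (v0 :+ v3) by (sym (cong (lam *_) T+)) &ᵉ v4 :* (v0 :+ v3) ≐ v4 :* v4 by cong (p *_) T+) refl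
      enough : lam + T ≤ p + m
      enough = ≤-pred (*-cancelʳ-< p (lam + T) (suc (p + m)) (lin≤ (lam ∷ T ∷ p ∷ m ∷ T′ ∷ lam′ ∷ β ∷ []) (# 1 :+ ((v0 :+ v1) :* v2)) ((# 1 :+ (v2 :+ v3)) :* v2) (v4 :* v5 :+ (v0 :+ v1) :* v2 == v6 :+ (v2 :+ v3) :* v2 by square & # 1 :+ v6 <= v2 by β<p) refl))
      m+ : m′ + (lam + T) ≡ p + m
      m+ = m∸n+n≡m enough
      Tλ′ : T′ * lam′ ≡ β + m′ * p
      Tλ′ = lin≡ (T′ ∷ lam′ ∷ β ∷ m′ ∷ p ∷ lam ∷ T ∷ m ∷ []) (v0 :* v1) (v2 :+ v3 :* v4) (v0 :* v1 :+ (v5 :+ v6) :* v4 ≐ v2 :+ (v4 :+ v7) :* v4 by square &ᵉ (v4 :+ v7) :* v4 ≐ (v3 :+ (v5 :+ v6)) :* v4 by (sym (cong (_* p) m+))) refl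
      y<p : y < p
      y<p = ≤-trans (s≤s (m≤m+n y β)) (Double.y< db)
      s : ℕ
      s = p ∸ suc (tm y)
      s+ : s + suc (tm y) ≡ p
      s+ = m∸n+n≡m (tm< y y<p)
      cross′ : p ≤ s + T′
      cross′ = lin≤ (p ∷ s ∷ T′ ∷ (tm y) ∷ T ∷ []) v0 (v1 :+ v2) (v0 ==˘ v1 :+ (# 1 :+ v3) by s+ & v0 ==˘ v2 :+ v4 by T+ & # 1 :+ (v3 :+ v4) <= v0 by ≰⇒> ¬cross) refl

-- The differences ±1 in terms of the coordinates

module Values (p q N Q : ℕ) where
  State : ℕ → ℕ → ℕ → Set
  State x y w = x * q + y + w ≡ N ⊎ x * q + y + w ≡ N + p * q ⊎ x * q + y + w ≡ N + 2 * (p * q)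

  -- By Q q + s p = p q + 1 this is the test h ≥ s when y = h p. Phrased through y alone it keeps
  -- its form under the reflection Q ↦ p - Q.
  high : ℕ → Bool
  high y = ⌊ p * q ≤? y + Q * q ⌋

  -- the binary coefficient at (x , y , w) is +1, resp. -1, and its index is at most N
  one⁺ one⁻ : ℕ → ℕ → ℕ → Bool
  one⁺ x y w = (⌊ x <? Q ⌋ ∧ not (high y)) ∧ ⌊ x * q + y + w ≟ N ⌋
  one⁻ x y w = (⌊ Q ≤? x ⌋ ∧ high y) ∧ ⌊ x * q + y + w ≟ N + p * q ⌋

  one⁺-intro : ∀ {x y w} → x < Q → high y ≡ false → x * q + y + w ≡ N → one⁺ x y w ≡ true
  one⁺-intro {x} {y} {w} l h e = ∧-intro (∧-intro (dec-intro {d = x <? Q} l) (not-intro h)) (dec-intro {d = x * q + y + w ≟ N} e)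
  one⁺-elim : ∀ {x y w} → one⁺ x y w ≡ true → x < Q × x * q + y + w ≡ N
  one⁺-elim {x} {y} {w} e = let (a , b) = ∧-true {⌊ x <? Q ⌋ ∧ not (high y)} e in
    dec-true {d = x <? Q} (proj₁ (∧-true {⌊ x <? Q ⌋} a)) , dec-true {d = x * q + y + w ≟ N} b
  one⁻-intro : ∀ {x y w} → Q ≤ x → high y ≡ true → x * q + y + w ≡ N + p * q → one⁻ x y w ≡ true
  one⁻-intro {x} {y} {w} l h e = ∧-intro (∧-intro (dec-intro {d = Q ≤? x} l) h) (dec-intro {d = x * q + y + w ≟ N + p * q} e)
  one⁻-elim : ∀ {x y w} → one⁻ x y w ≡ true → Q ≤ x × x * q + y + w ≡ N + p * q
  one⁻-elim {x} {y} {w} e = let (a , b) = ∧-true {⌊ Q ≤? x ⌋ ∧ high y} e in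
    dec-true {d = Q ≤? x} (proj₁ (∧-true {⌊ Q ≤? x ⌋} a)) , dec-true {d = x * q + y + w ≟ N + p * q} b

  -- Passing from v to v′ keeps y, so by `high y` only one sign can occur at either end; the
  -- difference is therefore never ± 2.
  gain loss : ℕ → ℕ → ℕ → ℕ → ℕ → Bool
  gain x x′ y w w′ = if high y then one⁻ x′ y w′ ∧ not (one⁻ x y w) else one⁺ x y w ∧ not (one⁺ x′ y w′)
  loss x x′ y w w′ = if high y then one⁻ x y w ∧ not (one⁻ x′ y w′) else one⁺ x′ y w′ ∧ not (one⁺ x y w)

  if-true : ∀ {b u v : Bool} → b ≡ true → (if b then u else v) ≡ u
  if-true refl = refl
  if-false : ∀ {b u v : Bool} → b ≡ false → (if b then u else v) ≡ v
  if-false refl = refl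

  module Cell (R : ℕ) (Q+R≤p : Q + R ≤ p) (R<p : R < p) (q-pos : 0 < q) (N< : N < p * q)
    {x x′ y w w′ : ℕ} (x<p : x < p) (x′<p : x′ < p) (y< : y < p * q) (w< : w < p * q) (w′< : w′ < p * q)
    (st : State x y w) (st′ : State x′ y w′) (xs : x′ + R ≡ x ⊎ x′ + R ≡ x + p) (ws : Mod (p * q) w′ (w + R * q)) where

    Top : Set
    Top = p * q ≤ y + Q * q × p * q ≤ w + R * q

    hi : high y ≡ true → p * q ≤ y + Q * q
    hi = dec-true {d = p * q ≤? y + Q * q}
    lo : high y ≡ false → y + Q * q < p * q
    lo e = ≰⇒> (dec-false {d = p * q ≤? y + Q * q} e)

    -- If x does not wrap, the changes - R q of x q and + R q of w cancel, and the wrap count of the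
    -- sum drops by one exactly when w wraps. In `far` the wrap of x raises the count by one.
    near : x′ + R ≡ x → (w′ ≡ w + R * q × x′ * q + y + w′ ≡ x * q + y + w) ⊎ (p * q ≤ w + R * q × x′ * q + y + w′ + p * q ≡ x * q + y + w)
    near = near′ ws
      where
      near′ : Mod (p * q) w′ (w + R * q) → x′ + R ≡ x → (w′ ≡ w + R * q × x′ * q + y + w′ ≡ x * q + y + w) ⊎ (p * q ≤ w + R * q × x′ * q + y + w′ + p * q ≡ x * q + y + w)
      near′ (inj₁ e) refl = inj₁ (e , (lin≡ (x′ ∷ q ∷ y ∷ w′ ∷ R ∷ w ∷ []) (v0 :* v1 :+ v2 :+ v3) ((v0 :+ v4) :* v1 :+ v2 :+ v5) (v3 ≐ v5 :+ v4 :* v1 by e) refl))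
      near′ (inj₂ e) refl = inj₂ ((lin≤ (p ∷ q ∷ w ∷ R ∷ w′ ∷ []) (v0 :* v1) (v2 :+ v3 :* v1) (v4 :+ v0 :* v1 == v2 :+ v3 :* v1 by e) refl) , (lin≡ (x′ ∷ q ∷ y ∷ w′ ∷ p ∷ R ∷ w ∷ []) (v0 :* v1 :+ v2 :+ v3 :+ v4 :* v1) ((v0 :+ v5) :* v1 :+ v2 :+ v6) (v3 :+ v4 :* v1 ≐ v6 :+ v5 :* v1 by e) refl))

    far : x′ + R ≡ x + p → (w′ ≡ w + R * q × x′ * q + y + w′ ≡ x * q + y + w + p * q) ⊎ (p * q ≤ w + R * q × x′ * q + y + w′ ≡ x * q + y + w)
    far = far′ ws
      where
      far′ : Mod (p * q) w′ (w + R * q) → x′ + R ≡ x + p → (w′ ≡ w + R * q × x′ * q + y + w′ ≡ x * q + y + w + p * q) ⊎ (p * q ≤ w + R * q × x′ * q + y + w′ ≡ x * q + y + w)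
      far′ (inj₁ e) r = inj₁ (e , (lin≡ (x′ ∷ q ∷ y ∷ w′ ∷ x ∷ w ∷ p ∷ R ∷ []) (v0 :* v1 :+ v2 :+ v3) (v4 :* v1 :+ v2 :+ v5 :+ v6 :* v1) (v3 ≐ v5 :+ v7 :* v1 by e &ᵉ (v0 :+ v7) :* v1 ≐ (v4 :+ v6) :* v1 by cong (_* q) r) refl))
      far′ (inj₂ e) r = inj₂ ((lin≤ (p ∷ q ∷ w ∷ R ∷ w′ ∷ []) (v0 :* v1) (v2 :+ v3 :* v1) (v4 :+ v0 :* v1 == v2 :+ v3 :* v1 by e) refl) , (lin≡ (x′ ∷ q ∷ y ∷ w′ ∷ x ∷ w ∷ p ∷ R ∷ []) (v0 :* v1 :+ v2 :+ v3) (v4 :* v1 :+ v2 :+ v5) (v3 :+ v6 :* v1 ≐ v5 :+ v7 :* v1 by e &ᵉ (v0 :+ v7) :* v1 ≐ (v4 :+ v6) :* v1 by cong (_* q) r) refl))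

    -- The first two hypotheses already give x q + y ≥ p q > N.
    edge : Q ≤ x → high y ≡ true → x * q + y + w ≡ N → ⊥
    edge l h s = lin⊥ (Q ∷ q ∷ x ∷ p ∷ y ∷ w ∷ N ∷ []) (v0 :* v1 <= v2 :* v1 by scaleS q l & v3 :* v1 <= v4 :+ v0 :* v1 by hi h & v2 :* v1 :+ v4 :+ v5 == v6 by s & # 1 :+ v6 <= v3 :* v1 by N<) refl

    -- If y is not high, a +1 at v with x ≥ R would persist at x - R, so x < R. If y is high, a -1
    -- at v′ can be absent at v only because w wraps or because x lies below Q.
    gain⁻ : gain x x′ y w w′ ≡ true →
      (x < Q × x < R × (x * q + y + w ≡ N ⊎ (x * q + y + w ≡ N + p * q × Top))) ⊎ (Q + R ≤ x × x * q + y + w ≡ N + 2 * (p * q) × Top)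
    gain⁻ g with bool? (high y)
    ... | inj₂ h = inj₁ (proj₁ a , x<R xs , inj₁ (proj₂ a))
      where
      g′ = ∧-true {one⁺ x y w} (trans (sym (if-false h)) g)
      a = one⁺-elim (proj₁ g′)
      n : one⁺ x′ y w′ ≡ false
      n = not-true (proj₂ g′)
      x<R : x′ + R ≡ x ⊎ x′ + R ≡ x + p → x < R
      x<R (inj₂ r) = lin≤ (x ∷ R ∷ p ∷ x′ ∷ []) (# 1 :+ v0) v1 (v0 :+ v2 ==˘ v3 :+ v1 by r & # 1 :+ v3 <= v2 by x′<p) refl
      x<R (inj₁ r) with near r
      ... | inj₁ (_ , e) = T≢F (one⁺-intro (lin≤ (x′ ∷ Q ∷ R ∷ x ∷ []) (# 1 :+ v0) v1 (v0 :+ v2 == v3 by r & # 1 :+ v3 <= v1 by proj₁ a) refl) h (trans e (proj₂ a))) n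
      ... | inj₂ (_ , e) = lin⊥ (x′ ∷ q ∷ y ∷ w′ ∷ p ∷ x ∷ w ∷ N ∷ []) (v0 :* v1 :+ v2 :+ v3 :+ v4 :* v1 == v5 :* v1 :+ v2 :+ v6 by e & v5 :* v1 :+ v2 :+ v6 == v7 by proj₂ a & # 1 :+ v7 <= v4 :* v1 by N<) refl
    ... | inj₁ h = go xs
      where
      g′ = ∧-true {one⁻ x′ y w′} (trans (sym (if-true h)) g)
      a = one⁻-elim (proj₁ g′)
      n : one⁻ x y w ≡ false
      n = not-true (proj₂ g′)
      s′ : x′ * q + y + w′ ≡ N + p * q
      s′ = proj₂ a
      go : x′ + R ≡ x ⊎ x′ + R ≡ x + p → (x < Q × x < R × (x * q + y + w ≡ N ⊎ (x * q + y + w ≡ N + p * q × Top))) ⊎ (Q + R ≤ x × x * q + y + w ≡ N + 2 * (p * q) × Top)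
      go (inj₁ r) with near r
      ... | inj₁ (_ , e) = T≢F (one⁻-intro (lin≤ (Q ∷ x ∷ x′ ∷ R ∷ []) v0 v1 (v2 :+ v3 == v1 by r & v0 <= v2 by proj₁ a) refl) h (trans (sym e) s′)) n
      ... | inj₂ (t , e) = inj₂ ((lin≤ (Q ∷ R ∷ x ∷ x′ ∷ []) (v0 :+ v1) v2 (v3 :+ v1 == v2 by r & v0 <= v3 by proj₁ a) refl) , (lin≡ (x ∷ q ∷ y ∷ w ∷ N ∷ p ∷ x′ ∷ w′ ∷ []) (v0 :* v1 :+ v2 :+ v3) (v4 :+ # 2 :* (v5 :* v1)) (v0 :* v1 :+ v2 :+ v3 ≐ v6 :* v1 :+ v2 :+ v7 :+ v5 :* v1 by (sym e) &ᵉ v6 :* v1 :+ v2 :+ v7 ≐ v4 :+ v5 :* v1 by s′) refl) , hi h , t)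
      go (inj₂ r) with far r
      ... | inj₁ (_ , e) = inj₁ (≰⇒> (λ l → edge l h s) , (lin≤ (x ∷ R ∷ p ∷ x′ ∷ []) (# 1 :+ v0) v1 (v0 :+ v2 ==˘ v3 :+ v1 by r & # 1 :+ v3 <= v2 by x′<p) refl) , inj₁ s)
        where
        s : x * q + y + w ≡ N
        s = lin≡ (x ∷ q ∷ y ∷ w ∷ N ∷ p ∷ x′ ∷ w′ ∷ []) (v0 :* v1 :+ v2 :+ v3) v4 (v0 :* v1 :+ v2 :+ v3 :+ v5 :* v1 ≐ v6 :* v1 :+ v2 :+ v7 by (sym e) &ᵉ v6 :* v1 :+ v2 :+ v7 ≐ v4 :+ v5 :* v1 by s′) refl
      ... | inj₂ (t , e) = inj₁ (≰⇒> (λ l → T≢F (one⁻-intro l h (trans (sym e) s′)) n) , (lin≤ (x ∷ R ∷ p ∷ x′ ∷ []) (# 1 :+ v0) v1 (v0 :+ v2 ==˘ v3 :+ v1 by r & # 1 :+ v3 <= v2 by x′<p) refl) , inj₂ (trans (sym e) s′ , hi h , t))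

    loss⁻ : loss x x′ y w w′ ≡ true → x < Q + R × (Q ≤ x ⊎ R ≤ x)
    loss⁻ g with bool? (high y)
    ... | inj₂ h = go xs
      where
      g′ = ∧-true {one⁺ x′ y w′} (trans (sym (if-false h)) g)
      a = one⁺-elim (proj₁ g′)
      go : x′ + R ≡ x ⊎ x′ + R ≡ x + p → x < Q + R × (Q ≤ x ⊎ R ≤ x)
      go (inj₁ r) = (lin≤ (x ∷ Q ∷ R ∷ x′ ∷ []) (# 1 :+ v0) (v1 :+ v2) (v0 ==˘ v3 :+ v2 by r & # 1 :+ v3 <= v1 by proj₁ a) refl) , inj₂ (lin≤ (R ∷ x ∷ x′ ∷ []) v0 v1 (v2 :+ v0 == v1 by r) refl)
      go (inj₂ r) = lin⊥ (x ∷ p ∷ x′ ∷ R ∷ Q ∷ []) (v0 :+ v1 ==˘ v2 :+ v3 by r & # 1 :+ v2 <= v4 by proj₁ a & v4 :+ v3 <= v1 by Q+R≤p) refl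
    ... | inj₁ h = ≰⇒> big , inj₁ (proj₁ a)
      where
      g′ = ∧-true {one⁻ x y w} (trans (sym (if-true h)) g)
      a = one⁻-elim (proj₁ g′)
      n : one⁻ x′ y w′ ≡ false
      n = not-true (proj₂ g′)
      big : Q + R ≤ x → ⊥
      big l = go xs
        where
        go : x′ + R ≡ x ⊎ x′ + R ≡ x + p → ⊥
        go (inj₂ r) = lin⊥ (x ∷ p ∷ x′ ∷ R ∷ Q ∷ []) (v0 :+ v1 ==˘ v2 :+ v3 by r & # 1 :+ v2 <= v1 by x′<p & v4 :+ v3 <= v0 by l) refl
        go (inj₁ r) with near r
        ... | inj₁ (_ , e) = T≢F (one⁻-intro (lin≤ (Q ∷ x′ ∷ x ∷ R ∷ []) v0 v1 (v2 ==˘ v1 :+ v3 by r & v0 :+ v3 <= v2 by l) refl) h (trans e (proj₂ a))) n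
        ... | inj₂ (t , e) = lin⊥ (Q ∷ R ∷ q ∷ x ∷ p ∷ y ∷ w ∷ N ∷ []) ((v0 :+ v1) :* v2 <= v3 :* v2 by scaleS q l & v4 :* v2 <= v5 :+ v0 :* v2 by hi h & v4 :* v2 <= v6 :+ v1 :* v2 by t & v3 :* v2 :+ v5 :+ v6 == v7 :+ v4 :* v2 by proj₂ a & # 1 :+ v7 <= v4 :* v2 by N<) refl

    -- In this block x ≥ Q while x′ = x - R < Q, so a +1 at v′ or a -1 at v is always a loss. Its
    -- absence leaves only the two states listed.
    ¬loss⁻ : Q ≤ x → R ≤ x → x < Q + R → loss x x′ y w w′ ≡ false →
      (x * q + y + w ≡ N + p * q × y + Q * q < p * q × w + R * q < p * q) ⊎ x * q + y + w ≡ N + 2 * (p * q)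
    ¬loss⁻ lQ lR u g = cases st
     where
     cases : State x y w → (x * q + y + w ≡ N + p * q × y + Q * q < p * q × w + R * q < p * q) ⊎ x * q + y + w ≡ N + 2 * (p * q)
     cases (inj₂ (inj₂ s)) = inj₂ s
     cases (inj₁ s) = ⊥-elim (zero-case (bool? (high y)))
      where
      zero-case : high y ≡ true ⊎ high y ≡ false → ⊥
      zero-case (inj₁ h) = edge lQ h s
      zero-case (inj₂ h) = go xs
        where
        go : x′ + R ≡ x ⊎ x′ + R ≡ x + p → ⊥
        go (inj₂ r) = lin⊥ (x ∷ p ∷ x′ ∷ R ∷ []) (v0 :+ v1 ==˘ v2 :+ v3 by r & # 1 :+ v2 <= v1 by x′<p & v3 <= v0 by lR) refl
        go (inj₁ r) with near r
        ... | inj₂ (_ , e) = lin⊥ (x′ ∷ q ∷ y ∷ w′ ∷ p ∷ x ∷ w ∷ N ∷ []) (v0 :* v1 :+ v2 :+ v3 :+ v4 :* v1 == v5 :* v1 :+ v2 :+ v6 by e & v5 :* v1 :+ v2 :+ v6 == v7 by s & # 1 :+ v7 <= v4 :* v1 by N<) refl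
        ... | inj₁ (_ , e) = T≢F (trans (if-false h)
            (∧-intro (one⁺-intro (lin≤ (x′ ∷ Q ∷ R ∷ x ∷ []) (# 1 :+ v0) v1 (v0 :+ v2 == v3 by r & # 1 :+ v3 <= v1 :+ v2 by u) refl) h (trans e s)) (not-intro no⁺))) g
          where
          no⁺ : one⁺ x y w ≡ false
          no⁺ with bool? (one⁺ x y w)
          ... | inj₂ k = k
          ... | inj₁ k = ⊥-elim (<⇒≱ (proj₁ (one⁺-elim k)) lQ)
     cases (inj₂ (inj₁ s)) = inj₁ (s , one-case (bool? (high y)))
      where
      x′<Q : x′ + R ≡ x ⊎ x′ + R ≡ x + p → x′ < Q
      x′<Q (inj₁ r) = lin≤ (x′ ∷ Q ∷ R ∷ x ∷ []) (# 1 :+ v0) v1 (v0 :+ v2 == v3 by r & # 1 :+ v3 <= v1 :+ v2 by u) refl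
      x′<Q (inj₂ r) = lin⊥ (x ∷ p ∷ x′ ∷ R ∷ []) (v0 :+ v1 ==˘ v2 :+ v3 by r & # 1 :+ v2 <= v1 by x′<p & v3 <= v0 by lR) refl
      one-case : high y ≡ true ⊎ high y ≡ false → y + Q * q < p * q × w + R * q < p * q
      one-case (inj₁ h) = T≢F (trans (if-true h)
          (∧-intro (one⁻-intro lQ h s) (not-intro no⁻))) g
        where
        no⁻ : one⁻ x′ y w′ ≡ false
        no⁻ with bool? (one⁻ x′ y w′)
        ... | inj₂ k = k
        ... | inj₁ k = ⊥-elim (<⇒≱ (x′<Q xs) (proj₁ (one⁻-elim k)))
      one-case (inj₂ h) = lo h , go xs
        where
        go : x′ + R ≡ x ⊎ x′ + R ≡ x + p → w + R * q < p * q
        go (inj₂ r) = lin⊥ (x ∷ p ∷ x′ ∷ R ∷ []) (v0 :+ v1 ==˘ v2 :+ v3 by r & # 1 :+ v2 <= v1 by x′<p & v3 <= v0 by lR) refl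
        go (inj₁ r) with near r
        ... | inj₁ (e , _) = subst (_< p * q) e w′<
        ... | inj₂ (_ , e) = T≢F (trans (if-false h)
            (∧-intro (one⁺-intro (x′<Q xs) h (lin≡ (x′ ∷ q ∷ y ∷ w′ ∷ N ∷ p ∷ x ∷ w ∷ []) (v0 :* v1 :+ v2 :+ v3) v4 (v0 :* v1 :+ v2 :+ v3 :+ v5 :* v1 ≐ v6 :* v1 :+ v2 :+ v7 by e &ᵉ v6 :* v1 :+ v2 :+ v7 ≐ v4 :+ v5 :* v1 by s) refl)) (not-intro no⁺))) g
          where
          no⁺ : one⁺ x y w ≡ false
          no⁺ with bool? (one⁺ x y w)
          ... | inj₂ k = k
          ... | inj₁ k = ⊥-elim (<⇒≱ (proj₁ (one⁺-elim k)) lQ)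

-- The coefficients along an orbit

open import Data.Integer using (ℤ; +_)

open import Algebra.Properties.CommutativeSemigroup ℤP.+-commutativeSemigroup using () renaming (interchange to ℤ-interchange)

quot-rem : ∀ a M .{{_ : NonZero M}} → a % M + a / M * M ≡ a
quot-rem a M = sym (m≡m%n+[m/n]*n a M)

-- The congruence behind every coordinate shift: r and r′ reduce (v + o) T and (u + o) T modulo M,
-- where v ≡ u + d modulo c M and A ≡ d T modulo M. All quotients are explicit, so it is pure linear
-- arithmetic.
res-shift : ∀ {M c T o v u d A r r′} k k′ j l a b → r + k * M ≡ (v + o) * T → r′ + k′ * M ≡ (u + o) * T →
  v + j * (c * M) ≡ u + d + l * (c * M) → A + a * M ≡ d * T + b * M →
  r + (k + j * c * T + b) * M ≡ r′ + A + (k′ + a + l * c * T) * M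
res-shift {M} {c} {T} {o} {v} {u} {d} {A} {r} {r′} k k′ j l a b e e′ h g =
  (lin≡ (r ∷ k ∷ j ∷ c ∷ T ∷ b ∷ M ∷ r′ ∷ A ∷ k′ ∷ a ∷ l ∷ v ∷ o ∷ u ∷ d ∷ []) (v0 :+ (v1 :+ v2 :* v3 :* v4 :+ v5) :* v6) (v7 :+ v8 :+ (v9 :+ v10 :+ v11 :* v3 :* v4) :* v6) (v0 :+ v1 :* v6 ≐ (v12 :+ v13) :* v4 by e &ᵉ (v14 :+ v13) :* v4 ≐ v7 :+ v9 :* v6 by (sym e′) &ᵉ (v12 :+ v2 :* (v3 :* v6)) :* v4 ≐ (v14 :+ v15 :+ v11 :* (v3 :* v6)) :* v4 by cong (_* T) h &ᵉ v15 :* v4 :+ v5 :* v6 ≐ v8 :+ v10 :* v6 by (sym g)) refl)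

ι : Bool → ℤ
ι b = if b then + 1 else + 0

sum< : ℕ → (ℕ → ℤ) → ℤ
sum< zero f = + 0
sum< (suc n) f = sum< n f ℤ.+ f n

sum<-cong : ∀ {f g} n → (∀ x → x < n → f x ≡ g x) → sum< n f ≡ sum< n g
sum<-cong zero h = refl
sum<-cong (suc n) h = cong₂ ℤ._+_ (sum<-cong n (λ x l → h x (m≤n⇒m≤1+n l))) (h n ≤-refl)

cutoff : (ℕ → ℤ) → ℕ → ℕ → ℤ
cutoff f N v = if ⌊ v ≤? N ⌋ then f v else + 0

terms : (ℕ → ℤ) → ℕ → (ℕ → ℕ) → (ℕ → ℕ) → ℕ → ℤ
terms f N a b t = cutoff f N (a t) ℤ.- cutoff f N (b t)

sum<-cnt : ∀ f g n → sum< n (λ t → ι (f t) ℤ.- ι (g t)) ≡ + cnt f n ℤ.- + cnt g n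
sum<-cnt f g zero = refl
sum<-cnt f g (suc n) = trans (cong (ℤ._+ (ι (f n) ℤ.- ι (g n))) (sum<-cnt f g n)) (go (f n) (g n))
  where
  open ≡-Reasoning
  rearrange : ∀ a b x y → (x ℤ.- y) ℤ.+ (a ℤ.- b) ≡ (a ℤ.+ x) ℤ.- (b ℤ.+ y)
  rearrange a b x y = begin
    (x ℤ.- y) ℤ.+ (a ℤ.- b) ≡⟨ ℤP.+-comm (x ℤ.- y) (a ℤ.- b) ⟩
    (a ℤ.- b) ℤ.+ (x ℤ.- y) ≡⟨ ℤ-interchange a (ℤ.- b) x (ℤ.- y) ⟩
    (a ℤ.+ x) ℤ.+ (ℤ.- b ℤ.- y) ≡⟨ cong (λ z → (a ℤ.+ x) ℤ.+ z) (sym (ℤP.neg-distrib-+ b y)) ⟩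
    (a ℤ.+ x) ℤ.- (b ℤ.+ y) ∎
  go : ∀ b c → (+ cnt f n ℤ.- + cnt g n) ℤ.+ (ι b ℤ.- ι c) ≡ + ((if b then 1 else 0) + cnt f n) ℤ.- + ((if c then 1 else 0) + cnt g n)
  go true true = rearrange (+ 1) (+ 1) (+ cnt f n) (+ cnt g n)
  go true false = rearrange (+ 1) (+ 0) (+ cnt f n) (+ cnt g n)
  go false true = rearrange (+ 0) (+ 1) (+ cnt f n) (+ cnt g n)
  go false false = rearrange (+ 0) (+ 0) (+ cnt f n) (+ cnt g n)

cnt-reindex : ∀ (f g : ℕ → Bool) (σ τ : ℕ → ℕ) n → (∀ x → x < n → σ x < n) → (∀ x → x < n → τ x < n) →
  (∀ x → x < n → f x ≡ g (σ x)) → (∀ x → x < n → σ (τ x) ≡ x) → (∀ x → x < n → τ (σ x) ≡ x) → cnt f n ≡ cnt g n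
cnt-reindex f g σ τ n σ< τ< fg στ τσ = ≤-antisym
  (cnt-inj {f} {g} (λ x y → y ≡ σ x) n n (λ x l e → σ x , σ< x l , trans (sym (fg x l)) e , refl)
    λ x x′ y l l′ _ _ _ e e′ → trans (sym (τσ x l)) (trans (cong τ (trans (sym e) e′)) (τσ x′ l′)))
  (cnt-inj {g} {f} (λ x y → y ≡ τ x) n n (λ x l e → τ x , τ< x l , trans (fg _ (τ< x l)) (trans (cong g (στ x l)) e) , refl)
    λ x x′ y l l′ _ _ _ e e′ → trans (sym (στ x l)) (trans (cong σ (trans (sym e) e′)) (στ x′ l′)))

drop-mod : ∀ {M z u} k l → z < M → z + k * M ≡ u + l * M → Σ ℕ λ j → z + j * M ≡ u
drop-mod {M} {z} {u} k l z<M e = k ∸ l , (lin≡ (z ∷ (k ∸ l) ∷ M ∷ u ∷ k ∷ l ∷ []) (v0 :+ v1 :* v2) v3 (v0 :+ v4 :* v2 ≐ v3 :+ v5 :* v2 by e &ᵉ (v1 :+ v5) :* v2 ≐ v4 :* v2 by cong (_* M) (m∸n+n≡m l≤k)) refl)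
  where
  l≤k : l ≤ k
  l≤k = by-contra λ h → (lin⊥ (k ∷ M ∷ l ∷ u ∷ z ∷ []) ((# 1 :+ v0) :* v1 <= v2 :* v1 by scaleS M h & v3 :+ v2 :* v1 ==˘ v4 :+ v0 :* v1 by e & # 1 :+ v4 <= v1 by z<M) refl)

∧-absorb : ∀ {a b} → (a ≡ true → b ≡ true) → a ∧ b ≡ a
∧-absorb {true} h = h refl
∧-absorb {false} h = refl
∧-vanish : ∀ {a b} → (a ≡ true → b ≡ false) → a ∧ b ≡ false
∧-vanish {true} h = h refl
∧-vanish {false} h = refl
dec-no : ∀ {A : Set} {d : Dec A} → ¬ A → ⌊ d ⌋ ≡ false
dec-no {d = yes a} n = ⊥-elim (n a)
dec-no {d = no _} n = refl

Bounds : ℕ → ℕ → ℕ → ℕ → ℕ → Set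
Bounds p α β P M = P + β ≤ p × P ≤ α + (α + β) × M ≤ β × 3 * P ≤ 2 * p + 3 * M

layout-bounds : ∀ {p q N α β Y W plus minus} → Residues.Layout p q N α β Y W plus minus → α ≤ β → 1 ≤ α → α + β ≤ p →
  (τ : Timing p (p * q) Y W) → ∀ h → p ≡ 2 * h + 1 → (2 ≤ α → Timing.lam τ ≢ β × p ∸ Timing.lam τ ≢ β) → Bounds p α β (cnt plus p) (cnt minus p)
layout-bounds {p} {q} {N} {α} {β} {Y} {W} {plus} {minus} L α≤β 1≤α α+β≤p τ h odd clash = a , b , Easy.neg≤β L α≤β α+β≤p , c
  where
  open Residues p q N α β Y W plus minus
  P M : ℕ
  P = cnt plus p
  M = cnt minus p
  a : P + β ≤ p
  a = Easy.plus≤′ L α≤β α+β≤p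
  b : P ≤ α + (α + β)
  b = Easy.plus≤ L α≤β α+β≤p
  c : 3 * P ≤ 2 * p + 3 * M
  c with 2 ≤? α | p ≤? 3 * β
  ... | yes k | _ = Beiter.bound L α≤β k α+β≤p τ (proj₁ (clash k)) (proj₂ (clash k))
  ... | no n | yes r = lin≤ (P ∷ p ∷ M ∷ β ∷ []) (# 3 :* v0) (# 2 :* v1 :+ # 3 :* v2) (3 · v0 :+ v3 <= v1 by a & v1 <= # 3 :* v3 by r) refl
  -- For α = 1 the step may be ± β, so this case is counted directly: 3 P ≤ 3 (2 + β) ≤ p + 5, and p
  -- ≥ 5.
  ... | no n | no r = lin≤ (P ∷ p ∷ M ∷ α ∷ β ∷ h ∷ []) (# 3 :* v0) (# 2 :* v1 :+ # 3 :* v2) (3 · v0 <= v3 :+ (v3 :+ v4) by b & 6 · # 1 :+ v3 <= # 2 by ≰⇒> n & # 1 :+ # 3 :* v4 <= v1 by ≰⇒> r & # 2 :* v5 :+ # 1 ==˘ v1 by odd & 2 · # 2 <= v5 by 2≤h) refl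
    where
    2≤h : 2 ≤ h
    2≤h = by-contra λ l → (lin⊥ (β ∷ p ∷ h ∷ α ∷ []) (# 1 :+ # 3 :* v0 <= v1 by ≰⇒> r & v1 == # 2 :* v2 :+ # 1 by odd & 3 · v3 <= v0 by α≤β & 3 · # 1 <= v3 by 1≤α & 2 · # 1 :+ v2 <= # 2 by l) refl)

-- The offset `o` and its correction `δ` are 0 and 0, or p q - 1 and 1; the second choice realises
-- the reflection Q ↦ p - Q.
module Coordinates (p q : ℕ) {{_ : NonZero p}} {{_ : NonZero q}} (Q s o δ : ℕ) where
  xc hc yc : ℕ → ℕ
  xc v = ((v + o) * Q) % p
  hc v = ((v + o) * s) % q
  yc v = hc v * p + δ
  residue : ∀ {e} → Q * q + s * p ≡ p * q + 1 → o + δ ≡ e * (p * q) → ∀ v →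
    v + (v + o + e) * (p * q) ≡ xc v * q + yc v + ((v + o) * Q / p + (v + o) * s / q) * (p * q)
  residue {e} bez shift v = lin≡ (v ∷ o ∷ e ∷ p ∷ q ∷ (xc v) ∷ (hc v) ∷ δ ∷ a ∷ b ∷ Q ∷ s ∷ []) (v0 :+ (v0 :+ v1 :+ v2) :* (v3 :* v4)) (v5 :* v4 :+ (v6 :* v3 :+ v7) :+ (v8 :+ v9) :* (v3 :* v4)) ((v0 :+ v1) :* v10 :* v4 ≐ (v5 :+ v8 :* v3) :* v4 by (sym (cong (_* q) (quot-rem ((v + o) * Q) p))) &ᵉ (v0 :+ v1) :* v11 :* v3 ≐ (v6 :+ v9 :* v4) :* v3 by (sym (cong (_* p) (quot-rem ((v + o) * s) q))) &ᵉ (v0 :+ v1) :* (v3 :* v4 :+ # 1) ≐ (v0 :+ v1) :* (v10 :* v4 :+ v11 :* v3) by (sym (cong ((v + o) *_) bez)) &ᵉ v2 :* (v3 :* v4) ≐ v1 :+ v7 by (sym shift)) refl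
    where
    a = (v + o) * Q / p
    b = (v + o) * s / q

  -- val is ± the coefficient sequence of the binary polynomial, on the residues v ≡ x q + y modulo p q
  record Chart (e K : ℕ) (val : ℕ → ℤ) : Set where
    field
      δ<p : δ < p
      shift : o + δ ≡ e * (p * q)
      val≡ : ∀ v → v < p * q → val v ≡ ι (⌊ xc v <? K ⌋ ∧ not (Values.high p q 0 K (yc v))) ℤ.- ι (⌊ K ≤? xc v ⌋ ∧ Values.high p q 0 K (yc v))

-- `K` is Q or its reflection and `R°` is p - R. The residue v moves by `g` per unit of time, and
-- the partner of v is v + R° q, whose first coordinate is lower by R modulo p.
module Orbits (p q : ℕ) {{_ : NonZero p}} {{_ : NonZero q}} {{_ : NonZero (p * q)}} (Q s : ℕ) (bez : Q * q + s * p ≡ p * q + 1)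
  {o δ e K : ℕ} {val : ℕ → ℤ} (ch : Coordinates.Chart p q Q s o δ e K val)
  (g v₀ μ κ : ℕ) (inv : μ * (g * Q) ≡ 1 + κ * p) (R R° : ℕ) (R+R° : R + R° ≡ p) (0<R° : 0 < R°) (K+R≤p : K + R ≤ p) (N : ℕ) (N< : N < p * q) where
  open Coordinates p q Q s o δ
  open Chart ch
  open Values p q N K
  C : ℕ
  C = p * q

  0<q : 0 < q
  0<q = >-nonZero⁻¹ q
  0<p : 0 < p
  0<p = >-nonZero⁻¹ p

  x< : ∀ v → xc v < p
  x< v = m%n<n _ p
  y< : ∀ v → yc v < C
  y< v = lin≤ ((hc v) ∷ p ∷ δ ∷ q ∷ []) (# 1 :+ (v0 :* v1 :+ v2)) (v1 :* v3) ((# 1 :+ v0) :* v1 <= v3 :* v1 by scaleS p (m%n<n ((v + o) * s) q) & # 1 :+ v2 <= v1 by δ<p) refl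

  chart : ∀ {v} → v < C → Mod C v (xc v * q + yc v)
  chart {v} v<C = mod-lift (v + o + e) ((v + o) * Q / p + (v + o) * s / q)
    v<C (lin≤ ((xc v) ∷ q ∷ (yc v) ∷ p ∷ []) (# 1 :+ (v0 :* v1 :+ v2)) (# 2 :* (v3 :* v1)) ((# 1 :+ v0) :* v1 <= v3 :* v1 by scaleS q (x< v) & # 1 :+ v2 <= v3 :* v1 by y< v & # 1 :+ # 0 <= v1 by 0<q) refl) (residue bez shift v)

  cut : ℕ → ℤ
  cut = cutoff val N

  -- N - v modulo p q; the cutoff v ≤ N holds exactly when `wc v` + v does not wrap.
  wc : ℕ → ℕ
  wc v = (N + (C ∸ v)) % C
  w< : ∀ v → wc v < C
  w< v = m%n<n _ C

  wq : ℕ → ℕ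
  wq v = (N + (C ∸ v)) / C
  wv : ∀ {v} → v < C → wc v + v + wq v * C ≡ N + C
  wv {v} v<C = lin≡ ((wc v) ∷ v ∷ (wq v) ∷ C ∷ N ∷ (C ∸ v) ∷ []) (v0 :+ v1 :+ v2 :* v3) (v4 :+ v3) (v0 :+ v2 :* v3 ≐ v4 :+ v5 by quot-rem (N + (C ∸ v)) C &ᵉ v5 :+ v1 ≐ v3 by m∸n+n≡m (<⇒≤ v<C)) refl

  index : ∀ {v} → v < C → Mod C N (wc v + v)
  index {v} v<C = mod-lift 1 (wq v) N< (lin≤ ((wc v) ∷ v ∷ C ∷ []) (# 1 :+ (v0 :+ v1)) (# 2 :* v2) (# 1 :+ v0 <= v2 by w< v & # 1 :+ v1 <= v2 by v<C) refl)
    (lin≡ (N ∷ C ∷ (wc v) ∷ v ∷ (wq v) ∷ []) (v0 :+ # 1 :* v1) (v2 :+ v3 :+ v4 :* v1) (v0 :+ v1 ≐ v2 :+ v3 :+ v4 :* v1 by (sym (wv v<C))) refl)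

  state : ∀ {v} → v < C → State (xc v) (yc v) (wc v)
  state {v} v<C = go (index v<C) (chart v<C)
    where
    go : Mod C N (wc v + v) → Mod C v (xc v * q + yc v) → State (xc v) (yc v) (wc v)
    go (inj₁ i) (inj₁ c) = inj₁ (lin≡ ((xc v) ∷ q ∷ (yc v) ∷ (wc v) ∷ N ∷ v ∷ []) (v0 :* v1 :+ v2 :+ v3) v4 (v3 :+ v5 ≐ v4 by (sym i) &ᵉ v0 :* v1 :+ v2 ≐ v5 by (sym c)) refl)
    go (inj₁ i) (inj₂ c) = inj₂ (inj₁ (lin≡ ((xc v) ∷ q ∷ (yc v) ∷ (wc v) ∷ N ∷ p ∷ v ∷ []) (v0 :* v1 :+ v2 :+ v3) (v4 :+ v5 :* v1) (v3 :+ v6 ≐ v4 by (sym i) &ᵉ v0 :* v1 :+ v2 ≐ v6 :+ v5 :* v1 by (sym c)) refl))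
    go (inj₂ i) (inj₁ c) = inj₂ (inj₁ (lin≡ ((xc v) ∷ q ∷ (yc v) ∷ (wc v) ∷ N ∷ p ∷ v ∷ []) (v0 :* v1 :+ v2 :+ v3) (v4 :+ v5 :* v1) (v3 :+ v6 ≐ v4 :+ v5 :* v1 by (sym i) &ᵉ v0 :* v1 :+ v2 ≐ v6 by (sym c)) refl))
    go (inj₂ i) (inj₂ c) = inj₂ (inj₂ (lin≡ ((xc v) ∷ q ∷ (yc v) ∷ (wc v) ∷ N ∷ p ∷ v ∷ []) (v0 :* v1 :+ v2 :+ v3) (v4 :+ # 2 :* (v5 :* v1)) (v3 :+ v6 ≐ v4 :+ v5 :* v1 by (sym i) &ᵉ v0 :* v1 :+ v2 ≐ v6 :+ v5 :* v1 by (sym c)) refl))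

  pos neg : ℕ → Bool
  pos v = one⁺ (xc v) (yc v) (wc v)
  neg v = one⁻ (xc v) (yc v) (wc v)

  -- A coefficient +1 forces x q + y < p q and a -1 forces x q + y ≥ p q, so the sign determines the
  -- wrap between v and x q + y. The cutoff thereby becomes a single equation for x q + y + w.
  cut≡ : ∀ {v} → v < C → cut v ≡ ι (pos v) ℤ.- ι (neg v)
  cut≡ {v} v<C = go (index v<C) (chart v<C)
    where
    x y w : ℕ
    x = xc v
    y = yc v
    w = wc v
    P M : Bool
    P = ⌊ x <? K ⌋ ∧ not (high y)
    M = ⌊ K ≤? x ⌋ ∧ high y
    P⁻ : P ≡ true → x * q + y < C
    P⁻ t = lin≤ (x ∷ q ∷ y ∷ p ∷ K ∷ []) (# 1 :+ (v0 :* v1 :+ v2)) (v3 :* v1) ((# 1 :+ v0) :* v1 <= v4 :* v1 by scaleS q (dec-true {d = x <? K} (proj₁ (∧-true t))) & # 1 :+ (v2 :+ v4 :* v1) <= v3 :* v1 by ≰⇒> (dec-false {d = C ≤? y + K * q} (not-true (proj₂ (∧-true {⌊ x <? K ⌋} t)))) & # 1 :+ # 0 <= v1 by 0<q) refl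
    M⁻ : M ≡ true → C ≤ x * q + y
    M⁻ t = lin≤ (p ∷ q ∷ x ∷ y ∷ K ∷ []) (v0 :* v1) (v2 :* v1 :+ v3) (v4 :* v1 <= v2 :* v1 by scaleS q (dec-true {d = K ≤? x} (proj₁ (∧-true t))) & v0 :* v1 <= v3 :+ v4 :* v1 by dec-true {d = C ≤? y + K * q} (proj₂ (∧-true {⌊ K ≤? x ⌋} t))) refl
    go : Mod C N (w + v) → Mod C v (x * q + y) → cut v ≡ ι (pos v) ℤ.- ι (neg v)
    go (inj₁ i) c = trans (cong (λ b → if b then val v else + 0) (dec-intro {d = v ≤? N} (lin≤ (v ∷ N ∷ w ∷ []) v0 v1 (v2 :+ v0 ==˘ v1 by i) refl)))
      (trans (val≡ v v<C) (cong₂ (λ a b → ι a ℤ.- ι b) (sym (∧-absorb {P} λ t → dec-intro {d = x * q + y + w ≟ N} (hit⁺ t c))) (sym (∧-absorb {M} λ t → dec-intro {d = x * q + y + w ≟ N + C} (hit⁻ t c)))))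
      where
      hit⁺ : P ≡ true → Mod C v (x * q + y) → x * q + y + w ≡ N
      hit⁺ t (inj₁ c) = lin≡ (x ∷ q ∷ y ∷ w ∷ N ∷ v ∷ []) (v0 :* v1 :+ v2 :+ v3) v4 (v3 :+ v5 ≐ v4 by (sym i) &ᵉ v0 :* v1 :+ v2 ≐ v5 by (sym c)) refl
      hit⁺ t (inj₂ c) = lin⊥ (x ∷ q ∷ y ∷ C ∷ v ∷ []) (# 1 :+ (v0 :* v1 :+ v2) <= v3 by P⁻ t & v4 :+ v3 == v0 :* v1 :+ v2 by c) refl
      hit⁻ : M ≡ true → Mod C v (x * q + y) → x * q + y + w ≡ N + C
      hit⁻ t (inj₁ c) = lin⊥ (C ∷ x ∷ q ∷ y ∷ v ∷ []) (v0 <= v1 :* v2 :+ v3 by M⁻ t & v1 :* v2 :+ v3 ==˘ v4 by c & # 1 :+ v4 <= v0 by v<C) refl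
      hit⁻ t (inj₂ c) = lin≡ (x ∷ q ∷ y ∷ w ∷ N ∷ C ∷ v ∷ []) (v0 :* v1 :+ v2 :+ v3) (v4 :+ v5) (v3 :+ v6 ≐ v4 by (sym i) &ᵉ v0 :* v1 :+ v2 ≐ v6 :+ v5 by (sym c)) refl
    go (inj₂ i) c = trans (cong (λ b → if b then val v else + 0) (dec-no {d = v ≤? N} λ l → (lin⊥ (N ∷ C ∷ w ∷ v ∷ []) (v0 :+ v1 == v2 :+ v3 by i & # 1 :+ v2 <= v1 by w< v & v3 <= v0 by l) refl)))
      (cong₂ (λ a b → ι a ℤ.- ι b) (sym (∧-vanish {P} λ t → dec-no {d = x * q + y + w ≟ N} λ z → miss⁺ z c)) (sym (∧-vanish {M} λ t → dec-no {d = x * q + y + w ≟ N + C} λ z → miss⁻ t z c)))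
      where
      miss⁺ : x * q + y + w ≡ N → Mod C v (x * q + y) → ⊥
      miss⁺ z (inj₁ c) = lin⊥ (N ∷ C ∷ w ∷ v ∷ x ∷ q ∷ y ∷ []) (v0 :+ v1 == v2 :+ v3 by i & v4 :* v5 :+ v6 :+ v2 == v0 by z & # 1 :+ v3 <= v1 by v<C) refl
      miss⁺ z (inj₂ c) = lin⊥ (N ∷ C ∷ w ∷ v ∷ x ∷ q ∷ y ∷ []) (3 · v0 :+ v1 == v2 :+ v3 by i & v4 :* v5 :+ v6 :+ v2 == v0 by z & v3 :+ v1 == v4 :* v5 :+ v6 by c & 2 · # 1 :+ v3 <= v1 by v<C & 2 · # 1 :+ v2 <= v1 by w< v) refl
      miss⁻ : M ≡ true → x * q + y + w ≡ N + C → Mod C v (x * q + y) → ⊥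
      miss⁻ t z (inj₁ c) = lin⊥ (C ∷ x ∷ q ∷ y ∷ v ∷ []) (v0 <= v1 :* v2 :+ v3 by M⁻ t & v1 :* v2 :+ v3 ==˘ v4 by c & # 1 :+ v4 <= v0 by v<C) refl
      miss⁻ t z (inj₂ c) = lin⊥ (N ∷ C ∷ w ∷ v ∷ x ∷ q ∷ y ∷ []) (2 · v0 :+ v1 == v2 :+ v3 by i & v4 :* v5 :+ v6 :+ v2 == v0 :+ v1 by z & v3 :+ v1 == v4 :* v5 :+ v6 by c & # 1 :+ v3 <= v1 by v<C & # 1 :+ v2 <= v1 by w< v) refl

  vt v′ : ℕ → ℕ
  vt t = (v₀ + t * g) % C
  v′ v = (v + R° * q) % C
  v< : ∀ t → vt t < C
  v< t = m%n<n _ C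
  v′< : ∀ v → v′ v < C
  v′< v = m%n<n _ C

  vq : ℕ → ℕ
  vq t = (v₀ + t * g) / C
  v-step : ∀ d t → vt (t + d) + vq (t + d) * C ≡ vt t + d * g + vq t * C
  v-step d t = lin≡ ((vt (t + d)) ∷ (vq (t + d)) ∷ C ∷ (vt t) ∷ d ∷ g ∷ (vq t) ∷ v₀ ∷ t ∷ []) (v0 :+ v1 :* v2) (v3 :+ v4 :* v5 :+ v6 :* v2) (v0 :+ v1 :* v2 ≐ v7 :+ (v8 :+ v4) :* v5 by quot-rem (v₀ + (t + d) * g) C &ᵉ v7 :+ v8 :* v5 ≐ v3 :+ v6 :* v2 by (sym (quot-rem (v₀ + t * g) C))) refl

  v′q : ℕ → ℕ
  v′q v = (v + R° * q) / C
  v′-back : ∀ v → v + 1 * C ≡ v′ v + R * q + v′q v * C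
  v′-back v = lin≡ (v ∷ p ∷ q ∷ (v′ v) ∷ R ∷ (v′q v) ∷ R° ∷ []) (v0 :+ # 1 :* (v1 :* v2)) (v3 :+ v4 :* v2 :+ v5 :* (v1 :* v2)) (v0 :+ v6 :* v2 ≐ v3 :+ v5 :* (v1 :* v2) by (sym (quot-rem (v + R° * q) C)) &ᵉ v1 :* v2 ≐ (v4 :+ v6) :* v2 by (sym (cong (_* q) R+R°))) refl

  transpose : ∀ {a b} j l → a + j * C ≡ b + l * C → a + j * (q * p) ≡ b + l * (q * p)
  transpose {a} {b} j l h = lin≡ (a ∷ j ∷ q ∷ p ∷ b ∷ l ∷ []) (v0 :+ v1 :* (v2 :* v3)) (v4 :+ v5 :* (v2 :* v3)) (v0 :+ v1 :* (v3 :* v2) ≐ v4 :+ v5 :* (v3 :* v2) by h) refl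

  R<p : R < p
  R<p = lin≤ (R ∷ p ∷ R° ∷ []) (# 1 :+ v0) v1 (v0 :+ v2 == v1 by R+R° & # 1 :+ # 0 <= v2 by 0<R°) refl

  x-shift : ∀ v → xc (v′ v) + R ≡ xc v ⊎ xc (v′ v) + R ≡ xc v + p
  x-shift v = [ (λ h → inj₁ (sym h)) , (λ h → inj₂ (sym h)) ]′ (mod-lift {p} {xc v} {xc (v′ v) + R} ((v + o) * Q / p + 1 * q * Q + R * s) ((v′ v + o) * Q / p + R * q + v′q v * q * Q) (x< v) (lin≤ ((xc (v′ v)) ∷ R ∷ p ∷ []) (# 1 :+ (v0 :+ v1)) (# 2 :* v2) (# 1 :+ v0 <= v2 by x< (v′ v) & # 1 :+ v1 <= v2 by R<p) refl)
    (res-shift {p} {q} {Q} {o} {v} {v′ v} {R * q} {R} {xc v} {xc (v′ v)} ((v + o) * Q / p) ((v′ v + o) * Q / p) 1 (v′q v) (R * q) (R * s)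
      (quot-rem ((v + o) * Q) p) (quot-rem ((v′ v + o) * Q) p) (transpose {v} {v′ v + R * q} 1 (v′q v) (v′-back v))
      (lin≡ (R ∷ q ∷ p ∷ Q ∷ s ∷ []) (v0 :+ v0 :* v1 :* v2) (v0 :* v1 :* v3 :+ v0 :* v4 :* v2) (v0 :* (v2 :* v1 :+ # 1) ≐ v0 :* (v3 :* v1 :+ v4 :* v2) by (sym (cong (R *_) bez))) refl)))

  y-same : ∀ v → yc (v′ v) ≡ yc v
  y-same v = cong (λ h → h * p + δ) (sym (uniq ((v + o) * s / q + 1 * p * s + 0) ((v′ v + o) * s / q + R * s + v′q v * p * s) (m%n<n _ q) (m%n<n _ q) (subst (λ z → hc v + ((v + o) * s / q + 1 * p * s + 0) * q ≡ z + ((v′ v + o) * s / q + R * s + v′q v * p * s) * q) (+-identityʳ (hc (v′ v)))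
    (res-shift {q} {p} {s} {o} {v} {v′ v} {R * q} {0} {hc v} {hc (v′ v)} ((v + o) * s / q) ((v′ v + o) * s / q) 1 (v′q v) (R * s) 0
      (quot-rem ((v + o) * s) q) (quot-rem ((v′ v + o) * s) q) (v′-back v)
      (lin≡ (R ∷ s ∷ q ∷ []) (# 0 :+ v0 :* v1 :* v2) (v0 :* v2 :* v1 :+ # 0 :* v2) trivialᵉ refl)))))

  w-shift : ∀ {v} → v < C → Mod C (wc (v′ v)) (wc v + R * q)
  w-shift {v} v<C = mod-lift (wq (v′ v) + 1) (wq v + v′q v) (w< (v′ v)) (lin≤ ((wc v) ∷ R ∷ q ∷ p ∷ []) (# 1 :+ (v0 :+ v1 :* v2)) (# 2 :* (v3 :* v2)) (# 1 :+ v0 <= v3 :* v2 by w< v & (# 1 :+ v1) :* v2 <= v3 :* v2 by scaleS q R<p & # 1 :+ # 0 <= v2 by 0<q) refl)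
    (lin≡ ((wc (v′ v)) ∷ (wq (v′ v)) ∷ C ∷ (wc v) ∷ R ∷ q ∷ (wq v) ∷ (v′q v) ∷ N ∷ v ∷ (v′ v) ∷ []) (v0 :+ (v1 :+ # 1) :* v2) (v3 :+ v4 :* v5 :+ (v6 :+ v7) :* v2) (v8 :+ v2 ≐ v3 :+ v9 :+ v6 :* v2 by (sym (wv v<C)) &ᵉ v0 :+ v10 :+ v1 :* v2 ≐ v8 :+ v2 by wv (v′< v) &ᵉ v9 :+ # 1 :* v2 ≐ v10 :+ v4 :* v5 :+ v7 :* v2 by v′-back v) refl)

  state′ : ∀ {v} → v < C → State (xc (v′ v)) (yc v) (wc (v′ v))
  state′ {v} _ = subst (λ y → State (xc (v′ v)) y (wc (v′ v))) (y-same v) (state (v′< v))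

  gained lost : ℕ → Bool
  gained v = gain (xc v) (xc (v′ v)) (yc v) (wc v) (wc (v′ v))
  lost v = loss (xc v) (xc (v′ v)) (yc v) (wc v) (wc (v′ v))

  difference : ∀ {v} → v < C → cut v ℤ.- cut (v′ v) ≡ ι (gained v) ℤ.- ι (lost v)
  difference {v} v<C = trans (cong₂ ℤ._-_ (cut≡ v<C) (trans (cut≡ (v′< v)) (cong (λ y → ι (one⁺ x′ y w′) ℤ.- ι (one⁻ x′ y w′)) (y-same v)))) (go (bool? (high y)))
    where
    x x′ y w w′ : ℕ
    x = xc v
    x′ = xc (v′ v)
    y = yc v
    w = wc v
    w′ = wc (v′ v)
    no⁺ : ∀ {x w} → high y ≡ true → one⁺ x y w ≡ false
    no⁺ {x} h with ⌊ x <? K ⌋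
    ... | true rewrite h = refl
    ... | false = refl
    no⁻ : ∀ {x w} → high y ≡ false → one⁻ x y w ≡ false
    no⁻ {x} h with ⌊ K ≤? x ⌋
    ... | true rewrite h = refl
    ... | false = refl
    bools⁺ : ∀ a b → (ι a ℤ.- + 0) ℤ.- (ι b ℤ.- + 0) ≡ ι (a ∧ not b) ℤ.- ι (b ∧ not a)
    bools⁺ true true = refl
    bools⁺ true false = refl
    bools⁺ false true = refl
    bools⁺ false false = refl
    bools⁻ : ∀ a b → (+ 0 ℤ.- ι a) ℤ.- (+ 0 ℤ.- ι b) ≡ ι (b ∧ not a) ℤ.- ι (a ∧ not b)
    bools⁻ true true = refl
    bools⁻ true false = refl
    bools⁻ false true = refl
    bools⁻ false false = refl
    diff : Bool → Bool → Bool → Bool → ℤ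
    diff a b c d = (ι a ℤ.- ι b) ℤ.- (ι c ℤ.- ι d)
    go : high y ≡ true ⊎ high y ≡ false → diff (one⁺ x y w) (one⁻ x y w) (one⁺ x′ y w′) (one⁻ x′ y w′) ≡ ι (gained v) ℤ.- ι (lost v)
    go (inj₁ h) = trans (cong₂ (λ a c → diff a (one⁻ x y w) c (one⁻ x′ y w′)) (no⁺ h) (no⁺ h)) (trans (bools⁻ (one⁻ x y w) (one⁻ x′ y w′))
      (cong₂ (λ a b → ι a ℤ.- ι b) (sym (if-true h)) (sym (if-true h))))
    go (inj₂ h) = trans (cong₂ (λ b d → diff (one⁺ x y w) b (one⁺ x′ y w′) d) (no⁻ h) (no⁻ h)) (trans (bools⁺ (one⁺ x y w) (one⁺ x′ y w′))
      (cong₂ (λ a b → ι a ℤ.- ι b) (sym (if-false h)) (sym (if-false h))))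

  lam : ℕ
  lam = (g * Q) % p
  lq : ℕ
  lq = (g * Q) / p
  lam-eq : lam + lq * p ≡ g * Q
  lam-eq = quot-rem (g * Q) p

  xt : ℕ → ℕ
  xt t = xc (vt t)

  x-step : ∀ d t → Σ ℕ λ k → xt (t + d) + k * p ≡ xt t + d * lam
  x-step d t = drop-mod {p} {xt (t + d)} {xt t + d * lam} ((vt (t + d) + o) * Q / p + vq (t + d) * q * Q + 0) ((vt t + o) * Q / p + d * lq + vq t * q * Q) (x< (vt (t + d)))
    (res-shift {p} {q} {Q} {o} {vt (t + d)} {vt t} {d * g} {d * lam} {xt (t + d)} {xt t} ((vt (t + d) + o) * Q / p) ((vt t + o) * Q / p) (vq (t + d)) (vq t) (d * lq) 0
      (quot-rem ((vt (t + d) + o) * Q) p) (quot-rem ((vt t + o) * Q) p) (transpose (vq (t + d)) (vq t) (v-step d t))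
      (lin≡ (d ∷ lam ∷ lq ∷ p ∷ g ∷ Q ∷ []) (v0 :* v1 :+ v0 :* v2 :* v3) (v0 :* v4 :* v5 :+ # 0 :* v3) (v0 :* (v1 :+ v2 :* v3) ≐ v0 :* (v4 :* v5) by cong (d *_) lam-eq) refl))

  -- Solves x ≡ xt 0 + t lam for t: `μ` inverts g Q ≡ lam modulo p, and p - xt 0 stands for - xt 0.
  tm : ℕ → ℕ
  tm x = ((x + (p ∸ xt 0)) * μ) % p
  tq : ℕ → ℕ
  tq x = ((x + (p ∸ xt 0)) * μ) / p
  tm-eq : ∀ x → tm x + tq x * p ≡ (x + (p ∸ xt 0)) * μ
  tm-eq x = quot-rem ((x + (p ∸ xt 0)) * μ) p
  h+ : (p ∸ xt 0) + xt 0 ≡ p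
  h+ = m∸n+n≡m (<⇒≤ (x< (vt 0)))

  xt-tm : ∀ x → x < p → xt (tm x) ≡ x
  xt-tm x x<p = go (x-step (tm x) 0)
    where
    go : Σ ℕ (λ k → xt (tm x) + k * p ≡ xt 0 + tm x * lam) → xt (tm x) ≡ x
    go (k , e) = solve (p ∸ xt 0) (xt 0) (xt (tm x)) (tm x) (tq x) lam lq (x< (vt (tm x))) h+ (tm-eq x) lam-eq e
      where
      solve : ∀ h a z t j l f → z < p → h + a ≡ p → t + j * p ≡ (x + h) * μ → l + f * p ≡ g * Q → z + k * p ≡ a + t * l → z ≡ x
      solve h a z t j l f z<p hE tE lE e = uniq (k + j * l + (x + h) * μ * f) (1 + (x + h) * κ) z<p x<p
        (lin≡ (z ∷ k ∷ j ∷ l ∷ x ∷ h ∷ μ ∷ f ∷ p ∷ κ ∷ a ∷ t ∷ g ∷ Q ∷ []) (v0 :+ (v1 :+ v2 :* v3 :+ (v4 :+ v5) :* v6 :* v7) :* v8) (v4 :+ (# 1 :+ (v4 :+ v5) :* v9) :* v8) (v0 :+ v1 :* v8 ≐ v10 :+ v11 :* v3 by e &ᵉ (v11 :+ v2 :* v8) :* v3 ≐ (v4 :+ v5) :* v6 :* v3 by cong (_* l) tE &ᵉ (v4 :+ v5) :* (v6 :* (v12 :* v13)) ≐ (v4 :+ v5) :* (# 1 :+ v9 :* v8) by cong ((x + h) *_) inv &ᵉ (v4 :+ v5) :* v6 :* (v3 :+ v7 :* v8) ≐ (v4 :+ v5) :* v6 :* (v12 :* v13) by cong ((x + h) * μ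 *_) lE &ᵉ v5 :+ v10 ≐ v8 by hE) refl)

  tm-xt : ∀ t → t < p → tm (xt t) ≡ t
  tm-xt t t<p = go (x-step t 0)
    where
    go : Σ ℕ (λ k → xt t + k * p ≡ xt 0 + t * lam) → tm (xt t) ≡ t
    go (k , e) = solve (p ∸ xt 0) (xt 0) (xt t) (tm (xt t)) (tq (xt t)) lam lq (m%n<n _ p) h+ (tm-eq (xt t)) lam-eq e
      where
      solve : ∀ h a x T j l f → T < p → h + a ≡ p → T + j * p ≡ (x + h) * μ → l + f * p ≡ g * Q → x + k * p ≡ a + t * l → T ≡ t
      solve h a x T j l f T<p hE TE lE e = uniq (j + k * μ + t * μ * f) (μ + t * κ) T<p t<p
        (lin≡ (T ∷ j ∷ k ∷ μ ∷ t ∷ f ∷ p ∷ κ ∷ x ∷ h ∷ a ∷ l ∷ g ∷ Q ∷ []) (v0 :+ (v1 :+ v2 :* v3 :+ v4 :* v3 :* v5) :* v6) (v4 :+ (v3 :+ v4 :* v7) :* v6) (v0 :+ v1 :* v6 ≐ (v8 :+ v9) :* v3 by TE &ᵉ (v8 :+ v2 :* v6) :* v3 ≐ (v10 :+ v4 :* v11) :* v3 by cong (_* μ) e &ᵉ v4 :* (v3 :* (v12 :* v13)) ≐ v4 :* (# 1 :+ v7 :* v6) by cong (t *_) inv &ᵉ v4 :* v3 :* (v11 :+ v5 :* v6) ≐ v4 :* v3 :* (v12 :* v13) by cong (t * μ *_) lE &ᵉ (v9 :+ v10) :* v3 ≐ v6 :* v3 by cong (_* μ) hE) refl)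

  AY AW : ℕ → ℕ
  AY d = ((d * g * s) % q) * p
  AW d = Opp C ((d * g) % C)

  y-step : ∀ d t → Mod C (yc (vt (t + d))) (yc (vt t) + AY d)
  y-step d t = go (mod-lift ((vt (t + d) + o) * s / q + vq (t + d) * p * s + 0) ((vt t + o) * s / q + d * g * s / q + vq t * p * s) (m%n<n _ q) (lin≤ ((hc (vt t)) ∷ (d * g * s % q) ∷ q ∷ []) (# 1 :+ (v0 :+ v1)) (# 2 :* v2) (# 1 :+ v0 <= v2 by m%n<n ((vt t + o) * s) q & # 1 :+ v1 <= v2 by m%n<n (d * g * s) q) refl)
    (res-shift {q} {p} {s} {o} {vt (t + d)} {vt t} {d * g} {d * g * s % q} {hc (vt (t + d))} {hc (vt t)} ((vt (t + d) + o) * s / q) ((vt t + o) * s / q) (vq (t + d)) (vq t) (d * g * s / q) 0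
      (quot-rem ((vt (t + d) + o) * s) q) (quot-rem ((vt t + o) * s) q) (v-step d t)
      (trans (quot-rem (d * g * s) q) (sym (+-identityʳ _)))))
    where
    go : Mod q (hc (vt (t + d))) (hc (vt t) + d * g * s % q) → Mod C (yc (vt (t + d))) (yc (vt t) + AY d)
    go (inj₁ h) = inj₁ (lin≡ ((hc (vt (t + d))) ∷ p ∷ δ ∷ (hc (vt t)) ∷ (d * g * s % q) ∷ []) (v0 :* v1 :+ v2) (v3 :* v1 :+ v2 :+ v4 :* v1) (v0 :* v1 ≐ (v3 :+ v4) :* v1 by cong (_* p) h) refl)
    go (inj₂ h) = inj₂ (lin≡ ((hc (vt (t + d))) ∷ p ∷ δ ∷ q ∷ (hc (vt t)) ∷ (d * g * s % q) ∷ []) (v0 :* v1 :+ v2 :+ v1 :* v3) (v4 :* v1 :+ v2 :+ v5 :* v1) ((v0 :+ v3) :* v1 ≐ (v4 :+ v5) :* v1 by cong (_* p) h) refl)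

  w-step : ∀ d t → Mod C (wc (vt (t + d))) (wc (vt t) + AW d)
  w-step d t = mod-flip (w< (vt (t + d))) (m%n<n (d * g) C) (mod-lift (wq (vt t) + vq (t + d)) (wq (vt (t + d)) + d * g / C + vq t) (w< (vt t))
    (lin≤ ((wc (vt (t + d))) ∷ (d * g % C) ∷ C ∷ []) (# 1 :+ (v0 :+ v1)) (# 2 :* v2) (# 1 :+ v0 <= v2 by w< (vt (t + d)) & # 1 :+ v1 <= v2 by m%n<n (d * g) C) refl)
    (lin≡ ((wc (vt t)) ∷ (wq (vt t)) ∷ (vq (t + d)) ∷ C ∷ (wc (vt (t + d))) ∷ (d * g % C) ∷ (wq (vt (t + d))) ∷ (d * g / C) ∷ (vq t) ∷ (vt t) ∷ N ∷ (vt (t + d)) ∷ d ∷ g ∷ []) (v0 :+ (v1 :+ v2) :* v3) (v4 :+ v5 :+ (v6 :+ v7 :+ v8) :* v3) (v0 :+ v9 :+ v1 :* v3 ≐ v10 :+ v3 by wv (v< t) &ᵉ v10 :+ v3 ≐ v4 :+ v11 :+ v6 :* v3 by (sym (wv (v< (t + d)))) &ᵉ v11 :+ v2 :* v3 ≐ v9 :+ v12 :* v13 :+ v8 :* v3 by v-step d t &ᵉ v12 :* v13 ≐ v5 :+ v7 :* v3 by (sym (quot-rem (d * g) C))) refl))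

  Y W : ℕ → ℕ
  Y x = yc (vt (tm x))
  W x = wc (vt (tm x))
  plus minus : ℕ → Bool
  plus x = gained (vt (tm x))
  minus x = lost (vt (tm x))

  timing : Timing p C Y W
  timing = record
    { tm = tm ; xt = xt ; tm< = λ x _ → m%n<n _ p ; xt< = λ t _ → x< (vt t) ; xt-tm = xt-tm ; tm-xt = tm-xt
    ; lam = lam ; lam≤ = <⇒≤ (m%n<n (g * Q) p) ; shX = λ d t _ → x-step d t
    ; AY = AY ; AW = AW
    ; AY< = λ d → (lin≤ ((d * g * s % q) ∷ p ∷ q ∷ []) (# 1 :+ (v0 :* v1)) (v1 :* v2) ((# 1 :+ v0) :* v1 <= v2 :* v1 by scaleS p (m%n<n (d * g * s) q) & # 1 :+ # 0 <= v1 by 0<p) refl)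
    ; AW< = λ d → Opp< (m%n<n (d * g) C)
    ; shY = λ d t l → subst₂ (λ a b → Mod C (yc (vt a)) (yc (vt b) + AY d)) (sym (tm-xt (t + d) l)) (sym (tm-xt t (≤-trans (s≤s (m≤m+n t d)) l))) (y-step d t)
    ; shW = λ d t l → subst₂ (λ a b → Mod C (wc (vt a)) (wc (vt b) + AW d)) (sym (tm-xt (t + d) l)) (sym (tm-xt t (≤-trans (s≤s (m≤m+n t d)) l))) (w-step d t) }

  total : sum< p (terms val N vt (λ t → v′ (vt t))) ≡ + cnt plus p ℤ.- + cnt minus p
  total = trans (sum<-cong p (λ t _ → difference (v< t))) (trans (sum<-cnt (λ t → gained (vt t)) (λ t → lost (vt t)) p)
    (cong₂ (λ a b → + a ℤ.- + b) (reindex gained) (reindex lost)))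
    where
    reindex : ∀ f → cnt (λ t → f (vt t)) p ≡ cnt (λ x → f (vt (tm x))) p
    reindex f = cnt-reindex _ _ xt tm p (λ t _ → x< (vt t)) (λ x _ → m%n<n _ p) (λ t l → cong (λ z → f (vt z)) (sym (tm-xt t l))) xt-tm tm-xt

  module At {x} (x<p : x < p) where
    v : ℕ
    v = vt (tm x)
    open Cell R K+R≤p R<p 0<q N< (x< v) (x< (v′ v)) (y< v) (w< v) (w< (v′ v)) (state (v< (tm x))) (state′ (v< (tm x))) (x-shift v) (w-shift (v< (tm x))) public
      using (gain⁻; loss⁻; ¬loss⁻)

  module _ (0<K : 0 < K) (0<R : 0 < R) (h : ℕ) (odd : p ≡ 2 * h + 1)
    (clash : 2 ≤ K → 2 ≤ R → (lam ≢ R × p ∸ lam ≢ R) × (lam ≢ K × p ∸ lam ≢ K)) where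

    PlusAt MinusAt : ℕ → ℕ → ℕ → Set
    PlusAt x y w = (x < K × x < R × (x * q + y + w ≡ N ⊎ (x * q + y + w ≡ N + C × C ≤ y + K * q × C ≤ w + R * q))) ⊎ (K + R ≤ x × x * q + y + w ≡ N + 2 * C × C ≤ y + K * q × C ≤ w + R * q)
    MinusAt x y w = (x * q + y + w ≡ N + C × y + K * q < C × w + R * q < C) ⊎ x * q + y + w ≡ N + 2 * C

    plus⁻ : ∀ x → x < p → plus x ≡ true → PlusAt x (Y x) (W x)
    plus⁻ x l e = subst (λ z → PlusAt z (Y x) (W x)) (xt-tm x l) (At.gain⁻ l e)
    minus⁻ : ∀ x → x < p → minus x ≡ true → x < K + R × (K ≤ x ⊎ R ≤ x)
    minus⁻ x l e = subst (λ z → z < K + R × (K ≤ z ⊎ R ≤ z)) (xt-tm x l) (At.loss⁻ l e)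
    ¬minus⁻ : ∀ x → x < p → K ≤ x → R ≤ x → x < K + R → minus x ≡ false → MinusAt x (Y x) (W x)
    ¬minus⁻ x l = subst (λ z → K ≤ z → R ≤ z → z < K + R → minus x ≡ false → MinusAt z (Y x) (W x)) (xt-tm x l) (At.¬loss⁻ l)

    layout : Residues.Layout p q N K R Y W plus minus
    layout = record { q-pos = 0<q ; N< = N< ; Y< = λ x _ → y< (vt (tm x)) ; W< = λ x _ → w< (vt (tm x)) ; plus⁻ = plus⁻ ; neg⁻ = minus⁻ ; ¬neg⁻ = ¬minus⁻ }

    exchange : ∀ x y w {M} → x * q + y + w ≡ M → x * q + w + y ≡ M
    exchange x y w e = trans (trans (+-assoc (x * q) w y) (trans (cong (λ z → x * q + z) (+-comm w y)) (sym (+-assoc (x * q) y w)))) e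

    -- For R ≤ K the coordinates `Y` and `W` trade places, so that the smaller parameter comes
    -- first.
    layout′ : Residues.Layout p q N R K W Y plus minus
    layout′ = record { q-pos = 0<q ; N< = N< ; Y< = λ x _ → w< (vt (tm x)) ; W< = λ x _ → y< (vt (tm x))
      ; plus⁻ = λ x l e → plus-swap x (plus⁻ x l e)
      ; neg⁻ = λ x l e → subst (x <_) (+-comm K R) (proj₁ (minus⁻ x l e)) , swap (proj₂ (minus⁻ x l e))
      ; ¬neg⁻ = λ x l a b c e → minus-swap x (¬minus⁻ x l b a (subst (x <_) (+-comm R K) c) e) }
      where
      plus-swap : ∀ x → PlusAt x (Y x) (W x) → (x < R × x < K × (x * q + W x + Y x ≡ N ⊎ (x * q + W x + Y x ≡ N + C × C ≤ W x + R * q × C ≤ Y x + K * q))) ⊎ (R + K ≤ x × x * q + W x + Y x ≡ N + 2 * C × C ≤ W x + R * q × C ≤ Y x + K * q)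
      plus-swap x (inj₁ (a , b , inj₁ e)) = inj₁ (b , a , inj₁ (exchange x (Y x) (W x) e))
      plus-swap x (inj₁ (a , b , inj₂ (e , t , u))) = inj₁ (b , a , inj₂ (exchange x (Y x) (W x) e , u , t))
      plus-swap x (inj₂ (a , e , t , u)) = inj₂ (subst (_≤ x) (+-comm K R) a , exchange x (Y x) (W x) e , u , t)
      minus-swap : ∀ x → MinusAt x (Y x) (W x) → (x * q + W x + Y x ≡ N + C × W x + R * q < C × Y x + K * q < C) ⊎ x * q + W x + Y x ≡ N + 2 * C
      minus-swap x (inj₁ (e , t , u)) = inj₁ (exchange x (Y x) (W x) e , u , t)
      minus-swap x (inj₂ e) = inj₂ (exchange x (Y x) (W x) e)

    timing′ : Timing p C W Y
    timing′ = record { Timing timing ; AY = AW ; AW = AY ; AY< = Timing.AW< timing ; AW< = Timing.AY< timing ; shY = Timing.shW timing ; shW = Timing.shY timing }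

    bounds : (K ≤ R × Bounds p K R (cnt plus p) (cnt minus p)) ⊎ (R ≤ K × Bounds p R K (cnt plus p) (cnt minus p))
    bounds = [ (λ l → inj₁ (l , layout-bounds layout l 0<K K+R≤p timing h odd λ k → proj₁ (clash k (≤-trans k l))))
             , (λ l → inj₂ (l , layout-bounds layout′ l 0<R (subst (_≤ p) (+-comm K R) K+R≤p) timing′ h odd λ k → proj₂ (clash (≤-trans k l) k))) ]′ (≤-total K R)

-- Formal power series and the product over divisors

import Data.List.Relation.Unary.Unique.Propositional.Properties as Uniqueₚ
open import Algebra.Bundles using (CommutativeMonoid; module AbelianGroup)
open import Data.Fin.Patterns
open import Data.List using (applyUpTo; foldr; map; _++_)
open import Data.List.Membership.Propositional using (_∈_)
open import Data.List.Membership.Propositional.Properties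
open import Data.List.Membership.Propositional.Properties.WithK using (unique∧set⇒bag)
open import Data.List.Relation.Binary.BagAndSetEquality using (∼bag⇒↭)
open import Data.List.Relation.Binary.Permutation.Propositional as ↭ using (_↭_)
open import Data.List.Relation.Unary.All using ([]; _∷_)
open import Data.List.Relation.Unary.AllPairs using ([]; _∷_)
open import Data.List.Relation.Unary.Any using (here)
open import Data.List.Relation.Unary.Unique.Propositional using (Unique)
open import Data.Nat.Coprimality using (Coprime; coprime-divisor; coprime-Bézout)
open import Data.Nat.Divisibility hiding (quotient)
open import Data.Nat.GCD using (module Bézout)
open import Data.Nat.Primality using (¬prime[1]; prime⇒nonZero; prime⇒irreducible; euclidsLemma)
open import Data.Vec using ([]; _∷_)
open import Function.Bundles using (mk⇔)

open import Algebra.Properties.Group (AbelianGroup.group ℤP.+-0-abelianGroup) using () renaming (∙-cancelˡ to ℤ-cancelˡ)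

infix 4 _≈_
_≈_ : Poly → Poly → Set
f ≈ g = ∀ k → f k ≡ g k

tail : Poly → Poly
tail f k = f (suc k)

sumTo-cong : ∀ n {f g} → (∀ i → i ≤ n → f i ≡ g i) → sumTo n f ≡ sumTo n g
sumTo-cong zero h = h 0 z≤n
sumTo-cong (suc n) h = cong₂ ℤ._+_ (sumTo-cong n (λ i l → h i (m≤n⇒m≤1+n l))) (h (suc n) ≤-refl)

sumTo-head : ∀ n f → sumTo (suc n) f ≡ f 0 ℤ.+ sumTo n (λ i → f (suc i))
sumTo-head zero f = refl
sumTo-head (suc n) f = trans (cong (ℤ._+ f (suc (suc n))) (sumTo-head n f)) (ℤP.+-assoc (f 0) _ _)

sumTo-linear : ∀ n a f g → sumTo n (λ i → a ℤ.* f i ℤ.+ g i) ≡ a ℤ.* sumTo n f ℤ.+ sumTo n g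
sumTo-linear zero a f g = refl
sumTo-linear (suc n) a f g = trans (cong (ℤ._+ (a ℤ.* f (suc n) ℤ.+ g (suc n))) (sumTo-linear n a f g))
  (trans (ℤ-interchange (a ℤ.* sumTo n f) _ _ _) (cong (ℤ._+ (sumTo n g ℤ.+ g (suc n))) (sym (ℤP.*-distribˡ-+ a (sumTo n f) (f (suc n))))))

⊛-cong : ∀ {f f′ g g′} → f ≈ f′ → g ≈ g′ → f ⊛ g ≈ f′ ⊛ g′
⊛-cong h k n = sumTo-cong n (λ i _ → cong₂ ℤ._*_ (h i) (k (n ∸ i)))

⊛-head : ∀ f g n → (f ⊛ g) (suc n) ≡ f 0 ℤ.* g (suc n) ℤ.+ (tail f ⊛ g) n
⊛-head f g n = sumTo-head n (λ i → f i ℤ.* g (suc n ∸ i))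

⊛-last : ∀ f g n → (f ⊛ g) (suc n) ≡ (f ⊛ tail g) n ℤ.+ f (suc n) ℤ.* g 0
⊛-last f g n = cong₂ ℤ._+_ (sumTo-cong n (λ i l → cong (λ z → f i ℤ.* g z) (+-∸-assoc 1 l))) (cong (λ z → f (suc n) ℤ.* g z) (n∸n≡0 n))

⊛-comm : ∀ f g → f ⊛ g ≈ g ⊛ f
⊛-comm f g zero = ℤP.*-comm (f 0) (g 0)
⊛-comm f g (suc n) = trans (⊛-head f g n) (trans (cong₂ ℤ._+_ (ℤP.*-comm (f 0) (g (suc n))) (⊛-comm (tail f) g n))
  (trans (ℤP.+-comm (g (suc n) ℤ.* f 0) _) (sym (⊛-last g f n))))

⊛-linear : ∀ a f g h → (λ k → a ℤ.* f k ℤ.+ g k) ⊛ h ≈ λ k → a ℤ.* (f ⊛ h) k ℤ.+ (g ⊛ h) k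
⊛-linear a f g h n = trans (sumTo-cong n (λ i _ → trans (ℤP.*-distribʳ-+ (h (n ∸ i)) (a ℤ.* f i) (g i)) (cong (ℤ._+ g i ℤ.* h (n ∸ i)) (ℤP.*-assoc a (f i) (h (n ∸ i))))))
  (sumTo-linear n a (λ i → f i ℤ.* h (n ∸ i)) (λ i → g i ℤ.* h (n ∸ i)))

⊛-assoc : ∀ f g h → (f ⊛ g) ⊛ h ≈ f ⊛ (g ⊛ h)
⊛-assoc f g h zero = ℤP.*-assoc (f 0) (g 0) (h 0)
⊛-assoc f g h (suc n) = begin
  ((f ⊛ g) ⊛ h) (suc n) ≡⟨ ⊛-head (f ⊛ g) h n ⟩
  f 0 ℤ.* g 0 ℤ.* h (suc n) ℤ.+ (tail (f ⊛ g) ⊛ h) n ≡⟨ cong (λ z → f 0 ℤ.* g 0 ℤ.* h (suc n) ℤ.+ z) (trans (⊛-cong {g = h} (⊛-head f g) (λ _ → refl) n) (⊛-linear (f 0) (tail g) (tail f ⊛ g) h n)) ⟩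
  f 0 ℤ.* g 0 ℤ.* h (suc n) ℤ.+ (f 0 ℤ.* (tail g ⊛ h) n ℤ.+ ((tail f ⊛ g) ⊛ h) n) ≡⟨ sym (ℤP.+-assoc (f 0 ℤ.* g 0 ℤ.* h (suc n)) _ _) ⟩
  f 0 ℤ.* g 0 ℤ.* h (suc n) ℤ.+ f 0 ℤ.* (tail g ⊛ h) n ℤ.+ ((tail f ⊛ g) ⊛ h) n ≡⟨ cong₂ ℤ._+_ (trans (cong (ℤ._+ f 0 ℤ.* (tail g ⊛ h) n) (ℤP.*-assoc (f 0) (g 0) (h (suc n)))) (sym (ℤP.*-distribˡ-+ (f 0) (g 0 ℤ.* h (suc n)) ((tail g ⊛ h) n)))) (⊛-assoc (tail f) g h n) ⟩
  f 0 ℤ.* (g 0 ℤ.* h (suc n) ℤ.+ (tail g ⊛ h) n) ℤ.+ (tail f ⊛ (g ⊛ h)) n ≡⟨ cong (λ z → f 0 ℤ.* z ℤ.+ (tail f ⊛ (g ⊛ h)) n) (sym (⊛-head g h n)) ⟩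
  f 0 ℤ.* (g ⊛ h) (suc n) ℤ.+ (tail f ⊛ (g ⊛ h)) n ≡⟨ sym (⊛-head f (g ⊛ h) n) ⟩
  (f ⊛ (g ⊛ h)) (suc n) ∎
  where open ≡-Reasoning

sh : ℕ → Poly → Poly
sh zero f k = f k
sh (suc d) f zero = + 0
sh (suc d) f (suc k) = sh d f k

sh-≤ : ∀ {d k} f → d ≤ k → sh d f k ≡ f (k ∸ d)
sh-≤ f z≤n = refl
sh-≤ f (s≤s l) = sh-≤ f l
sh-> : ∀ {d k} f → k < d → sh d f k ≡ + 0
sh-> {suc d} {zero} f _ = refl
sh-> {suc d} {suc k} f (s≤s l) = sh-> f l
sh-+ : ∀ d e f → sh d (sh e f) ≈ sh (d + e) f
sh-+ zero e f k = refl
sh-+ (suc d) e f zero = refl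
sh-+ (suc d) e f (suc k) = sh-+ d e f k

x^ : ℕ → Poly
x^ d k = ι ⌊ k ≟ d ⌋

dec-cong : ∀ {A B : Set} {d : Dec A} {e : Dec B} → (A → B) → (B → A) → ⌊ d ⌋ ≡ ⌊ e ⌋
dec-cong {d = yes a} {e = yes b} f g = refl
dec-cong {d = yes a} {e = no n} f g = ⊥-elim (n (f a))
dec-cong {d = no n} {e = yes b} f g = ⊥-elim (n (g b))
dec-cong {d = no _} {e = no _} f g = refl

x^-⊛ : ∀ d f → x^ d ⊛ f ≈ sh d f
x^-⊛ zero f zero = ℤP.*-identityˡ (f 0)
x^-⊛ zero f (suc n) = trans (⊛-head (x^ 0) f n) (trans (cong₂ ℤ._+_ (ℤP.*-identityˡ (f (suc n))) (null n)) (ℤP.+-identityʳ _))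
  where
  null : ∀ n → (tail (x^ 0) ⊛ f) n ≡ + 0
  null zero = refl
  null (suc n) = cong₂ ℤ._+_ (null′ n n) refl
    where
    null′ : ∀ j m → sumTo j (λ i → tail (x^ 0) i ℤ.* f (suc m ∸ i)) ≡ + 0
    null′ zero m = refl
    null′ (suc j) m = cong₂ ℤ._+_ (null′ j m) refl
x^-⊛ (suc d) f zero = refl
x^-⊛ (suc d) f (suc n) = trans (⊛-head (x^ (suc d)) f n) (trans (ℤP.+-identityˡ _)
  (trans (⊛-cong {g = f} (λ k → cong ι (dec-cong {d = suc k ≟ suc d} {e = k ≟ d} suc-injective (cong suc))) (λ _ → refl) n) (x^-⊛ d f n)))

one≈ : one ≈ x^ 0
one≈ zero = refl
one≈ (suc k) = refl

⊛-identityˡ : ∀ f → one ⊛ f ≈ f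
⊛-identityˡ f k = trans (⊛-cong {g = f} one≈ (λ _ → refl) k) (x^-⊛ 0 f k)

-- Multiplication alone is bundled, so that rearrangements of factors can be left to the commutative
-- monoid solver.
⊛-one : CommutativeMonoid _ _
⊛-one = record
  { Carrier = Poly ; _≈_ = _≈_ ; _∙_ = _⊛_ ; ε = one
  ; isCommutativeMonoid = record
    { isMonoid = record
      { isSemigroup = record
        { isMagma = record
          { isEquivalence = record { refl = λ _ → refl ; sym = λ h k → sym (h k) ; trans = λ h g k → trans (h k) (g k) }
          ; ∙-cong = ⊛-cong }
        ; assoc = ⊛-assoc }
      ; identity = ⊛-identityˡ , λ f k → trans (⊛-comm f one k) (⊛-identityˡ f k) }
    ; comm = ⊛-comm } }

Δ : ℕ → Poly → Poly
Δ d f k = sh d f k ℤ.- f k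

xⁿ-1-⊛ : ∀ d f → xⁿ-1 d ⊛ f ≈ Δ d f
xⁿ-1-⊛ d f k = trans (⊛-cong {g = f} (λ i → trans (ℤP.+-comm (x^ d i) _) (cong (ℤ._+ x^ d i) (sym (ℤP.-1*i≡-i (x^ 0 i))))) (λ _ → refl) k)
  (trans (⊛-linear (ℤ.- + 1) (x^ 0) (x^ d) f k) (trans (cong₂ (λ a b → ℤ.- + 1 ℤ.* a ℤ.+ b) (x^-⊛ 0 f k) (x^-⊛ d f k))
    (trans (cong (ℤ._+ sh d f k) (ℤP.-1*i≡-i (f k))) (ℤP.+-comm (ℤ.- f k) (sh d f k)))))

sh-cong-< : ∀ {f g : Poly} d k → (∀ i → i < k → f i ≡ g i) → 0 < d → sh d f k ≡ sh d g k
sh-cong-< (suc d) zero h _ = refl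
sh-cong-< {f} {g} (suc zero) (suc k) h _ = h k ≤-refl
sh-cong-< (suc (suc d)) (suc k) h _ = sh-cong-< (suc d) k (λ i l → h i (m≤n⇒m≤1+n l)) (s≤s z≤n)

-- The constant term of x^d - 1 is - 1, so the coefficients are recovered one by one from the
-- earlier ones.
⊛-cancel : ∀ {d f g} → 0 < d → xⁿ-1 d ⊛ f ≈ xⁿ-1 d ⊛ g → f ≈ g
⊛-cancel {d} {f} {g} 0<d h k = below (suc k) k ≤-refl
  where
  below : ∀ n i → i < n → f i ≡ g i
  below (suc n) i l = ℤP.neg-injective (ℤ-cancelˡ (sh d f i) _ _ (trans (trans (sym (xⁿ-1-⊛ d f i)) (trans (h i) (xⁿ-1-⊛ d g i)))
    (cong (ℤ._- g i) (sym (sh-cong-< d i (λ j j<i → below n j (≤-trans j<i (≤-pred l))) 0<d)))))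

-- (x ^ p − 1) / (x − 1) as a sum of shifts
sh-sum : ℕ → Poly → Poly
sh-sum zero f k = + 0
sh-sum (suc p) f k = sh-sum p f k ℤ.+ sh p f k

sh-linear : ∀ d f g → sh d (λ k → f k ℤ.+ g k) ≈ λ k → sh d f k ℤ.+ sh d g k
sh-linear zero f g k = refl
sh-linear (suc d) f g zero = refl
sh-linear (suc d) f g (suc k) = sh-linear d f g k

sh-cong : ∀ d {f g} → f ≈ g → sh d f ≈ sh d g
sh-cong zero h k = h k
sh-cong (suc d) h zero = refl
sh-cong (suc d) h (suc k) = sh-cong d h k

Δ-sh-sum : ∀ p f → Δ 1 (sh-sum p f) ≈ Δ p f
Δ-sh-sum zero f zero = sym (ℤP.+-inverseʳ (f 0))
Δ-sh-sum zero f (suc k) = sym (ℤP.+-inverseʳ (f (suc k)))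
Δ-sh-sum (suc p) f k = trans (cong (ℤ._- (sh-sum p f k ℤ.+ sh p f k)) (trans (sh-linear 1 (sh-sum p f) (sh p f) k) (cong (λ z → sh 1 (sh-sum p f) k ℤ.+ z) (sh-+ 1 p f k))))
  (trans (cong (λ z → sh 1 (sh-sum p f) k ℤ.+ sh (suc p) f k ℤ.+ z) (ℤP.neg-distrib-+ (sh-sum p f k) (sh p f k)))
  (trans (ℤ-interchange (sh 1 (sh-sum p f) k) _ _ _) (trans (cong (ℤ._+ (sh (suc p) f k ℤ.- sh p f k)) (Δ-sh-sum p f k)) (telescope (sh p f k) (f k) (sh (suc p) f k)))))
  where
  telescope : ∀ a b c → (a ℤ.- b) ℤ.+ (c ℤ.- a) ≡ c ℤ.- b
  telescope a b c = trans (ℤP.+-comm (a ℤ.- b) (c ℤ.- a)) (trans (ℤP.+-assoc c (ℤ.- a) (a ℤ.- b)) (cong (λ z → c ℤ.+ z) (trans (sym (ℤP.+-assoc (ℤ.- a) a (ℤ.- b))) (trans (cong (ℤ._- b) (ℤP.+-inverseˡ a)) (ℤP.+-identityˡ _)))))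

prod : (ℕ → Poly) → List ℕ → Poly
prod F = foldr (λ d acc → F d ⊛ acc) one

module ⊛M = CommutativeMonoid ⊛-one
open import Algebra.Solver.CommutativeMonoid ⊛-one using (prove; var; _⊕_; id)

prod-↭ : ∀ F {xs ys} → xs ↭ ys → prod F xs ≈ prod F ys
prod-↭ F ↭.refl = ⊛M.refl
prod-↭ F (↭.prep x h) = ⊛-cong {f = F x} ⊛M.refl (prod-↭ F h)
prod-↭ F (↭.swap {xs} {ys} x y h) = ⊛M.trans {i = F x ⊛ (F y ⊛ prod F xs)} (⊛M.sym (⊛-assoc (F x) (F y) (prod F xs)))
  (⊛M.trans {j = (F y ⊛ F x) ⊛ prod F ys} (⊛-cong (⊛-comm (F x) (F y)) (prod-↭ F h)) (⊛-assoc (F y) (F x) (prod F ys)))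
prod-↭ F (↭.trans h k) = λ i → trans (prod-↭ F h i) (prod-↭ F k i)

IsDivisors : ℕ → List ℕ → Set
IsDivisors n ys = Unique ys × (∀ {d} → d ∈ ys → d ∣ n) × (∀ {d} → d ∣ n → d ∈ ys)

one-divisors : IsDivisors 1 (1 ∷ [])
one-divisors = ([] ∷ []) , (λ { (here refl) → ∣-refl }) , λ d → here (∣1⇒≡1 d)

-- A divisor of a p either is coprime to p and divides a, or is p times a divisor of a. Starting
-- from the list of 1, this fixes products of the shape `1 * p * q`.
times-prime : ∀ {a p ys} → Prime p → ¬ p ∣ a → IsDivisors a ys → IsDivisors (a * p) (ys ++ map (_* p) ys)
times-prime {a} {p} {ys} pr p∤a (u , s , c) = Uniqueₚ.++⁺ u (Uniqueₚ.map⁺ (*-cancelʳ-≡ _ _ p) u) disj , sound , complete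
  where
  instance
    p≢0 : NonZero p
    p≢0 = prime⇒nonZero pr
  disj : ∀ {d} → d ∈ ys × d ∈ map (_* p) ys → ⊥
  disj (i , j) = let (e , _ , eq) = ∈-map⁻ (_* p) j in p∤a (∣-trans (divides e eq) (s i))
  sound : ∀ {d} → d ∈ ys ++ map (_* p) ys → d ∣ a * p
  sound i with ∈-++⁻ ys i
  ... | inj₁ j = ∣-trans (s j) (m∣m*n p)
  ... | inj₂ j = let (e , k , eq) = ∈-map⁻ (_* p) j in subst (_∣ a * p) (sym eq) (*-monoˡ-∣ p (s k))
  complete : ∀ {d} → d ∣ a * p → d ∈ ys ++ map (_* p) ys
  complete {d} h with p ∣? d
  ... | yes (divides e refl) = ∈-++⁺ʳ ys (∈-map⁺ (_* p) (c {e} (*-cancelʳ-∣ p h)))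
  ... | no n = ∈-++⁺ˡ (c (coprime-divisor cop (subst (d ∣_) (*-comm a p) h)))
    where
    cop : Coprime d p
    cop (i , j) with prime⇒irreducible pr j
    ... | inj₁ e = e
    ... | inj₂ e = ⊥-elim (n (subst (_∣ d) e i))

divProd≈ : ∀ F {n ys} → 0 < n → IsDivisors n ys → divProd F n ≈ prod F ys
divProd≈ F {n} {ys} 0<n (u , s , c) = prod-↭ F (∼bag⇒↭ (unique∧set⇒bag (Uniqueₚ.filter⁺ (_∣? n) (Uniqueₚ.applyUpTo⁺₁ suc n λ i<j _ e → <⇒≢ i<j (suc-injective e))) u
  (mk⇔ (λ i → c (proj₂ (∈-filter⁻ (_∣? n) {xs = applyUpTo suc n} i))) λ i → ∈-filter⁺ (_∣? n) (range (s i)) (s i))))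
  where
  range : ∀ {d} → d ∣ n → d ∈ applyUpTo suc n
  range {zero} d∣n = ⊥-elim (<⇒≢ 0<n (sym (0∣⇒≡0 d∣n)))
  range {suc d} d∣n = ∈-applyUpTo⁺ suc (∣⇒≤ {{>-nonZero 0<n}} d∣n)

X : ℕ → Poly
X = xⁿ-1

X-cong : ∀ {a b} → a ≡ b → X a ≈ X b
X-cong refl k = refl

∤-prime : ∀ {p a} → Prime p → Prime a → a ≢ p → ¬ p ∣ a
∤-prime {p} {a} pp pa n d with prime⇒irreducible pa d
... | inj₁ e = ¬prime[1] (subst Prime e pp)
... | inj₂ e = n (sym e)

∤-* : ∀ {p a b} → Prime p → ¬ p ∣ a → ¬ p ∣ b → ¬ p ∣ a * b
∤-* pp na nb d = [ na , nb ]′ (euclidsLemma _ _ pp d)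

module Cyclotomic (F : ℕ → Poly) (cyc : IsCyclotomicFamily F) {p q r : ℕ} (pp : Prime p) (pq : Prime q) (pr : Prime r) (p<q : p < q) (q<r : q < r) where

  open import Relation.Binary.Reasoning.Setoid ⊛M.setoid using (begin_; step-≈-⟩; step-≈-⟨; _∎)

  product : ∀ {n ys} → 0 < n → IsDivisors n ys → X n ≈ prod F ys
  product {n} l D = ⊛M.trans {i = X n} {j = divProd F n} (λ k → sym (cyc n l k)) (divProd≈ F l D)

  pos : ∀ {a} → Prime a → 0 < a
  pos {a} pa = >-nonZero⁻¹ a {{prime⇒nonZero pa}}

  *-pos : ∀ {a b} → 0 < a → 0 < b → 0 < a * b
  *-pos {suc a} {suc b} _ _ = s≤s z≤n

  ∤1 : ∀ {a} → Prime a → ¬ a ∣ 1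
  ∤1 pa d = ¬prime[1] (subst Prime (∣1⇒≡1 d) pa)

  ∤1* : ∀ {a b} → Prime a → Prime b → b < a → ¬ a ∣ 1 * b
  ∤1* pa pb l = ∤-* pa (∤1 pa) (∤-prime pa pb (<⇒≢ l))

  private
    D₁ = one-divisors
    Dp = times-prime pp (∤1 pp) D₁
    Dq = times-prime pq (∤1 pq) D₁
    Dpq = times-prime pq (∤1* pq pp p<q) Dp
    Dpr = times-prime pr (∤1* pr pp (<-trans p<q q<r)) Dp
    Dqr = times-prime pr (∤1* pr pq q<r) Dq
    Dpqr = times-prime pr (∤-* pr (∤1* pr pp (<-trans p<q q<r)) (∤-prime pr pq (<⇒≢ q<r))) Dpq
    Dr = times-prime pr (∤1 pr) D₁
    0<1 : 0 < 1
    0<1 = s≤s z≤n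

  -- Expanded by the defining products, both sides contain each factor F d equally often; `F 1`, for
  -- instance, occurs four times on each side.
  identity : F (1 * p * q * r) ⊛ (X 1 ⊛ (X (1 * p * q) ⊛ (X (1 * p * r) ⊛ X (1 * q * r)))) ≈ X (1 * p * q * r) ⊛ (X (1 * p) ⊛ (X (1 * q) ⊛ X (1 * r)))
  identity = begin
    F (1 * p * q * r) ⊛ (X 1 ⊛ (X (1 * p * q) ⊛ (X (1 * p * r) ⊛ X (1 * q * r))))
      ≈⟨ ⊛-cong {f = F (1 * p * q * r)} ⊛M.refl (⊛-cong (product 0<1 D₁) (⊛-cong (product (*-pos (*-pos 0<1 (pos pp)) (pos pq)) Dpq)
          (⊛-cong (product (*-pos (*-pos 0<1 (pos pp)) (pos pr)) Dpr) (product (*-pos (*-pos 0<1 (pos pq)) (pos pr)) Dqr)))) ⟩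
    F (1 * p * q * r) ⊛ (prod F (1 ∷ []) ⊛ (prod F (1 ∷ 1 * p ∷ 1 * q ∷ 1 * p * q ∷ []) ⊛ (prod F (1 ∷ 1 * p ∷ 1 * r ∷ 1 * p * r ∷ []) ⊛ prod F (1 ∷ 1 * q ∷ 1 * r ∷ 1 * q * r ∷ []))))
      ≈⟨ shuffle ⟩
    prod F (1 ∷ 1 * p ∷ 1 * q ∷ 1 * p * q ∷ 1 * r ∷ 1 * p * r ∷ 1 * q * r ∷ 1 * p * q * r ∷ []) ⊛ (prod F (1 ∷ 1 * p ∷ []) ⊛ (prod F (1 ∷ 1 * q ∷ []) ⊛ prod F (1 ∷ 1 * r ∷ [])))
      ≈⟨ ⊛-cong (product (*-pos (*-pos (*-pos 0<1 (pos pp)) (pos pq)) (pos pr)) Dpqr) (⊛-cong (product (*-pos 0<1 (pos pp)) Dp) (⊛-cong (product (*-pos 0<1 (pos pq)) Dq) (product (*-pos 0<1 (pos pr)) Dr))) ⟨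
    X (1 * p * q * r) ⊛ (X (1 * p) ⊛ (X (1 * q) ⊛ X (1 * r))) ∎
    where
    f₁ = var 0F
    fp = var 1F
    fq = var 2F
    fpq = var 3F
    fr = var 4F
    fpr = var 5F
    fqr = var 6F
    fpqr = var 7F
    shuffle = prove 8
      (fpqr ⊕ ((f₁ ⊕ id) ⊕ ((f₁ ⊕ (fp ⊕ (fq ⊕ (fpq ⊕ id)))) ⊕ ((f₁ ⊕ (fp ⊕ (fr ⊕ (fpr ⊕ id)))) ⊕ (f₁ ⊕ (fq ⊕ (fr ⊕ (fqr ⊕ id))))))))
      ((f₁ ⊕ (fp ⊕ (fq ⊕ (fpq ⊕ (fr ⊕ (fpr ⊕ (fqr ⊕ (fpqr ⊕ id)))))))) ⊕ ((f₁ ⊕ (fp ⊕ id)) ⊕ ((f₁ ⊕ (fq ⊕ id)) ⊕ (f₁ ⊕ (fr ⊕ id)))))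
      (F 1 ∷ F (1 * p) ∷ F (1 * q) ∷ F (1 * p * q) ∷ F (1 * r) ∷ F (1 * p * r) ∷ F (1 * q * r) ∷ F (1 * p * q * r) ∷ [])

-- h(x) ↦ h(x ^ r)
E : (r : ℕ) .{{_ : NonZero r}} → Poly → Poly
E r h k = if ⌊ r ∣? k ⌋ then h (k / r) else + 0

module Dilate (r : ℕ) {{r≢0 : NonZero r}} where
  E-∣ : ∀ h j → E r h (j * r) ≡ h j
  E-∣ h j with r ∣? j * r
  ... | yes _ = cong h (m*n/n≡m j r)
  ... | no n = ⊥-elim (n (divides j refl))

  E-∤ : ∀ h k → ¬ r ∣ k → E r h k ≡ + 0
  E-∤ h k n with r ∣? k
  ... | yes d = ⊥-elim (n d)
  ... | no _ = refl

  E-cong : ∀ {g h} → g ≈ h → E r g ≈ E r h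
  E-cong e k with r ∣? k
  ... | yes _ = e (k / r)
  ... | no _ = refl

  E-one : E r one ≈ one
  E-one zero = E-∣ one 0
  E-one (suc k) with r ∣? suc k
  ... | no _ = refl
  ... | yes (divides (suc j) e) = cong one (trans (cong (_/ r) e) (m*n/n≡m (suc j) r))

  E-sh : ∀ d h → E r (sh d h) ≈ sh (d * r) (E r h)
  E-sh d h k with r ∣? k
  ... | no n with d * r ≤? k
  ...   | no l = sym (sh-> (E r h) (≰⇒> l))
  ...   | yes l = sym (trans (sh-≤ (E r h) l) (E-∤ h (k ∸ d * r) λ x → n (∣m∸n∣n⇒∣m r l x (n∣m*n d))))
  E-sh d h k | yes (divides j refl) with d ≤? j
  ...   | yes l = trans (cong (sh d h) (m*n/n≡m j r)) (trans (sh-≤ h l) (sym (trans (sh-≤ (E r h) (*-monoˡ-≤ r l)) (trans (cong (E r h) (sym (*-distribʳ-∸ r j d))) (E-∣ h (j ∸ d))))))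
  ...   | no l = trans (cong (sh d h) (m*n/n≡m j r)) (trans (sh-> h (≰⇒> l)) (sym (sh-> (E r h) (*-monoˡ-< r (≰⇒> l)))))

  E-X : ∀ d h → E r (X d ⊛ h) ≈ X (d * r) ⊛ E r h
  E-X d h k = trans (E-cong (xⁿ-1-⊛ d h) k) (trans (minus k) (trans (cong (ℤ._- E r h k) (E-sh d h k)) (sym (xⁿ-1-⊛ (d * r) (E r h) k))))
    where
    minus : ∀ k → E r (Δ d h) k ≡ E r (sh d h) k ℤ.- E r h k
    minus k with r ∣? k
    ... | yes _ = refl
    ... | no _ = refl

-- The binary polynomial enters as (x - 1) θ, with θ = (x^(p q) - 1) / ((x^p - 1) (x^q - 1))
-- described by `θ-step` and `ψ-step`, rather than as a member of the family `F`.
module Ternary (F : ℕ → Poly) (cyc : IsCyclotomicFamily F) {p q r : ℕ} (pp : Prime p) (pq : Prime q) (pr : Prime r) (p<q : p < q) (q<r : q < r)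
  {{r≢0 : NonZero r}} {θ ψ G : Poly} (θ-step : Δ q θ ≈ ψ) (ψ-step : Δ p ψ ≈ Δ (p * q) one) (G-step : Δ (p * q) G ≈ E r (Δ 1 θ)) where
  open Cyclotomic F cyc pp pq pr p<q q<r
  open Dilate r

  private
    f : Poly
    f = F (p * q * r)

  open import Relation.Binary.Reasoning.Setoid ⊛M.setoid using (begin_; step-≈-⟩; step-≈-⟨; _∎)

  lift : ∀ d {g h} → Δ d g ≈ h → X d ⊛ g ≈ h
  lift d {g} e k = trans (xⁿ-1-⊛ d g k) (e k)

  identity′ : f ⊛ (X 1 ⊛ (X (p * q) ⊛ (X (p * r) ⊛ X (q * r)))) ≈ X (p * q * r) ⊛ (X p ⊛ (X q ⊛ X r))
  identity′ = subst₂ (λ a b → F (a * q * r) ⊛ (X 1 ⊛ (X (a * q) ⊛ (X (a * r) ⊛ X (b * r)))) ≈ X (a * q * r) ⊛ (X a ⊛ (X b ⊛ X r))) (*-identityˡ p) (*-identityˡ q)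
    (subst (λ c → F (1 * p * q * r) ⊛ (X 1 ⊛ (X (1 * p * q) ⊛ (X (1 * p * r) ⊛ X (1 * q * r)))) ≈ X (1 * p * q * r) ⊛ (X (1 * p) ⊛ (X (1 * q) ⊛ X c))) (*-identityˡ r) identity)

  dilated : X (p * r) ⊛ (X (q * r) ⊛ (X (p * q) ⊛ G)) ≈ X r ⊛ X (p * q * r)
  dilated = begin
    X (p * r) ⊛ (X (q * r) ⊛ (X (p * q) ⊛ G)) ≈⟨ ⊛-cong {f = X (p * r)} ⊛M.refl (⊛-cong {f = X (q * r)} ⊛M.refl (⊛M.trans {i = X (p * q) ⊛ G} (lift (p * q) G-step) (E-cong λ k → sym (xⁿ-1-⊛ 1 θ k)))) ⟩
    X (p * r) ⊛ (X (q * r) ⊛ E r (X 1 ⊛ θ)) ≈⟨ ⊛-cong {f = X (p * r)} ⊛M.refl (E-X q (X 1 ⊛ θ)) ⟨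
    X (p * r) ⊛ E r (X q ⊛ (X 1 ⊛ θ)) ≈⟨ E-X p (X q ⊛ (X 1 ⊛ θ)) ⟨
    E r (X p ⊛ (X q ⊛ (X 1 ⊛ θ))) ≈⟨ E-cong base ⟩
    E r (X 1 ⊛ (X (p * q) ⊛ one)) ≈⟨ E-X 1 (X (p * q) ⊛ one) ⟩
    X (1 * r) ⊛ E r (X (p * q) ⊛ one) ≈⟨ ⊛-cong (X-cong (*-identityˡ r)) (⊛M.trans {i = E r (X (p * q) ⊛ one)} (E-X (p * q) one) (⊛M.trans {i = X (p * q * r) ⊛ E r one} (⊛-cong {f = X (p * q * r)} ⊛M.refl E-one) (⊛M.identityʳ (X (p * q * r))))) ⟩
    X r ⊛ X (p * q * r) ∎
    where
    base : X p ⊛ (X q ⊛ (X 1 ⊛ θ)) ≈ X 1 ⊛ (X (p * q) ⊛ one)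
    base = begin
      X p ⊛ (X q ⊛ (X 1 ⊛ θ)) ≈⟨ prove 4 (var 0F ⊕ (var 1F ⊕ (var 2F ⊕ var 3F))) (var 2F ⊕ (var 0F ⊕ (var 1F ⊕ var 3F))) (X p ∷ X q ∷ X 1 ∷ θ ∷ []) ⟩
      X 1 ⊛ (X p ⊛ (X q ⊛ θ)) ≈⟨ ⊛-cong {f = X 1} ⊛M.refl (⊛-cong {f = X p} ⊛M.refl (lift q θ-step)) ⟩
      X 1 ⊛ (X p ⊛ ψ) ≈⟨ ⊛-cong {f = X 1} ⊛M.refl (lift p ψ-step) ⟩
      X 1 ⊛ Δ (p * q) one ≈⟨ ⊛-cong {f = X 1} ⊛M.refl (xⁿ-1-⊛ (p * q) one) ⟨
      X 1 ⊛ (X (p * q) ⊛ one) ∎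

  -- All denominators are multiplied out and cleared again by cancelling factors x^d - 1. `sh-sum`
  -- is the quotient (x^p - 1) / (x - 1) as an operator.
  factored : f ≈ sh-sum p (Δ q G)
  factored = ⊛-cancel (s≤s z≤n) (begin
    X 1 ⊛ f ≈⟨ ⊛-cancel (*-pos (pos pp) (pos pr)) (⊛-cancel (*-pos (pos pq) (pos pr)) (⊛-cancel (*-pos (pos pp) (pos pq)) cleared)) ⟩
    X p ⊛ (X q ⊛ G) ≈⟨ ⊛-cong {f = X p} ⊛M.refl (xⁿ-1-⊛ q G) ⟩
    X p ⊛ Δ q G ≈⟨ xⁿ-1-⊛ p (Δ q G) ⟩
    Δ p (Δ q G) ≈⟨ Δ-sh-sum p (Δ q G) ⟨
    Δ 1 (sh-sum p (Δ q G)) ≈⟨ xⁿ-1-⊛ 1 (sh-sum p (Δ q G)) ⟨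
    X 1 ⊛ sh-sum p (Δ q G) ∎)
    where
    cleared : X (p * q) ⊛ (X (q * r) ⊛ (X (p * r) ⊛ (X 1 ⊛ f))) ≈ X (p * q) ⊛ (X (q * r) ⊛ (X (p * r) ⊛ (X p ⊛ (X q ⊛ G))))
    cleared = begin
      X (p * q) ⊛ (X (q * r) ⊛ (X (p * r) ⊛ (X 1 ⊛ f))) ≈⟨ prove 5 (var 0F ⊕ (var 1F ⊕ (var 2F ⊕ (var 3F ⊕ var 4F)))) (var 4F ⊕ (var 3F ⊕ (var 0F ⊕ (var 2F ⊕ var 1F)))) (X (p * q) ∷ X (q * r) ∷ X (p * r) ∷ X 1 ∷ f ∷ []) ⟩
      f ⊛ (X 1 ⊛ (X (p * q) ⊛ (X (p * r) ⊛ X (q * r)))) ≈⟨ identity′ ⟩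
      X (p * q * r) ⊛ (X p ⊛ (X q ⊛ X r)) ≈⟨ prove 4 (var 0F ⊕ (var 1F ⊕ (var 2F ⊕ var 3F))) (var 1F ⊕ (var 2F ⊕ (var 3F ⊕ var 0F))) (X (p * q * r) ∷ X p ∷ X q ∷ X r ∷ []) ⟩
      X p ⊛ (X q ⊛ (X r ⊛ X (p * q * r))) ≈⟨ ⊛-cong {f = X p} ⊛M.refl (⊛-cong {f = X q} ⊛M.refl dilated) ⟨
      X p ⊛ (X q ⊛ (X (p * r) ⊛ (X (q * r) ⊛ (X (p * q) ⊛ G)))) ≈⟨ prove 6 (var 0F ⊕ (var 1F ⊕ (var 2F ⊕ (var 3F ⊕ (var 4F ⊕ var 5F))))) (var 4F ⊕ (var 3F ⊕ (var 2F ⊕ (var 0F ⊕ (var 1F ⊕ var 5F))))) (X p ∷ X q ∷ X (p * r) ∷ X (q * r) ∷ X (p * q) ∷ G ∷ []) ⟩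
      X (p * q) ⊛ (X (q * r) ⊛ (X (p * r) ⊛ (X p ⊛ (X q ⊛ G)))) ∎

-- Binary cyclotomic coefficients

mod-gap : ∀ {C u v} i j → u + i * C ≡ v + j * C → u < v → v < u + C → ⊥
mod-gap {C} {u} {v} i j e l h with i ≤? j
... | yes k = lin⊥ (i ∷ C ∷ j ∷ v ∷ u ∷ []) (v0 :* v1 <= v2 :* v1 by scaleS C k & v3 :+ v2 :* v1 ==˘ v4 :+ v0 :* v1 by e & # 1 :+ v4 <= v3 by l) refl
... | no k = lin⊥ (j ∷ C ∷ i ∷ u ∷ v ∷ []) ((# 1 :+ v0) :* v1 <= v2 :* v1 by scaleS C (≰⇒> k) & v3 :+ v2 :* v1 == v4 :+ v0 :* v1 by e & # 1 :+ v4 <= v3 :+ v1 by h) refl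

ι-yes : ∀ {A : Set} {d : Dec A} → A → ι ⌊ d ⌋ ≡ + 1
ι-yes {d = d} a = cong ι (dec-intro {d = d} a)
ι-no : ∀ {A : Set} {d : Dec A} → ¬ A → ι ⌊ d ⌋ ≡ + 0
ι-no {d = d} a = cong ι (dec-no {d = d} a)

sh-neg : ∀ d f k → sh d (λ i → ℤ.- f i) k ≡ ℤ.- sh d f k
sh-neg zero f k = refl
sh-neg (suc d) f zero = refl
sh-neg (suc d) f (suc k) = sh-neg d f k

module BinaryCoefficients (p q : ℕ) {{_ : NonZero p}} {{_ : NonZero q}} (Q s : ℕ) (1<p : 1 < p) (1<q : 1 < q) (0<Q : 0 < Q) (0<s : 0 < s) (bez : Q * q + s * p ≡ p * q + 1) where
  open Coordinates p q Q s 0 0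
  C : ℕ
  C = p * q
  -- The representative x q + y p of k with x < p and y < q. For k < p q it is k or k + p q.
  S : ℕ → ℕ
  S k = xc k * q + hc k * p

  x< : ∀ k → xc k < p
  x< k = m%n<n _ p
  y< : ∀ k → hc k < q
  y< k = m%n<n _ q

  Q<p : Q < p
  Q<p = *-cancelʳ-< q Q p (lin≤ (Q ∷ q ∷ p ∷ s ∷ []) (# 1 :+ (v0 :* v1)) (v2 :* v1) (v0 :* v1 :+ v3 :* v2 == v2 :* v1 :+ # 1 by bez & # 1 :* v2 <= v3 :* v2 by scaleS p 0<s & # 1 :+ # 1 <= v2 by 1<p) refl)
  s<q : s < q
  s<q = *-cancelʳ-< p s q (lin≤ (s ∷ p ∷ q ∷ Q ∷ []) (# 1 :+ (v0 :* v1)) (v2 :* v1) (v3 :* v2 :+ v0 :* v1 == v1 :* v2 :+ # 1 by bez & # 1 :* v2 <= v3 :* v2 by scaleS q 0<Q & # 1 :+ # 1 <= v2 by 1<q) refl)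
  p≤C : p ≤ C
  p≤C = lin≤* (p ∷ q ∷ []) 2 v0 (v0 :* v1) (v0 :* # 2 <= v0 :* v1 by (p ⋆ 1<q)) refl
  q≤C : q ≤ C
  q≤C = lin≤* (q ∷ p ∷ []) 2 v0 (v1 :* v0) (# 2 :* v0 <= v1 :* v0 by scaleS q 1<p) refl

  S< : ∀ k → S k + 2 ≤ 2 * C
  S< k = lin≤ ((xc k) ∷ q ∷ (hc k) ∷ p ∷ []) (v0 :* v1 :+ v2 :* v3 :+ # 2) (# 2 :* (v3 :* v1)) ((# 1 :+ v0) :* v1 <= v3 :* v1 by scaleS q (x< k) & (# 1 :+ v2) :* v3 <= v1 :* v3 by scaleS p (y< k) & # 1 :+ # 1 <= v3 by 1<p & # 1 :+ # 1 <= v1 by 1<q) refl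

  lq : ℕ → ℕ
  lq k = (k + 0) * Q / p + (k + 0) * s / q
  S≡ : ∀ k → k + k * C ≡ S k + lq k * C
  S≡ k = lin≡ (k ∷ p ∷ q ∷ (xc k) ∷ (hc k) ∷ (lq k) ∷ []) (v0 :+ v0 :* (v1 :* v2)) (v3 :* v2 :+ v4 :* v1 :+ v5 :* (v1 :* v2)) (v0 :+ (v0 :+ # 0 :+ # 0) :* (v1 :* v2) ≐ v3 :* v2 :+ (v4 :* v1 :+ # 0) :+ v5 :* (v1 :* v2) by residue {0} bez refl k) refl

  S-mod : ∀ {k} → k < C → Mod C k (S k)
  S-mod {k} k<C = mod-lift k (lq k) k<C (lin≤ ((S k) ∷ C ∷ []) (# 1 :+ v0) (# 2 :* v1) (v0 :+ # 2 <= # 2 :* v1 by S< k) refl) (S≡ k)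

  x+1 : ∀ k → Mod p (xc (suc k)) (xc k + Q)
  x+1 k = mod-lift {p} {xc (suc k)} {xc k + Q} ((suc k + 0) * Q / p + 0 * q * Q + 0) ((k + 0) * Q / p + 0 + 0 * q * Q) (x< (suc k)) (lin≤ ((xc k) ∷ Q ∷ p ∷ []) (# 1 :+ (v0 :+ v1)) (# 2 :* v2) (# 1 :+ v0 <= v2 by x< k & # 1 :+ v1 <= v2 by Q<p) refl)
    (res-shift {p} {q} {Q} {0} {suc k} {k} {1} {Q} {xc (suc k)} {xc k} ((suc k + 0) * Q / p) ((k + 0) * Q / p) 0 0 0 0 (quot-rem ((suc k + 0) * Q) p) (quot-rem ((k + 0) * Q) p)
      (lin≡ (k ∷ q ∷ p ∷ []) (# 1 :+ v0 :+ # 0 :* (v1 :* v2)) (v0 :+ # 1 :+ # 0 :* (v1 :* v2)) trivialᵉ refl) (lin≡ (Q ∷ p ∷ []) (v0 :+ # 0 :* v1) (# 1 :* v0 :+ # 0 :* v1) trivialᵉ refl))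
  y+1 : ∀ k → Mod q (hc (suc k)) (hc k + s)
  y+1 k = mod-lift {q} {hc (suc k)} {hc k + s} ((suc k + 0) * s / q + 0 * p * s + 0) ((k + 0) * s / q + 0 + 0 * p * s) (y< (suc k)) (lin≤ ((hc k) ∷ s ∷ q ∷ []) (# 1 :+ (v0 :+ v1)) (# 2 :* v2) (# 1 :+ v0 <= v2 by y< k & # 1 :+ v1 <= v2 by s<q) refl)
    (res-shift {q} {p} {s} {0} {suc k} {k} {1} {s} {hc (suc k)} {hc k} ((suc k + 0) * s / q) ((k + 0) * s / q) 0 0 0 0 (quot-rem ((suc k + 0) * s) q) (quot-rem ((k + 0) * s) q)
      (lin≡ (k ∷ p ∷ q ∷ []) (# 1 :+ v0 :+ # 0 :* (v1 :* v2)) (v0 :+ # 1 :+ # 0 :* (v1 :* v2)) trivialᵉ refl) (lin≡ (s ∷ q ∷ []) (v0 :+ # 0 :* v1) (# 1 :* v0 :+ # 0 :* v1) trivialᵉ refl))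
  x+q : ∀ k → Mod p (xc (k + q)) (xc k + 1)
  x+q k = mod-lift {p} {xc (k + q)} {xc k + 1} ((k + q + 0) * Q / p + 0 * q * Q + s) ((k + 0) * Q / p + q + 0 * q * Q) (x< (k + q)) (lin≤ ((xc k) ∷ p ∷ []) (# 1 :+ (v0 :+ # 1)) (# 2 :* v1) (# 1 :+ v0 <= v1 by x< k & # 1 :+ # 1 <= v1 by 1<p) refl)
    (res-shift {p} {q} {Q} {0} {k + q} {k} {q} {1} {xc (k + q)} {xc k} ((k + q + 0) * Q / p) ((k + 0) * Q / p) 0 0 q s (quot-rem ((k + q + 0) * Q) p) (quot-rem ((k + 0) * Q) p)
      refl (lin≡ (q ∷ p ∷ Q ∷ s ∷ []) (# 1 :+ v0 :* v1) (v0 :* v2 :+ v3 :* v1) (v1 :* v0 :+ # 1 ≐ v2 :* v0 :+ v3 :* v1 by (sym bez)) refl))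
  y+q : ∀ k → hc (k + q) ≡ hc k
  y+q k = uniq ((k + q + 0) * s / q + 0 * p * s + 0) ((k + 0) * s / q + s + 0 * p * s) (y< (k + q)) (y< k) (subst (λ z → hc (k + q) + ((k + q + 0) * s / q + 0 * p * s + 0) * q ≡ z + ((k + 0) * s / q + s + 0 * p * s) * q) (+-identityʳ (hc k))
    (res-shift {q} {p} {s} {0} {k + q} {k} {q} {0} {hc (k + q)} {hc k} ((k + q + 0) * s / q) ((k + 0) * s / q) 0 0 s 0 (quot-rem ((k + q + 0) * s) q) (quot-rem ((k + 0) * s) q)
      refl (lin≡ (s ∷ q ∷ []) (# 0 :+ v0 :* v1) (v1 :* v0 :+ # 0 :* v1) trivialᵉ refl)))
  y+p : ∀ k → Mod q (hc (k + p)) (hc k + 1)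
  y+p k = mod-lift {q} {hc (k + p)} {hc k + 1} ((k + p + 0) * s / q + 0 * p * s + Q) ((k + 0) * s / q + p + 0 * p * s) (y< (k + p)) (lin≤ ((hc k) ∷ q ∷ []) (# 1 :+ (v0 :+ # 1)) (# 2 :* v1) (# 1 :+ v0 <= v1 by y< k & # 1 :+ # 1 <= v1 by 1<q) refl)
    (res-shift {q} {p} {s} {0} {k + p} {k} {p} {1} {hc (k + p)} {hc k} ((k + p + 0) * s / q) ((k + 0) * s / q) 0 0 p Q (quot-rem ((k + p + 0) * s) q) (quot-rem ((k + 0) * s) q)
      refl (lin≡ (p ∷ q ∷ s ∷ Q ∷ []) (# 1 :+ v0 :* v1) (v0 :* v2 :+ v3 :* v1) (v0 :* v1 :+ # 1 ≐ v3 :* v1 :+ v2 :* v0 by (sym bez)) refl))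
  y-C : hc C ≡ 0
  y-C = uniq ((C + 0) * s / q) (p * s) (y< C) (<-trans (s≤s z≤n) 1<q) (lin≡ ((hc C) ∷ ((C + 0) * s / q) ∷ q ∷ p ∷ s ∷ []) (v0 :+ v1 :* v2) (# 0 :+ v3 :* v4 :* v2) (v0 :+ v1 :* v2 ≐ (v3 :* v2 :+ # 0) :* v4 by quot-rem ((C + 0) * s) q) refl)
  x-0 : xc 0 ≡ 0
  x-0 = m<n⇒m%n≡m {m = 0} (<-trans (s≤s z≤n) 1<p)
  y-0 : hc 0 ≡ 0
  y-0 = m<n⇒m%n≡m {m = 0} (<-trans (s≤s z≤n) 1<q)

  -- `χ` is the indicator of the semigroup generated by p and q. Then `θ` = - `χ` expands (x^(p q) -
  -- 1) / ((x^p - 1) (x^q - 1)), and `ψ` is the sum of x^(y p) over y < q.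
  χ θ ψ c : Poly
  χ k = ι ⌊ S k ≤? k ⌋
  θ k = ℤ.- χ k
  ψ k = ι ⌊ k ≟ hc k * p ⌋
  c = Δ 1 θ

  -- The Frobenius bound: S k > k would mean S k ≥ k + p q, beyond the maximum 2 p q - p - q.
  χ-top : ∀ {k} → C ≤ suc k → χ k ≡ + 1
  χ-top {k} h = ι-yes {d = S k ≤? k} (by-contra λ l → mod-gap k (lq k) (S≡ k) l (lin≤ ((S k) ∷ k ∷ C ∷ []) (# 1 :+ v0) (v1 :+ v2) (v0 :+ # 2 <= # 2 :* v2 by S< k & v2 <= # 1 :+ v1 by h) refl))

  c-high : ∀ {k} → C ≤ k → c k ≡ + 0
  c-high {zero} h = lin⊥ (p ∷ C ∷ []) (v0 <= v1 by p≤C & v1 <= # 0 by h & # 1 :+ # 1 <= v0 by 1<p) refl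
  c-high {suc k} h = cong₂ (λ a b → ℤ.- a ℤ.- (ℤ.- b)) (χ-top {k} h) (χ-top {suc k} (m≤n⇒m≤1+n h))

  n[_] : Bool → ℕ
  n[ b ] = if b then 1 else 0

  wrap : ∀ {M u v} → Mod M u v → Σ Bool λ a → u + n[ a ] * M ≡ v
  wrap {M} {u} (inj₁ e) = false , trans (+-identityʳ u) e
  wrap {M} {u} (inj₂ e) = true , trans (cong (λ z → u + z) (+-identityʳ M)) e

  -- From j to j + 1 the coordinates grow by (Q, s), with carries a and b. By Q q + s p = p q + 1
  -- the wraps of S satisfy σ′ + a + b = σ + 1, so the coefficient σ - σ′ is a + b - 1; a carry
  -- shows in the new coordinate being below Q, respectively s.
  c-low : ∀ {k} → k < C → c k ≡ ι ⌊ xc k <? Q ⌋ ℤ.+ ι ⌊ hc k <? s ⌋ ℤ.- + 1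
  c-low {zero} _ = trans (cong (λ a → + 0 ℤ.- (ℤ.- a)) (ι-yes {d = S 0 ≤? 0} (≤-reflexive (cong₂ (λ a b → a * q + b * p) x-0 y-0))))
    (sym (cong₂ (λ a b → a ℤ.+ b ℤ.- + 1) (ι-yes {d = xc 0 <? Q} (subst (_< Q) (sym x-0) 0<Q)) (ι-yes {d = hc 0 <? s} (subst (_< s) (sym y-0) 0<s))))
  c-low {suc j} k<C = go (wrap (S-mod k<C)) (wrap (S-mod (<-trans ≤-refl k<C))) (wrap (x+1 j)) (wrap (y+1 j))
    where
    x x′ y y′ S₀ S₁ : ℕ
    x = xc j
    x′ = xc (suc j)
    y = hc j
    y′ = hc (suc j)
    S₀ = S j
    S₁ = S (suc j)
    high-bit : ∀ {k} a → k + n[ a ] * C ≡ S k → χ k ≡ ι (not a)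
    high-bit {k} false e = ι-yes {d = S k ≤? k} (≤-reflexive (trans (sym e) (+-identityʳ k)))
    high-bit {k} true e = ι-no {d = S k ≤? k} λ l → (lin⊥ (k ∷ C ∷ (S k) ∷ p ∷ []) (v0 :+ (# 1 :* v1) == v2 by e & v2 <= v0 by l & v3 <= v1 by p≤C & # 1 :+ # 1 <= v3 by 1<p) refl)
    wrapped : ∀ {M u v T} a → v < M → u + n[ a ] * M ≡ v + T → ι ⌊ u <? T ⌋ ≡ ι a
    wrapped {M} {u} {v} {T} false l e = ι-no {d = u <? T} λ h → (lin⊥ (v ∷ T ∷ u ∷ M ∷ []) (v0 :+ v1 ==˘ v2 :+ (# 0 :* v3) by e & # 1 :+ v2 <= v1 by h) refl)
    wrapped {M} {u} {v} {T} true l e = ι-yes {d = u <? T} (lin≤ (u ∷ T ∷ M ∷ v ∷ []) (# 1 :+ v0) v1 (v0 :+ (# 1 :* v2) == v3 :+ v1 by e & # 1 :+ v3 <= v2 by l) refl)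
    finish : ∀ σ′ σ a b → n[ σ′ ] + n[ a ] + n[ b ] ≡ n[ σ ] + 1 → (ℤ.- ι (not σ)) ℤ.- (ℤ.- ι (not σ′)) ≡ ι a ℤ.+ ι b ℤ.- + 1
    finish false false true false _ = refl
    finish false false false true _ = refl
    finish false true true true _ = refl
    finish true false false false _ = refl
    finish true true true false _ = refl
    finish true true false true _ = refl
    finish false false true true ()
    finish true false true true ()
    finish true true true true ()
    finish true true false false ()
    finish true false false true ()
    finish true false true false ()
    finish false true true false ()
    finish false true false true ()
    finish false true false false ()
    finish false false false false ()
    go : (Σ Bool λ σ′ → suc j + n[ σ′ ] * C ≡ S₁) → (Σ Bool λ σ → j + n[ σ ] * C ≡ S₀) →
         (Σ Bool λ a → x′ + n[ a ] * p ≡ x + Q) → (Σ Bool λ b → y′ + n[ b ] * q ≡ y + s) → c (suc j) ≡ ι ⌊ x′ <? Q ⌋ ℤ.+ ι ⌊ y′ <? s ⌋ ℤ.- + 1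
    go (σ′ , e₁) (σ , e₀) (a , ea) (b , eb) = trans (cong₂ (λ u v → (ℤ.- u) ℤ.- (ℤ.- v)) (high-bit {j} σ e₀) (high-bit {suc j} σ′ e₁)) (trans (finish σ′ σ a b count)
      (sym (cong₂ (λ u v → u ℤ.+ v ℤ.- + 1) (wrapped a (x< j) ea) (wrapped b (y< j) eb))))
      where
      count : n[ σ′ ] + n[ a ] + n[ b ] ≡ n[ σ ] + 1
      count = *-cancelʳ-≡ _ _ C {{>-nonZero (<-trans (s≤s z≤n) (≤-trans 1<p p≤C))}}
        (lin≡ ((n[ σ′ ]) ∷ (n[ a ]) ∷ (n[ b ]) ∷ p ∷ q ∷ (n[ σ ]) ∷ j ∷ x′ ∷ y′ ∷ x ∷ y ∷ Q ∷ s ∷ []) ((v0 :+ v1 :+ v2) :* (v3 :* v4)) ((v5 :+ # 1) :* (v3 :* v4)) (# 1 :+ v6 :+ v0 :* (v3 :* v4) ≐ v7 :* v4 :+ v8 :* v3 by e₁ &ᵉ v9 :* v4 :+ v10 :* v3 ≐ v6 :+ v5 :* (v3 :* v4) by (sym e₀) &ᵉ (v7 :+ v1 :* v3) :* v4 ≐ (v9 :+ v11) :* v4 by cong (_* q) ea &ᵉ (v8 :+ v2 :* v4) :* v3 ≐ (v10 :+ v12) :* v3 by cong (_* p) eb &ᵉ v11 :* v4 :+ v12 :* v3 ≐ v3 :* v4 :+ # 1 by bez) refl)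

  step : ∀ {a b c} x y z → a ≡ x → b ≡ y → c ≡ z → (ℤ.- x) ℤ.- (ℤ.- y) ≡ z → (ℤ.- a) ℤ.- (ℤ.- b) ≡ c
  step x y z refl refl refl e = e

  -- Adding q raises x by one and keeps y. Unless x wraps to 0, membership in the semigroup is
  -- unchanged; if it wraps, the two indicators differ only at the point y p itself.
  θ-step : Δ q θ ≈ ψ
  θ-step k with q ≤? k
  ... | no l = trans (cong (ℤ._- θ k) (sh-> θ (≰⇒> l))) (trans (neg-neg (χ k)) (cong ι (dec-cong {d = S k ≤? k} {e = k ≟ hc k * p} to from)))
    where
    neg-neg : ∀ z → + 0 ℤ.- (ℤ.- z) ≡ z
    neg-neg z = trans (ℤP.+-identityˡ _) (ℤP.neg-involutive z)
    k<C : k < C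
    k<C = ≤-trans (≰⇒> l) q≤C
    to : S k ≤ k → k ≡ hc k * p
    to h = go (xc k) refl (S-mod k<C)
      where
      go : ∀ x → x ≡ xc k → Mod C k (S k) → k ≡ hc k * p
      go zero e (inj₁ m) = trans m (cong (λ z → z * q + hc k * p) (sym e))
      go (suc x) e _ = lin⊥ (k ∷ q ∷ x ∷ (hc k) ∷ p ∷ []) (# 1 :+ v0 <= v1 by ≰⇒> l & (# 1 :+ v2) :* v1 :+ v3 :* v4 <= v0 by ≤-trans (≤-reflexive (cong (λ z → z * q + hc k * p) e)) h) refl
      go _ e (inj₂ m) = lin⊥ (k ∷ C ∷ (S k) ∷ p ∷ []) (v0 :+ v1 == v2 by m & v2 <= v0 by h & v3 <= v1 by p≤C & # 1 :+ # 1 <= v3 by 1<p) refl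
    from : k ≡ hc k * p → S k ≤ k
    from h = by-contra λ g → mod-gap k (lq k) (S≡ k) g (lin≤ ((xc k) ∷ q ∷ (hc k) ∷ p ∷ k ∷ []) (# 1 :+ (v0 :* v1 :+ v2 :* v3)) (v4 :+ v3 :* v1) (v2 :* v3 ==˘ v4 by h & (# 1 :+ v0) :* v1 <= v3 :* v1 by scaleS q (x< k) & # 1 :+ # 1 <= v1 by 1<q) refl)
  ... | yes l = subst (λ k → Δ q θ k ≡ ψ k) (m∸n+n≡m l) (main (k ∸ q))
    where
    main : ∀ j → Δ q θ (j + q) ≡ ψ (j + q)
    main j = trans (cong (ℤ._- θ (j + q)) (trans (sh-≤ θ (m≤n+m q j)) (cong θ (m+n∸n≡m j q)))) (go (x+q j))
      where
      Y x x′ : ℕ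
      Y = hc j * p
      x = xc j
      x′ = xc (j + q)
      y≡ : hc (j + q) ≡ hc j
      y≡ = y+q j
      S′ : S (j + q) ≡ x′ * q + Y
      S′ = cong (λ z → x′ * q + z * p) y≡
      go : Mod p x′ (x + 1) → (ℤ.- χ j) ℤ.- (ℤ.- χ (j + q)) ≡ ψ (j + q)
      go (inj₁ e) = trans (cong (λ z → (ℤ.- z) ℤ.- (ℤ.- χ (j + q))) (cong ι (dec-cong {d = S j ≤? j} {e = S (j + q) ≤? j + q} to from))) (trans (ℤP.+-inverseʳ (ℤ.- χ (j + q)))
        (sym (ι-no {d = j + q ≟ hc (j + q) * p} bad)))
        where
        to : S j ≤ j → S (j + q) ≤ j + q
        to h = lin≤ ((S (j + q)) ∷ j ∷ q ∷ x′ ∷ Y ∷ x ∷ []) v0 (v1 :+ v2) (v0 == v3 :* v2 :+ v4 by S′ & v3 :* v2 == (v5 :+ # 1) :* v2 by cong (_* q) e & v5 :* v2 :+ v4 <= v1 by h) refl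
        from : S (j + q) ≤ j + q → S j ≤ j
        from h = lin≤ (x ∷ q ∷ Y ∷ j ∷ x′ ∷ (S (j + q)) ∷ []) (v0 :* v1 :+ v2) v3 (v4 :* v1 :+ v2 ==˘ v5 by S′ & (v0 :+ # 1) :* v1 ==˘ v4 :* v1 by cong (_* q) e & v5 <= v3 :+ v1 by h) refl
        bad : j + q ≢ hc (j + q) * p
        bad h = mod-gap (j + q) (lq (j + q)) (S≡ (j + q)) (lin≤ (j ∷ q ∷ (S (j + q)) ∷ Y ∷ x′ ∷ x ∷ []) (# 1 :+ (v0 :+ v1)) v2 (v0 :+ v1 == v3 by h′ & v4 :* v1 :+ v3 ==˘ v2 by S′ & (v5 :+ # 1) :* v1 ==˘ v4 :* v1 by cong (_* q) e & # 1 :+ # 1 <= v1 by 1<q) refl) (lin≤ ((S (j + q)) ∷ j ∷ q ∷ p ∷ Y ∷ x′ ∷ []) (# 1 :+ v0) (v1 :+ v2 :+ v3 :* v2) (v4 ==˘ v1 :+ v2 by h′ & v0 == v5 :* v2 :+ v4 by S′ & (# 1 :+ v5) :* v2 <= v3 :* v2 by scaleS q (x< (j + q)) & # 1 :+ # 1 <= v2 by 1<q) refl)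
          where
          h′ : j + q ≡ Y
          h′ = trans h (cong (_* p) y≡)
      go (inj₂ e) = cases (Y ≤? j + q) (j + q ≟ Y)
        where
        x′≡0 : x′ ≡ 0
        x′≡0 = n≤0⇒n≡0 (lin≤ (x′ ∷ p ∷ x ∷ []) v0 (# 0) (v0 :+ v1 == v2 :+ # 1 by e & # 1 :+ v2 <= v1 by x< j) refl)
        S₁ : S (j + q) ≡ Y
        S₁ = trans S′ (cong (λ z → z * q + Y) x′≡0)
        S₀ : S j + q ≡ Y + C
        S₀ = lin≡ (x ∷ q ∷ Y ∷ p ∷ x′ ∷ []) (v0 :* v1 :+ v2 :+ v1) (v2 :+ v3 :* v1) ((v0 :+ # 1) :* v1 ≐ (v4 :+ v3) :* v1 by (sym (cong (_* q) e)) &ᵉ v4 :* v1 ≐ # 0 :* v1 by cong (_* q) x′≡0) refl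
        χ₁ : χ (j + q) ≡ ι ⌊ Y ≤? j + q ⌋
        χ₁ = cong ι (dec-cong {d = S (j + q) ≤? j + q} {e = Y ≤? j + q} (subst (_≤ j + q) S₁) (subst (_≤ j + q) (sym S₁)))
        ψ₁ : ψ (j + q) ≡ ι ⌊ j + q ≟ Y ⌋
        ψ₁ = cong ι (dec-cong {d = j + q ≟ hc (j + q) * p} {e = j + q ≟ Y} (λ z → trans z (cong (_* p) y≡)) (λ z → trans z (sym (cong (_* p) y≡))))
        cases : Dec (Y ≤ j + q) → Dec (j + q ≡ Y) → (ℤ.- χ j) ℤ.- (ℤ.- χ (j + q)) ≡ ψ (j + q)
        cases (no n) _ = step (+ 0) (+ 0) (+ 0) (ι-no {d = S j ≤? j} λ h → (lin⊥ (Y ∷ p ∷ q ∷ (S j) ∷ j ∷ []) (v0 :+ v1 :* v2 ==˘ v3 :+ v2 by S₀ & v3 <= v4 by h & # 1 :+ (v4 :+ v2) <= v0 by ≰⇒> n) refl)) (trans χ₁ (ι-no {d = Y ≤? j + q} n)) (trans ψ₁ (ι-no {d = j + q ≟ Y} λ z → n (≤-reflexive (sym z)))) refl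
        cases (yes u) (yes v) = step (+ 0) (+ 1) (+ 1) (ι-no {d = S j ≤? j} λ h → (lin⊥ (Y ∷ C ∷ (S j) ∷ q ∷ j ∷ p ∷ []) (v0 :+ v1 ==˘ v2 :+ v3 by S₀ & v2 <= v4 by h & v4 :+ v3 == v0 by v & v5 <= v1 by p≤C & # 1 :+ # 1 <= v5 by 1<p) refl)) (trans χ₁ (ι-yes {d = Y ≤? j + q} u)) (trans ψ₁ (ι-yes {d = j + q ≟ Y} v)) refl
        cases (yes u) (no v) = step (+ 1) (+ 1) (+ 0) (ι-yes {d = S j ≤? j} (by-contra λ h → mod-gap (lq (j + q)) (j + q) (sym (subst (λ z → j + q + (j + q) * C ≡ z + lq (j + q) * C) S₁ (S≡ (j + q)))) (≤∧≢⇒< u (λ z → v (sym z))) (lin≤ (j ∷ q ∷ Y ∷ C ∷ (S j) ∷ []) (# 1 :+ (v0 :+ v1)) (v2 :+ v3) (v4 :+ v1 == v2 :+ v3 by S₀ & # 1 :+ v0 <= v4 by h) refl)))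
          (trans χ₁ (ι-yes {d = Y ≤? j + q} u)) (trans ψ₁ (ι-no {d = j + q ≟ Y} v)) refl

  sh-one : ∀ d k → sh d one k ≡ ι ⌊ k ≟ d ⌋
  sh-one d k = trans (sh-cong d one≈ k) (trans (sym (x^-⊛ d (x^ 0) k)) (trans (⊛-comm (x^ d) (x^ 0) k) (x^-⊛ 0 (x^ d) k)))

  ψ-step : Δ p ψ ≈ Δ C one
  ψ-step k with p ≤? k
  ... | no l = cong₂ ℤ._-_ (trans (sh-> ψ (≰⇒> l)) (sym (sh-> one (≤-trans (≰⇒> l) p≤C)))) (trans (cong ι (dec-cong {d = k ≟ hc k * p} {e = k ≟ 0} to from)) (sym (one≈ k)))
    where
    to : k ≡ hc k * p → k ≡ 0
    to h = go (hc k) h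
      where
      go : ∀ y → k ≡ y * p → k ≡ 0
      go zero e = e
      go (suc y) e = lin⊥ (y ∷ p ∷ k ∷ []) ((# 1 :+ v0) :* v1 ==˘ v2 by e & # 1 :+ v2 <= v1 by ≰⇒> l) refl
    from : k ≡ 0 → k ≡ hc k * p
    from refl = cong (_* p) (sym y-0)
  ... | yes l = subst (λ k → Δ p ψ k ≡ Δ C one k) (m∸n+n≡m l) (main (k ∸ p))
    where
    main : ∀ j → Δ p ψ (j + p) ≡ Δ C one (j + p)
    main j = trans (cong (ℤ._- ψ (j + p)) (trans (sh-≤ ψ (m≤n+m p j)) (cong ψ (m+n∸n≡m j p)))) (trans (go (y+p j)) (cong₂ ℤ._-_ (sym (sh-one C (j + p))) (sym (trans (one≈ (j + p)) (ι-no {d = j + p ≟ 0} λ h → (lin⊥ (j ∷ p ∷ []) (v0 :+ v1 == # 0 by h & # 1 :+ # 1 <= v1 by 1<p) refl))))))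
      where
      y y′ : ℕ
      y = hc j
      y′ = hc (j + p)
      go : Mod q y′ (y + 1) → ψ j ℤ.- ψ (j + p) ≡ ι ⌊ j + p ≟ C ⌋ ℤ.- + 0
      go (inj₁ e) = trans (cong (ℤ._- ψ (j + p)) (cong ι (dec-cong {d = j ≟ y * p} {e = j + p ≟ y′ * p} to from))) (trans (ℤP.+-inverseʳ (ψ (j + p))) (sym (cong (ℤ._- + 0) (ι-no {d = j + p ≟ C} bad))))
        where
        to : j ≡ y * p → j + p ≡ y′ * p
        to h = lin≡ (j ∷ p ∷ y′ ∷ y ∷ []) (v0 :+ v1) (v2 :* v1) (v0 ≐ v3 :* v1 by h &ᵉ (v3 :+ # 1) :* v1 ≐ v2 :* v1 by (sym (cong (_* p) e))) refl
        from : j + p ≡ y′ * p → j ≡ y * p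
        from h = lin≡ (j ∷ y ∷ p ∷ y′ ∷ []) v0 (v1 :* v2) (v0 :+ v2 ≐ v3 :* v2 by h &ᵉ v3 :* v2 ≐ (v1 :+ # 1) :* v2 by cong (_* p) e) refl
        bad : j + p ≢ C
        bad h = lin⊥ (y ∷ []) (v0 :+ # 1 ==˘ # 0 by trans (sym (trans (cong hc h) y-C)) e) refl
      go (inj₂ e) = trans (cong₂ ℤ._-_ (cong ι (dec-cong {d = j ≟ y * p} {e = j + p ≟ C} to from)) (ι-no {d = j + p ≟ y′ * p} bad)) refl
        where
        y+1≡ : y + 1 ≡ q
        y+1≡ = ≤-antisym (lin≤ (y ∷ q ∷ []) (v0 :+ # 1) v1 (# 1 :+ v0 <= v1 by y< j) refl) (lin≤ (q ∷ y ∷ y′ ∷ []) v0 (v1 :+ # 1) (v2 :+ v0 == v1 :+ # 1 by e) refl)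
        to : j ≡ y * p → j + p ≡ C
        to h = lin≡ (j ∷ p ∷ q ∷ y ∷ []) (v0 :+ v1) (v1 :* v2) (v0 ≐ v3 :* v1 by h &ᵉ (v3 :+ # 1) :* v1 ≐ v2 :* v1 by cong (_* p) y+1≡) refl
        from : j + p ≡ C → j ≡ y * p
        from h = lin≡ (j ∷ y ∷ p ∷ q ∷ []) v0 (v1 :* v2) (v0 :+ v2 ≐ v2 :* v3 by h &ᵉ v3 :* v2 ≐ (v1 :+ # 1) :* v2 by (sym (cong (_* p) y+1≡))) refl
        y′≡0 : y′ ≡ 0
        y′≡0 = n≤0⇒n≡0 (lin≤ (y′ ∷ q ∷ y ∷ []) v0 (# 0) (v0 :+ v1 == v2 :+ # 1 by e & # 1 :+ v2 <= v1 by y< j) refl)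
        bad : j + p ≢ y′ * p
        bad h = lin⊥ (j ∷ p ∷ y′ ∷ []) (v0 :+ v1 == v2 :* v1 by h & v2 :* v1 == # 0 :* v1 by cong (_* p) y′≡0 & # 1 :+ # 1 <= v1 by 1<p) refl

-- From the counts to the bound m

open import Defs using (m; w; wLow)

∣⊖∣≤ : ∀ {a b X} → a ≤ X + b → b ≤ X + a → ∣ + a ℤ.- + b ∣ ≤ X
∣⊖∣≤ {a} {b} {X} h k = subst (_≤ X) (sym (cong ∣_∣ (ℤP.m-n≡m⊖n a b))) (go (≤-total a b))
  where
  go : a ≤ b ⊎ b ≤ a → ∣ a ℤ.⊖ b ∣ ≤ X
  go (inj₁ l) = subst (_≤ X) (sym (ℤP.∣⊖∣-≤ l)) (≤-trans (∸-monoˡ-≤ a k) (≤-reflexive (m+n∸n≡m X a)))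
  go (inj₂ l) = subst (_≤ X) (sym (cong ∣_∣ (ℤP.⊖-≥ l))) (≤-trans (∸-monoˡ-≤ b h) (≤-reflexive (m+n∸n≡m X b)))

-- K is the distance from Q to the nearest multiple of p
data Nearest (p Q K : ℕ) : Set where
  below : 2 * Q ≤ p ∸ 1 → K ≡ Q → Nearest p Q K
  above : ¬ 2 * Q ≤ p ∸ 1 → K ≡ p ∸ Q → Nearest p Q K

w-nearest : ∀ {p Q K} → Nearest p Q K → w p Q ≡ wLow p K
w-nearest {p} {Q} (below l refl) = cong (λ b → if b then wLow p Q else wLow p (p ∸ Q)) (dec-intro {d = 2 * Q ≤? p ∸ 1} l)
w-nearest {p} {Q} (above l refl) = cong (λ b → if b then wLow p Q else wLow p (p ∸ Q)) (dec-no {d = 2 * Q ≤? p ∸ 1} l)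

-- M ≤ h settles the lower side. For 4 K < p and K ≤ R, adding P ≤ p - R and P ≤ 2 K + R gives 2 P ≤
-- p + 2 K; for R ≤ K, P ≤ 2 R + K ≤ 3 K is small enough. Otherwise P is at most p minus the larger
-- parameter, hence at most p - K.
bounds⇒m : ∀ {p h Q K R P M} → p ≡ 2 * h + 1 → Nearest p Q K → K ≤ h → R ≤ h →
  (K ≤ R × Bounds p K R P M) ⊎ (R ≤ K × Bounds p R K P M) → ∣ + P ℤ.- + M ∣ ≤ m p Q
bounds⇒m {p} {h} {Q} {K} {R} {P} {M} odd near K≤h R≤h bs =
  ⊓-glb (subst (∣ + P ℤ.- + M ∣ ≤_) (sym (w-nearest near)) (∣⊖∣≤ (P≤ bs) (≤-trans (M≤ bs) (≤-trans h≤w (m≤m+n _ P)))))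
        (subst (_≤ 2 * p / 3) (m*n/n≡m ∣ + P ℤ.- + M ∣ 3) (/-monoˡ-≤ 3 (≤-trans (*-monoˡ-≤ 3 (∣⊖∣≤ {X = ⌊2p/3⌋} (third bs) (≤-trans (M≤ bs) (≤-trans h≤⌊2p/3⌋ (m≤m+n ⌊2p/3⌋ P))))) (m/n*n≤m (2 * p) 3))))
  where
  ⌊2p/3⌋ : ℕ
  ⌊2p/3⌋ = 2 * p / 3
  half : (p ∸ 1) / 2 ≡ h
  half = trans (cong (λ z → (z ∸ 1) / 2) odd) (trans (cong (_/ 2) (trans (m+n∸n≡m (2 * h) 1) (*-comm 2 h))) (m*n/n≡m h 2))
  floor : ∀ z → 3 * z ≤ 2 * p → z ≤ ⌊2p/3⌋
  floor z l = subst (_≤ ⌊2p/3⌋) (m*n/n≡m z 3) (/-monoˡ-≤ 3 (subst (_≤ 2 * p) (*-comm 3 z) l))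
  h≤⌊2p/3⌋ : h ≤ ⌊2p/3⌋
  h≤⌊2p/3⌋ = floor h (lin≤ (h ∷ p ∷ []) (# 3 :* v0) (# 2 :* v1) (2 · # 2 :* v0 :+ # 1 ==˘ v1 by odd) refl)
  M≤ : (K ≤ R × Bounds p K R P M) ⊎ (R ≤ K × Bounds p R K P M) → M ≤ h
  M≤ (inj₁ (_ , _ , _ , l , _)) = ≤-trans l R≤h
  M≤ (inj₂ (_ , _ , _ , l , _)) = ≤-trans l K≤h
  third : (K ≤ R × Bounds p K R P M) ⊎ (R ≤ K × Bounds p R K P M) → P ≤ ⌊2p/3⌋ + M
  third bs = ≤-trans (≤-trans (m≤n+m∸n P M) (+-monoʳ-≤ M (floor (P ∸ M) (≤-trans (≤-reflexive (*-distribˡ-∸ 3 P M)) (≤-trans (∸-monoˡ-≤ (3 * M) (3P≤ bs)) (≤-reflexive (m+n∸n≡m (2 * p) (3 * M)))))))) (≤-reflexive (+-comm M ⌊2p/3⌋))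
    where
    3P≤ : (K ≤ R × Bounds p K R P M) ⊎ (R ≤ K × Bounds p R K P M) → 3 * P ≤ 2 * p + 3 * M
    3P≤ (inj₁ (_ , _ , _ , _ , l)) = l
    3P≤ (inj₂ (_ , _ , _ , _ , l)) = l
  p-K : p ∸ K + K ≡ p
  p-K = m∸n+n≡m (lin≤ (K ∷ p ∷ h ∷ []) v0 v1 (# 2 :* v2 :+ # 1 ==˘ v1 by odd & v0 <= v2 by K≤h) refl)
  h≤w : h ≤ wLow p K
  h≤w with 4 * K <? p
  ... | yes _ = subst (λ z → h ≤ z + K) (sym half) (m≤m+n h K)
  ... | no _ = lin≤ (h ∷ (p ∸ K) ∷ p ∷ K ∷ []) v0 v1 (v2 ==˘ v1 :+ v3 by p-K & # 2 :* v0 :+ # 1 ==˘ v2 by odd & v3 <= v0 by K≤h) refl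
  P≤ : (K ≤ R × Bounds p K R P M) ⊎ (R ≤ K × Bounds p R K P M) → P ≤ wLow p K + M
  P≤ bs with 4 * K <? p
  ... | yes l = ≤-trans (subst (λ z → P ≤ z + K) (sym half) (go bs)) (m≤m+n _ M)
    where
    go : (K ≤ R × Bounds p K R P M) ⊎ (R ≤ K × Bounds p R K P M) → P ≤ h + K
    go (inj₁ (_ , a , b , _)) = by-contra λ c → (lin⊥ (P ∷ R ∷ p ∷ K ∷ h ∷ []) (v0 :+ v1 <= v2 by a & v0 <= v3 :+ (v3 :+ v1) by b & v2 == # 2 :* v4 :+ # 1 by odd & 2 · # 1 :+ (v4 :+ v3) <= v0 by c) refl)
    go (inj₂ (k , a , b , _)) = by-contra λ c → (lin⊥ (P ∷ R ∷ K ∷ p ∷ h ∷ []) (2 · v0 <= v1 :+ (v1 :+ v2) by b & 4 · v1 <= v2 by k & v3 == # 2 :* v4 :+ # 1 by odd & # 1 :+ # 4 :* v2 <= v3 by l & 2 · # 1 :+ (v4 :+ v2) <= v0 by c) refl)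
  ... | no _ = ≤-trans (go bs) (m≤m+n _ M)
    where
    go : (K ≤ R × Bounds p K R P M) ⊎ (R ≤ K × Bounds p R K P M) → P ≤ p ∸ K
    go (inj₁ (k , a , _)) = lin≤ (P ∷ (p ∸ K) ∷ p ∷ K ∷ R ∷ []) v0 v1 (v2 ==˘ v1 :+ v3 by p-K & v0 :+ v4 <= v2 by a & v3 <= v4 by k) refl
    go (inj₂ (_ , a , _)) = lin≤ (P ∷ (p ∸ K) ∷ p ∷ K ∷ []) v0 v1 (v2 ==˘ v1 :+ v3 by p-K & v0 :+ v3 <= v2 by a) refl

dec-flip : ∀ {A B : Set} {d : Dec A} {e : Dec B} → (A → ¬ B) → (¬ A → B) → ⌊ d ⌋ ≡ not ⌊ e ⌋
dec-flip {d = yes a} {e = yes b} f g = ⊥-elim (f a b)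
dec-flip {d = yes a} {e = no n} f g = refl
dec-flip {d = no n} {e = yes b} f g = refl
dec-flip {d = no n} {e = no k} f g = ⊥-elim (k (g n))

module Charts (p q : ℕ) {{_ : NonZero p}} {{_ : NonZero q}} (Q s : ℕ) (1<p : 1 < p) (1<q : 1 < q) (0<Q : 0 < Q) (0<s : 0 < s) (bez : Q * q + s * p ≡ p * q + 1) where
  open BinaryCoefficients p q Q s 1<p 1<q 0<Q 0<s bez
  open Coordinates p q Q s 0 0 using (xc; hc)

  chart : Coordinates.Chart p q Q s 0 0 0 Q c
  chart = record { δ<p = <-trans (s≤s z≤n) 1<p ; shift = refl ; val≡ = λ v v<C → trans (c-low v<C) (signs v) }
    where
    signs : ∀ v → ι ⌊ xc v <? Q ⌋ ℤ.+ ι ⌊ hc v <? s ⌋ ℤ.- + 1 ≡ ι (⌊ xc v <? Q ⌋ ∧ not (Values.high p q 0 Q (hc v * p + 0))) ℤ.- ι (⌊ Q ≤? xc v ⌋ ∧ Values.high p q 0 Q (hc v * p + 0))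
    signs v = trans (bools ⌊ xc v <? Q ⌋ ⌊ hc v <? s ⌋) (cong₂ (λ a b → ι (⌊ xc v <? Q ⌋ ∧ not b) ℤ.- ι (a ∧ b))
      (sym (dec-flip {d = Q ≤? xc v} {e = xc v <? Q} ≤⇒≯ ≰⇒>)) (sym (dec-flip {d = C ≤? hc v * p + 0 + Q * q} {e = hc v <? s} up down)))
      where
      bools : ∀ a b → ι a ℤ.+ ι b ℤ.- + 1 ≡ ι (a ∧ not (not b)) ℤ.- ι (not a ∧ not b)
      bools true true = refl
      bools true false = refl
      bools false true = refl
      bools false false = refl
      up : C ≤ hc v * p + 0 + Q * q → ¬ hc v < s
      up l k = lin⊥ (p ∷ q ∷ (hc v) ∷ Q ∷ s ∷ []) (v0 :* v1 <= v2 :* v0 :+ # 0 :+ v3 :* v1 by l & (# 1 :+ v2) :* v0 <= v4 :* v0 by scaleS p k & v3 :* v1 :+ v4 :* v0 == v0 :* v1 :+ # 1 by bez & # 1 :+ # 1 <= v0 by 1<p) refl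
      down : ¬ C ≤ hc v * p + 0 + Q * q → hc v < s
      down l = by-contra λ k → (lin⊥ ((hc v) ∷ p ∷ Q ∷ q ∷ s ∷ []) (# 1 :+ (v0 :* v1 :+ # 0 :+ v2 :* v3) <= v1 :* v3 by ≰⇒> l & v4 :* v1 <= v0 :* v1 by scaleS p (≤-pred k) & v1 :* v3 :+ # 1 ==˘ v2 :* v3 :+ v4 :* v1 by bez) refl)

  o : ℕ
  o = C ∸ 1
  o+1 : o + 1 ≡ C
  o+1 = m∸n+n≡m (<⇒≤ (≤-trans 1<p p≤C))

  -- The coordinates of v - 1, with o = p q - 1 in place of - 1. The carries a and b on returning to
  -- v are the tests x < Q and y < s for v, and equally the tests x̂ ≥ p - Q and `high` for v - 1;
  -- this exchanges the two signs and replaces Q by p - Q.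
  chart′ : Coordinates.Chart p q Q s o 1 1 (p ∸ Q) (λ v → ℤ.- c v)
  chart′ = record { δ<p = 1<p ; shift = trans o+1 (sym (+-identityʳ C)) ; val≡ = λ v v<C → trans (cong ℤ.-_ (c-low v<C)) (signs v (wrap (x-wrap v)) (wrap (y-wrap v))) }
    where
    open Coordinates p q Q s o 1 using () renaming (xc to x̂; hc to ŷ)
    K : ℕ
    K = p ∸ Q
    K+Q : K + Q ≡ p
    K+Q = m∸n+n≡m (<⇒≤ Q<p)
    next : ∀ v → suc (v + o) ≡ v + C
    next v = lin≡ (v ∷ o ∷ C ∷ []) (# 1 :+ (v0 :+ v1)) (v0 :+ v2) (v1 :+ # 1 ≐ v2 by o+1) refl
    x-wrap : ∀ v → Mod p (xc v) (x̂ v + Q)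
    x-wrap v = subst₂ (λ a b → Mod p a (b + Q)) (trans (cong xc (next v)) (trans (cong (_% p) (lin≡ (v ∷ p ∷ q ∷ Q ∷ []) ((v0 :+ v1 :* v2 :+ # 0) :* v3) ((v0 :+ # 0) :* v3 :+ v2 :* v3 :* v1) trivialᵉ refl)) ([m+kn]%n≡m%n ((v + 0) * Q) (q * Q) p))) (cong (λ z → (z * Q) % p) (+-identityʳ (v + o))) (x+1 (v + o))
    y-wrap : ∀ v → Mod q (hc v) (ŷ v + s)
    y-wrap v = subst₂ (λ a b → Mod q a (b + s)) (trans (cong hc (next v)) (trans (cong (_% q) (lin≡ (v ∷ p ∷ q ∷ s ∷ []) ((v0 :+ v1 :* v2 :+ # 0) :* v3) ((v0 :+ # 0) :* v3 :+ v1 :* v3 :* v2) trivialᵉ refl)) ([m+kn]%n≡m%n ((v + 0) * s) (p * s) q))) (cong (λ z → (z * s) % q) (+-identityʳ (v + o))) (y+1 (v + o))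
    signs : ∀ v → (Σ Bool λ a → xc v + n[ a ] * p ≡ x̂ v + Q) → (Σ Bool λ b → hc v + n[ b ] * q ≡ ŷ v + s) →
      ℤ.- (ι ⌊ xc v <? Q ⌋ ℤ.+ ι ⌊ hc v <? s ⌋ ℤ.- + 1) ≡ ι (⌊ x̂ v <? K ⌋ ∧ not (Values.high p q 0 K (ŷ v * p + 1))) ℤ.- ι (⌊ K ≤? x̂ v ⌋ ∧ Values.high p q 0 K (ŷ v * p + 1))
    signs v (a , ea) (b , eb) = trans (cong₂ (λ u z → ℤ.- (ι u ℤ.+ ι z ℤ.- + 1)) (xQ a ea) (ys b eb)) (trans (bools a b)
      (sym (trans (cong₂ (λ u z → ι (u ∧ not (Values.high p q 0 K (ŷ v * p + 1))) ℤ.- ι (z ∧ Values.high p q 0 K (ŷ v * p + 1))) (low a ea) (big a ea)) (cong (λ z → ι (not a ∧ not z) ℤ.- ι (a ∧ z)) (top b eb)))))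
      where
      bools : ∀ a b → ℤ.- (ι a ℤ.+ ι b ℤ.- + 1) ≡ ι (not a ∧ not b) ℤ.- ι (a ∧ b)
      bools true true = refl
      bools true false = refl
      bools false true = refl
      bools false false = refl
      x x̂′ y ŷ′ : ℕ
      x = xc v
      x̂′ = x̂ v
      y = hc v
      ŷ′ = ŷ v
      x̂< : x̂′ < p
      x̂< = m%n<n ((v + o) * Q) p
      ŷ< : ŷ′ < q
      ŷ< = m%n<n ((v + o) * s) q
      xQ : ∀ a → x + n[ a ] * p ≡ x̂′ + Q → ⌊ x <? Q ⌋ ≡ a
      xQ true e = dec-intro {d = x <? Q} (lin≤ (x ∷ Q ∷ p ∷ x̂′ ∷ []) (# 1 :+ v0) v1 (v0 :+ # 1 :* v2 == v3 :+ v1 by e & # 1 :+ v3 <= v2 by x̂<) refl)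
      xQ false e = dec-no {d = x <? Q} λ l → (lin⊥ (x̂′ ∷ Q ∷ x ∷ p ∷ []) (v0 :+ v1 ==˘ v2 :+ # 0 :* v3 by e & # 1 :+ v2 <= v1 by l) refl)
      ys : ∀ b → y + n[ b ] * q ≡ ŷ′ + s → ⌊ y <? s ⌋ ≡ b
      ys true e = dec-intro {d = y <? s} (lin≤ (y ∷ s ∷ q ∷ ŷ′ ∷ []) (# 1 :+ v0) v1 (v0 :+ # 1 :* v2 == v3 :+ v1 by e & # 1 :+ v3 <= v2 by ŷ<) refl)
      ys false e = dec-no {d = y <? s} λ l → (lin⊥ (ŷ′ ∷ s ∷ y ∷ q ∷ []) (v0 :+ v1 ==˘ v2 :+ # 0 :* v3 by e & # 1 :+ v2 <= v1 by l) refl)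
      big : ∀ a → x + n[ a ] * p ≡ x̂′ + Q → ⌊ K ≤? x̂′ ⌋ ≡ a
      big true e = dec-intro {d = K ≤? x̂′} (lin≤ (K ∷ x̂′ ∷ x ∷ p ∷ Q ∷ []) v0 v1 (v2 :+ # 1 :* v3 == v1 :+ v4 by e & v0 :+ v4 == v3 by K+Q) refl)
      big false e = dec-no {d = K ≤? x̂′} λ l → (lin⊥ (x̂′ ∷ Q ∷ x ∷ p ∷ K ∷ []) (v0 :+ v1 ==˘ v2 :+ # 0 :* v3 by e & v4 <= v0 by l & v3 ==˘ v4 :+ v1 by K+Q & # 1 :+ v2 <= v3 by x< v) refl)
      low : ∀ a → x + n[ a ] * p ≡ x̂′ + Q → ⌊ x̂′ <? K ⌋ ≡ not a
      low a e = trans (dec-flip {d = x̂′ <? K} {e = K ≤? x̂′} <⇒≱ ≮⇒≥) (cong not (big a e))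
      top : ∀ b → y + n[ b ] * q ≡ ŷ′ + s → Values.high p q 0 K (ŷ′ * p + 1) ≡ b
      top true e = dec-intro {d = C ≤? ŷ′ * p + 1 + K * q} (lin≤ (p ∷ q ∷ ŷ′ ∷ K ∷ y ∷ s ∷ Q ∷ []) (v0 :* v1) (v2 :* v0 :+ # 1 :+ v3 :* v1) ((v4 :+ # 1 :* v1) :* v0 == (v2 :+ v5) :* v0 by cong (_* p) e & v0 :* v1 ==˘ (v3 :+ v6) :* v1 by cong (_* q) K+Q & v6 :* v1 :+ v5 :* v0 == v0 :* v1 :+ # 1 by bez) refl)
      top false e = dec-no {d = C ≤? ŷ′ * p + 1 + K * q} λ l → (lin⊥ (ŷ′ ∷ s ∷ p ∷ y ∷ q ∷ K ∷ Q ∷ []) ((v0 :+ v1) :* v2 ==˘ (v3 :+ # 0 :* v4) :* v2 by cong (_* p) e & (v5 :+ v6) :* v4 == v2 :* v4 by cong (_* q) K+Q & v2 :* v4 :+ # 1 ==˘ v6 :* v4 :+ v1 :* v2 by bez & v2 :* v4 <= v0 :* v2 :+ # 1 :+ v5 :* v4 by l & (# 1 :+ v3) :* v2 <= v4 :* v2 by scaleS p (y< v) & # 1 :+ # 1 <= v2 by 1<p) refl)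

-- The series c(x^r) / (1 - x^(p q)) and its coefficients along an orbit

module Level (p q r : ℕ) {{_ : NonZero (p * q)}} {{_ : NonZero r}} (c : Poly) (c-high : ∀ {k} → p * q ≤ k → c k ≡ + 0)
  (r̄ ρ : ℕ) (inv-r : r * r̄ ≡ 1 + ρ * (p * q)) where
  open Dilate r
  C : ℕ
  C = p * q
  0<C : 0 < C
  0<C = >-nonZero⁻¹ C

  -- f k is the residue of k / r modulo p q
  f fq : ℕ → ℕ
  f k = (k * r̄) % C
  fq k = (k * r̄) / C

  f< : ∀ k → f k < C
  f< k = m%n<n (k * r̄) C

  f-mod : ∀ k → r * f k + r * fq k * C ≡ k + k * ρ * C
  f-mod k = lin≡ (r ∷ (f k) ∷ (fq k) ∷ C ∷ k ∷ ρ ∷ r̄ ∷ []) (v0 :* v1 :+ v0 :* v2 :* v3) (v4 :+ v4 :* v5 :* v3) (v0 :* (v1 :+ v2 :* v3) ≐ v0 :* (v4 :* v6) by cong (r *_) (quot-rem (k * r̄) C) &ᵉ v4 :* (v0 :* v6) ≐ v4 :* (# 1 :+ v5 :* v3) by cong (k *_) inv-r) refl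

  f-unique : ∀ {k v} a b → v < C → r * v + a * C ≡ k + b * C → f k ≡ v
  f-unique {k} {v} a b v<C e = uniq (fq k + r̄ * b) (v * ρ + r̄ * a) (f< k) v<C
    (lin≡ ((f k) ∷ (fq k) ∷ r̄ ∷ b ∷ C ∷ v ∷ ρ ∷ a ∷ k ∷ r ∷ []) (v0 :+ (v1 :+ v2 :* v3) :* v4) (v5 :+ (v5 :* v6 :+ v2 :* v7) :* v4) (v0 :+ v1 :* v4 ≐ v8 :* v2 by quot-rem (k * r̄) C &ᵉ v2 :* (v8 :+ v3 :* v4) ≐ v2 :* (v9 :* v5 :+ v7 :* v4) by (sym (cong (r̄ *_) e)) &ᵉ v5 :* (v9 :* v2) ≐ v5 :* (# 1 :+ v6 :* v4) by cong (v *_) inv-r) refl)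

  only-if : ∀ {A : Set} → Dec A → ℤ → ℤ
  only-if d z = if ⌊ d ⌋ then z else + 0

  -- `B` is c(x^r) / (1 - x^C): as c vanishes from C on, only v = f k can contribute to the
  -- coefficient at k, and only when r v ≤ k. The sign of `G` comes from dividing by x^C - 1.
  B G : Poly
  B k = only-if (r * f k ≤? k) (c (f k))
  G k = ℤ.- B k

  B-shift : ∀ k → sh C B k ≡ only-if (r * f k + C ≤? k) (c (f k))
  B-shift k with C ≤? k
  ... | no l = trans (sh-> B (≰⇒> l)) (sym (cong (λ b → if b then c (f k) else + 0) (dec-no {d = r * f k + C ≤? k} λ h → l (≤-trans (m≤n+m C _) h))))
  ... | yes l = trans (sh-≤ B l) (cong₂ (λ b z → if b then c z else + 0) (dec-cong {d = r * f (k ∸ C) ≤? k ∸ C} {e = r * f k + C ≤? k}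
        (λ h → subst₂ (λ a b → r * a + C ≤ b) same (m∸n+n≡m l) (+-monoˡ-≤ C h))
        (λ h → +-cancelʳ-≤ C _ _ (subst₂ (λ a b → r * a + C ≤ b) (sym same) (sym (m∸n+n≡m l)) h))) same)
    where
    same : f (k ∸ C) ≡ f k
    same = f-unique (r * fq k) (k * ρ + 1) (f< k) (lin≡ (r ∷ (f k) ∷ (fq k) ∷ C ∷ (k ∸ C) ∷ k ∷ ρ ∷ []) (v0 :* v1 :+ v0 :* v2 :* v3) (v4 :+ (v5 :* v6 :+ # 1) :* v3) (v0 :* v1 :+ v0 :* v2 :* v3 ≐ v5 :+ v5 :* v6 :* v3 by f-mod k &ᵉ v5 ≐ v4 :+ v3 by (sym (m∸n+n≡m l))) refl)

  E-c : ∀ k → E r c k ≡ only-if (r * f k ≟ k) (c (f k))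
  E-c k with r ∣? k
  ... | no n = trans refl (sym (cong (λ b → if b then c (f k) else + 0) (dec-no {d = r * f k ≟ k} λ h → n (divides (f k) (trans (sym h) (*-comm r (f k)))))))
  ... | yes (divides j refl) = trans (cong c (m*n/n≡m j r)) (go (j <? C))
    where
    go : Dec (j < C) → c j ≡ only-if (r * f (j * r) ≟ j * r) (c (f (j * r)))
    go (yes l) = sym (cong₂ (λ b z → if b then c z else + 0) (dec-intro {d = r * f (j * r) ≟ j * r} (trans (cong (r *_) same) (*-comm r j))) same)
      where
      same : f (j * r) ≡ j
      same = f-unique 0 0 l (lin≡ (r ∷ j ∷ C ∷ []) (v0 :* v1 :+ # 0 :* v2) (v1 :* v0 :+ # 0 :* v2) trivialᵉ refl)
    go (no l) = trans (c-high (≮⇒≥ l)) (sym (cong (λ b → if b then c (f (j * r)) else + 0) (dec-no {d = r * f (j * r) ≟ j * r}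
      λ h → l (subst (_< C) (*-cancelʳ-≡ (f (j * r)) j r (trans (*-comm (f (j * r)) r) h)) (f< (j * r))))))

  G-step : Δ C G ≈ E r c
  G-step k = trans (cong (ℤ._- G k) (trans (sh-neg C B k) (cong ℤ.-_ (B-shift k)))) (trans (go (r * f k ≤? k) (r * f k ≟ k)) (sym (E-c k)))
    where
    z : ℤ
    z = c (f k)
    rf : ℕ
    rf = r * f k
    pick : ∀ {A : Set} {d : Dec A} → A → only-if d z ≡ z
    pick {d = d} a = cong (λ b → if b then z else + 0) (dec-intro {d = d} a)
    drop : ∀ {A : Set} {d : Dec A} → ¬ A → only-if d z ≡ + 0
    drop {d = d} a = cong (λ b → if b then z else + 0) (dec-no {d = d} a)
    combine : ∀ {a b d} x y w → a ≡ x → b ≡ y → d ≡ w → (ℤ.- x) ℤ.- (ℤ.- y) ≡ w → (ℤ.- a) ℤ.- (ℤ.- b) ≡ d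
    combine x y w refl refl refl e = e
    go : Dec (rf ≤ k) → Dec (rf ≡ k) → (ℤ.- only-if (rf + C ≤? k) z) ℤ.- (ℤ.- only-if (rf ≤? k) z) ≡ only-if (rf ≟ k) z
    go (no n) _ = combine (+ 0) (+ 0) (+ 0) (drop {d = rf + C ≤? k} λ h → n (≤-trans (m≤m+n rf C) h)) (drop {d = rf ≤? k} n) (drop {d = rf ≟ k} λ h → n (≤-reflexive h)) refl
    go (yes l) (yes e) = combine (+ 0) z z (drop {d = rf + C ≤? k} λ h → (lin⊥ (rf ∷ C ∷ k ∷ []) (v0 :+ v1 <= v2 by h & v2 ==˘ v0 by e & # 1 :+ # 0 <= v1 by 0<C) refl)) (pick {d = rf ≤? k} l) (pick {d = rf ≟ k} e) (trans (ℤP.+-identityˡ _) (ℤP.neg-involutive z))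
    go (yes l) (no n) = combine z z (+ 0) (pick {d = rf + C ≤? k} (by-contra λ h → mod-gap (r * fq k) (k * ρ) (f-mod k) (≤∧≢⇒< l n) h)) (pick {d = rf ≤? k} l) (drop {d = rf ≟ k} n) (ℤP.+-inverseʳ (ℤ.- z))

  cut : ℕ → ℕ → ℤ
  cut = cutoff c

  IsLevel : ℕ → ℕ → Set
  IsLevel n N = ∀ v → v < C → (v ≤ N → r * v ≤ n) × (r * v ≤ n → v ≤ N)

  -- N is n / r rounded down, capped at C - 1 to keep N < C; residues v < C do not notice the cap.
  level : ∀ n → Σ ℕ λ N → N < C × IsLevel n N
  level n with n / r <? C
  ... | yes l = n / r , l , λ v _ → below′ v , above′ v
    where
    below′ : ∀ v → v ≤ n / r → r * v ≤ n
    below′ v h = ≤-trans (*-monoʳ-≤ r h) (subst (_≤ n) (*-comm (n / r) r) (m/n*n≤m n r))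
    above′ : ∀ v → r * v ≤ n → v ≤ n / r
    above′ v h = subst (_≤ n / r) (m*n/n≡m v r) (/-monoˡ-≤ r (subst (_≤ n) (*-comm r v) h))
  ... | no l = C ∸ 1 , (lin≤ ((C ∸ 1) ∷ C ∷ []) (# 1 :+ v0) v1 (v0 :+ # 1 == v1 by m∸n+n≡m 0<C) refl) , λ v v<C → (λ _ → ≤-trans (*-monoʳ-≤ r (≤-trans (<⇒≤ v<C) (≮⇒≥ l))) (subst (_≤ n) (*-comm (n / r) r) (m/n*n≤m n r)))
      , λ _ → (lin≤ (v ∷ (C ∸ 1) ∷ C ∷ []) v0 v1 (v2 ==˘ v1 :+ # 1 by m∸n+n≡m 0<C & # 1 :+ v0 <= v2 by v<C) refl)

  -- The condition at index n - m is r v ≤ n - m. As r v ≡ n - m modulo C and m < C, no such r v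
  -- lies strictly above n - m and at most n, so one cutoff N serves all m.
  B-at : ∀ {n m v N} a b → IsLevel n N → v < C → m < C → r * v + m + a * C ≡ n + b * C → sh m B n ≡ cut N v
  B-at {n} {m} {v} {N} a b lv v<C m<C e with m ≤? n
  ... | no l = trans (sh-> B (≰⇒> l)) (sym (cong (λ b → if b then c v else + 0) (dec-no {d = v ≤? N} λ h → clash (proj₁ (lv v v<C) h))))
    where
    clash : r * v ≤ n → ⊥
    clash h = mod-gap b a (sym e) (lin≤ (n ∷ r ∷ v ∷ m ∷ []) (# 1 :+ v0) (v1 :* v2 :+ v3) (# 1 :+ v0 <= v3 by ≰⇒> l) refl) (lin≤ (r ∷ v ∷ m ∷ n ∷ C ∷ []) (# 1 :+ (v0 :* v1 :+ v2)) (v3 :+ v4) (v0 :* v1 <= v3 by h & # 1 :+ v2 <= v4 by m<C) refl)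
  ... | yes l = trans (sh-≤ B l) (cong₂ (λ b z → if b then c z else + 0) (dec-cong {d = r * f j ≤? j} {e = v ≤? N}
        (λ h → proj₂ (lv v v<C) (≤-trans (subst (λ z → r * z ≤ j) same h) (m∸n≤m n m)))
        (λ h → subst (λ z → r * z ≤ j) (sym same) (low (proj₁ (lv v v<C) h)))) same)
    where
    j : ℕ
    j = n ∸ m
    j+m : j + m ≡ n
    j+m = m∸n+n≡m l
    rv≡ : r * v + a * C ≡ j + b * C
    rv≡ = lin≡ (r ∷ v ∷ a ∷ C ∷ j ∷ b ∷ m ∷ n ∷ []) (v0 :* v1 :+ v2 :* v3) (v4 :+ v5 :* v3) (v0 :* v1 :+ v6 :+ v2 :* v3 ≐ v7 :+ v5 :* v3 by e &ᵉ v7 ≐ v4 :+ v6 by (sym j+m)) refl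
    same : f j ≡ v
    same = f-unique a b v<C rv≡
    low : r * v ≤ n → r * v ≤ j
    low h = by-contra λ g → mod-gap b a (sym rv≡) g (lin≤ (r ∷ v ∷ j ∷ C ∷ n ∷ m ∷ []) (# 1 :+ (v0 :* v1)) (v2 :+ v3) (v0 :* v1 <= v4 by h & v4 ==˘ v2 :+ v5 by j+m & # 1 :+ v5 <= v3 by m<C) refl)

  module _ {n N : ℕ} (lv : IsLevel n N) (g γ : ℕ) (rg : r * g + 1 ≡ γ * C) (v₀ u : ℕ) (a b : ℕ) (rv₀ : r * v₀ + u + a * C ≡ n + b * C) where
    v : ℕ → ℕ
    v t = (v₀ + t * g) % C
    v-quot : ℕ → ℕ
    v-quot t = (v₀ + t * g) / C

    -- Because r g ≡ - 1, a step of `g` in v is compensated by one step of the index.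
    index : ∀ t → r * v t + (t + u) + (r * v-quot t + a) * C ≡ n + (b + t * γ) * C
    index t = lin≡ (r ∷ (v t) ∷ t ∷ u ∷ (v-quot t) ∷ a ∷ C ∷ n ∷ b ∷ γ ∷ v₀ ∷ g ∷ []) (v0 :* v1 :+ (v2 :+ v3) :+ (v0 :* v4 :+ v5) :* v6) (v7 :+ (v8 :+ v2 :* v9) :* v6) (v0 :* (v1 :+ v4 :* v6) ≐ v0 :* (v10 :+ v2 :* v11) by cong (r *_) (quot-rem (v₀ + t * g) C) &ᵉ v2 :* (v0 :* v11 :+ # 1) ≐ v2 :* (v9 :* v6) by cong (t *_) rg &ᵉ v0 :* v10 :+ v3 :+ v5 :* v6 ≐ v7 :+ v8 :* v6 by rv₀) refl

    B-orbit : ∀ t → t + u < C → sh (t + u) B n ≡ cut N (v t)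
    B-orbit t l = B-at (r * v-quot t + a) (b + t * γ) lv (m%n<n _ C) l (index t)

    B-orbit′ : ∀ d u′ a′ b′ → r * d + u′ + a′ * C ≡ u + b′ * C → ∀ t → t + u′ < C → sh (t + u′) B n ≡ cut N ((v t + d) % C)
    B-orbit′ d u′ a′ b′ e t l = B-at (r * ((v t + d) / C) + a′ + (r * v-quot t + a)) (b + t * γ + b′) lv (m%n<n _ C) l
      (lin≡ (r ∷ ((v t + d) % C) ∷ t ∷ u′ ∷ ((v t + d) / C) ∷ a′ ∷ (v-quot t) ∷ a ∷ C ∷ n ∷ b ∷ γ ∷ b′ ∷ (v t) ∷ d ∷ u ∷ []) (v0 :* v1 :+ (v2 :+ v3) :+ (v0 :* v4 :+ v5 :+ (v0 :* v6 :+ v7)) :* v8) (v9 :+ (v10 :+ v2 :* v11 :+ v12) :* v8) (v0 :* (v1 :+ v4 :* v8) ≐ v0 :* (v13 :+ v14) by cong (r *_) (quot-rem (v t + d) C) &ᵉ v0 :* v13 :+ (v2 :+ v15) :+ (v0 :* v6 :+ v7) :* v8 ≐ v9 :+ (v10 :+ v2 :* v11) :* v8 by index t &ᵉ v0 :* v14 :+ v3 :+ v5 :* v8 ≐ v15 :+ v12 :* v8 by e) refl)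

  sh-sum≡ : ∀ k f → sh-sum k f ≈ λ n → sum< k (λ t → sh t f n)
  sh-sum≡ zero f n = refl
  sh-sum≡ (suc k) f n = cong (ℤ._+ sh k f n) (sh-sum≡ k f n)

  coefficient : ∀ n → sh-sum p (Δ q G) n ≡ sum< p (λ t → sh t B n ℤ.- sh (t + q) B n)
  coefficient n = trans (sh-sum≡ p (Δ q G) n) (sum<-cong p λ t _ → trans (sh-cong t split n) (trans (sh-linear t B (sh q G) n) (cong (λ z → sh t B n ℤ.+ z) (trans (sh-+ t q G n) (sh-neg (t + q) B n)))))
    where
    split : Δ q G ≈ λ k → B k ℤ.+ sh q G k
    split k = trans (cong (λ z → sh q G k ℤ.+ z) (ℤP.neg-involutive (B k))) (ℤP.+-comm (sh q G k) (B k))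

-- Inverses, and the exclusion of coincident steps

inverse : ∀ {r M} → 1 < M → Coprime r M → Σ ℕ λ r̄ → Σ ℕ λ ρ → r * r̄ ≡ 1 + ρ * M
inverse {r} {M} 1<M co with coprime-Bézout co
... | Bézout.+- x y e = x , y , trans (*-comm r x) (sym e)
-- Here r x ≡ - 1 modulo M, so the inverse is - x, written x (M - 1).
... | Bézout.-+ x y e = x * (M ∸ 1) , proj₁ reduced , sym (proj₂ reduced)
  where
  M-1 : M ∸ 1 + 1 ≡ M
  M-1 = m∸n+n≡m (<⇒≤ 1<M)
  reduced : Σ ℕ λ ρ → 1 + ρ * M ≡ r * (x * (M ∸ 1))
  reduced = drop-mod (y * (M ∸ 1)) 1 1<M (lin≡ (y ∷ (M ∸ 1) ∷ M ∷ r ∷ x ∷ []) (# 1 :+ v0 :* v1 :* v2) (v3 :* (v4 :* v1) :+ # 1 :* v2) (v0 :* v2 :* v1 ≐ (# 1 :+ v4 :* v3) :* v1 by (sym (cong (_* (M ∸ 1)) e)) &ᵉ v1 :+ # 1 ≐ v2 by M-1) refl)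

Folded : ℕ → ℕ → ℕ → Set
Folded p a A = A ≡ a ⊎ A + a ≡ p

module _ {p : ℕ} (pp : Prime p) where
  ∣-small : ∀ {a} → 0 < a → a < p → ¬ p ∣ a
  ∣-small {a} 0<a a<p d = <⇒≱ a<p (∣⇒≤ {{>-nonZero 0<a}} d)

  -- With l ≡ - a b and l ≡ ± a, the prime p divides a (b ± 1) but not a.
  fold-unit : ∀ {l a b z} → 0 < a → a < p → 0 < b → b < p → l + a * b ≡ z * p → Folded p a l → b ≡ 1 ⊎ b + 1 ≡ p
  fold-unit {l} {a} {b} {z} 0<a a<p 0<b b<p e (inj₁ refl) with euclidsLemma a (1 + b) pp (divides z (trans (*-suc a b) e))
  ... | inj₁ d = ⊥-elim (∣-small 0<a a<p d)
  ... | inj₂ d = inj₂ (≤-antisym (subst (_≤ p) (+-comm 1 b) b<p) (subst (p ≤_) (+-comm 1 b) (∣⇒≤ d)))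
  fold-unit {l} {a} {suc b} {z} 0<a a<p 0<b b<p e (inj₂ refl) with euclidsLemma a b pp (∣m+n∣m⇒∣n (divides z (trans (trans (+-assoc l a (a * b)) (cong (λ x → l + x) (sym (*-suc a b)))) e)) ∣-refl)
  ... | inj₁ d = ⊥-elim (∣-small 0<a a<p d)
  ... | inj₂ d = inj₁ (cong suc (small b (<-trans ≤-refl b<p) d))
    where
    small : ∀ b → b < p → p ∣ b → b ≡ 0
    small zero _ _ = refl
    small (suc b) l d = ⊥-elim (∣-small (s≤s z≤n) l d)

  -- Used with a and b equal to Q and R in either order. A coincidence l = ± A would make b ≡ ± 1,
  -- whose reflection into [1, h] is 1, against 2 ≤ B.
  no-clash : ∀ {h l a b A B z} → p ≡ 2 * h + 1 → l < p → 0 < a → a < p → 0 < b → b < p → l + a * b ≡ z * p →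
    Folded p a A → Folded p b B → 2 ≤ B → B ≤ h → l ≢ A × p ∸ l ≢ A
  no-clash {h} {l} {a} {b} {A} {B} {z} odd l<p 0<a a<p 0<b b<p e fA fB 2≤B B≤h = (λ x → bad (same fA x)) , λ x → bad (opposite fA (trans (cong (_+ l) (sym x)) (m∸n+n≡m (<⇒≤ l<p))))
    where
    same : Folded p a A → l ≡ A → Folded p a l
    same f refl = f
    opposite : Folded p a A → A + l ≡ p → Folded p a l
    opposite (inj₁ refl) x = inj₂ (trans (+-comm l A) x)
    opposite (inj₂ f) x = inj₁ (+-cancelˡ-≡ A l a (trans x (sym f)))
    bad : Folded p a l → ⊥
    bad f = go (fold-unit {l} {a} {b} {z} 0<a a<p 0<b b<p e f) fB
      where
      go : b ≡ 1 ⊎ b + 1 ≡ p → Folded p b B → ⊥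
      go (inj₁ x) (inj₁ y) = lin⊥ (b ∷ B ∷ []) (v0 == # 1 by x & v1 == v0 by y & # 2 <= v1 by 2≤B) refl
      go (inj₁ x) (inj₂ y) = lin⊥ (b ∷ p ∷ B ∷ h ∷ []) (v0 == # 1 by x & v1 ==˘ v2 :+ v0 by y & # 2 :* v3 :+ # 1 ==˘ v1 by odd & # 2 <= v2 by 2≤B & 2 · v2 <= v3 by B≤h) refl
      go (inj₂ x) (inj₁ y) = lin⊥ (p ∷ b ∷ B ∷ h ∷ []) (v0 ==˘ v1 :+ # 1 by x & v1 ==˘ v2 by y & # 2 :* v3 :+ # 1 ==˘ v0 by odd & # 2 <= v2 by 2≤B & 2 · v2 <= v3 by B≤h) refl
      go (inj₂ x) (inj₂ y) = lin⊥ (p ∷ b ∷ B ∷ []) (v0 ==˘ v1 :+ # 1 by x & v2 :+ v1 == v0 by y & # 2 <= v2 by 2≤B) refl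

sum<-neg : ∀ n f → sum< n (λ t → ℤ.- f t) ≡ ℤ.- sum< n f
sum<-neg zero f = refl
sum<-neg (suc n) f = trans (cong (ℤ._+ (ℤ.- f n)) (sum<-neg n f)) (sym (ℤP.neg-distrib-+ (sum< n f) (f n)))

cutoff-cong : ∀ {f g} N → (∀ v → f v ≡ g v) → ∀ v → cutoff f N v ≡ cutoff g N v
cutoff-cong N e v = cong (λ z → if ⌊ v ≤? N ⌋ then z else + 0) (e v)

cutoff-neg : ∀ {f g} N → (∀ v → f v ≡ ℤ.- g v) → ∀ v → cutoff f N v ≡ ℤ.- cutoff g N v
cutoff-neg {f} {g} N e v with v ≤? N
... | yes _ = e v
... | no _ = refl

∣terms∣-± : ∀ n f g N a b {X} → (∀ v → f v ≡ g v) ⊎ (∀ v → f v ≡ ℤ.- g v) → ∣ sum< n (terms f N a b) ∣ ≤ X → ∣ sum< n (terms g N a b) ∣ ≤ X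
∣terms∣-± n f g N a b {X} (inj₁ e) = subst (_≤ X) (cong ∣_∣ (sum<-cong n λ t _ → cong₂ ℤ._-_ (cutoff-cong N e (a t)) (cutoff-cong N e (b t))))
∣terms∣-± n f g N a b {X} (inj₂ e) = subst (_≤ X) (trans (cong ∣_∣ (trans (sum<-cong n λ t _ → trans (cong₂ ℤ._-_ (cutoff-neg {f} {g} N e (a t)) (cutoff-neg {f} {g} N e (b t)))
  (sym (ℤP.neg-distrib-+ (cutoff g N (a t)) (ℤ.- cutoff g N (b t))))) (sum<-neg n (terms g N a b)))) (ℤP.∣-i∣≡∣i∣ (sum< n (terms g N a b))))

∣terms∣-swap : ∀ n f N a b → ∣ sum< n (terms f N b a) ∣ ≡ ∣ sum< n (terms f N a b) ∣
∣terms∣-swap n f N a b = trans (cong ∣_∣ (trans (sum<-cong n λ t _ → swap-minus (cutoff f N (b t)) (cutoff f N (a t))) (sum<-neg n (terms f N a b)))) (ℤP.∣-i∣≡∣i∣ (sum< n (terms f N a b)))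
  where
  swap-minus : ∀ x y → x ℤ.- y ≡ ℤ.- (y ℤ.- x)
  swap-minus x y = sym (trans (ℤP.neg-distrib-+ y (ℤ.- x)) (trans (cong (λ z → ℤ.- y ℤ.+ z) (ℤP.neg-involutive x)) (ℤP.+-comm (ℤ.- y) x)))

-- The coefficients of F (p q r)

module Height (F : ℕ → Poly) (cyc : IsCyclotomicFamily F) {p q r : ℕ} (pp : Prime p) (pq : Prime q) (pr : Prime r) (p<q : p < q) (q<r : q < r)
  {h : ℕ} (odd : p ≡ 2 * h + 1) (Q k : ℕ) (0<Q : 0 < Q) (Q<p : Q < p) (Qq : Q * q ≡ 1 + k * p) (n : ℕ) where
  instance
    p≢0 : NonZero p
    p≢0 = prime⇒nonZero pp
    q≢0 : NonZero q
    q≢0 = prime⇒nonZero pq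
    r≢0 : NonZero r
    r≢0 = prime⇒nonZero pr
    pq≢0 : NonZero (p * q)
    pq≢0 = m*n≢0 p q
  C : ℕ
  C = p * q

  1<p : 1 < p
  1<p = lin≤ (p ∷ Q ∷ []) (# 1 :+ (# 1)) v0 (# 1 :+ # 0 <= v1 by 0<Q & # 1 :+ v1 <= v0 by Q<p) refl
  1<q : 1 < q
  1<q = <-trans 1<p p<q

  k<q : k < q
  k<q = *-cancelʳ-< p k q (lin≤ (k ∷ p ∷ q ∷ Q ∷ []) (# 1 :+ (v0 :* v1)) (v2 :* v1) (# 1 :+ v0 :* v1 ==˘ v3 :* v2 by Qq & (# 1 :+ v3) :* v2 <= v1 :* v2 by scaleS q Q<p) refl)

  -- The inverse of p modulo q: Q q = 1 + k p says that k p ≡ - 1.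
  s : ℕ
  s = q ∸ k
  s+k : s + k ≡ q
  s+k = m∸n+n≡m (<⇒≤ k<q)
  0<s : 0 < s
  0<s = lin≤ (s ∷ q ∷ k ∷ []) (# 1 :+ (# 0)) v0 (v1 ==˘ v0 :+ v2 by s+k & # 1 :+ v2 <= v1 by k<q) refl
  bez : Q * q + s * p ≡ p * q + 1
  bez = lin≡ (Q ∷ q ∷ s ∷ p ∷ k ∷ []) (v0 :* v1 :+ v2 :* v3) (v3 :* v1 :+ # 1) (v0 :* v1 ≐ # 1 :+ v4 :* v3 by Qq &ᵉ (v2 :+ v4) :* v3 ≐ v1 :* v3 by cong (_* p) s+k) refl

  p+q≤C : p + q ≤ C
  p+q≤C = lin≤ (p ∷ q ∷ (q ∸ 2) ∷ []) (v0 :+ v1) (v0 :* v1) (2 · # 1 :+ # 1 <= v0 by 1<p & # 1 :+ v0 <= v1 by p<q & v2 :* # 2 <= v2 :* v0 by ((q ∸ 2) ⋆ 1<p) & 2 · v1 ==˘ v2 :+ # 2 by m∸n+n≡m {q} {2} 1<q & v0 :* (v2 :+ # 2) == v0 :* v1 by cong (p *_) (m∸n+n≡m {q} {2} 1<q)) refl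
  1<C : 1 < C
  1<C = lin≤ (C ∷ p ∷ q ∷ []) (# 1 :+ (# 1)) v0 (v1 :+ v2 <= v0 by p+q≤C & 2 · # 1 :+ # 1 <= v1 by 1<p & # 1 :+ v1 <= v2 by p<q) refl

  inverses : Σ ℕ λ r̄ → Σ ℕ λ ρ → r * r̄ ≡ 1 + ρ * C
  inverses = inverse 1<C coprime
    where
    r∤C : ¬ r ∣ C
    r∤C = ∤-* pr (∤-prime pr pp (<⇒≢ (<-trans p<q q<r))) (∤-prime pr pq (<⇒≢ q<r))
    coprime : Coprime r C
    coprime (i , j) with prime⇒irreducible pr i
    ... | inj₁ e = e
    ... | inj₂ refl = ⊥-elim (r∤C j)

  module Residue (r̄ ρ : ℕ) (inv-r : r * r̄ ≡ 1 + ρ * C) where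
    open BinaryCoefficients p q Q s 1<p 1<q 0<Q 0<s bez using (c; c-high; θ; ψ; θ-step; ψ-step)
    open Charts p q Q s 1<p 1<q 0<Q 0<s bez using (o; chart; chart′)
    open Level p q r c c-high r̄ ρ inv-r using (B; G; G-step; cut; IsLevel; level; B-orbit; B-orbit′; coefficient)

    R e : ℕ
    R = r̄ % p
    e = r̄ / p
    R+e : R + e * p ≡ r̄
    R+e = quot-rem r̄ p
    R<p : R < p
    R<p = m%n<n r̄ p
    0<R : 0 < R
    0<R = n≢0⇒n>0 λ z → 0≢1+n (uniq (r * e) (ρ * q) (<-trans (s≤s z≤n) 1<p) 1<p (≤-antisym (lin≤ (r ∷ e ∷ p ∷ ρ ∷ q ∷ r̄ ∷ R ∷ []) (v0 :* v1 :* v2) (# 1 :+ v3 :* v4 :* v2) (v0 :* v5 == # 1 :+ v3 :* (v2 :* v4) by inv-r & v0 :* (v6 :+ v1 :* v2) == v0 :* v5 by cong (r *_) R+e) refl) (lin≤ (ρ ∷ q ∷ p ∷ r ∷ e ∷ r̄ ∷ R ∷ []) (# 1 :+ v0 :* v1 :* v2) (v3 :* v4 :* v2) (# 1 :+ v0 :* (v2 :* v1) ==˘ v3 :* v5 by inv-r & v3 :* v5 ==˘ v3 :* (v6 :+ v4 :* v2) by cong (r *_) R+e & v3 :* v6 == v3 :* # 0 by cong (r *_) z) refl)))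

    -- `g` represents - 1 / r modulo p q, so that one unit of time moves the index m by one.
    g γ : ℕ
    g = (C ∸ 1) * r̄
    γ = 1 + (C ∸ 1) * ρ
    C-1 : C ∸ 1 + 1 ≡ C
    C-1 = m∸n+n≡m (<⇒≤ 1<C)
    rg : r * g + 1 ≡ γ * C
    rg = lin≡ (r ∷ (C ∸ 1) ∷ r̄ ∷ ρ ∷ C ∷ []) (v0 :* (v1 :* v2) :+ # 1) ((# 1 :+ v1 :* v3) :* v4) (v1 :+ # 1 ≐ v4 by C-1 &ᵉ v1 :* (v0 :* v2) ≐ v1 :* (# 1 :+ v3 :* v4) by cong ((C ∸ 1) *_) inv-r) refl

    -- Represents - r q modulo p, the inverse of g Q, since g ≡ - 1 / r and Q ≡ 1 / q.
    μ : ℕ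
    μ = (p ∸ 1) * r * q
    unit : Σ ℕ λ κ → 1 + κ * p ≡ μ * (g * Q)
    unit = drop-mod ((p ∸ 1) * γ * q * (Q * q) + k) (Q * q) 1<p
      (lin≡ ((p ∸ 1) ∷ γ ∷ q ∷ Q ∷ k ∷ p ∷ r ∷ g ∷ []) (# 1 :+ (v0 :* v1 :* v2 :* (v3 :* v2) :+ v4) :* v5) (v0 :* v6 :* v2 :* (v7 :* v3) :+ v3 :* v2 :* v5) (# 1 :+ v4 :* v5 ≐ v3 :* v2 by (sym Qq) &ᵉ v0 :* (v3 :* v2) :* (v1 :* (v5 :* v2)) ≐ v0 :* (v3 :* v2) :* (v6 :* v7 :+ # 1) by (sym (cong ((p ∸ 1) * (Q * q) *_) rg)) &ᵉ (v0 :+ # 1) :* (v3 :* v2) ≐ v5 :* (v3 :* v2) by cong (_* (Q * q)) (m∸n+n≡m (<⇒≤ 1<p))) refl)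
    κ : ℕ
    κ = proj₁ unit

    lam : ℕ
    lam = (g * Q) % p
    -- The relation lam ≡ - R Q, from which `no-clash` excludes the steps ± R and ± Q.
    lam-R : Σ ℕ λ z → z * p ≡ lam + R * Q
    lam-R = drop-mod (q * r̄ * Q) ((g * Q) / p + e * Q) (<-trans (s≤s z≤n) 1<p)
      (lin≡ (q ∷ r̄ ∷ Q ∷ p ∷ lam ∷ R ∷ ((g * Q) / p) ∷ e ∷ (C ∸ 1) ∷ []) (v0 :* v1 :* v2 :* v3) (v4 :+ v5 :* v2 :+ (v6 :+ v7 :* v2) :* v3) (v8 :* v1 :* v2 ≐ v4 :+ v6 :* v3 by (sym (quot-rem (g * Q) p)) &ᵉ v3 :* v0 :* v1 :* v2 ≐ (v8 :+ # 1) :* v1 :* v2 by (sym (cong (λ z → z * r̄ * Q) C-1)) &ᵉ v1 :* v2 ≐ (v5 :+ v7 :* v3) :* v2 by (sym (cong (_* Q) R+e))) refl)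

    summand : ℕ → ℤ
    summand t = sh t B n ℤ.- sh (t + q) B n
    F≡ : F (p * q * r) n ≡ sum< p summand
    F≡ = trans (Ternary.factored F cyc pp pq pr p<q q<r θ-step ψ-step G-step n) (coefficient n)

    N : ℕ
    N = proj₁ (level n)
    N< : N < C
    N< = proj₁ (proj₂ (level n))
    lv : IsLevel n N
    lv = proj₂ (proj₂ (level n))

    module _ {o δ ε K : ℕ} {val : ℕ → ℤ} (ch : Coordinates.Chart p q Q s o δ ε K val) (sign : (∀ v → val v ≡ c v) ⊎ (∀ v → val v ≡ ℤ.- c v))
      (near : Nearest p Q K) (K≤h : K ≤ h) (0<K : 0 < K) (foldK : Folded p Q K) where

      -- `R̂` is whichever of R and p - R is at most h; together with K ≤ h this gives the
      -- hypothesis K + R̂ ≤ p of `Orbits`.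
      module Turn (R̂ R° v₀ : ℕ) (R̂+R° : R̂ + R° ≡ p) (0<R̂ : 0 < R̂) (0<R° : 0 < R°) (R̂≤h : R̂ ≤ h) (foldR : Folded p R R̂) where
        open Orbits p q Q s bez ch g v₀ μ κ (sym (proj₂ unit)) R̂ R° R̂+R° 0<R° (lin≤ (K ∷ R̂ ∷ p ∷ h ∷ []) (v0 :+ v1) v2 (# 2 :* v3 :+ # 1 ==˘ v2 by odd & v0 <= v3 by K≤h & v1 <= v3 by R̂≤h) refl) N N< public
          using (vt; v′; total; bounds)

        oriented : ∣ sum< p (terms val N vt (λ t → v′ (vt t))) ∣ ≤ m p Q
        oriented = subst (λ z → ∣ z ∣ ≤ m p Q) (sym total) (bounds⇒m odd near K≤h R̂≤h (bounds 0<K 0<R̂ h odd λ 2≤K 2≤R̂ →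
          no-clash pp {z = proj₁ lam-R} odd (m%n<n (g * Q) p) 0<R R<p 0<Q Q<p (sym (proj₂ lam-R)) foldR foldK 2≤K K≤h ,
          no-clash pp {z = proj₁ lam-R} odd (m%n<n (g * Q) p) 0<Q Q<p 0<R R<p (trans (cong (λ x → lam + x) (*-comm Q R)) (sym (proj₂ lam-R))) foldK foldR 2≤R̂ R̂≤h))

        small : ∣ sum< p (terms c N vt (λ t → v′ (vt t))) ∣ ≤ m p Q
        small = ∣terms∣-± p val c N vt (λ t → v′ (vt t)) sign oriented

      R′ : ℕ
      R′ = p ∸ R
      R′+R : R′ + R ≡ p
      R′+R = m∸n+n≡m (<⇒≤ R<p)
      0<R′ : 0 < R′
      0<R′ = lin≤ (R′ ∷ p ∷ R ∷ []) (# 1 :+ (# 0)) v0 (v1 ==˘ v0 :+ v2 by R′+R & # 1 :+ v2 <= v1 by R<p) refl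
      t+0< : ∀ {t} → t < p → t + 0 < C
      t+0< {t} l = lin≤ (t ∷ C ∷ p ∷ q ∷ []) (# 1 :+ (v0 :+ # 0)) v1 (# 1 :+ v0 <= v2 by l & v2 :+ v3 <= v1 by p+q≤C) refl
      t+q< : ∀ {t} → t < p → t + q < C
      t+q< {t} l = lin≤ (t ∷ q ∷ C ∷ p ∷ []) (# 1 :+ (v0 :+ v1)) v2 (# 1 :+ v0 <= v3 by l & v3 :+ v1 <= v2 by p+q≤C) refl

      lower : R ≤ h → ∣ sum< p summand ∣ ≤ m p Q
      lower l = subst (λ z → ∣ z ∣ ≤ m p Q) (sym (sum<-cong {summand} {terms c N vt (λ t → v′ (vt t))} p λ t t<p → cong₂ ℤ._-_ (at t t<p) (at+q t t<p))) small
        where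
        open Turn R R′ (n * r̄) (trans (+-comm R R′) R′+R) 0<R 0<R′ l (inj₁ refl)
        start : r * (n * r̄) + 0 + 0 * C ≡ n + n * ρ * C
        start = lin≡ (r ∷ n ∷ r̄ ∷ p ∷ q ∷ ρ ∷ []) (v0 :* (v1 :* v2) :+ # 0 :+ # 0 :* (v3 :* v4)) (v1 :+ v1 :* v5 :* (v3 :* v4)) (v1 :* (v0 :* v2) ≐ v1 :* (# 1 :+ v5 :* (v3 :* v4)) by cong (n *_) inv-r) refl
        turn : r * (R′ * q) + q + ρ * q * C ≡ 0 + (r + r * e) * C
        turn = lin≡ (r ∷ R′ ∷ q ∷ ρ ∷ p ∷ e ∷ R ∷ r̄ ∷ []) (v0 :* (v1 :* v2) :+ v2 :+ v3 :* v2 :* (v4 :* v2)) (# 0 :+ (v0 :+ v0 :* v5) :* (v4 :* v2)) (v0 :* (v1 :+ v6) :* v2 ≐ v0 :* v4 :* v2 by cong (λ z → r * z * q) R′+R &ᵉ v0 :* v7 :* v2 ≐ v0 :* (v6 :+ v5 :* v4) :* v2 by (sym (cong (λ z → r * z * q) R+e)) &ᵉ (# 1 :+ v3 :* (v4 :* v2)) :* v2 ≐ v0 :* v7 :* v2 by (sym (cong (_* q) inv-r))) refl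
        at : ∀ t → t < p → sh t B n ≡ cut N (vt t)
        at t t<p = trans (cong (λ i → sh i B n) (sym (+-identityʳ t))) (B-orbit lv g γ rg (n * r̄) 0 0 (n * ρ) start t (t+0< t<p))
        at+q : ∀ t → t < p → sh (t + q) B n ≡ cut N (v′ (vt t))
        at+q t t<p = B-orbit′ lv g γ rg (n * r̄) 0 0 (n * ρ) start (R′ * q) q (ρ * q) (r + r * e) turn t (t+q< t<p)

      -- The orbit now runs through the indices t + q and its partners have the indices t. Reading
      -- the pairs in this direction replaces R by p - R and changes the sign of the sum.
      upper : h < R → ∣ sum< p summand ∣ ≤ m p Q
      upper l = subst (λ z → ∣ z ∣ ≤ m p Q) (sym (sum<-cong {summand} {terms c N (λ t → v′ (vt t)) vt} p λ t t<p → cong₂ ℤ._-_ (at t t<p) (at+q t t<p))) (subst (_≤ m p Q) (sym (∣terms∣-swap p c N vt (λ t → v′ (vt t)))) small)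
        where
        open Turn R′ R (n * r̄ + R′ * q) R′+R 0<R′ 0<R (lin≤ (R′ ∷ h ∷ R ∷ p ∷ []) v0 v1 (v0 :+ v2 == v3 by R′+R & v3 == # 2 :* v1 :+ # 1 by odd & # 1 :+ v1 <= v2 by l) refl) (inj₂ R′+R)
        start : r * (n * r̄ + R′ * q) + q + ρ * q * C ≡ n + (n * ρ + r + r * e) * C
        start = lin≡ (r ∷ n ∷ r̄ ∷ R′ ∷ q ∷ ρ ∷ p ∷ e ∷ R ∷ []) (v0 :* (v1 :* v2 :+ v3 :* v4) :+ v4 :+ v5 :* v4 :* (v6 :* v4)) (v1 :+ (v1 :* v5 :+ v0 :+ v0 :* v7) :* (v6 :* v4)) (v1 :* (v0 :* v2) ≐ v1 :* (# 1 :+ v5 :* (v6 :* v4)) by cong (n *_) inv-r &ᵉ v0 :* (v3 :+ v8) :* v4 ≐ v0 :* v6 :* v4 by cong (λ z → r * z * q) R′+R &ᵉ v0 :* v2 :* v4 ≐ v0 :* (v8 :+ v7 :* v6) :* v4 by (sym (cong (λ z → r * z * q) R+e)) &ᵉ (# 1 :+ v5 :* (v6 :* v4)) :* v4 ≐ v0 :* v2 :* v4 by (sym (cong (_* q) inv-r))) refl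
        turn : r * (R * q) + 0 + r * e * C ≡ q + ρ * q * C
        turn = lin≡ (r ∷ R ∷ q ∷ e ∷ p ∷ ρ ∷ r̄ ∷ []) (v0 :* (v1 :* v2) :+ # 0 :+ v0 :* v3 :* (v4 :* v2)) (v2 :+ v5 :* v2 :* (v4 :* v2)) (v0 :* (v1 :+ v3 :* v4) :* v2 ≐ v0 :* v6 :* v2 by cong (λ z → r * z * q) R+e &ᵉ v0 :* v6 :* v2 ≐ (# 1 :+ v5 :* (v4 :* v2)) :* v2 by cong (_* q) inv-r) refl
        at : ∀ t → t < p → sh t B n ≡ cut N (v′ (vt t))
        at t t<p = trans (cong (λ i → sh i B n) (sym (+-identityʳ t))) (B-orbit′ lv g γ rg (n * r̄ + R′ * q) q (ρ * q) (n * ρ + r + r * e) start (R * q) 0 (r * e) (ρ * q) turn t (t+0< t<p))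
        at+q : ∀ t → t < p → sh (t + q) B n ≡ cut N (vt t)
        at+q t t<p = B-orbit lv g γ rg (n * r̄ + R′ * q) q (ρ * q) (n * ρ + r + r * e) start t (t+q< t<p)

      height : ∣ F (p * q * r) n ∣ ≤ m p Q
      height = subst (λ z → ∣ z ∣ ≤ m p Q) (sym F≡) ([ lower , upper ]′ (≤-<-connex R h))

    at-nearest : ∣ F (p * q * r) n ∣ ≤ m p Q
    at-nearest = go (2 * Q ≤? p ∸ 1)
     where
     go : Dec (2 * Q ≤ p ∸ 1) → ∣ F (p * q * r) n ∣ ≤ m p Q
     go (yes l) = height chart (inj₁ λ _ → refl) (below l refl) (*-cancelˡ-≤ 2 (subst (2 * Q ≤_) p-1 l)) 0<Q (inj₁ refl)
      where
      p-1 : p ∸ 1 ≡ 2 * h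
      p-1 = trans (cong (_∸ 1) odd) (m+n∸n≡m (2 * h) 1)
     go (no l) = height chart′ (inj₂ λ _ → refl) (above l refl) (lin≤* ((p ∸ Q) ∷ h ∷ p ∷ Q ∷ (p ∸ 1) ∷ []) 2 v0 v1 (v2 == # 2 :* v1 :+ # 1 by odd & 2 · v0 :+ v3 == v2 by p-Q & # 1 :+ v4 <= # 2 :* v3 by ≰⇒> l & v2 ==˘ v4 :+ # 1 by m∸n+n≡m (<⇒≤ 1<p)) refl) (lin≤ ((p ∸ Q) ∷ p ∷ Q ∷ []) (# 1 :+ (# 0)) v0 (v1 ==˘ v0 :+ v2 by p-Q & # 1 :+ v2 <= v1 by Q<p) refl) (inj₂ p-Q)
      where
      p-Q : p ∸ Q + Q ≡ p
      p-Q = m∸n+n≡m (<⇒≤ Q<p)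

  theorem : ∣ F (p * q * r) n ∣ ≤ m p Q
  theorem = Residue.at-nearest (proj₁ inverses) (proj₁ (proj₂ inverses)) (proj₂ (proj₂ inverses))

theorem4p3 : (F : ℕ → Poly) → IsCyclotomicFamily F →
    (p q β β* : ℕ) → .{{_ : NonZero p}} →
    Prime p → p % 2 ≡ 1 → Prime q → p < q →
    1 ≤ β → β ≤ p ∸ 1 → q % p ≡ β →
    1 ≤ β* → β* ≤ p ∸ 1 → (β * β*) % p ≡ 1 →
    ((r : ℕ) → Prime r → q < r → (k : ℕ) → ∣ F (p * q * r) k ∣ ≤ m p β*)
    × ((q′ : ℕ) → Prime q′ → p < q′ → q′ % p ≡ β →
    (r : ℕ) → Prime r → q′ < r → (k : ℕ) → ∣ F (p * q′ * r) k ∣ ≤ m p β*)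
theorem4p3 F cyc p q β β* pp p-odd pq p<q _ _ q≡β 1≤β* β*≤ ββ* = bound q pq p<q q≡β , bound
  where
  odd : p ≡ 2 * (p / 2) + 1
  odd = lin≡ (p ∷ (p / 2) ∷ (p % 2) ∷ []) v0 (# 2 :* v1 :+ # 1) (v0 ≐ v2 :+ v1 :* # 2 by (sym (quot-rem p 2)) &ᵉ v2 ≐ # 1 by p-odd) refl
  β*<p : β* < p
  β*<p = lin≤ (β* ∷ p ∷ (p ∸ 1) ∷ []) (# 1 :+ v0) v1 (v0 <= v2 by β*≤ & v2 :+ # 1 == v1 by m∸n+n≡m (>-nonZero⁻¹ p)) refl
  -- Of q′ only its residue modulo p matters, through β* q′ ≡ 1, so the same bound serves q itself
  -- and every q′ in its class.
  bound : (q′ : ℕ) → Prime q′ → p < q′ → q′ % p ≡ β → (r : ℕ) → Prime r → q′ < r → (k : ℕ) → ∣ F (p * q′ * r) k ∣ ≤ m p β*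
  bound q′ pq′ p<q′ q′≡β r pr q′<r = Height.theorem F cyc pp pq′ pr p<q′ q′<r {p / 2} odd β* (β * β* / p + β* * (q′ / p)) 1≤β* β*<p
    (lin≡ (β* ∷ q′ ∷ (β * β* / p) ∷ (q′ / p) ∷ p ∷ β ∷ ((β * β*) % p) ∷ (q′ % p) ∷ []) (v0 :* v1) (# 1 :+ (v2 :+ v0 :* v3) :* v4) (v5 :* v0 ≐ v6 :+ v2 :* v4 by (sym (quot-rem (β * β*) p)) &ᵉ v6 ≐ # 1 by ββ* &ᵉ v0 :* v1 ≐ v0 :* (v7 :+ v3 :* v4) by (sym (cong (β* *_) (quot-rem q′ p))) &ᵉ v0 :* v7 ≐ v0 :* v5 by cong (β* *_) q′≡β) refl)
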